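{- Let $v>4$ be an integer with prime factorization $v=p_1^{n_1}\cdots p_k^{n_k}$, and let $\#C(v_3)$ denote the number of isomorphism classes of connected cyclic configurations of type $(v_3)$. Then \[ \#C(v_3)=\begin{cases}\frac{v}{6}\prod_{i=1}^k\big(1+\frac{1}{p_i}\big)+\alpha 2^k-2 & \text{if } v \text{ is odd},\\[1ex] \frac{v}{6}\prod_{i=1}^k\big(1+\frac{1}{p_i}\big)+\beta 2^k-3 & \text{if } v \text{ is even},\end{cases} \] where, for $v$ odd, \[ \alpha=\begin{cases}5/6 & \text{if every } p_i\equiv 1 \pmod 3,\\ 2/3 & \text{if } p_1^{n_1}=3 \text{ and } p_i\equiv 1\pmod 3 \text{ for all } i>1,\\ 1/2 & \text{otherwise},\end{cases} \] and, for $v$ even, \[ \beta=\begin{cases}1/4 & \text{if } v\equiv 2 \text{ or } 6 \pmod 8,\\ 1/2 & \text{if } v\equiv 4\pmod 8,\\ 1 & \text{if } v\equiv 0\pmod 8.\end{cases} \]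
   Context: A (combinatorial) configuration of type $(v_r,b_k)$ is a pair $(P,\mathcal{B})$ where $P$ is a set of $v$ points and $\mathcal{B}$ is a collection of $b$ subsets of $P$ (lines) with $|B_i\cap B_j|\le 1$ for distinct lines, every point lying on exactly $r$ lines, and every line having exactly $k\ge 3$ points. It is balanced, of type $(v_k)$, when $v=b$ (hence $r=k$). It is decomposable if it is the disjoint union of two configurations $(P_1,\mathcal{B}_1),(P_2,\mathcal{B}_2)$ with $P=P_1\cup P_2$, $P_1\cap P_2=\emptyset$, $\mathcal{B}=\mathcal{B}_1\cup\mathcal{B}_2$; otherwise it is connected. An isomorphism between two configurations is a bijection between point sets mapping the set of lines onto the set of lines; an automorphism is an isomorphism of a configuration to itself. A configuration is cyclic if it has an automorphism permuting its points in a single full cycle. The primes $p_1,\dots,p_k$ are distinct and, in the case defining $\alpha=2/3$, the factor $p_1^{n_1}$ is the $3$-part of $v$. -}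

module Defs where

open import Data.Bool using (Bool; if_then_else_)
open import Data.Nat as ℕ using (ℕ; zero; suc; _%_; _^_; _≤_; _<_)
open import Data.Nat.Divisibility using (_∣_; _∣?_)
open import Data.Nat.Primality using (prime?)
open import Data.Integer using (+_)
open import Data.Rational as ℚ using (ℚ; _/_)
open import Data.Fin using (Fin)
open import Data.Fin.Subset using (Subset; _∈_; _⊆_; ∁; Nonempty; _∩_; ∣_∣)
open import Data.Fin.Subset.Properties using (_∈?_)
open import Data.Fin.Permutation using (Permutation′; _⟨$⟩ʳ_; _⟨$⟩ˡ_)
open import Data.Vec using (tabulate; lookup)
open import Data.List using (List; []; _∷_; length; filter; upTo; allFin; foldr)
import Data.List as L
open import Data.List.Relation.Unary.All using (All; all?)
open import Data.Product using (Σ; ∃; _×_; _,_)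
open import Data.Sum using (_⊎_)
open import Relation.Nullary using (¬_; does; _×-dec_; ¬?)
open import Relation.Nullary.Decidable using (_⊎-dec_)
open import Relation.Binary.PropositionalEquality using (_≡_; _≢_)
open import Function using (_∘_)

record Config (v : ℕ) : Set where
  field
    line     : Fin v → Subset v
    lineSize : ∀ i → ∣ line i ∣ ≡ 3
    pointDeg : ∀ x → length (filter (λ i → x ∈? line i) (allFin v)) ≡ 3
    meet     : ∀ i j → i ≢ j → ∣ line i ∩ line j ∣ ≤ 1

open Config public

image : ∀ {v} → Permutation′ v → Subset v → Subset v
image σ s = tabulate (λ y → lookup s (σ ⟨$⟩ˡ y))

IsIsoVia : ∀ {v} → Permutation′ v → Config v → Config v → Set
IsIsoVia σ C D =
  (∀ i → ∃ λ j → image σ (line C i) ≡ line D j) ×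
  (∀ j → ∃ λ i → image σ (line C i) ≡ line D j)

Isomorphic : ∀ {v} → Config v → Config v → Set
Isomorphic C D = ∃ λ σ → IsIsoVia σ C D

iter : ∀ {A : Set} → (A → A) → ℕ → A → A
iter f zero    x = x
iter f (suc n) x = f (iter f n x)

FullCycle : ∀ {v} → Permutation′ v → Set
FullCycle {v} σ = ∀ (x y : Fin v) → ∃ λ n → iter (σ ⟨$⟩ʳ_) n x ≡ y

Cyclic : ∀ {v} → Config v → Set
Cyclic C = ∃ λ σ → IsIsoVia σ C C × FullCycle σ

Decomposable : ∀ {v} → Config v → Set
Decomposable {v} C = ∃ λ (P : Subset v) →
  Nonempty P × Nonempty (∁ P) × (∀ i → line C i ⊆ P ⊎ line C i ⊆ ∁ P)

Connected : ∀ {v} → Config v → Set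
Connected C = ¬ Decomposable C

primeDivisors : ℕ → List ℕ
primeDivisors v = filter (λ p → prime? p ×-dec (p ∣? v)) (upTo (suc v))

fromℕ : ℕ → ℚ
fromℕ n = + n / 1

recip : ℕ → ℚ
recip zero    = ℚ.0ℚ
recip (suc n) = + 1 / suc n

prodFactor : ℕ → ℚ
prodFactor v = foldr (λ p acc → (ℚ.1ℚ ℚ.+ recip p) ℚ.* acc) ℚ.1ℚ (primeDivisors v)

alpha : ℕ → ℚ
alpha v =
  if does (all? (λ p → p % 3 ℕ.≟ 1) ps) then + 5 / 6
  else if does ((3 ∣? v) ×-dec (¬? (9 ∣? v))
                 ×-dec all? (λ p → (p ℕ.≟ 3) ⊎-dec (p % 3 ℕ.≟ 1)) ps)
       then + 2 / 3
  else + 1 / 2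
  where ps = primeDivisors v

beta : ℕ → ℚ
beta v =
  if does (v % 8 ℕ.≟ 0) then ℚ.1ℚ
  else if does (v % 8 ℕ.≟ 4) then + 1 / 2
  else + 1 / 4

countFormula : ℕ → ℚ
countFormula v =
  if does (2 ∣? v)
  then main ℚ.+ beta v ℚ.* fromℕ (2 ^ k) ℚ.- fromℕ 3
  else main ℚ.+ alpha v ℚ.* fromℕ (2 ^ k) ℚ.- fromℕ 2
  where
    k = length (primeDivisors v)
    main = (+ v / 6) ℚ.* prodFactor v

{-# OPTIONS --safe #-}
-- A cyclic configuration has, up to isomorphism, the lines {i, i + a, i + b} for i in ℤ/v: only one orbit of lines can
-- be short (the cosets of the subgroup of order 3), so the lines form a full orbit. It is connected iff a and b generate
-- ℤ/v, and two such pairs are declared equivalent when related by a unit and one of the six affine relabellings of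
-- {0, a, b}, which act as a group D₃ of integer matrices.
--
-- Isomorphic configurations come from equivalent pairs. The incidence graph is a quotient of the honeycomb, whose faces
-- are triangles of the configuration. If two of the points of a line lie on a single triangle, an isomorphism maps faces
-- to faces near that pair, hence preserves the types of all incidences along two generating directions and is affine.
-- Such a pair of points is missing only when 3p = 2q + r for the points p, q, r of a line, and this is a single class.
--
-- The classes are counted by Burnside's lemma for (ℤ/v)ˣ × D₃. The identity contributes Jordan's totient J₂(v), with
-- J₂(v)/φ(v) = v ∏ (1 + 1/p); reflections contribute the square roots of 1 and rotations the roots of u² + u + 1 modulo v,
-- both counted by the Chinese remainder theorem. Finally the pairs for which the lines do not form a configuration make up
-- two classes, or three if v is even.
module Submission where

open import Defs
open import Data.Bool using (true; false; if_then_else_)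
open import Data.Empty using (⊥; ⊥-elim)
open import Data.Fin using (Fin; toℕ; fromℕ<)
open import Data.Fin.Patterns using (0F; 1F; 2F)
open import Data.Fin.Permutation using (Permutation′; permutation; _⟨$⟩ʳ_; _⟨$⟩ˡ_; inverseˡ; inverseʳ)
open import Data.Fin.Subset using (Subset; _⊆_; ∁; _∩_) renaming (∣_∣ to card)
open import Data.Integer using (ℤ; -[1+_]; _%ℕ_; _/ℕ_) renaming (+_ to pos; _+_ to _⊕_; _*_ to _⊗_; _-_ to _⊖_; -_ to ⊝_)
open import Data.Integer.Divisibility.Signed using () renaming (_∣_ to _∣ᶻ_; _∣?_ to _∣ᶻ?_; divides to dividesᶻ)
open import Data.List using (List; []; _∷_; _++_; length; map; filter; upTo; allFin; cartesianProduct; lookup)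
open import Data.List.Membership.Propositional using (_∈_; find)
open import Data.List.Relation.Binary.Permutation.Propositional using (_↭_)
open import Data.List.Relation.Unary.All using (All; []; _∷_)
open import Data.List.Relation.Unary.Any using (here; there)
open import Data.List.Relation.Unary.Unique.Propositional using (Unique; []; _∷_)
open import Data.Nat using (ℕ; zero; suc; _+_; _*_; _∸_; _^_; _≤_; _<_; z≤n; s≤s; _%_; NonZero)
open import Data.Nat.Coprimality using (Coprime; coprime?)
open import Data.Nat.DivMod using (m≡m%n+[m/n]*n; m%n<n; [m+kn]%n≡m%n)
open import Data.Nat.Divisibility using (_∣_; _∣?_; divides)
open import Data.Nat.GCD using (gcd; gcd[m,n]∣m; gcd[m,n]∣n; gcd-greatest; c*gcd[m,n]≡gcd[cm,cn]; gcd-GCD; module Bézout)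
open import Data.Nat.Induction using (<-rec)
open import Data.Nat.ListAction using (product)
open import Data.Nat.ListAction.Properties using (product-↭)
open import Data.Nat.Primality using (Prime; prime?)
open import Data.Nat.Primality.Factorisation using (factorise; PrimeFactorisation)
open import Data.Product using (Σ; ∃; _×_; _,_; proj₁; proj₂)
open import Data.Product.Properties using (≡-dec)
open import Data.Rational using (ℚ)
open import Data.Rational.Unnormalised using (mkℚᵘ)
open import Data.Sum using (_⊎_; inj₁; inj₂; [_,_]′)
open import Function using (_∘_; id; case_of_; mk⇔)
open import Relation.Binary.PropositionalEquality using (_≡_; _≢_; refl; sym; trans; cong; cong₂; subst; subst₂; module ≡-Reasoning)
open import Relation.Nullary using (¬_; Dec; yes; no; does; ¬?; _×-dec_; contradiction)
open import Relation.Nullary.Decidable using (_⊎-dec_; _→-dec_; map′; from-yes; dec-true; decidable-stable)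
import Data.Fin as Fin
import Data.Fin.Permutation as FinPerm
import Data.Fin.Properties as FinP
import Data.Fin.Subset as Sub
import Data.Fin.Subset.Properties as SubP
import Data.Integer as ℤ
import Data.Integer.DivMod as ℤDivMod
import Data.Integer.Divisibility.Signed as ℤDiv
import Data.Integer.Properties as ℤP
import Data.Integer.Tactic.RingSolver as ℤ-Solver
import Data.List.Membership.DecPropositional as DecMem
import Data.List.Membership.Propositional.Properties as Mem
import Data.List.Membership.Propositional.Properties.WithK as MemK
import Data.List.Properties as List
import Data.List.Relation.Binary.BagAndSetEquality as BagSet
import Data.List.Relation.Binary.Permutation.Propositional as Perm
import Data.List.Relation.Binary.Permutation.Propositional.Properties as PermP
import Data.List.Relation.Unary.All as All
import Data.List.Relation.Unary.All.Properties as AllP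
import Data.List.Relation.Unary.AllPairs as AllPairs
import Data.List.Relation.Unary.Any as Any
import Data.List.Relation.Unary.Unique.Propositional.Properties as Uniq
import Data.Nat as ℕ
import Data.Nat.Coprimality as Coprimality
import Data.Nat.Divisibility as Div
import Data.Nat.Primality as Primality
import Data.Nat.Properties as ℕP
import Data.Nat.Tactic.RingSolver as ℕ-Solver
import Data.Rational as ℚ
import Data.Rational.Properties as ℚP
import Data.Rational.Solver as ℚ-Solver
import Data.Rational.Unnormalised as ℚᵘ
import Data.Rational.Unnormalised.Properties as ℚᵘP
import Data.Sum as Sum
import Data.Vec as Vec
import Data.Vec.Properties as VecP

-- Sums over lists

-- The obstacle is that an isomorphism between two cyclic structures on ℤ/v need not respect the
-- cyclic automorphisms, so nothing makes it affine a priori. This is why the argument is local: the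
-- ways in which triangles can coincide near a line are integer linear forms in a and b, finitely
-- many, and the tables of these forms are verified by decision procedures. Let Q be the number of
-- square roots of 1 and T the number of roots of u² + u + 1. The generating pairs have J₂(v)/6φ(v)
-- + Q/2 + T/3 classes. For odd v, Q = 2^k, and T = 2^k, 2^k/2 or 0 gives α = 5/6, 2/3 or 1/2. For
-- even v, T = 0 and β = Q/(2 · 2^k). That roots of u² + u + 1 exist modulo powers of primes p ≡ 1
-- (mod 3) is shown without primitive roots or lifting: the map x ↦ -1/(1 + x) has order 3, so
-- counting its orbits fixes T modulo 3, and T is at most 2. The subtracted classes are those of (0,
-- 1), of (1, -1) and, for even v, of (v/2, 1). The bound v > 4 keeps them distinct.

∑ : {A : Set} → List A → (A → ℕ) → ℕ
∑ []       f = 0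
∑ (x ∷ xs) f = f x + ∑ xs f

𝟙 : {P : Set} → Dec P → ℕ
𝟙 (yes _) = 1
𝟙 (no _)  = 0

𝟙-yes : {P : Set} (p : Dec P) → P → 𝟙 p ≡ 1
𝟙-yes (yes _) _ = refl
𝟙-yes (no ¬p) p = contradiction p ¬p

𝟙-no : {P : Set} (p : Dec P) → ¬ P → 𝟙 p ≡ 0
𝟙-no (yes p) ¬p = contradiction p ¬p
𝟙-no (no _)  _  = refl

𝟙-cong : {P Q : Set} (p : Dec P) (q : Dec Q) → (P → Q) → (Q → P) → 𝟙 p ≡ 𝟙 q
𝟙-cong (yes p) q f g = sym (𝟙-yes q (f p))
𝟙-cong (no ¬p) q f g = sym (𝟙-no q (¬p ∘ g))

𝟙-× : {P Q : Set} (p : Dec P) (q : Dec Q) → 𝟙 (p ×-dec q) ≡ 𝟙 p * 𝟙 q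
𝟙-× (yes _) (yes _) = refl
𝟙-× (yes _) (no _)  = refl
𝟙-× (no _)  _       = refl

module _ {A : Set} where

  ∑-cong∈ : ∀ (xs : List A) {f g} → (∀ x → x ∈ xs → f x ≡ g x) → ∑ xs f ≡ ∑ xs g
  ∑-cong∈ []       eq = refl
  ∑-cong∈ (x ∷ xs) eq = cong₂ _+_ (eq x (here refl)) (∑-cong∈ xs (λ y → eq y ∘ there))

  ∑-cong : ∀ (xs : List A) {f g} → (∀ x → f x ≡ g x) → ∑ xs f ≡ ∑ xs g
  ∑-cong xs eq = ∑-cong∈ xs (λ x _ → eq x)

  ∑-+ : ∀ (xs : List A) f g → ∑ xs (λ x → f x + g x) ≡ ∑ xs f + ∑ xs g
  ∑-+ []       f g = refl
  ∑-+ (x ∷ xs) f g rewrite ∑-+ xs f g = lem (f x) (g x) (∑ xs f) (∑ xs g)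
    where
    lem : ∀ a b c d → a + b + (c + d) ≡ a + c + (b + d)
    lem = ℕ-Solver.solve-∀

  ∑-*ˡ : ∀ (xs : List A) c f → ∑ xs (λ x → c * f x) ≡ c * ∑ xs f
  ∑-*ˡ []       c f = sym (ℕP.*-zeroʳ c)
  ∑-*ˡ (x ∷ xs) c f rewrite ∑-*ˡ xs c f = sym (ℕP.*-distribˡ-+ c (f x) _)

  ∑-const : ∀ (xs : List A) c → ∑ xs (λ _ → c) ≡ length xs * c
  ∑-const []       c = refl
  ∑-const (x ∷ xs) c = cong (c +_) (∑-const xs c)

  ∑-1 : ∀ (xs : List A) → ∑ xs (λ _ → 1) ≡ length xs
  ∑-1 []       = refl
  ∑-1 (x ∷ xs) = cong suc (∑-1 xs)

  ∑-zero : ∀ (xs : List A) {f} → (∀ x → x ∈ xs → f x ≡ 0) → ∑ xs f ≡ 0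
  ∑-zero xs eq = trans (∑-cong∈ xs eq) (trans (∑-const xs 0) (ℕP.*-zeroʳ (length xs)))

  ∑-++ : ∀ (xs ys : List A) f → ∑ (xs ++ ys) f ≡ ∑ xs f + ∑ ys f
  ∑-++ []       ys f = refl
  ∑-++ (x ∷ xs) ys f rewrite ∑-++ xs ys f = sym (ℕP.+-assoc (f x) _ _)

  ∑-filter : ∀ {P : A → Set} (P? : ∀ x → Dec (P x)) xs f →
             ∑ (filter P? xs) f ≡ ∑ xs (λ x → 𝟙 (P? x) * f x)
  ∑-filter P? []       f = refl
  ∑-filter P? (x ∷ xs) f with P? x
  ... | yes _ = cong₂ _+_ (sym (ℕP.*-identityˡ (f x))) (∑-filter P? xs f)
  ... | no _  = ∑-filter P? xs f

  length-filter : ∀ {P : A → Set} (P? : ∀ x → Dec (P x)) xs → length (filter P? xs) ≡ ∑ xs (𝟙 ∘ P?)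
  length-filter P? []       = refl
  length-filter P? (x ∷ xs) with P? x
  ... | yes _ = cong suc (length-filter P? xs)
  ... | no _  = length-filter P? xs

  ∑-↭ : ∀ {xs ys : List A} f → xs ↭ ys → ∑ xs f ≡ ∑ ys f
  ∑-↭ f Perm.refl              = refl
  ∑-↭ f (Perm.prep x p)        = cong (f x +_) (∑-↭ f p)
  ∑-↭ f (Perm.swap x y p) rewrite ∑-↭ f p = lem (f x) (f y) _
    where
    lem : ∀ a b c → a + (b + c) ≡ b + (a + c)
    lem = ℕ-Solver.solve-∀
  ∑-↭ f (Perm.trans p q)       = trans (∑-↭ f p) (∑-↭ f q)

∑-map : ∀ {A B : Set} (h : A → B) xs f → ∑ (map h xs) f ≡ ∑ xs (f ∘ h)
∑-map h []       f = refl
∑-map h (x ∷ xs) f = cong (f (h x) +_) (∑-map h xs f)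

∑-swap : ∀ {A B : Set} (xs : List A) (ys : List B) (f : A → B → ℕ) →
         ∑ xs (λ x → ∑ ys (f x)) ≡ ∑ ys (λ y → ∑ xs (λ x → f x y))
∑-swap []       ys f = sym (∑-zero ys (λ _ _ → refl))
∑-swap (x ∷ xs) ys f rewrite ∑-swap xs ys f = sym (∑-+ ys (f x) _)

∑-cartesianProduct : ∀ {A B : Set} (xs : List A) (ys : List B) f →
                     ∑ (cartesianProduct xs ys) f ≡ ∑ xs (λ x → ∑ ys (λ y → f (x , y)))
∑-cartesianProduct []       ys f = refl
∑-cartesianProduct (x ∷ xs) ys f = trans (∑-++ (map (x ,_) ys) _ f)
  (cong₂ _+_ (∑-map (x ,_) ys f) (∑-cartesianProduct xs ys f))

length-cartesianProduct : ∀ {A B : Set} (xs : List A) (ys : List B) →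
                          length (cartesianProduct xs ys) ≡ length xs * length ys
length-cartesianProduct []       ys = refl
length-cartesianProduct (x ∷ xs) ys = trans (List.length-++ (map (x ,_) ys))
  (cong₂ _+_ (List.length-map (x ,_) ys) (length-cartesianProduct xs ys))

module _ {A : Set} where

  unique-↭ : {xs ys : List A} → Unique xs → Unique ys →
             (∀ {x} → x ∈ xs → x ∈ ys) → (∀ {x} → x ∈ ys → x ∈ xs) → xs ↭ ys
  unique-↭ u w f g = BagSet.∼bag⇒↭ (MemK.unique∧set⇒bag u w (mk⇔ f g))

  unique-⊆-length : {xs ys : List A} → Unique xs → (∀ {x} → x ∈ xs → x ∈ ys) → length xs ≤ length ys
  unique-⊆-length {[]}     u        sub = z≤n
  unique-⊆-length {x ∷ xs} (x∉ ∷ u) sub with Mem.∈-∃++ (sub (here refl))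
  ... | ls , rs , refl = subst (suc (length xs) ≤_) (sym len) (s≤s (unique-⊆-length u sub′))
    where
    len : length (ls ++ x ∷ rs) ≡ suc (length (ls ++ rs))
    len = trans (List.length-++ ls) (trans (ℕP.+-suc _ _) (cong suc (sym (List.length-++ ls))))
    sub′ : ∀ {y} → y ∈ xs → y ∈ ls ++ rs
    sub′ {y} y∈ with Mem.∈-++⁻ ls (sub (there y∈))
    ... | inj₁ p           = Mem.∈-++⁺ˡ p
    ... | inj₂ (here y≡x)  = contradiction (sym y≡x) (All.lookup x∉ y∈)
    ... | inj₂ (there p)   = Mem.∈-++⁺ʳ ls p

  -- Pigeonhole: each head of `xs` uses up one entry of `ys`, and `ys` is not longer than `xs`, so
  -- nothing of it is left over.
  unique-⊆-↭ : {xs ys : List A} → Unique xs → (∀ {x} → x ∈ xs → x ∈ ys) →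
               length ys ≤ length xs → xs ↭ ys
  unique-⊆-↭ {[]}     {[]}    u        sub len = Perm.refl
  unique-⊆-↭ {x ∷ xs}         (x∉ ∷ u) sub len with Mem.∈-∃++ (sub (here refl))
  ... | ls , rs , refl = Perm.trans (Perm.prep x (unique-⊆-↭ u sub′ len′)) (Perm.↭-sym (PermP.shift x ls rs))
    where
    len₁ : length (ls ++ x ∷ rs) ≡ suc (length (ls ++ rs))
    len₁ = trans (List.length-++ ls) (trans (ℕP.+-suc _ _) (cong suc (sym (List.length-++ ls))))
    len′ : length (ls ++ rs) ≤ length xs
    len′ = ℕP.≤-pred (subst (_≤ suc (length xs)) len₁ len)
    sub′ : ∀ {y} → y ∈ xs → y ∈ ls ++ rs
    sub′ {y} y∈ with Mem.∈-++⁻ ls (sub (there y∈))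
    ... | inj₁ p           = Mem.∈-++⁺ˡ p
    ... | inj₂ (here y≡x)  = contradiction (sym y≡x) (All.lookup x∉ y∈)
    ... | inj₂ (there p)   = Mem.∈-++⁺ʳ ls p

map-unique : ∀ {A B : Set} (f : A → B) {xs} → Unique xs →
             (∀ {x y} → x ∈ xs → y ∈ xs → f x ≡ f y → x ≡ y) → Unique (map f xs)
map-unique f []       inj = []
map-unique f {x ∷ xs} (x∉ ∷ u) inj =
  AllP.map⁺ (All.tabulate (λ y∈ eq → All.lookup x∉ y∈ (inj (here refl) (there y∈) eq)))
  ∷ map-unique f u (λ x∈ y∈ → inj (there x∈) (there y∈))

module _ {A B : Set} {P : A → Set} {Q : B → Set} (P? : ∀ x → Dec (P x)) (Q? : ∀ y → Dec (Q y)) where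

  -- Counts are compared by injections; an equality comes from two injections in opposite
  -- directions, which need not be shown to be inverse to each other.
  ∑-𝟙-injection : ∀ {xs ys} (f : A → B) → Unique xs →
                  (∀ {x} → x ∈ xs → P x → f x ∈ ys × Q (f x)) →
                  (∀ {x y} → x ∈ xs → y ∈ xs → P x → P y → f x ≡ f y → x ≡ y) →
                  ∑ xs (𝟙 ∘ P?) ≤ ∑ ys (𝟙 ∘ Q?)
  ∑-𝟙-injection {xs} {ys} f u into inj =
    subst₂ _≤_ (trans (List.length-map f (filter P? xs)) (length-filter P? xs)) (length-filter Q? ys)
      (unique-⊆-length {xs = map f (filter P? xs)} {filter Q? ys}
        (map-unique f (Uniq.filter⁺ P? u) inj′) sub)
    where
    inj′ : ∀ {x y} → x ∈ filter P? xs → y ∈ filter P? xs → f x ≡ f y → x ≡ y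
    inj′ x∈ y∈ with Mem.∈-filter⁻ P? {xs = xs} x∈ | Mem.∈-filter⁻ P? {xs = xs} y∈
    ... | a , b | c , d = inj a c b d
    sub : ∀ {y} → y ∈ map f (filter P? xs) → y ∈ filter Q? ys
    sub y∈ with Mem.∈-map⁻ f y∈
    ... | x , x∈ , refl with Mem.∈-filter⁻ P? {xs = xs} x∈
    ...   | a , b = let (p , q) = into a b in Mem.∈-filter⁺ Q? p q

∑-𝟙-single : ∀ {A : Set} {P : A → Set} (P? : ∀ x → Dec (P x)) {xs} → Unique xs → ∀ {a} → a ∈ xs → P a →
             (∀ {x} → x ∈ xs → P x → x ≡ a) → ∑ xs (𝟙 ∘ P?) ≡ 1
∑-𝟙-single P? {xs} u {a} a∈ pa only = trans (sym (length-filter P? xs))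
  (ℕP.≤-antisym
    (unique-⊆-length {ys = a ∷ []} (Uniq.filter⁺ P? u)
      (λ x∈ → let (p , q) = Mem.∈-filter⁻ P? {xs = xs} x∈ in here (only p q)))
    (Mem.∈-length (Mem.∈-filter⁺ P? a∈ pa)))

-- Burnside's lemma

-- The laws are relative to the lists `gs` and `xs`, because the groups used below sit inside larger
-- types, such as all residues paired with all integer matrices, where inverses exist only for the
-- listed members.
record FiniteAction (G A : Set) : Set where
  field
    _≟_         : (x y : A) → Dec (x ≡ y)
    gs          : List G
    xs          : List A
    gs-unique   : Unique gs
    xs-unique   : Unique xs
    act         : G → A → A
    mul         : G → G → G
    inv         : G → G
    one         : G
    one∈        : one ∈ gs
    act∈        : ∀ {g x} → g ∈ gs → x ∈ xs → act g x ∈ xs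
    mul∈        : ∀ {g h} → g ∈ gs → h ∈ gs → mul g h ∈ gs
    inv∈        : ∀ {g} → g ∈ gs → inv g ∈ gs
    act-mul     : ∀ {g h x} → g ∈ gs → h ∈ gs → x ∈ xs → act (mul g h) x ≡ act g (act h x)
    act-inv     : ∀ {g x} → g ∈ gs → x ∈ xs → act (inv g) (act g x) ≡ x
    mul-cancelʳ : ∀ {g g′ h} → g ∈ gs → g′ ∈ gs → h ∈ gs → mul g h ≡ mul g′ h → g ≡ g′

module Burnside {G A : Set} (action : FiniteAction G A) where
  open FiniteAction action

  infix 4 _∼_ _∼?_

  _∼_ : A → A → Set
  x ∼ y = Any.Any (λ g → act g x ≡ y) gs

  _∼?_ : (x y : A) → Dec (x ∼ y)
  x ∼? y = Any.any? (λ g → act g x ≟ y) gs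

  ∼-intro : ∀ {x y g} → g ∈ gs → act g x ≡ y → x ∼ y
  ∼-intro g∈ eq = Any.map (λ { refl → eq }) g∈

  ∼-elim : ∀ {x y} → x ∼ y → ∃ λ g → g ∈ gs × act g x ≡ y
  ∼-elim r = find r

  ∼-refl : ∀ {x} → x ∈ xs → x ∼ x
  -- The identity of the group is obtained as the inverse of `one` times `one`.
  ∼-refl {x} x∈ = ∼-intro (mul∈ (inv∈ one∈) one∈) (trans (act-mul (inv∈ one∈) one∈ x∈) (act-inv one∈ x∈))

  ∼-sym : ∀ {x y} → x ∈ xs → x ∼ y → y ∼ x
  ∼-sym x∈ r with ∼-elim r
  ... | g , g∈ , refl = ∼-intro (inv∈ g∈) (act-inv g∈ x∈)

  ∼-trans : ∀ {x y z} → x ∈ xs → x ∼ y → y ∼ z → x ∼ z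
  ∼-trans x∈ r s with ∼-elim r | ∼-elim s
  ... | g , g∈ , refl | h , h∈ , refl = ∼-intro (mul∈ h∈ g∈) (act-mul h∈ g∈ x∈)

  private
    transporters : A → A → ℕ
    transporters x y = ∑ gs (λ g → 𝟙 (act g x ≟ y))

    -- Right multiplication by the inverse of `h` carries the elements taking x to y into the
    -- stabiliser of y, and right multiplication by `h` carries them back. Both are injective by
    -- right cancellation.
    transporters≡stabiliser : ∀ {x y h} → h ∈ gs → x ∈ xs → act h x ≡ y → transporters x y ≡ transporters y y
    transporters≡stabiliser {x} {_} {h} h∈ x∈ refl = ℕP.≤-antisym
      (∑-𝟙-injection (λ g → act g x ≟ y) (λ g → act g y ≟ y) (λ g → mul g (inv h)) gs-unique
        (λ {g} g∈ gx≡y → mul∈ g∈ (inv∈ h∈) ,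
           trans (act-mul g∈ (inv∈ h∈) (act∈ h∈ x∈)) (trans (cong (act g) (act-inv h∈ x∈)) gx≡y))
        (λ g∈ g′∈ _ _ → mul-cancelʳ g∈ g′∈ (inv∈ h∈)))
      (∑-𝟙-injection (λ g → act g y ≟ y) (λ g → act g x ≟ y) (λ g → mul g h) gs-unique
        (λ {g} g∈ gy≡y → mul∈ g∈ h∈ , trans (act-mul g∈ h∈ x∈) gy≡y)
        (λ g∈ g′∈ _ _ → mul-cancelʳ g∈ g′∈ h∈))
      where y = act h x

    ∑-transporters : ∀ {x} → x ∈ xs → ∑ xs (transporters x) ≡ length gs
    ∑-transporters {x} x∈ = begin
      ∑ xs (λ y → ∑ gs (λ g → 𝟙 (act g x ≟ y)))  ≡⟨ ∑-swap xs gs _ ⟩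
      ∑ gs (λ g → ∑ xs (λ y → 𝟙 (act g x ≟ y)))  ≡⟨ ∑-cong∈ gs (λ g g∈ → ∑-𝟙-single (act g x ≟_) xs-unique (act∈ g∈ x∈) refl (λ _ → sym)) ⟩
      ∑ gs (λ _ → 1)                             ≡⟨ ∑-const gs 1 ⟩
      length gs * 1                              ≡⟨ ℕP.*-identityʳ _ ⟩
      length gs                                  ∎
      where open ≡-Reasoning

    -- The orbit-stabiliser theorem without division: each element of the group takes x to exactly
    -- one y of its class, and those with the same y are as many as the stabiliser of y.
    ∑-class : ∀ {x} → x ∈ xs → ∑ xs (λ y → 𝟙 (x ∼? y) * transporters y y) ≡ length gs
    ∑-class {x} x∈ = trans (∑-cong xs step) (∑-transporters x∈)
      where
      step : ∀ y → 𝟙 (x ∼? y) * transporters y y ≡ transporters x y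
      step y with x ∼? y
      ... | yes r = let (h , h∈ , eq) = ∼-elim r in
                    trans (ℕP.*-identityˡ _) (sym (transporters≡stabiliser h∈ x∈ eq))
      ... | no ¬r = sym (∑-zero gs (λ g g∈ → 𝟙-no (act g x ≟ y) (λ eq → ¬r (∼-intro g∈ eq))))

    select : List A → List A
    select []       = []
    select (y ∷ ys) = y ∷ filter (λ z → ¬? (y ∼? z)) (select ys)

    select⊆ : ∀ ys {z} → z ∈ select ys → z ∈ ys
    select⊆ (y ∷ ys) (here eq) = here eq
    select⊆ (y ∷ ys) (there p) = there (select⊆ ys (proj₁ (Mem.∈-filter⁻ _ {xs = select ys} p)))

    select-cover : ∀ ys → (∀ {z} → z ∈ ys → z ∈ xs) → ∀ {z} → z ∈ ys → ∃ λ r → r ∈ select ys × r ∼ z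
    select-cover (y ∷ ys) sub (here refl) = y , here refl , ∼-refl (sub (here refl))
    select-cover (y ∷ ys) sub (there p) with select-cover ys (sub ∘ there) p
    ... | r , r∈ , r∼z with y ∼? r
    ...   | yes y∼r = y , here refl , ∼-trans (sub (here refl)) y∼r r∼z
    ...   | no ¬y∼r = r , there (Mem.∈-filter⁺ _ r∈ ¬y∼r) , r∼z

    select-inequivalent : ∀ ys → (∀ {z} → z ∈ ys → z ∈ xs) → ∀ {r s} → r ∈ select ys → s ∈ select ys → r ∼ s → r ≡ s
    select-inequivalent (y ∷ ys) sub (here refl) (here refl) _ = refl
    select-inequivalent (y ∷ ys) sub (here refl) (there q) r∼s =
      contradiction r∼s (proj₂ (Mem.∈-filter⁻ (λ z → ¬? (y ∼? z)) {xs = select ys} q))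
    select-inequivalent (y ∷ ys) sub (there p) (here refl) r∼s with Mem.∈-filter⁻ (λ z → ¬? (y ∼? z)) {xs = select ys} p
    ... | p′ , ¬y∼r = contradiction (∼-sym (sub (there (select⊆ ys p′))) r∼s) ¬y∼r
    select-inequivalent (y ∷ ys) sub (there p) (there q) r∼s =
      select-inequivalent ys (sub ∘ there) (proj₁ (Mem.∈-filter⁻ _ {xs = select ys} p)) (proj₁ (Mem.∈-filter⁻ _ {xs = select ys} q)) r∼s

    select-unique : ∀ {ys} → Unique ys → Unique (select ys)
    select-unique []              = []
    select-unique {y ∷ ys} (y∉ ∷ u) =
      All.tabulate (λ p → All.lookup y∉ (select⊆ ys (proj₁ (Mem.∈-filter⁻ _ {xs = select ys} p))))
      ∷ Uniq.filter⁺ _ (select-unique u)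

  abstract
    orbitReps : List A
    orbitReps = select xs

    orbitReps-unique : Unique orbitReps
    orbitReps-unique = select-unique xs-unique

    orbitReps⊆ : ∀ {r} → r ∈ orbitReps → r ∈ xs
    orbitReps⊆ = select⊆ xs

    orbitReps-cover : ∀ {x} → x ∈ xs → ∃ λ r → r ∈ orbitReps × r ∼ x
    orbitReps-cover = select-cover xs id

    orbitReps-inequivalent : ∀ {r s} → r ∈ orbitReps → s ∈ orbitReps → r ∼ s → r ≡ s
    orbitReps-inequivalent = select-inequivalent xs id

  ∑-orbitReps : ∀ {x} → x ∈ xs → ∑ orbitReps (λ r → 𝟙 (r ∼? x)) ≡ 1
  ∑-orbitReps {x} x∈ with orbitReps-cover x∈
  ... | r , r∈ , r∼x = ∑-𝟙-single (_∼? x) orbitReps-unique r∈ r∼x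
    (λ {s} s∈ s∼x → orbitReps-inequivalent s∈ r∈ (∼-trans (orbitReps⊆ s∈) s∼x (∼-sym (orbitReps⊆ r∈) r∼x)))

  -- Adding `∑-class` over the representatives counts the stabiliser of every point once, since
  -- every point has exactly one representative. Exchanging the sums turns stabilisers of points
  -- into fixed points of group elements.
  burnside : length orbitReps * length gs ≡ ∑ gs (λ g → ∑ xs (λ x → 𝟙 (act g x ≟ x)))
  burnside = begin
    length orbitReps * length gs                                          ≡⟨ ∑-const orbitReps _ ⟨
    ∑ orbitReps (λ _ → length gs)                                         ≡⟨ ∑-cong∈ orbitReps (λ r r∈ → ∑-class (orbitReps⊆ r∈)) ⟨
    ∑ orbitReps (λ r → ∑ xs (λ y → 𝟙 (r ∼? y) * transporters y y))        ≡⟨ ∑-swap orbitReps xs _ ⟩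
    ∑ xs (λ y → ∑ orbitReps (λ r → 𝟙 (r ∼? y) * transporters y y))        ≡⟨ ∑-cong∈ xs step ⟩
    ∑ xs (λ y → transporters y y)                                         ≡⟨ ∑-swap xs gs _ ⟩
    ∑ gs (λ g → ∑ xs (λ x → 𝟙 (act g x ≟ x)))                             ∎
    where
    open ≡-Reasoning
    step : ∀ y → y ∈ xs → ∑ orbitReps (λ r → 𝟙 (r ∼? y) * transporters y y) ≡ transporters y y
    step y y∈ = begin
      ∑ orbitReps (λ r → 𝟙 (r ∼? y) * transporters y y)  ≡⟨ ∑-cong orbitReps (λ r → ℕP.*-comm (𝟙 (r ∼? y)) _) ⟩
      ∑ orbitReps (λ r → transporters y y * 𝟙 (r ∼? y))  ≡⟨ ∑-*ˡ orbitReps (transporters y y) (λ r → 𝟙 (r ∼? y)) ⟩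
      transporters y y * ∑ orbitReps (λ r → 𝟙 (r ∼? y))  ≡⟨ cong (transporters y y *_) (∑-orbitReps y∈) ⟩
      transporters y y * 1                               ≡⟨ ℕP.*-identityʳ _ ⟩
      transporters y y                                   ∎

-- The totients of Euler and Jordan

∑-applyUpTo : ∀ {A : Set} (g : ℕ → A) n f → ∑ (Data.List.applyUpTo g n) f ≡ ∑ (upTo n) (f ∘ g)
∑-applyUpTo g zero    f = refl
∑-applyUpTo g (suc n) f = cong (f (g 0) +_)
  (trans (∑-applyUpTo (g ∘ suc) n f) (sym (∑-applyUpTo suc n (f ∘ g))))

∑-upTo-suc : ∀ n f → ∑ (upTo (suc n)) f ≡ f 0 + ∑ (upTo n) (f ∘ suc)
∑-upTo-suc n f = cong (f 0 +_) (∑-applyUpTo suc n f)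

∑-upTo-+ : ∀ m n f → ∑ (upTo (m + n)) f ≡ ∑ (upTo m) f + ∑ (upTo n) (λ i → f (m + i))
∑-upTo-+ zero    n f = refl
∑-upTo-+ (suc m) n f = begin
  ∑ (upTo (suc m + n)) f                                               ≡⟨ ∑-upTo-suc (m + n) f ⟩
  f 0 + ∑ (upTo (m + n)) (f ∘ suc)                                     ≡⟨ cong (f 0 +_) (∑-upTo-+ m n (f ∘ suc)) ⟩
  f 0 + (∑ (upTo m) (f ∘ suc) + ∑ (upTo n) (λ i → f (suc m + i)))      ≡⟨ ℕP.+-assoc (f 0) _ _ ⟨
  f 0 + ∑ (upTo m) (f ∘ suc) + ∑ (upTo n) (λ i → f (suc m + i))        ≡⟨ cong (_+ ∑ (upTo n) (λ i → f (suc m + i))) (∑-upTo-suc m f) ⟨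
  ∑ (upTo (suc m)) f + ∑ (upTo n) (λ i → f (suc m + i))                ∎
  where open ≡-Reasoning

∑-periodic : ∀ k n f → (∀ i → f (n + i) ≡ f i) → ∑ (upTo (k * n)) f ≡ k * ∑ (upTo n) f
∑-periodic zero    n f per = refl
∑-periodic (suc k) n f per = trans (∑-upTo-+ n (k * n) f)
  (cong (∑ (upTo n) f +_) (trans (∑-cong (upTo (k * n)) per) (∑-periodic k n f per)))

-- Each block of p consecutive numbers starting at a multiple of p contains no other multiple than
-- its first member.
∑-multiples : ∀ p .{{_ : NonZero p}} n (g : ℕ → ℕ) →
              ∑ (upTo (n * p)) (λ a → 𝟙 (p ∣? a) * g a) ≡ ∑ (upTo n) (λ a → g (a * p))
∑-multiples p         zero    g = refl
∑-multiples p@(suc k) (suc n) g = begin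
  ∑ (upTo (p + n * p)) (λ a → 𝟙 (p ∣? a) * g a)                                     ≡⟨ ∑-upTo-+ p (n * p) _ ⟩
  ∑ (upTo p) (λ a → 𝟙 (p ∣? a) * g a) + ∑ (upTo (n * p)) (λ a → 𝟙 (p ∣? (p + a)) * g (p + a)) ≡⟨ cong₂ _+_ first rest ⟩
  g 0 + ∑ (upTo n) (λ a → g (p + a * p))                                            ≡⟨ ∑-upTo-suc n (λ a → g (a * p)) ⟨
  ∑ (upTo (suc n)) (λ a → g (a * p))                                                ∎
  where
  open ≡-Reasoning
  first : ∑ (upTo p) (λ a → 𝟙 (p ∣? a) * g a) ≡ g 0
  first = begin
    ∑ (upTo p) (λ a → 𝟙 (p ∣? a) * g a)                                 ≡⟨ ∑-upTo-suc k _ ⟩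
    𝟙 (p ∣? 0) * g 0 + ∑ (upTo k) (λ a → 𝟙 (p ∣? suc a) * g (suc a))    ≡⟨ cong₂ _+_ (cong (_* g 0) (𝟙-yes (p ∣? 0) (p Div.∣0))) (∑-zero (upTo k) (λ a a∈ → cong (_* g (suc a)) (𝟙-no (p ∣? suc a) (λ p∣ → ℕP.<-irrefl refl (ℕP.≤-trans (Div.∣⇒≤ p∣) (Mem.∈-upTo⁻ a∈)))))) ⟩
    1 * g 0 + 0                                                         ≡⟨ ℕP.+-identityʳ _ ⟩
    1 * g 0                                                             ≡⟨ ℕP.*-identityˡ _ ⟩
    g 0                                                                 ∎
  rest : ∑ (upTo (n * p)) (λ a → 𝟙 (p ∣? (p + a)) * g (p + a)) ≡ ∑ (upTo n) (λ a → g (p + a * p))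
  rest = trans
    (∑-cong (upTo (n * p)) (λ a → cong (_* g (p + a))
      (𝟙-cong (p ∣? (p + a)) (p ∣? a) (λ d → Div.∣m+n∣m⇒∣n d Div.∣-refl) (Div.∣m∣n⇒∣m+n Div.∣-refl))))
    (∑-multiples p n (λ a → g (p + a)))

totient : ℕ → ℕ
totient n = ∑ (upTo n) (λ a → 𝟙 (coprime? a n))

jordan₂ : ℕ → ℕ
jordan₂ n = ∑ (upTo n) (λ a → ∑ (upTo n) (λ b → 𝟙 (coprime? (gcd a b) n)))

prime∤1 : ∀ {p} → Prime p → p ≢ 1
prime∤1 pr refl = Primality.¬prime[1] pr

prime-coprime : ∀ {p g} → Prime p → ¬ p ∣ g → Coprime g p
prime-coprime pr p∤g (d∣g , d∣p) with Primality.prime⇒irreducible pr d∣p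
... | inj₁ d≡1  = d≡1
... | inj₂ refl = contradiction d∣g p∤g

coprime-∣ : ∀ {g m n} → m ∣ n → Coprime g n → Coprime g m
coprime-∣ m∣n c (d∣g , d∣m) = c (d∣g , Div.∣-trans d∣m m∣n)

coprime-* : ∀ {g m n} → Coprime g m → Coprime g n → Coprime g (m * n)
coprime-* cm cn {d} (d∣g , d∣mn) =
  cn (d∣g , Coprimality.coprime-divisor (λ (e∣d , e∣m) → cm (Div.∣-trans e∣d d∣g , e∣m)) d∣mn)

coprime-prime-* : ∀ {p g n} → Prime p → ¬ p ∣ g → Coprime g n → Coprime g (p * n)
coprime-prime-* pr p∤g = coprime-* (prime-coprime pr p∤g)

coprime-+ : ∀ {n a} → Coprime a n → Coprime (n + a) n
coprime-+ c (d∣ , d∣n) = c (Div.∣m+n∣m⇒∣n d∣ d∣n , d∣n)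

coprime-+⁻ : ∀ {n a} → Coprime (n + a) n → Coprime a n
coprime-+⁻ c (d∣a , d∣n) = c (Div.∣m∣n⇒∣m+n d∣n d∣a , d∣n)

coprime-gcd-+ : ∀ {n} a b → Coprime (gcd a b) n → Coprime (gcd (n + a) b) n
coprime-gcd-+ {n} a b c (d∣ , d∣n) = c (gcd-greatest
  (Div.∣m+n∣m⇒∣n (Div.∣-trans d∣ (gcd[m,n]∣m (n + a) b)) d∣n)
  (Div.∣-trans d∣ (gcd[m,n]∣n (n + a) b)) , d∣n)

coprime-gcd-+⁻ : ∀ {n} a b → Coprime (gcd (n + a) b) n → Coprime (gcd a b) n
coprime-gcd-+⁻ {n} a b c (d∣ , d∣n) = c (gcd-greatest
  (Div.∣m∣n⇒∣m+n d∣n (Div.∣-trans d∣ (gcd[m,n]∣m a b)))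
  (Div.∣-trans d∣ (gcd[m,n]∣n a b)) , d∣n)

coprime-gcd-comm : ∀ {n} a b → Coprime (gcd a b) n → Coprime (gcd b a) n
coprime-gcd-comm a b c (d∣ , d∣n) = c (gcd-greatest
  (Div.∣-trans d∣ (gcd[m,n]∣n b a)) (Div.∣-trans d∣ (gcd[m,n]∣m b a)) , d∣n)

module _ {p} (pr : Prime p) (n : ℕ) where
  private
    instance
      p≢0 : NonZero p
      p≢0 = Primality.prime⇒nonZero pr

    𝟙-coprime-∣ : ∀ g → p ∣ n → 𝟙 (coprime? g (p * n)) ≡ 𝟙 (coprime? g n)
    𝟙-coprime-∣ g p∣n = 𝟙-cong (coprime? g (p * n)) (coprime? g n) (coprime-∣ (Div.n∣m*n p))
      (λ c → coprime-* (coprime-∣ p∣n c) c)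

    -- Inclusion and exclusion for the prime p, in additive form so that no truncated subtraction
    -- occurs.
    𝟙-coprime-∤ : ∀ g → 𝟙 (coprime? g (p * n)) + 𝟙 (p ∣? g) * 𝟙 (coprime? g n) ≡ 𝟙 (coprime? g n)
    𝟙-coprime-∤ g with p ∣? g
    ... | yes p∣g = trans (cong (_+ (𝟙 (coprime? g n) + 0)) (𝟙-no (coprime? g (p * n))
                      (λ c → prime∤1 pr (c (p∣g , Div.m∣m*n n)))))
                      (ℕP.+-identityʳ _)
    ... | no p∤g  = trans (ℕP.+-identityʳ _)
                      (𝟙-cong (coprime? g (p * n)) (coprime? g n) (coprime-∣ (Div.n∣m*n p)) (coprime-prime-* pr p∤g))

    𝟙-multiple : ¬ p ∣ n → ∀ g → 𝟙 (coprime? (p * g) n) ≡ 𝟙 (coprime? g n)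
    𝟙-multiple p∤n g = 𝟙-cong (coprime? (p * g) n) (coprime? g n)
      (λ c → Coprimality.sym (coprime-∣ (Div.n∣m*n p) (Coprimality.sym c)))
      (λ c → Coprimality.sym (coprime-prime-* pr p∤n (Coprimality.sym c)))

    totient-period : ∑ (upTo (p * n)) (λ a → 𝟙 (coprime? a n)) ≡ p * totient n
    totient-period = ∑-periodic p n _ (λ i → 𝟙-cong (coprime? (n + i) n) (coprime? i n) coprime-+⁻ coprime-+)

    jordan₂-period : ∑ (upTo (p * n)) (λ a → ∑ (upTo (p * n)) (λ b → 𝟙 (coprime? (gcd a b) n))) ≡ p * (p * jordan₂ n)
    jordan₂-period = begin
      ∑ (upTo (p * n)) (λ a → ∑ (upTo (p * n)) (λ b → 𝟙 (coprime? (gcd a b) n)))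
        ≡⟨ ∑-cong (upTo (p * n)) (λ a → ∑-periodic p n _ (λ b →
             𝟙-cong (coprime? (gcd a (n + b)) n) (coprime? (gcd a b) n)
               (coprime-gcd-comm b a ∘ coprime-gcd-+⁻ b a ∘ coprime-gcd-comm a (n + b))
               (coprime-gcd-comm (n + b) a ∘ coprime-gcd-+ b a ∘ coprime-gcd-comm a b))) ⟩
      ∑ (upTo (p * n)) (λ a → p * ∑ (upTo n) (λ b → 𝟙 (coprime? (gcd a b) n)))
        ≡⟨ ∑-*ˡ (upTo (p * n)) p _ ⟩
      p * ∑ (upTo (p * n)) (λ a → ∑ (upTo n) (λ b → 𝟙 (coprime? (gcd a b) n)))
        ≡⟨ cong (p *_) (∑-periodic p n _ (λ a → ∑-cong (upTo n) (λ b →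
             𝟙-cong (coprime? (gcd (n + a) b) n) (coprime? (gcd a b) n) (coprime-gcd-+⁻ a b) (coprime-gcd-+ a b)))) ⟩
      p * (p * jordan₂ n) ∎
      where open ≡-Reasoning

  totient-∣ : p ∣ n → totient (p * n) ≡ p * totient n
  totient-∣ p∣n = trans (∑-cong (upTo (p * n)) (λ a → 𝟙-coprime-∣ a p∣n)) totient-period

  -- Among the p φ(n) residues modulo p n that are coprime to n, those to be discarded are the
  -- multiples p g; as p is coprime to n, such a g ranges over the φ(n) residues coprime to n.
  totient-∤ : ¬ p ∣ n → totient (p * n) + totient n ≡ p * totient n
  totient-∤ p∤n = begin
    totient (p * n) + totient n
      ≡⟨ cong (totient (p * n) +_) (∑-cong (upTo n) (λ a →
           trans (cong (λ k → 𝟙 (coprime? k n)) (ℕP.*-comm a p)) (𝟙-multiple p∤n a))) ⟨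
    totient (p * n) + ∑ (upTo n) (λ a → 𝟙 (coprime? (a * p) n))
      ≡⟨ cong (totient (p * n) +_) (∑-multiples p n (λ a → 𝟙 (coprime? a n))) ⟨
    totient (p * n) + ∑ (upTo (n * p)) (λ a → 𝟙 (p ∣? a) * 𝟙 (coprime? a n))
      ≡⟨ cong (λ k → totient (p * n) + ∑ (upTo k) (λ a → 𝟙 (p ∣? a) * 𝟙 (coprime? a n))) (ℕP.*-comm n p) ⟩
    totient (p * n) + ∑ (upTo (p * n)) (λ a → 𝟙 (p ∣? a) * 𝟙 (coprime? a n))
      ≡⟨ ∑-+ (upTo (p * n)) _ _ ⟨
    ∑ (upTo (p * n)) (λ a → 𝟙 (coprime? a (p * n)) + 𝟙 (p ∣? a) * 𝟙 (coprime? a n))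
      ≡⟨ ∑-cong (upTo (p * n)) 𝟙-coprime-∤ ⟩
    ∑ (upTo (p * n)) (λ a → 𝟙 (coprime? a n))
      ≡⟨ totient-period ⟩
    p * totient n ∎
    where open ≡-Reasoning

  jordan₂-∣ : p ∣ n → jordan₂ (p * n) ≡ p * (p * jordan₂ n)
  jordan₂-∣ p∣n = trans (∑-cong (upTo (p * n)) (λ a → ∑-cong (upTo (p * n)) (λ b → 𝟙-coprime-∣ (gcd a b) p∣n)))
    jordan₂-period

  -- As for the totient, with pairs in place of residues: the discarded pairs have both entries
  -- divisible by p and come from the pairs modulo n by multiplication with p.
  jordan₂-∤ : ¬ p ∣ n → jordan₂ (p * n) + jordan₂ n ≡ p * (p * jordan₂ n)
  jordan₂-∤ p∤n = begin
    jordan₂ (p * n) + jordan₂ n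
      ≡⟨ cong (jordan₂ (p * n) +_) multiples ⟨
    jordan₂ (p * n) + ∑ (upTo (p * n)) (λ a → ∑ (upTo (p * n)) (λ b → 𝟙 (p ∣? gcd a b) * c (gcd a b)))
      ≡⟨ ∑-+ (upTo (p * n)) _ _ ⟨
    ∑ (upTo (p * n)) (λ a → ∑ (upTo (p * n)) (λ b → 𝟙 (coprime? (gcd a b) (p * n))) + ∑ (upTo (p * n)) (λ b → 𝟙 (p ∣? gcd a b) * c (gcd a b)))
      ≡⟨ ∑-cong (upTo (p * n)) (λ a → ∑-+ (upTo (p * n)) _ _) ⟨
    ∑ (upTo (p * n)) (λ a → ∑ (upTo (p * n)) (λ b → 𝟙 (coprime? (gcd a b) (p * n)) + 𝟙 (p ∣? gcd a b) * c (gcd a b)))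
      ≡⟨ ∑-cong (upTo (p * n)) (λ a → ∑-cong (upTo (p * n)) (λ b → 𝟙-coprime-∤ (gcd a b))) ⟩
    ∑ (upTo (p * n)) (λ a → ∑ (upTo (p * n)) (λ b → c (gcd a b)))
      ≡⟨ jordan₂-period ⟩
    p * (p * jordan₂ n) ∎
    where
    open ≡-Reasoning
    c : ℕ → ℕ
    c g = 𝟙 (coprime? g n)
    𝟙-∣gcd : ∀ a b → 𝟙 (p ∣? gcd a b) ≡ 𝟙 (p ∣? a) * 𝟙 (p ∣? b)
    𝟙-∣gcd a b = trans (𝟙-cong (p ∣? gcd a b) ((p ∣? a) ×-dec (p ∣? b))
      (λ d → Div.∣-trans d (gcd[m,n]∣m a b) , Div.∣-trans d (gcd[m,n]∣n a b))
      (λ (d , e) → gcd-greatest d e)) (𝟙-× (p ∣? a) (p ∣? b))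
    row : ∀ a → ∑ (upTo (p * n)) (λ b → 𝟙 (p ∣? gcd a b) * c (gcd a b)) ≡
                𝟙 (p ∣? a) * ∑ (upTo n) (λ b → c (gcd a (b * p)))
    row a = begin
      ∑ (upTo (p * n)) (λ b → 𝟙 (p ∣? gcd a b) * c (gcd a b))
        ≡⟨ ∑-cong (upTo (p * n)) (λ b → trans (cong (_* c (gcd a b)) (𝟙-∣gcd a b)) (ℕP.*-assoc (𝟙 (p ∣? a)) _ _)) ⟩
      ∑ (upTo (p * n)) (λ b → 𝟙 (p ∣? a) * (𝟙 (p ∣? b) * c (gcd a b)))
        ≡⟨ ∑-*ˡ (upTo (p * n)) (𝟙 (p ∣? a)) _ ⟩
      𝟙 (p ∣? a) * ∑ (upTo (p * n)) (λ b → 𝟙 (p ∣? b) * c (gcd a b))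
        ≡⟨ cong (λ k → 𝟙 (p ∣? a) * ∑ (upTo k) (λ b → 𝟙 (p ∣? b) * c (gcd a b))) (ℕP.*-comm p n) ⟩
      𝟙 (p ∣? a) * ∑ (upTo (n * p)) (λ b → 𝟙 (p ∣? b) * c (gcd a b))
        ≡⟨ cong (𝟙 (p ∣? a) *_) (∑-multiples p n (λ b → c (gcd a b))) ⟩
      𝟙 (p ∣? a) * ∑ (upTo n) (λ b → c (gcd a (b * p))) ∎
    multiples : ∑ (upTo (p * n)) (λ a → ∑ (upTo (p * n)) (λ b → 𝟙 (p ∣? gcd a b) * c (gcd a b))) ≡ jordan₂ n
    multiples = begin
      ∑ (upTo (p * n)) (λ a → ∑ (upTo (p * n)) (λ b → 𝟙 (p ∣? gcd a b) * c (gcd a b)))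
        ≡⟨ ∑-cong (upTo (p * n)) row ⟩
      ∑ (upTo (p * n)) (λ a → 𝟙 (p ∣? a) * ∑ (upTo n) (λ b → c (gcd a (b * p))))
        ≡⟨ cong (λ k → ∑ (upTo k) (λ a → 𝟙 (p ∣? a) * ∑ (upTo n) (λ b → c (gcd a (b * p))))) (ℕP.*-comm p n) ⟩
      ∑ (upTo (n * p)) (λ a → 𝟙 (p ∣? a) * ∑ (upTo n) (λ b → c (gcd a (b * p))))
        ≡⟨ ∑-multiples p n (λ a → ∑ (upTo n) (λ b → c (gcd a (b * p)))) ⟩
      ∑ (upTo n) (λ a → ∑ (upTo n) (λ b → c (gcd (a * p) (b * p))))
        ≡⟨ ∑-cong (upTo n) (λ a → ∑-cong (upTo n) (λ b → begin
             c (gcd (a * p) (b * p))  ≡⟨ cong₂ (λ x y → c (gcd x y)) (ℕP.*-comm a p) (ℕP.*-comm b p) ⟩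
             c (gcd (p * a) (p * b))  ≡⟨ cong c (c*gcd[m,n]≡gcd[cm,cn] p a b) ⟨
             c (p * gcd a b)          ≡⟨ 𝟙-multiple p∤n (gcd a b) ⟩
             c (gcd a b)              ∎)) ⟩
      jordan₂ n ∎

∈-primeDivisors⁺ : ∀ {v p} .{{_ : NonZero v}} → Prime p → p ∣ v → p ∈ primeDivisors v
∈-primeDivisors⁺ {v} pr p∣v = Mem.∈-filter⁺ (λ p → prime? p ×-dec (p ∣? v)) (Mem.∈-upTo⁺ (s≤s (Div.∣⇒≤ p∣v))) (pr , p∣v)

∈-primeDivisors⁻ : ∀ {v p} → p ∈ primeDivisors v → Prime p × p ∣ v
∈-primeDivisors⁻ {v} p∈ = proj₂ (Mem.∈-filter⁻ (λ p → prime? p ×-dec (p ∣? v)) {xs = upTo (suc v)} p∈)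

primeDivisors-unique : ∀ v → Unique (primeDivisors v)
primeDivisors-unique v = Uniq.filter⁺ (λ p → prime? p ×-dec (p ∣? v)) (Uniq.upTo⁺ (suc v))

primeDivisors-∣ : ∀ {p n} .{{_ : NonZero n}} → Prime p → p ∣ n → primeDivisors (p * n) ↭ primeDivisors n
primeDivisors-∣ {p} {n} pr p∣n = unique-↭ (primeDivisors-unique (p * n)) (primeDivisors-unique n) to from
  where
  instance
    pn≢0 : NonZero (p * n)
    pn≢0 = ℕP.m*n≢0 p n {{Primality.prime⇒nonZero pr}}
  to : ∀ {q} → q ∈ primeDivisors (p * n) → q ∈ primeDivisors n
  to q∈ with ∈-primeDivisors⁻ q∈
  ... | qr , q∣pn with Primality.euclidsLemma p n qr q∣pn
  ...   | inj₁ q∣p = ∈-primeDivisors⁺ qr (Div.∣-trans q∣p p∣n)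
  ...   | inj₂ q∣n = ∈-primeDivisors⁺ qr q∣n
  from : ∀ {q} → q ∈ primeDivisors n → q ∈ primeDivisors (p * n)
  from q∈ with ∈-primeDivisors⁻ q∈
  ... | qr , q∣n = ∈-primeDivisors⁺ qr (Div.∣n⇒∣m*n p q∣n)

prime∣prime : ∀ {p q} → Prime p → Prime q → q ∣ p → q ≡ p
prime∣prime pr qr q∣p with Primality.prime⇒irreducible pr q∣p
... | inj₁ q≡1 = contradiction q≡1 (prime∤1 qr)
... | inj₂ q≡p = q≡p

primeDivisors-∤ : ∀ {p n} .{{_ : NonZero n}} → Prime p → ¬ p ∣ n → primeDivisors (p * n) ↭ p ∷ primeDivisors n
primeDivisors-∤ {p} {n} pr p∤n = unique-↭ (primeDivisors-unique (p * n))
  (All.tabulate (λ q∈ p≡q → p∤n (subst (_∣ n) (sym p≡q) (proj₂ (∈-primeDivisors⁻ q∈)))) ∷ primeDivisors-unique n) to from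
  where
  instance
    pn≢0 : NonZero (p * n)
    pn≢0 = ℕP.m*n≢0 p n {{Primality.prime⇒nonZero pr}}
  to : ∀ {q} → q ∈ primeDivisors (p * n) → q ∈ p ∷ primeDivisors n
  to q∈ with ∈-primeDivisors⁻ q∈
  ... | qr , q∣pn with Primality.euclidsLemma p n qr q∣pn
  ...   | inj₁ q∣p = here (prime∣prime pr qr q∣p)
  ...   | inj₂ q∣n = there (∈-primeDivisors⁺ qr q∣n)
  from : ∀ {q} → q ∈ p ∷ primeDivisors n → q ∈ primeDivisors (p * n)
  from (here refl) = ∈-primeDivisors⁺ pr (Div.m∣m*n n)
  from (there q∈) with ∈-primeDivisors⁻ q∈
  ... | qr , q∣n = ∈-primeDivisors⁺ qr (Div.∣n⇒∣m*n p q∣n)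

-- One prime is added at a time, possibly one that already divides n. This suits the totients, whose
-- recursions only ask whether p divides n.
prime-induction : (P : ℕ → Set) → P 1 → (∀ p n → Prime p → NonZero n → P n → P (p * n)) → ∀ n .{{_ : NonZero n}} → P n
prime-induction P P1 step n = subst P (sym isFactorisation) (go factors factorsPrime)
  where
  open PrimeFactorisation (factorise n)
  go : ∀ ps → All Prime ps → P (product ps)
  go []       []         = P1
  go (p ∷ ps) (pr ∷ prs) = step p (product ps) pr (Primality.productOfPrimes≢0 prs) (go ps prs)

-- |P¹(ℤ/v)| = v ∏ (1 + 1/p), cleared of denominators.
jordan₂-totient : ∀ v .{{_ : NonZero v}} →
  jordan₂ v * product (primeDivisors v) ≡ totient v * (v * product (map suc (primeDivisors v)))
jordan₂-totient = prime-induction _ refl step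
  where
  step : ∀ p n → Prime p → NonZero n →
    jordan₂ n * product (primeDivisors n) ≡ totient n * (n * product (map suc (primeDivisors n))) →
    jordan₂ (p * n) * product (primeDivisors (p * n)) ≡ totient (p * n) * (p * n * product (map suc (primeDivisors (p * n))))
  step p n pr n≢0 ih with p ∣? n
  ... | yes p∣n = begin
    jordan₂ (p * n) * product (primeDivisors (p * n))  ≡⟨ cong₂ _*_ (jordan₂-∣ pr n p∣n) (product-↭ perm) ⟩
    p * (p * jordan₂ n) * Π                            ≡⟨ l₁ p (jordan₂ n) Π ⟩
    p * p * (jordan₂ n * Π)                            ≡⟨ cong (p * p *_) ih ⟩
    p * p * (totient n * (n * Π⁺))                     ≡⟨ l₂ p n (totient n) Π⁺ ⟩
    p * totient n * (p * n * Π⁺)                       ≡⟨ cong₂ (λ x y → x * (p * n * y)) (totient-∣ pr n p∣n) (product-↭ (PermP.map⁺ suc perm)) ⟨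
    totient (p * n) * (p * n * product (map suc (primeDivisors (p * n)))) ∎
    where
    open ≡-Reasoning
    Π  = product (primeDivisors n)
    Π⁺ = product (map suc (primeDivisors n))
    perm : primeDivisors (p * n) ↭ primeDivisors n
    perm = primeDivisors-∣ {{n≢0}} pr p∣n
    l₁ : ∀ p j x → p * (p * j) * x ≡ p * p * (j * x)
    l₁ = ℕ-Solver.solve-∀
    l₂ : ∀ p n t y → p * p * (t * (n * y)) ≡ p * t * (p * n * y)
    l₂ = ℕ-Solver.solve-∀
  -- The recursions for φ and J₂ are additive, so J₂(n) p Π is added to both sides and cancelled at
  -- the end.
  ... | no p∤n = ℕP.+-cancelʳ-≡ _ _ _ (begin
    jordan₂ (p * n) * product (primeDivisors (p * n)) + jordan₂ n * (p * Π)  ≡⟨ cong (λ x → jordan₂ (p * n) * x + jordan₂ n * (p * Π)) (product-↭ perm) ⟩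
    jordan₂ (p * n) * (p * Π) + jordan₂ n * (p * Π)                          ≡⟨ ℕP.*-distribʳ-+ (p * Π) (jordan₂ (p * n)) _ ⟨
    (jordan₂ (p * n) + jordan₂ n) * (p * Π)                                  ≡⟨ cong (_* (p * Π)) (jordan₂-∤ pr n p∤n) ⟩
    p * (p * jordan₂ n) * (p * Π)                                            ≡⟨ l₁ p (jordan₂ n) Π ⟩
    p * p * p * (jordan₂ n * Π)                                              ≡⟨ cong (p * p * p *_) ih ⟩
    p * p * p * (totient n * (n * Π⁺))                                       ≡⟨ l₂ p n (totient n) Π⁺ ⟩
    p * totient n * (p * n * (p * Π⁺))                                       ≡⟨ cong (_* (p * n * (p * Π⁺))) (totient-∤ pr n p∤n) ⟨
    (totient (p * n) + totient n) * (p * n * (p * Π⁺))                       ≡⟨ l₃ p n (totient (p * n)) (totient n) Π⁺ ⟩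
    totient (p * n) * (p * n * (p * Π⁺)) + p * totient n * (p * n * Π⁺)      ≡⟨ cong (λ x → totient (p * n) * (p * n * (p * Π⁺)) + x * (p * n * Π⁺)) (totient-∤ pr n p∤n) ⟨
    totient (p * n) * (p * n * (p * Π⁺)) + (totient (p * n) + totient n) * (p * n * Π⁺)  ≡⟨ l₄ p n (totient (p * n)) (totient n) Π⁺ ⟩
    totient (p * n) * (p * n * (suc p * Π⁺)) + p * (totient n * (n * Π⁺))    ≡⟨ cong₂ (λ x y → totient (p * n) * (p * n * x) + p * y) (product-↭ (PermP.map⁺ suc perm)) ih ⟨
    totient (p * n) * (p * n * product (map suc (primeDivisors (p * n)))) + p * (jordan₂ n * Π)  ≡⟨ cong (totient (p * n) * (p * n * product (map suc (primeDivisors (p * n)))) +_) (l₅ p (jordan₂ n) Π) ⟩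
    totient (p * n) * (p * n * product (map suc (primeDivisors (p * n)))) + jordan₂ n * (p * Π)  ∎)
    where
    open ≡-Reasoning
    Π  = product (primeDivisors n)
    Π⁺ = product (map suc (primeDivisors n))
    perm : primeDivisors (p * n) ↭ p ∷ primeDivisors n
    perm = primeDivisors-∤ {{n≢0}} pr p∤n
    l₁ : ∀ p j x → p * (p * j) * (p * x) ≡ p * p * p * (j * x)
    l₁ = ℕ-Solver.solve-∀
    l₂ : ∀ p n t y → p * p * p * (t * (n * y)) ≡ p * t * (p * n * (p * y))
    l₂ = ℕ-Solver.solve-∀
    l₃ : ∀ p n s t y → (s + t) * (p * n * (p * y)) ≡ s * (p * n * (p * y)) + p * t * (p * n * y)
    l₃ = ℕ-Solver.solve-∀
    l₄ : ∀ p n s t y → s * (p * n * (p * y)) + (s + t) * (p * n * y) ≡ s * (p * n * ((1 + p) * y)) + p * (t * (n * y))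
    l₄ = ℕ-Solver.solve-∀
    l₅ : ∀ p j x → p * (j * x) ≡ j * (p * x)
    l₅ = ℕ-Solver.solve-∀

-- Integers modulo v

module _ {d : ℤ} where

  -- Divisibilities and congruences below are derived as explicit linear combinations of known ones.
  -- The coefficients are the certificate, and the remaining equation is an identity of integer
  -- polynomials for the ring solver.
  ∣-combine₁ : ∀ {x y} c → d ∣ᶻ x → y ≡ c ⊗ x → d ∣ᶻ y
  ∣-combine₁ c p refl = ℤDiv.∣n⇒∣m*n c p

  ∣-combine₂ : ∀ {x₁ x₂ y} c₁ c₂ → d ∣ᶻ x₁ → d ∣ᶻ x₂ → y ≡ c₁ ⊗ x₁ ⊕ c₂ ⊗ x₂ → d ∣ᶻ y
  ∣-combine₂ c₁ c₂ p₁ p₂ refl = ℤDiv.∣m∣n⇒∣m+n (ℤDiv.∣n⇒∣m*n c₁ p₁) (ℤDiv.∣n⇒∣m*n c₂ p₂)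

  ∣-combine₃ : ∀ {x₁ x₂ x₃ y} c₁ c₂ c₃ → d ∣ᶻ x₁ → d ∣ᶻ x₂ → d ∣ᶻ x₃ → y ≡ c₁ ⊗ x₁ ⊕ c₂ ⊗ x₂ ⊕ c₃ ⊗ x₃ → d ∣ᶻ y
  ∣-combine₃ c₁ c₂ c₃ p₁ p₂ p₃ refl = ℤDiv.∣m∣n⇒∣m+n (∣-combine₂ c₁ c₂ p₁ p₂ refl) (ℤDiv.∣n⇒∣m*n c₃ p₃)

∣ᶻ⇒∣ : ∀ {d x} → pos d ∣ᶻ x → d ∣ ℤ.∣ x ∣
∣ᶻ⇒∣ = ℤDiv.∣⇒∣ᵤ

∣⇒∣ᶻ : ∀ {d x} → d ∣ ℤ.∣ x ∣ → pos d ∣ᶻ x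
∣⇒∣ᶻ = ℤDiv.∣ᵤ⇒∣

∣ᶻ-trans : ∀ {d e x} → d ∣ e → pos e ∣ᶻ x → pos d ∣ᶻ x
∣ᶻ-trans d∣e e∣x = ∣⇒∣ᶻ (Div.∣-trans d∣e (∣ᶻ⇒∣ e∣x))

coprime-∣-⊗ : ∀ {d} x {y} → Coprime ℤ.∣ x ∣ d → pos d ∣ᶻ x ⊗ y → pos d ∣ᶻ y
coprime-∣-⊗ {d} x {y} c d∣xy = ∣⇒∣ᶻ (Coprimality.coprime-divisor (Coprimality.sym c)
  (subst (d ∣_) (ℤP.abs-* x y) (∣ᶻ⇒∣ d∣xy)))

∣-<⇒≡-ordered : ∀ {v u w} → u ≤ w → w < v → pos v ∣ᶻ (pos w ⊖ pos u) → u ≡ w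
∣-<⇒≡-ordered {v} {u} {w} u≤w w<v d with w ∸ u in eq
... | zero  = ℕP.≤-antisym u≤w (ℕP.m∸n≡0⇒m≤n eq)
... | suc k = contradiction
  (ℕP.≤-trans (Div.∣⇒≤ (subst (v ∣_) (trans (cong ℤ.∣_∣ (trans (ℤP.m-n≡m⊖n w u) (ℤP.⊖-≥ u≤w))) eq) (∣ᶻ⇒∣ d)))
    (subst (_≤ w) eq (ℕP.m∸n≤m w u)))
  (ℕP.<⇒≱ w<v)

∣-<⇒≡ : ∀ {v u w} → u < v → w < v → pos v ∣ᶻ (pos u ⊖ pos w) → u ≡ w
∣-<⇒≡ {v} {u} {w} u<v w<v v∣ with ℕP.≤-total u w
... | inj₁ u≤w = ∣-<⇒≡-ordered u≤w w<v (∣-combine₁ (⊝ pos 1) v∣ (e (pos u) (pos w)))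
  where
  e : ∀ a b → b ⊖ a ≡ (⊝ pos 1) ⊗ (a ⊖ b)
  e = ℤ-Solver.solve-∀
... | inj₂ w≤u = sym (∣-<⇒≡-ordered w≤u u<v v∣)

module Residues (v : ℕ) .{{_ : NonZero v}} where

  infix 4 _≈_ _≈?_

  -- A record rather than a synonym for the divisibility, so that x and y can be inferred from the
  -- type; they could not be read off from the difference.
  record _≈_ (x y : ℤ) : Set where
    constructor by
    field ∣-difference : pos v ∣ᶻ (x ⊖ y)
  open _≈_ public

  _≈?_ : ∀ x y → Dec (x ≈ y)
  x ≈? y = map′ by ∣-difference (pos v ∣ᶻ? (x ⊖ y))

  combine₁ : ∀ {x y x₁ y₁} c → x₁ ≈ y₁ → x ⊖ y ≡ c ⊗ (x₁ ⊖ y₁) → x ≈ y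
  combine₁ c (by p) eq = by (∣-combine₁ c p eq)

  combine₂ : ∀ {x y x₁ y₁ x₂ y₂} c₁ c₂ → x₁ ≈ y₁ → x₂ ≈ y₂ → x ⊖ y ≡ c₁ ⊗ (x₁ ⊖ y₁) ⊕ c₂ ⊗ (x₂ ⊖ y₂) → x ≈ y
  combine₂ c₁ c₂ (by p₁) (by p₂) eq = by (∣-combine₂ c₁ c₂ p₁ p₂ eq)

  combine₃ : ∀ {x y x₁ y₁ x₂ y₂ x₃ y₃} c₁ c₂ c₃ → x₁ ≈ y₁ → x₂ ≈ y₂ → x₃ ≈ y₃ →
             x ⊖ y ≡ c₁ ⊗ (x₁ ⊖ y₁) ⊕ c₂ ⊗ (x₂ ⊖ y₂) ⊕ c₃ ⊗ (x₃ ⊖ y₃) → x ≈ y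
  combine₃ c₁ c₂ c₃ (by p₁) (by p₂) (by p₃) eq = by (∣-combine₃ c₁ c₂ c₃ p₁ p₂ p₃ eq)

  modulus≈0 : pos v ≈ pos 0
  modulus≈0 = by (dividesᶻ (pos 1) (trans (ℤP.+-identityʳ (pos v)) (sym (ℤP.*-identityˡ (pos v)))))

  ≈-reflexive : ∀ {x y} → x ≡ y → x ≈ y
  ≈-reflexive {x} refl = by (dividesᶻ (pos 0) (ℤP.+-inverseʳ x))

  ≈-refl : ∀ {x} → x ≈ x
  ≈-refl = ≈-reflexive refl

  ≈-sym : ∀ {x y} → x ≈ y → y ≈ x
  ≈-sym {x} {y} p = combine₁ (⊝ pos 1) p (e x y)
    where
    e : ∀ x y → y ⊖ x ≡ (⊝ pos 1) ⊗ (x ⊖ y)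
    e = ℤ-Solver.solve-∀

  ≈-trans : ∀ {x y z} → x ≈ y → y ≈ z → x ≈ z
  ≈-trans {x} {y} {z} p q = combine₂ (pos 1) (pos 1) p q (e x y z)
    where
    e : ∀ x y z → x ⊖ z ≡ pos 1 ⊗ (x ⊖ y) ⊕ pos 1 ⊗ (y ⊖ z)
    e = ℤ-Solver.solve-∀

  ⊖-cong : ∀ {x y z w} → x ≈ y → z ≈ w → x ⊖ z ≈ y ⊖ w
  ⊖-cong {x} {y} {z} {w} p q = combine₂ (pos 1) (⊝ pos 1) p q (e x y z w)
    where
    e : ∀ x y z w → x ⊖ z ⊖ (y ⊖ w) ≡ pos 1 ⊗ (x ⊖ y) ⊕ (⊝ pos 1) ⊗ (z ⊖ w)
    e = ℤ-Solver.solve-∀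

  ⊗-cong : ∀ {x y z w} → x ≈ y → z ≈ w → x ⊗ z ≈ y ⊗ w
  ⊗-cong {x} {y} {z} {w} p q = combine₂ z y p q (e x y z w)
    where
    e : ∀ x y z w → x ⊗ z ⊖ y ⊗ w ≡ z ⊗ (x ⊖ y) ⊕ y ⊗ (z ⊖ w)
    e = ℤ-Solver.solve-∀

  val : Fin v → ℤ
  val a = pos (toℕ a)

  val-injective : ∀ {a b} → val a ≈ val b → a ≡ b
  val-injective {a} {b} (by p) = FinP.toℕ-injective (∣-<⇒≡ (FinP.toℕ<n a) (FinP.toℕ<n b) p)

  abstract
    res : ℤ → Fin v
    res x = fromℕ< (ℤDivMod.n%ℕd<d x v)

    val-res : ∀ x → val (res x) ≈ x
    val-res x = by (∣-combine₁ (⊝ (x /ℕ v)) (ℤDiv.∣-refl {pos v})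
      (trans (cong₂ (λ r y → pos r ⊖ y) (FinP.toℕ-fromℕ< _) (ℤDivMod.a≡a%ℕn+[a/ℕn]*n x v)) (e (pos (x %ℕ v)) (x /ℕ v) (pos v))))
      where
      e : ∀ r q n → r ⊖ (r ⊕ q ⊗ n) ≡ (⊝ q) ⊗ n
      e = ℤ-Solver.solve-∀

  res-cong : ∀ {x y} → x ≈ y → res x ≡ res y
  res-cong {x} {y} p = val-injective (≈-trans (val-res x) (≈-trans p (≈-sym (val-res y))))

  res-injective : ∀ {x y} → res x ≡ res y → x ≈ y
  res-injective {x} {y} p = ≈-trans (≈-sym (val-res x)) (≈-trans (≈-reflexive (cong val p)) (val-res y))

  res-val : ∀ a → res (val a) ≡ a
  res-val a = val-injective (val-res (val a))

  Unit : ℤ → Set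
  Unit x = Coprime ℤ.∣ x ∣ v

  unit? : ∀ x → Dec (Unit x)
  unit? x = coprime? ℤ.∣ x ∣ v

  unit-intro : ∀ x y → x ⊗ y ≈ pos 1 → Unit x
  unit-intro x y (by p) {d} (d∣x , d∣v) = Div.∣1⇒≡1 (∣ᶻ⇒∣ {x = pos 1} (∣-combine₂ y (⊝ pos 1) (∣⇒∣ᶻ {x = x} d∣x) (∣ᶻ-trans d∣v p) (e x y)))
    where
    e : ∀ x y → pos 1 ≡ y ⊗ x ⊕ (⊝ pos 1) ⊗ (x ⊗ y ⊖ pos 1)
    e = ℤ-Solver.solve-∀

  private
    bezout : ∀ n → Coprime n v → ∃ λ y → pos n ⊗ y ≈ pos 1
    bezout n c with Coprimality.coprime-Bézout c
    ... | Bézout.Identity.+- x y eq = pos x , by (∣-combine₁ (pos y) (ℤDiv.∣-refl {pos v}) (begin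
        pos n ⊗ pos x ⊖ pos 1          ≡⟨ cong (_⊖ pos 1) (trans (ℤP.*-comm (pos n) (pos x)) (sym (ℤP.pos-* x n))) ⟩
        pos (x * n) ⊖ pos 1            ≡⟨ cong (λ k → pos k ⊖ pos 1) eq ⟨
        pos (1 + y * v) ⊖ pos 1        ≡⟨ cong (_⊖ pos 1) (trans (ℤP.pos-+ 1 (y * v)) (cong (pos 1 ⊕_) (ℤP.pos-* y v))) ⟩
        pos 1 ⊕ pos y ⊗ pos v ⊖ pos 1  ≡⟨ e (pos y) (pos v) ⟩
        pos y ⊗ pos v                  ∎))
      where
      open ≡-Reasoning
      e : ∀ y n → pos 1 ⊕ y ⊗ n ⊖ pos 1 ≡ y ⊗ n
      e = ℤ-Solver.solve-∀
    ... | Bézout.Identity.-+ x y eq = ⊝ pos x , by (∣-combine₁ (⊝ pos y) (ℤDiv.∣-refl {pos v}) (begin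
        pos n ⊗ (⊝ pos x) ⊖ pos 1       ≡⟨ e (pos n) (pos x) ⟩
        ⊝ (pos 1 ⊕ pos x ⊗ pos n)       ≡⟨ cong ⊝_ (trans (cong (pos 1 ⊕_) (sym (ℤP.pos-* x n))) (sym (ℤP.pos-+ 1 (x * n)))) ⟩
        ⊝ (pos (1 + x * n))             ≡⟨ cong (λ k → ⊝ (pos k)) eq ⟩
        ⊝ (pos (y * v))                 ≡⟨ cong ⊝_ (ℤP.pos-* y v) ⟩
        ⊝ (pos y ⊗ pos v)               ≡⟨ ℤP.neg-distribˡ-* (pos y) (pos v) ⟩
        (⊝ pos y) ⊗ pos v               ∎))
      where
      open ≡-Reasoning
      e : ∀ n x → n ⊗ (⊝ x) ⊖ pos 1 ≡ ⊝ (pos 1 ⊕ x ⊗ n)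
      e = ℤ-Solver.solve-∀

  unit-elim : ∀ x → Unit x → ∃ λ y → x ⊗ y ≈ pos 1
  unit-elim (pos n)  c = bezout n c
  unit-elim -[1+ n ] c with bezout (suc n) c
  ... | y , p = ⊝ y , subst (_≈ pos 1) (e (pos (suc n)) y) p
    where
    e : ∀ n y → n ⊗ y ≡ (⊝ n) ⊗ (⊝ y)
    e = ℤ-Solver.solve-∀

  abstract
    -- Junk value 0 on non-units.
    recipᵛ : ℤ → ℤ
    recipᵛ x with unit? x
    ... | yes c = proj₁ (unit-elim x c)
    ... | no _  = pos 0

    ⊗-recipᵛ : ∀ x → Unit x → x ⊗ recipᵛ x ≈ pos 1
    ⊗-recipᵛ x c with unit? x
    ... | yes c′ = proj₂ (unit-elim x c′)
    ... | no ¬c  = contradiction (λ {d} → c {d}) ¬c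

  unit-cong : ∀ {x y} → x ≈ y → Unit x → Unit y
  unit-cong {x} {y} p c = unit-intro y (recipᵛ x) (≈-trans (⊗-cong (≈-sym p) ≈-refl) (⊗-recipᵛ x c))

  unit-⊗ : ∀ {x y} → Unit x → Unit y → Unit (x ⊗ y)
  unit-⊗ {x} {y} c d = unit-intro (x ⊗ y) (recipᵛ x ⊗ recipᵛ y)
    (combine₂ (y ⊗ recipᵛ y) (pos 1) (⊗-recipᵛ x c) (⊗-recipᵛ y d) (e x y (recipᵛ x) (recipᵛ y)))
    where
    e : ∀ x y s t → x ⊗ y ⊗ (s ⊗ t) ⊖ pos 1 ≡ y ⊗ t ⊗ (x ⊗ s ⊖ pos 1) ⊕ pos 1 ⊗ (y ⊗ t ⊖ pos 1)
    e = ℤ-Solver.solve-∀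

  unit-⊗⁻ : ∀ x y → Unit (x ⊗ y) → Unit x
  unit-⊗⁻ x y c = unit-intro x (y ⊗ recipᵛ (x ⊗ y))
    (≈-trans (≈-reflexive (sym (ℤP.*-assoc x y (recipᵛ (x ⊗ y))))) (⊗-recipᵛ (x ⊗ y) c))

  unit-recipᵛ : ∀ x → Unit x → Unit (recipᵛ x)
  unit-recipᵛ x c = unit-intro (recipᵛ x) x (≈-trans (≈-reflexive (ℤP.*-comm (recipᵛ x) x)) (⊗-recipᵛ x c))

  unit-cancel : ∀ x {y z} → Unit x → x ⊗ y ≈ x ⊗ z → y ≈ z
  unit-cancel x {y} {z} c (by p) = by (coprime-∣-⊗ x c (subst (pos v ∣ᶻ_) (e x y z) p))
    where
    e : ∀ x y z → x ⊗ y ⊖ x ⊗ z ≡ x ⊗ (y ⊖ z)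
    e = ℤ-Solver.solve-∀

-- Roots of polynomials modulo v

roots : (ℤ → ℤ) → ℕ → ℕ
roots f v = ∑ (upTo v) (λ u → 𝟙 (pos v ∣ᶻ? f (pos u)))

-- What the Chinese remainder theorem uses of a polynomial with integer coefficients: it respects
-- congruence to every modulus.
Polynomial : (ℤ → ℤ) → Set
Polynomial f = ∀ {d} x y → d ∣ᶻ (x ⊖ y) → d ∣ᶻ (f x ⊖ f y)

∣-polynomial : ∀ f → Polynomial f → ∀ {d} x y → d ∣ᶻ (x ⊖ y) → d ∣ᶻ f y → d ∣ᶻ f x
∣-polynomial f poly x y d∣ d∣fy = ∣-combine₂ (pos 1) (pos 1) (poly x y d∣) d∣fy (e (f x) (f y))
  where
  e : ∀ a b → a ≡ pos 1 ⊗ (a ⊖ b) ⊕ pos 1 ⊗ b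
  e = ℤ-Solver.solve-∀

∣-flip : ∀ {d} x y → d ∣ᶻ (x ⊖ y) → d ∣ᶻ (y ⊖ x)
∣-flip x y p = ∣-combine₁ (⊝ pos 1) p (e x y)
  where
  e : ∀ x y → y ⊖ x ≡ (⊝ pos 1) ⊗ (x ⊖ y)
  e = ℤ-Solver.solve-∀

roots-list : ∀ (f : ℤ → ℤ) {v} → List ℕ
roots-list f {v} = filter (λ u → pos v ∣ᶻ? f (pos u)) (upTo v)

roots≡length : ∀ (f : ℤ → ℤ) v → roots f v ≡ length (roots-list f {v})
roots≡length f v = sym (length-filter (λ u → pos v ∣ᶻ? f (pos u)) (upTo v))

∈-roots⁺ : ∀ (f : ℤ → ℤ) {v u} → u < v → pos v ∣ᶻ f (pos u) → u ∈ roots-list f {v}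
∈-roots⁺ f {v} u<v p = Mem.∈-filter⁺ (λ u → pos v ∣ᶻ? f (pos u)) (Mem.∈-upTo⁺ u<v) p

∈-roots⁻ : ∀ (f : ℤ → ℤ) {v u} → u ∈ roots-list f {v} → u < v × pos v ∣ᶻ f (pos u)
∈-roots⁻ f {v} u∈ with Mem.∈-filter⁻ (λ u → pos v ∣ᶻ? f (pos u)) {xs = upTo v} u∈
... | a , b = Mem.∈-upTo⁻ a , b

roots-unique : ∀ (f : ℤ → ℤ) v → Unique (roots-list f {v})
roots-unique f v = Uniq.filter⁺ (λ u → pos v ∣ᶻ? f (pos u)) (Uniq.upTo⁺ v)

roots-explicit : ∀ (f : ℤ → ℤ) {v} us → Unique us → All (λ u → u < v × pos v ∣ᶻ f (pos u)) us →
                 (∀ {u} → u < v → pos v ∣ᶻ f (pos u) → u ∈ us) → roots f v ≡ length us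
roots-explicit f {v} us unique sound complete = trans (roots≡length f v)
  (PermP.↭-length (unique-↭ (roots-unique f v) unique
    (λ u∈ → let (a , b) = ∈-roots⁻ f u∈ in complete a b)
    (λ u∈ → let (a , b) = All.lookup sound u∈ in ∈-roots⁺ f a b)))

∣-% : ∀ u m .{{_ : NonZero m}} → pos m ∣ᶻ (pos u ⊖ pos (u % m))
∣-% u m = dividesᶻ (pos (u ℕ./ m)) (begin
  pos u ⊖ pos (u % m)                                     ≡⟨ cong (λ k → pos k ⊖ pos (u % m)) (m≡m%n+[m/n]*n u m) ⟩
  pos (u % m + u ℕ./ m * m) ⊖ pos (u % m)                 ≡⟨ cong (_⊖ pos (u % m)) (trans (ℤP.pos-+ (u % m) _) (cong (pos (u % m) ⊕_) (ℤP.pos-* (u ℕ./ m) m))) ⟩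
  pos (u % m) ⊕ pos (u ℕ./ m) ⊗ pos m ⊖ pos (u % m)       ≡⟨ e (pos (u % m)) (pos (u ℕ./ m)) (pos m) ⟩
  pos (u ℕ./ m) ⊗ pos m                                   ∎)
  where
  open ≡-Reasoning
  e : ∀ r q m → r ⊕ q ⊗ m ⊖ r ≡ q ⊗ m
  e = ℤ-Solver.solve-∀

module _ (m n : ℕ) .{{_ : NonZero m}} .{{_ : NonZero n}} (m⊥n : Coprime m n) where

  coprime-*-∣ : ∀ {x} → m ∣ x → n ∣ x → m * n ∣ x
  coprime-*-∣ m∣x (divides q refl) =
    Div.*-monoˡ-∣ n (Coprimality.coprime-divisor {m} {n} {q} m⊥n (subst (m ∣_) (ℕP.*-comm q n) m∣x))

  -- The Chinese remainder theorem by pigeonhole: the map to pairs of residues is injective because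
  -- coprime divisors multiply, and both sides have m n members.
  residues-↭ : map (λ u → u % m , u % n) (upTo (m * n)) ↭ cartesianProduct (upTo m) (upTo n)
  residues-↭ = unique-⊆-↭ (map-unique _ (Uniq.upTo⁺ (m * n)) inj) into (ℕP.≤-reflexive len)
    where
    same : ∀ k .{{_ : NonZero k}} {x y} → x % k ≡ y % k → k ∣ ℤ.∣ pos x ⊖ pos y ∣
    same k {x} {y} eq = ∣ᶻ⇒∣ (∣-combine₂ (pos 1) (⊝ pos 1) (∣-% x k)
      (subst (λ r → pos k ∣ᶻ (pos y ⊖ pos r)) (sym eq) (∣-% y k)) (e (pos x) (pos y) (pos (x % k))))
      where
      e : ∀ x y r → x ⊖ y ≡ pos 1 ⊗ (x ⊖ r) ⊕ (⊝ pos 1) ⊗ (y ⊖ r)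
      e = ℤ-Solver.solve-∀
    inj : ∀ {x y} → x ∈ upTo (m * n) → y ∈ upTo (m * n) → (x % m , x % n) ≡ (y % m , y % n) → x ≡ y
    inj {x} {y} x∈ y∈ eq = ∣-<⇒≡ (Mem.∈-upTo⁻ x∈) (Mem.∈-upTo⁻ y∈)
      (∣⇒∣ᶻ (coprime-*-∣ (same m {x} {y} (cong proj₁ eq)) (same n {x} {y} (cong proj₂ eq))))
    into : ∀ {z} → z ∈ map (λ u → u % m , u % n) (upTo (m * n)) → z ∈ cartesianProduct (upTo m) (upTo n)
    into z∈ with Mem.∈-map⁻ _ z∈
    ... | u , _ , refl = Mem.∈-cartesianProduct⁺ (Mem.∈-upTo⁺ (m%n<n u m)) (Mem.∈-upTo⁺ (m%n<n u n))
    len : length (cartesianProduct (upTo m) (upTo n)) ≡ length (map (λ u → u % m , u % n) (upTo (m * n)))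
    len = trans (length-cartesianProduct (upTo m) (upTo n))
      (trans (cong₂ _*_ (List.length-upTo m) (List.length-upTo n))
        (sym (trans (List.length-map _ (upTo (m * n))) (List.length-upTo (m * n)))))

  -- Divisibility of f u by m n splits into two conditions, which depend on u only through its
  -- residues modulo m and modulo n, so the sum over pairs of residues factors.
  roots-* : ∀ f → Polynomial f → roots f (m * n) ≡ roots f m * roots f n
  roots-* f poly = begin
    ∑ (upTo (m * n)) (λ u → 𝟙 (pos (m * n) ∣ᶻ? f (pos u)))                      ≡⟨ ∑-cong (upTo (m * n)) split ⟩
    ∑ (upTo (m * n)) (λ u → F (u % m , u % n))                                  ≡⟨ ∑-map _ (upTo (m * n)) F ⟨
    ∑ (map (λ u → u % m , u % n) (upTo (m * n))) F                              ≡⟨ ∑-↭ F residues-↭ ⟩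
    ∑ (cartesianProduct (upTo m) (upTo n)) F                                    ≡⟨ ∑-cartesianProduct (upTo m) (upTo n) F ⟩
    ∑ (upTo m) (λ x → ∑ (upTo n) (λ y → [ m , x ] * [ n , y ]))                 ≡⟨ ∑-cong (upTo m) (λ x → trans (∑-*ˡ (upTo n) [ m , x ] _) (ℕP.*-comm [ m , x ] (roots f n))) ⟩
    ∑ (upTo m) (λ x → roots f n * [ m , x ])                                    ≡⟨ ∑-*ˡ (upTo m) (roots f n) _ ⟩
    roots f n * roots f m                                                       ≡⟨ ℕP.*-comm (roots f n) _ ⟩
    roots f m * roots f n                                                       ∎
    where
    open ≡-Reasoning
    [_,_] : ℕ → ℕ → ℕ
    [ d , u ] = 𝟙 (pos d ∣ᶻ? f (pos u))
    F : ℕ × ℕ → ℕ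
    F (x , y) = [ m , x ] * [ n , y ]
    split : ∀ u → [ m * n , u ] ≡ F (u % m , u % n)
    split u = trans
      (𝟙-cong (pos (m * n) ∣ᶻ? f (pos u)) ((pos m ∣ᶻ? f (pos (u % m))) ×-dec (pos n ∣ᶻ? f (pos (u % n))))
        (λ d → down m (Div.m∣m*n n) d , down n (Div.n∣m*n m) d)
        (λ (d , e) → ∣⇒∣ᶻ (coprime-*-∣ (up m d) (up n e))))
      (𝟙-× (pos m ∣ᶻ? f (pos (u % m))) (pos n ∣ᶻ? f (pos (u % n))))
      where
      down : ∀ k .{{_ : NonZero k}} → k ∣ m * n → pos (m * n) ∣ᶻ f (pos u) → pos k ∣ᶻ f (pos (u % k))
      down k k∣ d = ∣-polynomial f poly (pos (u % k)) (pos u) (∣-flip (pos u) (pos (u % k)) (∣-% u k)) (∣ᶻ-trans k∣ d)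
      up : ∀ k .{{_ : NonZero k}} → pos k ∣ᶻ f (pos (u % k)) → k ∣ ℤ.∣ f (pos u) ∣
      up k d = ∣ᶻ⇒∣ (∣-polynomial f poly (pos u) (pos (u % k)) (∣-% u k) d)

-- A root modulo v reduces to a root modulo each divisor of v.
roots-none : ∀ f → Polynomial f → ∀ {d v} .{{_ : NonZero d}} → d ∣ v → roots f d ≡ 0 → roots f v ≡ 0
roots-none f poly {d} {v} d∣v eq with roots-list f {v} in eqv
... | [] = trans (roots≡length f v) (cong length eqv)
... | u ∷ _ with ∈-roots⁻ f {v} {u} (subst (u ∈_) (sym eqv) (here refl))
...   | _ , root = contradiction (trans (sym (roots≡length f d)) eq) (ℕP.m<n⇒n≢0 (Mem.∈-length (∈-roots⁺ f (m%n<n u d)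
        (∣-polynomial f poly (pos (u % d)) (pos u) (∣-flip (pos u) (pos (u % d)) (∣-% u d)) (∣ᶻ-trans d∣v root)))))

prime-^-coprime : ∀ {p g} → Prime p → ¬ p ∣ g → ∀ e → Coprime g (p ^ e)
prime-^-coprime pr p∤g zero    (_ , d∣1) = Div.∣1⇒≡1 d∣1
prime-^-coprime pr p∤g (suc e) = coprime-prime-* pr p∤g (prime-^-coprime pr p∤g e)

primeDivisors-^-* : ∀ {p n} .{{_ : NonZero n}} → Prime p → ¬ p ∣ n → ∀ e →
                    primeDivisors (p ^ suc e * n) ↭ p ∷ primeDivisors n
primeDivisors-^-* {p} {n} pr p∤n zero =
  subst (λ k → primeDivisors (k * n) ↭ p ∷ primeDivisors n) (sym (ℕP.*-identityʳ p)) (primeDivisors-∤ pr p∤n)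
primeDivisors-^-* {p} {n} pr p∤n (suc e) =
  subst (λ k → primeDivisors k ↭ p ∷ primeDivisors n) (sym (ℕP.*-assoc p (p ^ suc e) n))
    (Perm.trans (primeDivisors-∣ {{nz}} pr (Div.∣-trans (Div.m∣m*n (p ^ e)) (Div.m∣m*n n))) (primeDivisors-^-* pr p∤n e))
  where
  nz : NonZero (p ^ suc e * n)
  nz = ℕP.m*n≢0 (p ^ suc e) n {{ℕP.m^n≢0 p (suc e) {{Primality.prime⇒nonZero pr}}}}

prime-part : ∀ {p} → Prime p → ∀ n → NonZero n → ∃ λ e → ∃ λ m → n ≡ p ^ e * m × ¬ p ∣ m × NonZero m
prime-part {p} pr n = <-rec (λ n → NonZero n → ∃ λ e → ∃ λ m → n ≡ p ^ e * m × ¬ p ∣ m × NonZero m) step n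
  where
  step : ∀ n → (∀ {k} → k < n → NonZero k → ∃ λ e → ∃ λ m → k ≡ p ^ e * m × ¬ p ∣ m × NonZero m) →
         NonZero n → ∃ λ e → ∃ λ m → n ≡ p ^ e * m × ¬ p ∣ m × NonZero m
  step n rec nz with p ∣? n
  ... | no p∤n  = 0 , n , sym (ℕP.*-identityˡ n) , p∤n , nz
  ... | yes p∣n with rec (Div.quotient-< p∣n {{Primality.prime⇒nonTrivial pr}} {{nz}}) (Div.quotient≢0 p∣n {{nz}})
  ...   | e , m , eq , p∤m , mz = suc e , m ,
          trans (Div.m∣n⇒n≡m*quotient p∣n) (trans (cong (p *_) eq) (sym (ℕP.*-assoc p (p ^ e) m))) , p∤m , mz

-- The whole power of p is split off at once, since numbers of roots multiply only over coprime
-- moduli.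
primary-induction : (P : ℕ → Set) → P 1 →
  (∀ p e n → Prime p → ¬ p ∣ n → NonZero n → P n → P (p ^ suc e * n)) → ∀ n → NonZero n → P n
primary-induction P P1 step = <-rec _ go
  where
  go : ∀ n → (∀ {k} → k < n → NonZero k → P k) → NonZero n → P n
  go n rec nz with factorise n {{nz}}
  ... | record { factors = [] ; isFactorisation = refl } = P1
  ... | record { factors = p ∷ ps ; isFactorisation = eq ; factorsPrime = pr ∷ _ } with prime-part pr n nz
  ...   | zero  , m , n≡m , p∤m , mz =
          contradiction (subst (p ∣_) (trans (sym eq) (trans n≡m (ℕP.*-identityˡ m))) (Div.m∣m*n (product ps))) p∤m
  ...   | suc e , m , refl , p∤m , mz = step p e m pr p∤m mz (rec m<n mz)
          where
          1<p^ : 1 < p ^ suc e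
          1<p^ = ℕP.≤-trans (ℕ.nonTrivial⇒n>1 p {{Primality.prime⇒nonTrivial pr}})
                   (ℕP.m≤m*n p (p ^ e) {{ℕP.m^n≢0 p e {{Primality.prime⇒nonZero pr}}}})
          m<n : m < p ^ suc e * m
          m<n = subst (_< p ^ suc e * m) (ℕP.*-identityˡ m) (ℕP.*-monoˡ-< m {{mz}} 1<p^)

roots-primary : ∀ f → Polynomial f → ∀ {p n} → Prime p → ¬ p ∣ n → NonZero n → ∀ e →
                roots f (p ^ suc e * n) ≡ roots f (p ^ suc e) * roots f n
roots-primary f poly {p} {n} pr p∤n nz e =
  roots-* (p ^ suc e) n {{ℕP.m^n≢0 p (suc e) {{Primality.prime⇒nonZero pr}}}} {{nz}}
    (Coprimality.sym (prime-^-coprime pr p∤n (suc e))) f poly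

-- Square roots of 1 modulo v

square-1 : ℤ → ℤ
square-1 x = x ⊗ x ⊖ pos 1

square-1-polynomial : Polynomial square-1
square-1-polynomial x y d = ∣-combine₁ (x ⊕ y) d (e x y)
  where
  e : ∀ x y → x ⊗ x ⊖ pos 1 ⊖ (y ⊗ y ⊖ pos 1) ≡ (x ⊕ y) ⊗ (x ⊖ y)
  e = ℤ-Solver.solve-∀

square-1-factor : ∀ x → square-1 x ≡ (x ⊖ pos 1) ⊗ (x ⊕ pos 1)
square-1-factor = e
  where
  e : ∀ x → x ⊗ x ⊖ pos 1 ≡ (x ⊖ pos 1) ⊗ (x ⊕ pos 1)
  e = ℤ-Solver.solve-∀

square-1-factor′ : ∀ x → square-1 x ≡ (x ⊕ pos 1) ⊗ (x ⊖ pos 1)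
square-1-factor′ x = trans (square-1-factor x) (ℤP.*-comm (x ⊖ pos 1) (x ⊕ pos 1))

prime^-∣-⊗ : ∀ {p} → Prime p → ∀ e x {y} → ¬ pos p ∣ᶻ x → pos (p ^ e) ∣ᶻ x ⊗ y → pos (p ^ e) ∣ᶻ y
prime^-∣-⊗ pr e x p∤x = coprime-∣-⊗ x (prime-^-coprime pr (p∤x ∘ ∣⇒∣ᶻ) e)

p∣p^suc : ∀ {p x} e → pos (p ^ suc e) ∣ᶻ x → pos p ∣ᶻ x
p∣p^suc {p} e = ∣ᶻ-trans (Div.m∣m*n (p ^ e))

∣ᶻ0 : ∀ {d} → d ∣ᶻ pos 0
∣ᶻ0 {d} = dividesᶻ (pos 0) (sym (ℤP.*-zeroˡ d))

≡-1 : ∀ {q u} → u < suc q → pos (suc q) ∣ᶻ (pos u ⊕ pos 1) → u ≡ q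
≡-1 {q} {u} u<q d = ∣-<⇒≡ u<q ℕP.≤-refl (∣-combine₂ (pos 1) (⊝ pos 1) d (ℤDiv.∣-refl {pos (suc q)}) (e (pos u) (pos q)))
  where
  e : ∀ u q → u ⊖ q ≡ pos 1 ⊗ (u ⊕ pos 1) ⊕ (⊝ pos 1) ⊗ (pos 1 ⊕ q)
  e = ℤ-Solver.solve-∀

-1-root : ∀ q → pos (suc q) ∣ᶻ (pos q ⊕ pos 1)
-1-root q = ∣⇒∣ᶻ (subst (suc q ∣_) (sym (ℕP.+-comm q 1)) Div.∣-refl)

module _ {p} (pr : Prime p) (p≢2 : p ≢ 2) (e : ℕ) where
  private
    2≤p : 2 ≤ p
    2≤p = ℕ.nonTrivial⇒n>1 p {{Primality.prime⇒nonTrivial pr}}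

    3≤q : 3 ≤ p ^ suc e
    3≤q = ℕP.≤-trans (ℕP.≤∧≢⇒< 2≤p (p≢2 ∘ sym)) (ℕP.m≤m*n p (p ^ e) {{ℕP.m^n≢0 p e {{Primality.prime⇒nonZero pr}}}})

    -- p divides at most one of u - 1 and u + 1.
    go : ∀ q → 3 ≤ q → q ≡ p ^ suc e → roots square-1 q ≡ 2
    go 1 (s≤s ())
    go 2 (s≤s (s≤s ()))
    go q@(suc q-1@(suc (suc _))) _ eq = roots-explicit square-1 (1 ∷ q-1 ∷ [])
      (((λ ()) ∷ []) ∷ [] ∷ [])
      ((s≤s (s≤s z≤n) , ∣ᶻ0)
       ∷ (ℕP.≤-refl , ∣-combine₁ (pos q-1 ⊖ pos 1) (-1-root q-1) (square-1-factor (pos q-1))) ∷ [])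
      complete
      where
      complete : ∀ {u} → u < q → pos q ∣ᶻ square-1 (pos u) → u ∈ 1 ∷ q-1 ∷ []
      complete {u} u<q root with pos p ∣ᶻ? (pos u ⊖ pos 1)
      ... | yes p∣u-1 = here (∣-<⇒≡ u<q (s≤s (s≤s z≤n))
              (subst (λ k → pos k ∣ᶻ (pos u ⊖ pos 1)) (sym eq)
                (prime^-∣-⊗ pr (suc e) (pos u ⊕ pos 1) p∤u+1
                  (subst₂ (λ k z → pos k ∣ᶻ z) eq (square-1-factor′ (pos u)) root))))
        where
        e₁ : ∀ u → pos 2 ≡ (⊝ pos 1) ⊗ (u ⊖ pos 1) ⊕ pos 1 ⊗ (u ⊕ pos 1)
        e₁ = ℤ-Solver.solve-∀
        p∤u+1 : ¬ pos p ∣ᶻ (pos u ⊕ pos 1)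
        p∤u+1 p∣u+1 = p≢2 (ℕP.≤-antisym (Div.∣⇒≤ (∣ᶻ⇒∣ {x = pos 2} (∣-combine₂ (⊝ pos 1) (pos 1) p∣u-1 p∣u+1 (e₁ (pos u))))) 2≤p)
      ... | no p∤u-1 = there (here (≡-1 u<q
              (subst (λ k → pos k ∣ᶻ (pos u ⊕ pos 1)) (sym eq)
                (prime^-∣-⊗ pr (suc e) (pos u ⊖ pos 1) p∤u-1
                  (subst₂ (λ k z → pos k ∣ᶻ z) eq (square-1-factor (pos u)) root)))))

  roots-square-1-odd : roots square-1 (p ^ suc e) ≡ 2
  roots-square-1-odd = go (p ^ suc e) 3≤q refl

data Parity : ℕ → Set where
  even : ∀ w → Parity (2 * w)
  odd  : ∀ w → Parity (1 + 2 * w)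

parity : ∀ u → Parity u
parity zero = even 0
parity (suc u) with parity u
... | even w = odd w
... | odd w  = subst Parity (cong suc (ℕP.+-suc w (w + 0))) (even (suc w))

-- Put t = 2^k, h = 4t and q = 2h = 8t. A root is odd, u = 1 + 2w, and u² - 1 = 4w(w + 1), so 2t
-- divides w(w + 1). One of w and w + 1 is odd, hence 2t divides the other and u is 1 or -1 modulo
-- h. These are four residues modulo q, and each is a root.
roots-square-1-8 : ∀ k → roots square-1 (2 ^ (3 + k)) ≡ 4
roots-square-1-8 k = go (2 ^ k) refl (ℕ.>-nonZero⁻¹ _ {{ℕP.m^n≢0 2 k}})
  where
  -- Matching t as `suc r` makes h - 1 the visible number 3 + 4r, so that the four roots are
  -- concrete enough to be compared with each other and with q.
  go : ∀ t → t ≡ 2 ^ k → 0 < t → roots square-1 (2 * (2 * (2 * 2 ^ k))) ≡ 4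
  go t@(suc r) eq _ = subst (λ x → roots square-1 (2 * (2 * (2 * x))) ≡ 4) eq
    (subst (λ q → roots square-1 q ≡ 4) (sym q≡) main)
    where
    h : ℕ
    h = 4 + 4 * r
    q : ℕ
    q = h + h
    q≡ : 2 * (2 * (2 * t)) ≡ q
    q≡ = l r
      where
      l : ∀ r → 2 * (2 * (2 * (1 + r))) ≡ 4 + 4 * r + (4 + 4 * r)
      l = ℕ-Solver.solve-∀
    h-half : pos h ≡ pos 2 ⊗ pos (2 * t)
    h-half = trans (cong pos (l r)) (ℤP.pos-* 2 (2 * t))
      where
      l : ∀ r → 4 + 4 * r ≡ 2 * (2 * (1 + r))
      l = ℕ-Solver.solve-∀
    q-pos : pos q ≡ pos 2 ⊗ pos h
    q-pos = trans (ℤP.pos-+ h h) (l (pos h))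
      where
      l : ∀ x → x ⊕ x ≡ pos 2 ⊗ x
      l = ℤ-Solver.solve-∀
    sound₋ : ∀ u → pos h ∣ᶻ (pos u ⊖ pos 1) → pos q ∣ᶻ square-1 (pos u)
    sound₋ u (dividesᶻ c eq₁) = dividesᶻ (c ⊗ (c ⊗ pos (2 * t) ⊕ pos 1)) (begin
      square-1 (pos u)                                        ≡⟨ l (pos u) ⟩
      (pos u ⊖ pos 1) ⊗ (pos u ⊖ pos 1 ⊕ pos 2)               ≡⟨ cong (λ z → z ⊗ (z ⊕ pos 2)) eq₁ ⟩
      c ⊗ pos h ⊗ (c ⊗ pos h ⊕ pos 2)                         ≡⟨ cong (λ z → c ⊗ pos h ⊗ (c ⊗ z ⊕ pos 2)) h-half ⟩
      c ⊗ pos h ⊗ (c ⊗ (pos 2 ⊗ pos (2 * t)) ⊕ pos 2)         ≡⟨ l₂ c (pos h) (pos (2 * t)) ⟩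
      c ⊗ (c ⊗ pos (2 * t) ⊕ pos 1) ⊗ (pos 2 ⊗ pos h)         ≡⟨ cong (c ⊗ (c ⊗ pos (2 * t) ⊕ pos 1) ⊗_) q-pos ⟨
      c ⊗ (c ⊗ pos (2 * t) ⊕ pos 1) ⊗ pos q                   ∎)
      where
      open ≡-Reasoning
      l : ∀ x → x ⊗ x ⊖ pos 1 ≡ (x ⊖ pos 1) ⊗ (x ⊖ pos 1 ⊕ pos 2)
      l = ℤ-Solver.solve-∀
      l₂ : ∀ c h s → c ⊗ h ⊗ (c ⊗ (pos 2 ⊗ s) ⊕ pos 2) ≡ c ⊗ (c ⊗ s ⊕ pos 1) ⊗ (pos 2 ⊗ h)
      l₂ = ℤ-Solver.solve-∀
    sound₊ : ∀ u → pos h ∣ᶻ (pos u ⊕ pos 1) → pos q ∣ᶻ square-1 (pos u)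
    sound₊ u (dividesᶻ c eq₁) = dividesᶻ (c ⊗ (c ⊗ pos (2 * t) ⊖ pos 1)) (begin
      square-1 (pos u)                                        ≡⟨ l (pos u) ⟩
      (pos u ⊕ pos 1) ⊗ (pos u ⊕ pos 1 ⊖ pos 2)               ≡⟨ cong (λ z → z ⊗ (z ⊖ pos 2)) eq₁ ⟩
      c ⊗ pos h ⊗ (c ⊗ pos h ⊖ pos 2)                         ≡⟨ cong (λ z → c ⊗ pos h ⊗ (c ⊗ z ⊖ pos 2)) h-half ⟩
      c ⊗ pos h ⊗ (c ⊗ (pos 2 ⊗ pos (2 * t)) ⊖ pos 2)         ≡⟨ l₂ c (pos h) (pos (2 * t)) ⟩
      c ⊗ (c ⊗ pos (2 * t) ⊖ pos 1) ⊗ (pos 2 ⊗ pos h)         ≡⟨ cong (c ⊗ (c ⊗ pos (2 * t) ⊖ pos 1) ⊗_) q-pos ⟨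
      c ⊗ (c ⊗ pos (2 * t) ⊖ pos 1) ⊗ pos q                   ∎)
      where
      open ≡-Reasoning
      l : ∀ x → x ⊗ x ⊖ pos 1 ≡ (x ⊕ pos 1) ⊗ (x ⊕ pos 1 ⊖ pos 2)
      l = ℤ-Solver.solve-∀
      l₂ : ∀ c h s → c ⊗ h ⊗ (c ⊗ (pos 2 ⊗ s) ⊖ pos 2) ≡ c ⊗ (c ⊗ s ⊖ pos 1) ⊗ (pos 2 ⊗ h)
      l₂ = ℤ-Solver.solve-∀
    h∣h+ : ∀ {x} → pos h ∣ᶻ x → pos h ∣ᶻ (pos h ⊕ x)
    h∣h+ = ℤDiv.∣m∣n⇒∣m+n (ℤDiv.∣-refl {pos h})
    h∣-h : ∀ {x} → pos h ∣ᶻ (pos h ⊕ x) → pos h ∣ᶻ x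
    h∣-h d = ℤDiv.∣m+n∣m⇒∣n d (ℤDiv.∣-refl {pos h})
    shift : ∀ u z → pos (h + u) ⊕ z ≡ pos h ⊕ (pos u ⊕ z)
    shift u z = trans (cong (_⊕ z) (ℤP.pos-+ h u)) (ℤP.+-assoc (pos h) (pos u) z)
    us : List ℕ
    us = 1 ∷ (3 + 4 * r) ∷ (h + 1) ∷ (h + (3 + 4 * r)) ∷ []
    below : ∀ {u} → u < h → pos h ∣ᶻ (pos u ⊖ pos 1) ⊎ pos h ∣ᶻ (pos u ⊕ pos 1) → u ≡ 1 ⊎ u ≡ 3 + 4 * r
    below u<h (inj₁ d) = inj₁ (∣-<⇒≡ u<h (s≤s (s≤s z≤n)) d)
    below u<h (inj₂ d) = inj₂ (≡-1 u<h d)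
    locate : ∀ {u} → u < q → pos h ∣ᶻ (pos u ⊖ pos 1) ⊎ pos h ∣ᶻ (pos u ⊕ pos 1) → u ∈ us
    locate {u} u<q d with u ℕ.<? h
    ... | yes u<h with below u<h d
    ...   | inj₁ eq₁ = here eq₁
    ...   | inj₂ eq₁ = there (here eq₁)
    locate {u} u<q d | no u≮h = high (u ∸ h) (ℕP.m+[n∸m]≡n (ℕP.≮⇒≥ u≮h)) u<q d
      where
      high : ∀ w {u} → h + w ≡ u → u < q → pos h ∣ᶻ (pos u ⊖ pos 1) ⊎ pos h ∣ᶻ (pos u ⊕ pos 1) → u ∈ us
      high w refl u<q d with below {w} (ℕP.+-cancelˡ-< h w h u<q) (Sum.map
              (λ d → h∣-h (subst (pos h ∣ᶻ_) (shift w (⊝ pos 1)) d)) (λ d → h∣-h (subst (pos h ∣ᶻ_) (shift w (pos 1)) d)) d)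
      ... | inj₁ refl = there (there (here refl))
      ... | inj₂ refl = there (there (there (here refl)))
    near : ∀ {u} → Parity u → pos q ∣ᶻ square-1 (pos u) → pos h ∣ᶻ (pos u ⊖ pos 1) ⊎ pos h ∣ᶻ (pos u ⊕ pos 1)
    near (even w) root = contradiction (∣ᶻ⇒∣ {x = pos 1} 2∣1) λ 2∣1 → case Div.∣1⇒≡1 2∣1 of λ ()
      where
      2∣q : pos 2 ∣ᶻ square-1 (pos (2 * w))
      2∣q = ∣ᶻ-trans (divides h (trans (cong (h +_) (sym (ℕP.+-identityʳ h))) (ℕP.*-comm 2 h))) root
      l : ∀ w → pos 1 ≡ w ⊗ pos 2 ⊗ w ⊗ pos 2 ⊕ (⊝ pos 1) ⊗ ((pos 2 ⊗ w) ⊗ (pos 2 ⊗ w) ⊖ pos 1)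
      l = ℤ-Solver.solve-∀
      2∣1 : pos 2 ∣ᶻ pos 1
      2∣1 = ∣-combine₂ (pos w ⊗ pos 2 ⊗ pos w) (⊝ pos 1) (ℤDiv.∣-refl {pos 2})
              (subst (λ z → pos 2 ∣ᶻ (z ⊗ z ⊖ pos 1)) (ℤP.pos-* 2 w) 2∣q) (l (pos w))
    near (odd w) root = [ (λ d → inj₁ (subst₂ _∣ᶻ_ (sym h-half) (sym u-1) (ℤDiv.*-monoʳ-∣ (pos 2) d)))
                        , (λ d → inj₂ (subst₂ _∣ᶻ_ (sym h-half) (sym u+1) (ℤDiv.*-monoʳ-∣ (pos 2) d))) ]′ halves
      where
      U : pos (1 + 2 * w) ≡ pos 1 ⊕ pos 2 ⊗ pos w
      U = trans (ℤP.pos-+ 1 (2 * w)) (cong (pos 1 ⊕_) (ℤP.pos-* 2 w))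
      u-1 : pos (1 + 2 * w) ⊖ pos 1 ≡ pos 2 ⊗ pos w
      u-1 = trans (cong (_⊖ pos 1) U) (l (pos w))
        where
        l : ∀ w → pos 1 ⊕ pos 2 ⊗ w ⊖ pos 1 ≡ pos 2 ⊗ w
        l = ℤ-Solver.solve-∀
      u+1 : pos (1 + 2 * w) ⊕ pos 1 ≡ pos 2 ⊗ (pos w ⊕ pos 1)
      u+1 = trans (cong (_⊕ pos 1) U) (l (pos w))
        where
        l : ∀ w → pos 1 ⊕ pos 2 ⊗ w ⊕ pos 1 ≡ pos 2 ⊗ (w ⊕ pos 1)
        l = ℤ-Solver.solve-∀
      product∣ : pos (2 * t) ∣ᶻ pos w ⊗ (pos w ⊕ pos 1)
      product∣ = ℤDiv.*-cancelˡ-∣ (pos 4) (subst₂ _∣ᶻ_ lhs rhs root)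
        where
        l : ∀ s → pos 2 ⊗ (pos 2 ⊗ s) ≡ pos 4 ⊗ s
        l = ℤ-Solver.solve-∀
        lhs : pos q ≡ pos 4 ⊗ pos (2 * t)
        lhs = trans q-pos (trans (cong (pos 2 ⊗_) h-half) (l (pos (2 * t))))
        l₂ : ∀ w → pos 2 ⊗ w ⊗ (pos 2 ⊗ (w ⊕ pos 1)) ≡ pos 4 ⊗ (w ⊗ (w ⊕ pos 1))
        l₂ = ℤ-Solver.solve-∀
        rhs : square-1 (pos (1 + 2 * w)) ≡ pos 4 ⊗ (pos w ⊗ (pos w ⊕ pos 1))
        rhs = trans (square-1-factor (pos (1 + 2 * w))) (trans (cong₂ _⊗_ u-1 u+1) (l₂ (pos w)))
      2t : 2 * t ≡ 2 ^ suc k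
      2t = cong (2 *_) eq
      halves : pos (2 * t) ∣ᶻ pos w ⊎ pos (2 * t) ∣ᶻ (pos w ⊕ pos 1)
      halves with pos 2 ∣ᶻ? (pos w ⊕ pos 1)
      ... | no ¬d = inj₁ (subst (λ x → pos x ∣ᶻ pos w) (sym 2t) (prime^-∣-⊗ Primality.prime[2] (suc k) (pos w ⊕ pos 1) ¬d
                      (subst₂ (λ x y → pos x ∣ᶻ y) 2t (ℤP.*-comm (pos w) (pos w ⊕ pos 1)) product∣)))
      ... | yes d = inj₂ (subst (λ x → pos x ∣ᶻ (pos w ⊕ pos 1)) (sym 2t) (prime^-∣-⊗ Primality.prime[2] (suc k) (pos w)
                      (λ 2∣w → case Div.∣1⇒≡1 (∣ᶻ⇒∣ {x = pos 1} (∣-combine₂ (⊝ pos 1) (pos 1) 2∣w d (l (pos w)))) of λ ())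
                      (subst (λ x → pos x ∣ᶻ (pos w ⊗ (pos w ⊕ pos 1))) 2t product∣)))
        where
        l : ∀ w → pos 1 ≡ (⊝ pos 1) ⊗ w ⊕ pos 1 ⊗ (w ⊕ pos 1)
        l = ℤ-Solver.solve-∀
    main : roots square-1 q ≡ 4
    main = roots-explicit square-1 us
      (((λ ()) ∷ (λ ()) ∷ (λ ()) ∷ [])
       ∷ (ℕP.<⇒≢ (ℕP.≤-trans ℕP.≤-refl (ℕP.m≤m+n h 1)) ∷ ℕP.<⇒≢ (ℕP.m≤m+n h (3 + 4 * r)) ∷ [])
       ∷ ((λ eq₁ → case ℕP.+-cancelˡ-≡ h 1 (3 + 4 * r) eq₁ of λ ()) ∷ [])
       ∷ [] ∷ [])
      ((s≤s (s≤s z≤n) , ∣ᶻ0)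
       ∷ (ℕP.m≤m+n h h , sound₊ (3 + 4 * r) (-1-root (3 + 4 * r)))
       ∷ (ℕP.+-monoʳ-< h (s≤s (s≤s z≤n)) , sound₋ (h + 1) (subst (pos h ∣ᶻ_) (sym (shift 1 (⊝ pos 1))) (h∣h+ (∣ᶻ0))))
       ∷ (ℕP.+-monoʳ-< h ℕP.≤-refl , sound₊ (h + (3 + 4 * r)) (subst (pos h ∣ᶻ_) (sym (shift (3 + 4 * r) (pos 1))) (h∣h+ (-1-root (3 + 4 * r)))))
       ∷ [])
      (λ {u} u<q root → locate u<q (near (parity u) root))

2^-length : ∀ {p n} .{{_ : NonZero n}} → Prime p → ¬ p ∣ n → ∀ e →
            2 ^ length (primeDivisors (p ^ suc e * n)) ≡ 2 * 2 ^ length (primeDivisors n)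
2^-length pr p∤n e = cong (2 ^_) (PermP.↭-length (primeDivisors-^-* pr p∤n e))

roots-square-1-odd-modulus : ∀ n → NonZero n → ¬ 2 ∣ n → roots square-1 n ≡ 2 ^ length (primeDivisors n)
roots-square-1-odd-modulus = primary-induction _ (λ _ → refl) step
  where
  step : ∀ p e n → Prime p → ¬ p ∣ n → NonZero n → (¬ 2 ∣ n → roots square-1 n ≡ 2 ^ length (primeDivisors n)) →
         ¬ 2 ∣ p ^ suc e * n → roots square-1 (p ^ suc e * n) ≡ 2 ^ length (primeDivisors (p ^ suc e * n))
  step p e n pr p∤n nz ih 2∤ = begin
    roots square-1 (p ^ suc e * n)                   ≡⟨ roots-primary square-1 square-1-polynomial pr p∤n nz e ⟩
    roots square-1 (p ^ suc e) * roots square-1 n    ≡⟨ cong₂ _*_ (roots-square-1-odd pr p≢2 e) (ih (2∤ ∘ Div.∣n⇒∣m*n (p ^ suc e))) ⟩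
    2 * 2 ^ length (primeDivisors n)                 ≡⟨ 2^-length {{nz}} pr p∤n e ⟨
    2 ^ length (primeDivisors (p ^ suc e * n))       ∎
    where
    open ≡-Reasoning
    p≢2 : p ≢ 2
    p≢2 refl = 2∤ (Div.∣-trans (Div.m∣m*n (p ^ e)) (Div.m∣m*n n))

-- The 2-part 2, 4 or 2^(3 + j) has 1, 2 or 4 roots and the odd part m has 2^K, where K is its
-- number of primes, while 2^k = 2 · 2^K. The ratios 1/2, 1 and 2 of the number of roots to 2^k are
-- the values of 2β. The moduli 2 and 4 are settled by evaluation.
square-1-even : ∀ v → NonZero v → 2 ∣ v → let k = length (primeDivisors v) in
  (v % 8 ≡ 0 × roots square-1 v ≡ 2 * 2 ^ k) ⊎
  (v % 8 ≡ 4 × roots square-1 v ≡ 2 ^ k) ⊎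
  (v % 8 ≢ 0 × v % 8 ≢ 4 × 2 * roots square-1 v ≡ 2 ^ k)
square-1-even v vz 2∣v with prime-part Primality.prime[2] v vz
... | zero , m , refl , 2∤m , mz = contradiction (subst (2 ∣_) (ℕP.+-identityʳ m) 2∣v) 2∤m
... | suc e , m , refl , 2∤m , mz = go e
  where
  K = length (primeDivisors m)
  Q : ∀ e → roots square-1 (2 ^ suc e * m) ≡ roots square-1 (2 ^ suc e) * 2 ^ K
  Q e = trans (roots-primary square-1 square-1-polynomial Primality.prime[2] 2∤m mz e)
    (cong (roots square-1 (2 ^ suc e) *_) (roots-square-1-odd-modulus m mz 2∤m))
  L : ∀ e → 2 ^ length (primeDivisors (2 ^ suc e * m)) ≡ 2 * 2 ^ K
  L e = 2^-length {{mz}} Primality.prime[2] 2∤m e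
  4∤2m : ¬ 4 ∣ 2 * m
  4∤2m 4∣ = 2∤m (Div.*-cancelˡ-∣ 2 4∣)
  4∣% : ∀ {x} → 4 ∣ x % 8 → 4 ∣ x
  4∣% = Div.∣n∣m%n⇒∣m {n = 8} (divides 2 refl)
  odd%8 : Parity m → (2 * (2 * 1)) * m % 8 ≡ 4
  odd%8 (even w) = contradiction (Div.m∣m*n w) 2∤m
  odd%8 (odd w)  = trans (cong (_% 8) (l w)) ([m+kn]%n≡m%n 4 w 8)
    where
    l : ∀ w → (2 * (2 * 1)) * (1 + 2 * w) ≡ 4 + w * 8
    l = ℕ-Solver.solve-∀
  go : ∀ e → let u = 2 ^ suc e * m ; k = length (primeDivisors u) in
    (u % 8 ≡ 0 × roots square-1 u ≡ 2 * 2 ^ k) ⊎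
    (u % 8 ≡ 4 × roots square-1 u ≡ 2 ^ k) ⊎
    (u % 8 ≢ 0 × u % 8 ≢ 4 × 2 * roots square-1 u ≡ 2 ^ k)
  go zero = inj₂ (inj₂ ((λ eq → 4∤2m (4∣% (subst (4 ∣_) (sym eq) (4 Div.∣0)))) ,
                        (λ eq → 4∤2m (4∣% (subst (4 ∣_) (sym eq) Div.∣-refl))) ,
                        trans (cong (2 *_) (trans (Q 0) (ℕP.*-identityˡ _))) (sym (L 0))))
  go (suc zero) = inj₂ (inj₁ (odd%8 (parity m) , trans (Q 1) (sym (L 1))))
  go (suc (suc j)) = inj₁ (Div.n∣m⇒m%n≡0 _ 8 (Div.∣-trans (divides (2 ^ j) (l (2 ^ j))) (Div.m∣m*n m)) ,
      trans (Q (2 + j)) (trans (cong (_* 2 ^ K) (roots-square-1-8 j)) (trans (ℕP.*-assoc 2 2 (2 ^ K)) (cong (2 *_) (sym (L (2 + j)))))))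
    where
    l : ∀ x → 2 * (2 * (2 * x)) ≡ x * 8
    l = ℕ-Solver.solve-∀

-- Roots of x² + x + 1 modulo v

cyclotomic₃ : ℤ → ℤ
cyclotomic₃ x = x ⊗ x ⊕ x ⊕ pos 1

cyclotomic₃-polynomial : Polynomial cyclotomic₃
cyclotomic₃-polynomial x y d = ∣-combine₁ (x ⊕ y ⊕ pos 1) d (e x y)
  where
  e : ∀ x y → x ⊗ x ⊕ x ⊕ pos 1 ⊖ (y ⊗ y ⊕ y ⊕ pos 1) ≡ (x ⊕ y ⊕ pos 1) ⊗ (x ⊖ y)
  e = ℤ-Solver.solve-∀

∑-allFin : ∀ n f → ∑ (allFin n) (f ∘ toℕ) ≡ ∑ (upTo n) f
∑-allFin n f = go n id (λ _ → refl)
  where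
  go : ∀ {A : Set} n (g : Fin n → A) {h : A → ℕ} {f : ℕ → ℕ} → (∀ i → h (g i) ≡ f (toℕ i)) → ∑ (Data.List.tabulate g) h ≡ ∑ (upTo n) f
  go zero    g eq = refl
  go (suc n) g {h} {f} eq = trans (cong₂ _+_ (eq Fin.zero) (go n (g ∘ Fin.suc) (eq ∘ Fin.suc))) (sym (∑-upTo-suc n f))

-- The Möbius map x ↦ -1/(1 + x) has order 3 on the x for which x and 1 + x are units,
-- and its fixed points are the roots of x² + x + 1.
module Möbius (v : ℕ) .{{_ : NonZero v}} where
  open Residues v

  Admissible : Fin v → Set
  Admissible x = Unit (val x) × Unit (pos 1 ⊕ val x)

  admissible? : ∀ x → Dec (Admissible x)
  admissible? x = unit? (val x) ×-dec unit? (pos 1 ⊕ val x)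

  möbius : Fin v → Fin v
  möbius x = res (⊝ recipᵛ (pos 1 ⊕ val x))

  möbius-equation : ∀ x → Admissible x → val (möbius x) ⊗ (pos 1 ⊕ val x) ≈ ⊝ pos 1
  möbius-equation x (_ , c) = combine₂ (⊝ pos 1) (pos 1 ⊕ val x) (⊗-recipᵛ (pos 1 ⊕ val x) c) (val-res (⊝ recipᵛ (pos 1 ⊕ val x)))
    (e (val (möbius x)) (val x) (recipᵛ (pos 1 ⊕ val x)))
    where
    e : ∀ y x r → y ⊗ (pos 1 ⊕ x) ⊖ (⊝ pos 1) ≡ (⊝ pos 1) ⊗ ((pos 1 ⊕ x) ⊗ r ⊖ pos 1) ⊕ (pos 1 ⊕ x) ⊗ (y ⊖ (⊝ r))
    e = ℤ-Solver.solve-∀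

  möbius-unique : ∀ {x y} → Admissible x → val y ⊗ (pos 1 ⊕ val x) ≈ ⊝ pos 1 → möbius x ≡ y
  möbius-unique {x} {y} adm p = val-injective (unit-cancel (pos 1 ⊕ val x) (λ {d} → proj₂ adm {d})
    (combine₂ (pos 1) (⊝ pos 1) (möbius-equation x adm) p (e (val (möbius x)) (val y) (val x))))
    where
    e : ∀ z y x → (pos 1 ⊕ x) ⊗ z ⊖ (pos 1 ⊕ x) ⊗ y ≡ pos 1 ⊗ (z ⊗ (pos 1 ⊕ x) ⊖ (⊝ pos 1)) ⊕ (⊝ pos 1) ⊗ (y ⊗ (pos 1 ⊕ x) ⊖ (⊝ pos 1))
    e = ℤ-Solver.solve-∀

  -- The relation y(1 + x) = -1 makes y a unit, and it gives (1 + y)(1 + x) = x, so that 1 + y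
  -- divides the unit x.
  möbius-admissible : ∀ x → Admissible x → Admissible (möbius x)
  möbius-admissible x adm@(ux , u1x) =
      (λ {d} → unit-intro y (⊝ (pos 1 ⊕ val x)) (combine₁ (⊝ pos 1) (möbius-equation x adm) (e₁ y (val x))) {d})
    , (λ {d} → unit-⊗⁻ (pos 1 ⊕ y) (pos 1 ⊕ val x)
         (λ {d} → unit-cong {val x} {(pos 1 ⊕ y) ⊗ (pos 1 ⊕ val x)} (combine₁ (⊝ pos 1) (möbius-equation x adm) (e₂ y (val x))) ux {d}) {d})
    where
    y = val (möbius x)
    e₁ : ∀ y x → y ⊗ (⊝ (pos 1 ⊕ x)) ⊖ pos 1 ≡ (⊝ pos 1) ⊗ (y ⊗ (pos 1 ⊕ x) ⊖ (⊝ pos 1))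
    e₁ = ℤ-Solver.solve-∀
    e₂ : ∀ y x → x ⊖ (pos 1 ⊕ y) ⊗ (pos 1 ⊕ x) ≡ (⊝ pos 1) ⊗ (y ⊗ (pos 1 ⊕ x) ⊖ (⊝ pos 1))
    e₂ = ℤ-Solver.solve-∀

  -- The defining relation closes up cyclically: y(1 + x) = -1 and z(1 + y) = -1 imply x(1 + z) =
  -- -1, after cancelling the unit y.
  möbius³ : ∀ x → Admissible x → möbius (möbius (möbius x)) ≡ x
  möbius³ x adm = möbius-unique adm₂ (unit-cancel y (λ {d} → proj₁ adm₁ {d})
    (combine₂ (pos 1 ⊕ z) (⊝ pos 1) (möbius-equation x adm) (möbius-equation (möbius x) adm₁) (e (val x) y z)))
    where
    adm₁ = möbius-admissible x adm
    adm₂ = möbius-admissible (möbius x) adm₁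
    y = val (möbius x)
    z = val (möbius (möbius x))
    e : ∀ x y z → y ⊗ (x ⊗ (pos 1 ⊕ z)) ⊖ y ⊗ (⊝ pos 1) ≡
        (pos 1 ⊕ z) ⊗ (y ⊗ (pos 1 ⊕ x) ⊖ (⊝ pos 1)) ⊕ (⊝ pos 1) ⊗ (z ⊗ (pos 1 ⊕ y) ⊖ (⊝ pos 1))
    e = ℤ-Solver.solve-∀

  private
    points : List (Fin v)
    points = filter admissible? (allFin v)

    adm : ∀ {x} → x ∈ points → Admissible x
    adm x∈ = proj₂ (Mem.∈-filter⁻ admissible? {xs = allFin v} x∈)

    ∈points : ∀ {x} → Admissible x → x ∈ points
    ∈points {x} a = Mem.∈-filter⁺ admissible? (Mem.∈-allFin x) a

    power : Fin 3 → Fin v → Fin v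
    power 0F x = x
    power 1F x = möbius x
    power 2F x = möbius (möbius x)

    _+₃_ : Fin 3 → Fin 3 → Fin 3
    0F +₃ j  = j
    1F +₃ 0F = 1F
    1F +₃ 1F = 2F
    1F +₃ 2F = 0F
    2F +₃ 0F = 2F
    2F +₃ 1F = 0F
    2F +₃ 2F = 1F

    -₃_ : Fin 3 → Fin 3
    -₃ 0F = 0F
    -₃ 1F = 2F
    -₃ 2F = 1F

    power-+ : ∀ i j {x} → Admissible x → power (i +₃ j) x ≡ power i (power j x)
    power-+ 0F j  a = refl
    power-+ 1F 0F a = refl
    power-+ 1F 1F a = refl
    power-+ 1F 2F a = sym (möbius³ _ a)
    power-+ 2F 0F a = refl
    power-+ 2F 1F a = sym (möbius³ _ a)
    power-+ 2F 2F {x} a = sym (cong möbius (möbius³ x a))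

    power-inverse : ∀ i {x} → Admissible x → power (-₃ i) (power i x) ≡ x
    power-inverse 0F a = refl
    power-inverse 1F a = möbius³ _ a
    power-inverse 2F a = möbius³ _ a

    power-admissible : ∀ i {x} → Admissible x → Admissible (power i x)
    power-admissible 0F a = a
    power-admissible 1F a = möbius-admissible _ a
    power-admissible 2F a = möbius-admissible _ (möbius-admissible _ a)

    +₃-cancelʳ : ∀ i j k → i +₃ k ≡ j +₃ k → i ≡ j
    +₃-cancelʳ 0F 0F _  _ = refl
    +₃-cancelʳ 1F 1F _  _ = refl
    +₃-cancelʳ 2F 2F _  _ = refl
    +₃-cancelʳ 0F 1F 0F ()
    +₃-cancelʳ 0F 1F 1F ()
    +₃-cancelʳ 0F 1F 2F ()
    +₃-cancelʳ 0F 2F 0F ()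
    +₃-cancelʳ 0F 2F 1F ()
    +₃-cancelʳ 0F 2F 2F ()
    +₃-cancelʳ 1F 0F 0F ()
    +₃-cancelʳ 1F 0F 1F ()
    +₃-cancelʳ 1F 0F 2F ()
    +₃-cancelʳ 1F 2F 0F ()
    +₃-cancelʳ 1F 2F 1F ()
    +₃-cancelʳ 1F 2F 2F ()
    +₃-cancelʳ 2F 0F 0F ()
    +₃-cancelʳ 2F 0F 1F ()
    +₃-cancelʳ 2F 0F 2F ()
    +₃-cancelʳ 2F 1F 0F ()
    +₃-cancelʳ 2F 1F 1F ()
    +₃-cancelʳ 2F 1F 2F ()

    action : FiniteAction (Fin 3) (Fin v)
    action = record
      { _≟_         = FinP._≟_
      ; gs          = allFin 3
      ; xs          = points
      ; gs-unique   = Uniq.allFin⁺ 3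
      ; xs-unique   = Uniq.filter⁺ admissible? (Uniq.allFin⁺ v)
      ; act         = power
      ; mul         = _+₃_
      ; inv         = -₃_
      ; one         = 0F
      ; one∈        = Mem.∈-allFin 0F
      ; act∈        = λ {i} _ x∈ → ∈points (power-admissible i (adm x∈))
      ; mul∈        = λ {i} {j} _ _ → Mem.∈-allFin (i +₃ j)
      ; inv∈        = λ {i} _ → Mem.∈-allFin (-₃ i)
      ; act-mul     = λ {i} {j} _ _ x∈ → power-+ i j (adm x∈)
      ; act-inv     = λ {i} _ x∈ → power-inverse i (adm x∈)
      ; mul-cancelʳ = λ {i} {j} {k} _ _ _ → +₃-cancelʳ i j k
      }

    fixed : Fin 3 → ℕ
    fixed i = ∑ points (λ x → 𝟙 (power i x FinP.≟ x))

    fixed-0 : fixed 0F ≡ ∑ (allFin v) (𝟙 ∘ admissible?)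
    fixed-0 = begin
      fixed 0F                        ≡⟨ ∑-cong points (λ x → 𝟙-yes (x FinP.≟ x) refl) ⟩
      ∑ points (λ _ → 1)              ≡⟨ ∑-const points 1 ⟩
      length points * 1               ≡⟨ ℕP.*-identityʳ _ ⟩
      length points                   ≡⟨ length-filter admissible? (allFin v) ⟩
      ∑ (allFin v) (𝟙 ∘ admissible?)  ∎
      where open ≡-Reasoning

    fixed-1 : fixed 1F ≡ roots cyclotomic₃ v
    fixed-1 = begin
      fixed 1F                                                       ≡⟨ ∑-filter admissible? (allFin v) (λ x → 𝟙 (möbius x FinP.≟ x)) ⟩
      ∑ (allFin v) (λ x → 𝟙 (admissible? x) * 𝟙 (möbius x FinP.≟ x)) ≡⟨ ∑-cong (allFin v) (λ x → 𝟙-× (admissible? x) (möbius x FinP.≟ x)) ⟨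
      ∑ (allFin v) (λ x → 𝟙 (admissible? x ×-dec (möbius x FinP.≟ x))) ≡⟨ ∑-cong (allFin v) (λ x →
          𝟙-cong (admissible? x ×-dec (möbius x FinP.≟ x)) (pos v ∣ᶻ? cyclotomic₃ (val x)) (to x) (from x)) ⟩
      ∑ (allFin v) (λ x → 𝟙 (pos v ∣ᶻ? cyclotomic₃ (val x)))         ≡⟨ ∑-allFin v (λ u → 𝟙 (pos v ∣ᶻ? cyclotomic₃ (pos u))) ⟩
      roots cyclotomic₃ v                                            ∎
      where
      open ≡-Reasoning
      e₁ : ∀ x → x ⊗ x ⊕ x ⊕ pos 1 ≡ pos 1 ⊗ (x ⊗ (pos 1 ⊕ x) ⊖ (⊝ pos 1))
      e₁ = ℤ-Solver.solve-∀
      to : ∀ x → Admissible x × möbius x ≡ x → pos v ∣ᶻ cyclotomic₃ (val x)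
      to x (a , eq) = ∣-combine₁ (pos 1) (∣-difference (subst (λ y → val y ⊗ (pos 1 ⊕ val x) ≈ ⊝ pos 1) eq (möbius-equation x a))) (e₁ (val x))
      e₂ : ∀ x → x ⊗ (pos 1 ⊕ x) ⊖ (⊝ pos 1) ≡ pos 1 ⊗ (x ⊗ x ⊕ x ⊕ pos 1)
      e₂ = ℤ-Solver.solve-∀
      e₃ : ∀ x → x ⊗ (⊝ (pos 1 ⊕ x)) ⊖ pos 1 ≡ (⊝ pos 1) ⊗ (x ⊗ (pos 1 ⊕ x) ⊖ (⊝ pos 1))
      e₃ = ℤ-Solver.solve-∀
      e₄ : ∀ x → (pos 1 ⊕ x) ⊗ (⊝ x) ⊖ pos 1 ≡ (⊝ pos 1) ⊗ (x ⊗ (pos 1 ⊕ x) ⊖ (⊝ pos 1))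
      e₄ = ℤ-Solver.solve-∀
      from : ∀ x → pos v ∣ᶻ cyclotomic₃ (val x) → Admissible x × möbius x ≡ x
      from x d = a , möbius-unique a p
        where
        p : val x ⊗ (pos 1 ⊕ val x) ≈ ⊝ pos 1
        p = by (∣-combine₁ (pos 1) d (e₂ (val x)))
        a : Admissible x
        a = (λ {d} → unit-intro (val x) (⊝ (pos 1 ⊕ val x)) (combine₁ (⊝ pos 1) p (e₃ (val x))) {d})
          , (λ {d} → unit-intro (pos 1 ⊕ val x) (⊝ val x) (combine₁ (⊝ pos 1) p (e₄ (val x))) {d})

    fixed-2 : fixed 2F ≡ fixed 1F
    fixed-2 = ∑-cong∈ points (λ x x∈ → 𝟙-cong (möbius (möbius x) FinP.≟ x) (möbius x FinP.≟ x)
      (λ eq → trans (sym (cong möbius eq)) (möbius³ x (adm x∈)))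
      (λ eq → trans (cong möbius eq) eq))

  -- Burnside's lemma for the group of order 3 generated by `möbius`, whose two elements of order 3
  -- both fix exactly the roots. Since 2 ≡ -1, the number of roots is known modulo 3 from the number
  -- of admissible residues.
  admissible-count : 3 ∣ ∑ (upTo v) (λ x → 𝟙 (coprime? x v ×-dec coprime? (suc x) v)) + 2 * roots cyclotomic₃ v
  admissible-count = divides (length orbitReps) (begin
    ∑ (upTo v) (λ x → 𝟙 (coprime? x v ×-dec coprime? (suc x) v)) + 2 * roots cyclotomic₃ v
      ≡⟨ cong₂ _+_ (trans fixed-0 (∑-allFin v (λ x → 𝟙 (coprime? x v ×-dec coprime? (suc x) v)))) (cong (2 *_) fixed-1) ⟨
    fixed 0F + (fixed 1F + (fixed 1F + 0))  ≡⟨ cong (λ k → fixed 0F + (fixed 1F + (k + 0))) fixed-2 ⟨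
    fixed 0F + (fixed 1F + (fixed 2F + 0))  ≡⟨ burnside ⟨
    length orbitReps * 3                    ∎)
    where
    open ≡-Reasoning
    open Burnside action

prime[3] : Prime 3
prime[3] = from-yes (prime? 3)

-- The excluded residues are 0 and p - 1, which are distinct for every prime.
admissible-count-prime : ∀ {p} → Prime p →
  ∑ (upTo p) (λ x → 𝟙 (¬? (p ∣? x) ×-dec ¬? (p ∣? suc x))) ≡ p ∸ 2
admissible-count-prime {zero}        pr = contradiction pr Primality.¬prime[0]
admissible-count-prime {suc zero}    pr = contradiction pr Primality.¬prime[1]
admissible-count-prime {p@(suc (suc r))} pr = begin
  ∑ (upTo (suc (suc r))) g                                  ≡⟨ ∑-upTo-suc (suc r) g ⟩
  g 0 + ∑ (upTo (suc r)) (g ∘ suc)                          ≡⟨ cong₂ _+_ (𝟙-no (g? 0) (λ (¬d , _) → ¬d (p Div.∣0))) (cong (λ k → ∑ (upTo k) (g ∘ suc)) (ℕP.+-comm 1 r)) ⟩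
  ∑ (upTo (r + 1)) (g ∘ suc)                                ≡⟨ ∑-upTo-+ r 1 (g ∘ suc) ⟩
  ∑ (upTo r) (g ∘ suc) + (g (suc (r + 0)) + 0)              ≡⟨ cong₂ _+_ ones (trans (ℕP.+-identityʳ _) (𝟙-no (g? (suc (r + 0))) (λ (_ , ¬d) → ¬d (Div.∣-reflexive (cong (2 +_) (sym (ℕP.+-identityʳ r))))))) ⟩
  r + 0                                                     ≡⟨ ℕP.+-identityʳ r ⟩
  r                                                         ∎
  where
  open ≡-Reasoning
  g? : ∀ x → Dec (¬ p ∣ x × ¬ p ∣ suc x)
  g? x = ¬? (p ∣? x) ×-dec ¬? (p ∣? suc x)
  g : ℕ → ℕ
  g x = 𝟙 (g? x)
  small : ∀ {x} → suc x < p → ¬ p ∣ suc x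
  small x<p d = ℕP.<⇒≱ x<p (Div.∣⇒≤ d)
  ones : ∑ (upTo r) (g ∘ suc) ≡ r
  ones = begin
    ∑ (upTo r) (g ∘ suc)  ≡⟨ ∑-cong∈ (upTo r) (λ x x∈ → 𝟙-yes (g? (suc x)) (small (s≤s (ℕP.m≤n⇒m≤1+n (Mem.∈-upTo⁻ x∈))) , small (s≤s (s≤s (Mem.∈-upTo⁻ x∈))))) ⟩
    ∑ (upTo r) (λ _ → 1)  ≡⟨ ∑-const (upTo r) 1 ⟩
    length (upTo r) * 1   ≡⟨ ℕP.*-identityʳ _ ⟩
    length (upTo r)       ≡⟨ List.length-upTo r ⟩
    r                     ∎

-- Being coprime to a power of p depends only on the residue modulo p, and there are p^e periods.
admissible-count-prime^ : ∀ {p} → Prime p → ∀ e →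
  ∑ (upTo (p ^ suc e)) (λ x → 𝟙 (coprime? x (p ^ suc e) ×-dec coprime? (suc x) (p ^ suc e))) ≡ p ^ e * (p ∸ 2)
admissible-count-prime^ {p} pr e = begin
  ∑ (upTo (p ^ suc e)) (λ x → 𝟙 (coprime? x (p ^ suc e) ×-dec coprime? (suc x) (p ^ suc e)))
    ≡⟨ ∑-cong (upTo (p ^ suc e)) (λ x → 𝟙-cong (coprime? x (p ^ suc e) ×-dec coprime? (suc x) (p ^ suc e)) (g? x)
         (λ (c , d) → to c , to d) (λ (c , d) → prime-^-coprime pr c (suc e) , prime-^-coprime pr d (suc e))) ⟩
  ∑ (upTo (p * p ^ e)) (𝟙 ∘ g?)  ≡⟨ cong (λ k → ∑ (upTo k) (𝟙 ∘ g?)) (ℕP.*-comm p (p ^ e)) ⟩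
  ∑ (upTo (p ^ e * p)) (𝟙 ∘ g?)  ≡⟨ ∑-periodic (p ^ e) p (𝟙 ∘ g?) (λ x → 𝟙-cong (g? (p + x)) (g? x)
                                      (λ (c , d) → c ∘ Div.∣m∣n⇒∣m+n Div.∣-refl , (λ p∣ → d (subst (p ∣_) (ℕP.+-suc p x) (Div.∣m∣n⇒∣m+n Div.∣-refl p∣))))
                                      (λ (c , d) → (λ p∣ → c (Div.∣m+n∣m⇒∣n p∣ Div.∣-refl)) ,
                                                   (λ p∣ → d (Div.∣m+n∣m⇒∣n (subst (p ∣_) (sym (ℕP.+-suc p x)) p∣) Div.∣-refl)))) ⟩
  p ^ e * ∑ (upTo p) (𝟙 ∘ g?)    ≡⟨ cong (p ^ e *_) (admissible-count-prime pr) ⟩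
  p ^ e * (p ∸ 2)                ∎
  where
  open ≡-Reasoning
  g? : ∀ x → Dec (¬ p ∣ x × ¬ p ∣ suc x)
  g? x = ¬? (p ∣? x) ×-dec ¬? (p ∣? suc x)
  to : ∀ {x} → Coprime x (p ^ suc e) → ¬ p ∣ x
  to c p∣x = prime∤1 pr (c (p∣x , Div.m∣m*n (p ^ e)))

-- p divides at most one factor of (w - u)(w + u + 1), since (2u + 1)² + 3 = 4 (u² + u + 1).
roots-cyclotomic₃≤2 : ∀ {p} → Prime p → p ≢ 3 → ∀ e → roots cyclotomic₃ (p ^ suc e) ≤ 2
roots-cyclotomic₃≤2 {p} pr p≢3 e with roots-list cyclotomic₃ {p ^ suc e} in eq
... | [] = subst (_≤ 2) (sym (trans (roots≡length cyclotomic₃ q) (cong length eq))) z≤n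
  where q = p ^ suc e
... | u ∷ _ = subst (_≤ 2) (sym (roots≡length cyclotomic₃ q))
    -- The second candidate is the conjugate root -1 - u, as the two roots of x² + x + 1 have sum
    -- -1.
    (unique-⊆-length {ys = u ∷ toℕ (res (⊝ pos 1 ⊖ pos u)) ∷ []} (roots-unique cyclotomic₃ q) sub)
  where
  q = p ^ suc e
  instance
    q≢0 : NonZero q
    q≢0 = ℕP.m^n≢0 p (suc e) {{Primality.prime⇒nonZero pr}}
  open Residues q
  u-root : u < q × pos q ∣ᶻ cyclotomic₃ (pos u)
  u-root = ∈-roots⁻ cyclotomic₃ (subst (u ∈_) (sym eq) (here refl))
  sub : ∀ {w} → w ∈ roots-list cyclotomic₃ {q} → w ∈ u ∷ toℕ (res (⊝ pos 1 ⊖ pos u)) ∷ []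
  sub {w} w∈ with ∈-roots⁻ cyclotomic₃ w∈
  ... | w<q , w-root with pos p ∣ᶻ? (pos w ⊖ pos u)
  ...   | no ¬d = there (here (∣-<⇒≡ w<q (FinP.toℕ<n (res (⊝ pos 1 ⊖ pos u)))
            (∣-combine₂ (pos 1) (⊝ pos 1) (prime^-∣-⊗ pr (suc e) (pos w ⊖ pos u) ¬d
              (∣-combine₂ (pos 1) (⊝ pos 1) w-root (proj₂ u-root) (e₁ (pos w) (pos u)))) (∣-difference (val-res (⊝ pos 1 ⊖ pos u)))
              (e₂ (pos w) (pos u) (val (res (⊝ pos 1 ⊖ pos u)))))))
    where
    e₁ : ∀ w u → (w ⊖ u) ⊗ (w ⊕ u ⊕ pos 1) ≡ pos 1 ⊗ (w ⊗ w ⊕ w ⊕ pos 1) ⊕ (⊝ pos 1) ⊗ (u ⊗ u ⊕ u ⊕ pos 1)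
    e₁ = ℤ-Solver.solve-∀
    e₂ : ∀ w u r → w ⊖ r ≡ pos 1 ⊗ (w ⊕ u ⊕ pos 1) ⊕ (⊝ pos 1) ⊗ (r ⊖ (⊝ pos 1 ⊖ u))
    e₂ = ℤ-Solver.solve-∀
  ...   | yes d = here (∣-<⇒≡ w<q (proj₁ u-root) (prime^-∣-⊗ pr (suc e) (pos w ⊕ pos u ⊕ pos 1) p∤
              (∣-combine₂ (pos 1) (⊝ pos 1) w-root (proj₂ u-root) (e₁ (pos w) (pos u)))))
    where
    e₁ : ∀ w u → (w ⊕ u ⊕ pos 1) ⊗ (w ⊖ u) ≡ pos 1 ⊗ (w ⊗ w ⊕ w ⊕ pos 1) ⊕ (⊝ pos 1) ⊗ (u ⊗ u ⊕ u ⊕ pos 1)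
    e₁ = ℤ-Solver.solve-∀
    e₃ : ∀ w u → pos 3 ≡ pos 4 ⊗ (u ⊗ u ⊕ u ⊕ pos 1) ⊕ (⊝ (pos 2 ⊗ u ⊕ pos 1)) ⊗ (w ⊕ u ⊕ pos 1) ⊕ (pos 2 ⊗ u ⊕ pos 1) ⊗ (w ⊖ u)
    e₃ = ℤ-Solver.solve-∀
    p∤ : ¬ pos p ∣ᶻ (pos w ⊕ pos u ⊕ pos 1)
    p∤ d′ = p≢3 (prime∣prime prime[3] pr (∣ᶻ⇒∣ {x = pos 3} (∣-combine₃ (pos 4) (⊝ (pos 2 ⊗ pos u ⊕ pos 1)) (pos 2 ⊗ pos u ⊕ pos 1)
      (p∣p^suc e (proj₂ u-root)) d′ d (e₃ (pos w) (pos u)))))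

-- Here p^e (p - 2) ≡ -1 (mod 3), so the number t of roots satisfies 2t ≡ 1 (mod 3); with t ≤ 2 only
-- t = 2 is possible. Counting thus replaces the construction of a root.
roots-cyclotomic₃-1mod3 : ∀ {p} → Prime p → p % 3 ≡ 1 → ∀ e → roots cyclotomic₃ (p ^ suc e) ≡ 2
roots-cyclotomic₃-1mod3 {p} pr p≡1 e =
  decide (roots cyclotomic₃ q) (roots-cyclotomic₃≤2 pr p≢3 e) (subst (λ k → 3 ∣ k + 2 * roots cyclotomic₃ q) (admissible-count-prime^ pr e) admissible-count)
  where
  q = p ^ suc e
  instance
    q≢0 : NonZero q
    q≢0 = ℕP.m^n≢0 p (suc e) {{Primality.prime⇒nonZero pr}}
  open Möbius q
  p≢3 : p ≢ 3
  p≢3 refl = case p≡1 of λ ()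
  p^≡1 : ∀ e → ∃ λ m → p ^ e ≡ 1 + m * 3
  p^≡1 zero = 0 , refl
  p^≡1 (suc e) with p^≡1 e
  ... | m , eq = m + p ℕ./ 3 * (1 + m * 3) , trans (cong₂ _*_ (trans (m≡m%n+[m/n]*n p 3) (cong (_+ p ℕ./ 3 * 3) p≡1)) eq) (l (p ℕ./ 3) m)
    where
    l : ∀ a m → (1 + a * 3) * (1 + m * 3) ≡ 1 + (m + a * (1 + m * 3)) * 3
    l = ℕ-Solver.solve-∀
  3∣X+1 : 3 ∣ p ^ e * (p ∸ 2) + 1
  3∣X+1 with p^≡1 e
  ... | m , eq = Div.∣m+n∣m⇒∣n {m = m * 3} (divides (p ^ e * (p ℕ./ 3)) (begin
      m * 3 + (p ^ e * (p ∸ 2) + 1)          ≡⟨ l₁ (m * 3) (p ^ e * (p ∸ 2)) ⟩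
      p ^ e * (p ∸ 2) + (1 + m * 3)          ≡⟨ cong (p ^ e * (p ∸ 2) +_) eq ⟨
      p ^ e * (p ∸ 2) + p ^ e                ≡⟨ l₂ (p ^ e) (p ∸ 2) ⟩
      p ^ e * (p ∸ 2 + 1)                    ≡⟨ cong (p ^ e *_) (ℕP.suc-injective (trans (trans (l₃ (p ∸ 2)) (ℕP.m∸n+n≡m 2≤p)) (trans (m≡m%n+[m/n]*n p 3) (cong (_+ p ℕ./ 3 * 3) p≡1)))) ⟩
      p ^ e * (p ℕ./ 3 * 3)                  ≡⟨ ℕP.*-assoc (p ^ e) (p ℕ./ 3) 3 ⟨
      p ^ e * (p ℕ./ 3) * 3                  ∎)) (Div.n∣m*n m)
    where
    open ≡-Reasoning
    2≤p : 2 ≤ p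
    2≤p = ℕ.nonTrivial⇒n>1 p {{Primality.prime⇒nonTrivial pr}}
    l₁ : ∀ a b → a + (b + 1) ≡ b + (1 + a)
    l₁ = ℕ-Solver.solve-∀
    l₂ : ∀ a b → a * b + a ≡ a * (b + 1)
    l₂ = ℕ-Solver.solve-∀
    l₃ : ∀ a → suc (a + 1) ≡ a + 2
    l₃ a = sym (ℕP.+-suc a 1)
  decide : ∀ t → t ≤ 2 → 3 ∣ p ^ e * (p ∸ 2) + 2 * t → t ≡ 2
  decide 0 _ d = case Div.∣1⇒≡1 (Div.∣m+n∣m⇒∣n 3∣X+1 (subst (3 ∣_) (ℕP.+-identityʳ _) d)) of λ ()
  decide 1 _ d = case Div.∣1⇒≡1 (Div.∣m+n∣m⇒∣n (subst (3 ∣_) (sym (ℕP.+-assoc (p ^ e * (p ∸ 2)) 1 1)) d) 3∣X+1) of λ ()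
  decide 2 _ _ = refl
  decide (suc (suc (suc _))) (s≤s (s≤s ()))

-- Now p - 2 ≡ 0 (mod 3), so 3 divides 2t, and t ≤ 2 leaves t = 0. The prime itself suffices,
-- because `roots-none` passes to its multiples.
roots-cyclotomic₃-2mod3 : ∀ {p} → Prime p → p % 3 ≡ 2 → roots cyclotomic₃ p ≡ 0
roots-cyclotomic₃-2mod3 {p} pr p≡2 = subst (λ k → roots cyclotomic₃ k ≡ 0) (ℕP.*-identityʳ p)
  (decide (roots cyclotomic₃ q) (roots-cyclotomic₃≤2 pr p≢3 0) (subst (λ k → 3 ∣ k + 2 * roots cyclotomic₃ q) (admissible-count-prime^ pr 0) admissible-count))
  where
  q = p ^ 1
  instance
    q≢0 : NonZero q
    q≢0 = ℕP.m^n≢0 p 1 {{Primality.prime⇒nonZero pr}}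
  open Möbius q
  p≢3 : p ≢ 3
  p≢3 refl = case p≡2 of λ ()
  3∣X : 3 ∣ 1 * (p ∸ 2)
  3∣X = subst (3 ∣_) (sym (trans (ℕP.*-identityˡ (p ∸ 2)) (trans (cong (_∸ 2) (trans (m≡m%n+[m/n]*n p 3) (cong (_+ p ℕ./ 3 * 3) p≡2))) refl))) (Div.n∣m*n (p ℕ./ 3))
  decide : ∀ t → t ≤ 2 → 3 ∣ 1 * (p ∸ 2) + 2 * t → t ≡ 0
  decide 0 _ _ = refl
  decide 1 _ d = case Div.∣⇒≤ (Div.∣m+n∣m⇒∣n d 3∣X) of λ { (s≤s (s≤s ())) }
  decide 2 _ d = contradiction (Div.∣m+n∣m⇒∣n d 3∣X) 3∤4
    where
    3∤4 : ¬ 3 ∣ 4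
    3∤4 d = case Div.∣1⇒≡1 (Div.∣m+n∣m⇒∣n {m = 3} {n = 1} d Div.∣-refl) of λ ()
  decide (suc (suc (suc _))) (s≤s (s≤s ()))

roots-cyclotomic₃-all1mod3 : ∀ n → NonZero n → All (λ p → p % 3 ≡ 1) (primeDivisors n) →
                             roots cyclotomic₃ n ≡ 2 ^ length (primeDivisors n)
roots-cyclotomic₃-all1mod3 = primary-induction _ (λ _ → refl) step
  where
  step : ∀ p e n → Prime p → ¬ p ∣ n → NonZero n →
         (All (λ p → p % 3 ≡ 1) (primeDivisors n) → roots cyclotomic₃ n ≡ 2 ^ length (primeDivisors n)) →
         All (λ p → p % 3 ≡ 1) (primeDivisors (p ^ suc e * n)) →
         roots cyclotomic₃ (p ^ suc e * n) ≡ 2 ^ length (primeDivisors (p ^ suc e * n))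
  step p e n pr p∤n nz ih all with PermP.All-resp-↭ (primeDivisors-^-* {{nz}} pr p∤n e) all
  ... | p≡1 ∷ rest = begin
    roots cyclotomic₃ (p ^ suc e * n)                     ≡⟨ roots-primary cyclotomic₃ cyclotomic₃-polynomial pr p∤n nz e ⟩
    roots cyclotomic₃ (p ^ suc e) * roots cyclotomic₃ n   ≡⟨ cong₂ _*_ (roots-cyclotomic₃-1mod3 pr p≡1 e) (ih rest) ⟩
    2 * 2 ^ length (primeDivisors n)                      ≡⟨ 2^-length {{nz}} pr p∤n e ⟨
    2 ^ length (primeDivisors (p ^ suc e * n))            ∎
    where open ≡-Reasoning

-- Modulo 3 the only root is 1, so the prime 3 contributes a factor 1 where each other prime
-- contributes 2.
roots-cyclotomic₃-3 : ∀ v → NonZero v → 3 ∣ v → ¬ 9 ∣ v → All (λ p → p ≡ 3 ⊎ p % 3 ≡ 1) (primeDivisors v) →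
                      2 * roots cyclotomic₃ v ≡ 2 ^ length (primeDivisors v)
roots-cyclotomic₃-3 v vz 3∣v 9∤v all with prime-part prime[3] v vz
... | zero , m , refl , 3∤m , mz = contradiction (subst (3 ∣_) (ℕP.+-identityʳ m) 3∣v) 3∤m
... | suc (suc e) , m , refl , 3∤m , mz = contradiction (Div.∣-trans (divides (3 ^ e) (l (3 ^ e))) (Div.m∣m*n m)) 9∤v
  where
  l : ∀ x → 3 * (3 * x) ≡ x * 9
  l = ℕ-Solver.solve-∀
... | suc zero , m , refl , 3∤m , mz with PermP.All-resp-↭ (primeDivisors-^-* {{mz}} prime[3] 3∤m 0) all
...   | _ ∷ rest = begin
    2 * roots cyclotomic₃ (3 ^ 1 * m)                        ≡⟨ cong (2 *_) (roots-primary cyclotomic₃ cyclotomic₃-polynomial prime[3] 3∤m mz 0) ⟩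
    2 * (1 * roots cyclotomic₃ m)                            ≡⟨ cong (2 *_) (ℕP.*-identityˡ (roots cyclotomic₃ m)) ⟩
    2 * roots cyclotomic₃ m                                  ≡⟨ cong (2 *_) (roots-cyclotomic₃-all1mod3 m mz (All.tabulate rest′)) ⟩
    2 * 2 ^ length (primeDivisors m)                         ≡⟨ 2^-length {{mz}} prime[3] 3∤m 0 ⟨
    2 ^ length (primeDivisors (3 ^ 1 * m))                   ∎
  where
  open ≡-Reasoning
  rest′ : ∀ {p} → p ∈ primeDivisors m → p % 3 ≡ 1
  rest′ p∈ with All.lookup rest p∈
  ... | inj₁ refl = contradiction (proj₂ (∈-primeDivisors⁻ p∈)) 3∤m
  ... | inj₂ eq   = eq

-- A root modulo 3 has the form 1 + 3y, and there the polynomial equals 3 + 9y + 9y², which is 3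
-- modulo 9.
roots-cyclotomic₃-9 : roots cyclotomic₃ 9 ≡ 0
roots-cyclotomic₃-9 = refl

-- Either 9 divides v, or some prime divisor is neither 3 nor 1 modulo 3, hence 2 modulo 3. Both
-- moduli have no roots.
roots-cyclotomic₃-other : ∀ v → NonZero v → ¬ All (λ p → p % 3 ≡ 1) (primeDivisors v) →
  ¬ (3 ∣ v × ¬ 9 ∣ v × All (λ p → p ≡ 3 ⊎ p % 3 ≡ 1) (primeDivisors v)) → roots cyclotomic₃ v ≡ 0
roots-cyclotomic₃-other v vz ¬all ¬three with 9 ∣? v
... | yes 9∣v = roots-none cyclotomic₃ cyclotomic₃-polynomial 9∣v roots-cyclotomic₃-9
... | no 9∤v with All.all? (λ p → (p ℕ.≟ 3) ⊎-dec (p % 3 ℕ.≟ 1)) (primeDivisors v)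
...   | yes all with 3 ∣? v
...     | yes 3∣v = contradiction (3∣v , 9∤v , all) ¬three
...     | no 3∤v  = contradiction (All.tabulate one) ¬all
  where
  one : ∀ {p} → p ∈ primeDivisors v → p % 3 ≡ 1
  one p∈ with All.lookup all p∈
  ... | inj₁ refl = contradiction (proj₂ (∈-primeDivisors⁻ {v} p∈)) 3∤v
  ... | inj₂ eq   = eq
roots-cyclotomic₃-other v vz ¬all ¬three | no 9∤v | no ¬all′
  with find (AllP.¬All⇒Any¬ (λ p → (p ℕ.≟ 3) ⊎-dec (p % 3 ℕ.≟ 1)) (primeDivisors v) ¬all′)
... | p , p∈ , ¬p with ∈-primeDivisors⁻ {v} p∈
...   | pr , p∣v = roots-none cyclotomic₃ cyclotomic₃-polynomial {{Primality.prime⇒nonZero pr}} p∣v (roots-cyclotomic₃-2mod3 pr (two (p % 3) refl (m%n<n p 3)))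
  where
  two : ∀ r → p % 3 ≡ r → r < 3 → r ≡ 2
  two 0 eq _ = contradiction (inj₁ (sym (prime∣prime pr prime[3] (Div.m%n≡0⇒n∣m p 3 eq)))) ¬p
  two 1 eq _ = contradiction (inj₂ eq) ¬p
  two 2 eq _ = refl
  two (suc (suc (suc _))) eq (s≤s (s≤s (s≤s ())))

roots-cyclotomic₃-even : ∀ v → 2 ∣ v → roots cyclotomic₃ v ≡ 0
roots-cyclotomic₃-even v 2∣v = roots-none cyclotomic₃ cyclotomic₃-polynomial 2∣v refl

-- The action of units and of the symmetries of a line on pairs

Matrix : Set
Matrix = (ℤ × ℤ) × (ℤ × ℤ)

_≟ᴹ_ : (M N : Matrix) → Dec (M ≡ N)
_≟ᴹ_ = ≡-dec (≡-dec ℤ._≟_ ℤ._≟_) (≡-dec ℤ._≟_ ℤ._≟_)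

-- eval and _•_ are abstract because products of integers otherwise unfold to signs and absolute values during conversion.
Form : Set
Form = ℤ × ℤ

infixr 7 _•_

abstract
  eval : Form → ℤ × ℤ → ℤ
  eval (α , β) (x , y) = α ⊗ x ⊕ β ⊗ y

  _•_ : ℤ → ℤ × ℤ → ℤ × ℤ
  u • (x , y) = u ⊗ x , u ⊗ y

  eval-≡ : ∀ φ p → eval φ p ≡ proj₁ φ ⊗ proj₁ p ⊕ proj₂ φ ⊗ proj₂ p
  eval-≡ φ p = refl

  •-≡ : ∀ u p → u • p ≡ (u ⊗ proj₁ p , u ⊗ proj₂ p)
  •-≡ u p = refl

  •-• : ∀ u w p → (u ⊗ w) • p ≡ u • w • p
  •-• u w (x , y) = cong₂ _,_ (ℤP.*-assoc u w x) (ℤP.*-assoc u w y)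

  1-• : ∀ p → pos 1 • p ≡ p
  1-• (x , y) = cong₂ _,_ (ℤP.*-identityˡ x) (ℤP.*-identityˡ y)

  eval-• : ∀ φ u p → eval φ (u • p) ≡ u ⊗ eval φ p
  eval-• (α , β) u (x , y) = e α β u x y
    where
    e : ∀ α β u x y → α ⊗ (u ⊗ x) ⊕ β ⊗ (u ⊗ y) ≡ u ⊗ (α ⊗ x ⊕ β ⊗ y)
    e = ℤ-Solver.solve-∀

  •-eval : ∀ r φ p → eval (r • φ) p ≡ r ⊗ eval φ p
  •-eval r (α , β) (x , y) = e r α β x y
    where
    e : ∀ r α β x y → r ⊗ α ⊗ x ⊕ r ⊗ β ⊗ y ≡ r ⊗ (α ⊗ x ⊕ β ⊗ y)
    e = ℤ-Solver.solve-∀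

-- The form as a row vector, multiplied by the matrix; this moves a matrix from the pair to the form
-- evaluated on it.
_∘ᴹ_ : Form → Matrix → Form
(α , β) ∘ᴹ ((m₁ , m₂) , (m₃ , m₄)) = α ⊗ m₁ ⊕ β ⊗ m₃ , α ⊗ m₂ ⊕ β ⊗ m₄

apply : Matrix → ℤ × ℤ → ℤ × ℤ
apply M p = eval (proj₁ M) p , eval (proj₂ M) p

infixl 7 _·_

_·_ : Matrix → Matrix → Matrix
M · N = proj₁ M ∘ᴹ N , proj₂ M ∘ᴹ N

abstract
  eval-∘ : ∀ φ M p → eval φ (apply M p) ≡ eval (φ ∘ᴹ M) p
  eval-∘ (α , β) ((m₁ , m₂) , (m₃ , m₄)) (x , y) = e α β m₁ m₂ m₃ m₄ x y
    where
    e : ∀ α β m₁ m₂ m₃ m₄ x y → α ⊗ (m₁ ⊗ x ⊕ m₂ ⊗ y) ⊕ β ⊗ (m₃ ⊗ x ⊕ m₄ ⊗ y) ≡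
        (α ⊗ m₁ ⊕ β ⊗ m₃) ⊗ x ⊕ (α ⊗ m₂ ⊕ β ⊗ m₄) ⊗ y
    e = ℤ-Solver.solve-∀

  apply-• : ∀ M u p → apply M (u • p) ≡ u • apply M p
  apply-• (φ , ψ) u p = cong₂ _,_ (eval-• φ u p) (eval-• ψ u p)

apply-· : ∀ M N p → apply (M · N) p ≡ apply M (apply N p)
apply-· M N p = cong₂ _,_ (sym (eval-∘ (proj₁ M) N p)) (sym (eval-∘ (proj₂ M) N p))

-- det · adj, an inverse only when det = ±1.
inverse : Matrix → Matrix
inverse ((m₁ , m₂) , (m₃ , m₄)) = (D ⊗ m₄ , D ⊗ (⊝ m₂)) , (D ⊗ (⊝ m₃) , D ⊗ m₁)
  where D = m₁ ⊗ m₄ ⊖ m₂ ⊗ m₃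

1ᴹ flip rot : Matrix
1ᴹ   = (pos 1 , pos 0) , (pos 0 , pos 1)
flip = (pos 0 , pos 1) , (pos 1 , pos 0)
rot  = (⊝ pos 1 , pos 1) , (⊝ pos 1 , pos 0)

-- The six permutations of the points of a line {0, a, b}, as maps of the pair (a, b);
-- rot translates the line so that a becomes 0.
D₃ : List Matrix
D₃ = 1ᴹ ∷ flip ∷ rot ∷ rot · rot ∷ flip · rot ∷ rot · flip ∷ []

open DecMem _≟ᴹ_ using () renaming (_∈?_ to _∈ᴹ?_) public

D₃-unique : Unique D₃
D₃-unique = from-yes (AllPairs.allPairs? (λ M N → ¬? (M ≟ᴹ N)) D₃)

·∈D₃ : ∀ {M N} → M ∈ D₃ → N ∈ D₃ → M · N ∈ D₃
·∈D₃ M∈ N∈ = All.lookup (All.lookup closed M∈) N∈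
  where
  closed : All (λ M → All (λ N → M · N ∈ D₃) D₃) D₃
  closed = from-yes (All.all? (λ M → All.all? (λ N → (M · N) ∈ᴹ? D₃) D₃) D₃)

inverse∈D₃ : ∀ {M} → M ∈ D₃ → inverse M ∈ D₃
inverse∈D₃ = All.lookup closed
  where
  closed : All (λ M → inverse M ∈ D₃) D₃
  closed = from-yes (All.all? (λ M → inverse M ∈ᴹ? D₃) D₃)

inverse-· : ∀ {M} → M ∈ D₃ → inverse M · M ≡ 1ᴹ
inverse-· = All.lookup inverses
  where
  inverses : All (λ M → inverse M · M ≡ 1ᴹ) D₃
  inverses = from-yes (All.all? (λ M → (inverse M · M) ≟ᴹ 1ᴹ) D₃)

·-cancelʳ : ∀ {M M′ N} → M ∈ D₃ → M′ ∈ D₃ → N ∈ D₃ → M · N ≡ M′ · N → M ≡ M′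
·-cancelʳ M∈ M′∈ N∈ = All.lookup (All.lookup (All.lookup cancel M∈) M′∈) N∈
  where
  cancel : All (λ M → All (λ M′ → All (λ N → M · N ≡ M′ · N → M ≡ M′) D₃) D₃) D₃
  cancel = from-yes (All.all? (λ M → All.all? (λ M′ → All.all? (λ N → ((M · N) ≟ᴹ (M′ · N)) →-dec (M ≟ᴹ M′)) D₃) D₃) D₃)

apply-1 : ∀ p → apply 1ᴹ p ≡ p
apply-1 p = cong₂ _,_ (trans (eval-≡ _ p) (e₁ (proj₁ p) (proj₂ p))) (trans (eval-≡ _ p) (e₂ (proj₁ p) (proj₂ p)))
  where
  e₁ : ∀ x y → pos 1 ⊗ x ⊕ pos 0 ⊗ y ≡ x
  e₁ = ℤ-Solver.solve-∀
  e₂ : ∀ x y → pos 0 ⊗ x ⊕ pos 1 ⊗ y ≡ y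
  e₂ = ℤ-Solver.solve-∀

apply-inverse : ∀ {M} x → M ∈ D₃ → apply (inverse M) (apply M x) ≡ x
apply-inverse {M} x M∈ = trans (sym (apply-· (inverse M) M x)) (trans (cong (λ N → apply N x) (inverse-· M∈)) (apply-1 x))

module Classes (v : ℕ) .{{_ : NonZero v}} where
  open Residues v public

  Pair : Set
  Pair = Fin v × Fin v

  _≟ᴾ_ : (x y : Pair) → Dec (x ≡ y)
  _≟ᴾ_ = ≡-dec FinP._≟_ FinP._≟_

  vals : Pair → ℤ × ℤ
  vals (a , b) = val a , val b

  infix 4 _≋_

  record _≋_ (p q : ℤ × ℤ) : Set where
    constructor pair
    field
      fst≈ : proj₁ p ≈ proj₁ q
      snd≈ : proj₂ p ≈ proj₂ q

  eval-cong : ∀ φ {p q} → p ≋ q → eval φ p ≈ eval φ q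
  eval-cong φ {p} {q} (pair e f) = combine₂ (proj₁ φ) (proj₂ φ) e f
    (trans (cong₂ _⊖_ (eval-≡ φ p) (eval-≡ φ q)) (l (proj₁ φ) (proj₂ φ) (proj₁ p) (proj₂ p) (proj₁ q) (proj₂ q)))
    where
    l : ∀ s t x y x′ y′ → s ⊗ x ⊕ t ⊗ y ⊖ (s ⊗ x′ ⊕ t ⊗ y′) ≡ s ⊗ (x ⊖ x′) ⊕ t ⊗ (y ⊖ y′)
    l = ℤ-Solver.solve-∀

  ≋-reflexive : ∀ {p q} → p ≡ q → p ≋ q
  ≋-reflexive refl = pair ≈-refl ≈-refl

  ≋-sym : ∀ {p q} → p ≋ q → q ≋ p
  ≋-sym (pair e f) = pair (≈-sym e) (≈-sym f)

  ≋-trans : ∀ {p q r} → p ≋ q → q ≋ r → p ≋ r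
  ≋-trans (pair e f) (pair e′ f′) = pair (≈-trans e e′) (≈-trans f f′)

  •-cong : ∀ {u w p q} → u ≈ w → p ≋ q → u • p ≋ w • q
  •-cong {u} {w} {p} {q} e (pair f g) = subst₂ _≋_ (sym (•-≡ u p)) (sym (•-≡ w q)) (pair (⊗-cong e f) (⊗-cong e g))

  apply-cong : ∀ M {p q} → p ≋ q → apply M p ≋ apply M q
  apply-cong M e = pair (eval-cong (proj₁ M) e) (eval-cong (proj₂ M) e)

  Generates : ℤ × ℤ → Set
  Generates p = ∃ λ φ → eval φ p ≈ pos 1

  generates-intro : ∀ s t p → s ⊗ proj₁ p ⊕ t ⊗ proj₂ p ≈ pos 1 → Generates p
  generates-intro s t p e = (s , t) , subst (_≈ pos 1) (sym (eval-≡ (s , t) p)) e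

  generates-elim : ∀ p → Generates p → ∃ λ s → ∃ λ t → s ⊗ proj₁ p ⊕ t ⊗ proj₂ p ≈ pos 1
  generates-elim p (φ , e) = proj₁ φ , proj₂ φ , subst (_≈ pos 1) (eval-≡ φ p) e

  generates-cong : ∀ {p q} → p ≋ q → Generates p → Generates q
  generates-cong e (φ , eq) = φ , ≈-trans (eval-cong φ (≋-sym e)) eq

  generates-• : ∀ u p → Unit u → Generates p → Generates (u • p)
  generates-• u p c (φ , eq) = recipᵛ u • φ , subst (_≈ pos 1) (sym (trans (•-eval (recipᵛ u) φ (u • p)) (cong (recipᵛ u ⊗_) (eval-• φ u p))))
    (combine₂ (recipᵛ u ⊗ u) (pos 1) eq (⊗-recipᵛ u c) (l (recipᵛ u) u (eval φ p)))
    where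
    l : ∀ r u x → r ⊗ (u ⊗ x) ⊖ pos 1 ≡ r ⊗ u ⊗ (x ⊖ pos 1) ⊕ pos 1 ⊗ (u ⊗ r ⊖ pos 1)
    l = ℤ-Solver.solve-∀

  generates-apply⁻ : ∀ M p → Generates (apply M p) → Generates p
  generates-apply⁻ M p (φ , eq) = φ ∘ᴹ M , subst (_≈ pos 1) (eval-∘ φ M p) eq

  generates-apply : ∀ {M} p → M ∈ D₃ → Generates p → Generates (apply M p)
  generates-apply {M} p M∈ g = generates-apply⁻ (inverse M) (apply M p) (subst Generates (sym (apply-inverse p M∈)) g)

  -- The decidable counterpart of `Generates`. `Generates` is convenient under linear maps, while
  -- `Primitive` is the condition counted by `jordan₂`.
  Primitive : Pair → Set
  Primitive (a , b) = Coprime (gcd (toℕ a) (toℕ b)) v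

  primitive? : ∀ x → Dec (Primitive x)
  primitive? (a , b) = coprime? (gcd (toℕ a) (toℕ b)) v

  generates⇒primitive : ∀ x → Generates (vals x) → Primitive x
  generates⇒primitive (a , b) g {d} (d∣g , d∣v) with generates-elim (val a , val b) g
  ... | s , t , by p = Div.∣1⇒≡1 (∣ᶻ⇒∣ {x = pos 1}
    (∣-combine₃ s t (⊝ pos 1)
      (∣⇒∣ᶻ {x = val a} (Div.∣-trans d∣g (gcd[m,n]∣m (toℕ a) (toℕ b))))
      (∣⇒∣ᶻ {x = val b} (Div.∣-trans d∣g (gcd[m,n]∣n (toℕ a) (toℕ b))))
      (∣ᶻ-trans d∣v p) (e s t (val a) (val b))))
    where
    e : ∀ s t a b → pos 1 ≡ s ⊗ a ⊕ t ⊗ b ⊕ (⊝ pos 1) ⊗ (s ⊗ a ⊕ t ⊗ b ⊖ pos 1)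
    e = ℤ-Solver.solve-∀

  private
    gcd-combination : ∀ m n → ∃ λ s → ∃ λ t → s ⊗ pos m ⊕ t ⊗ pos n ≡ pos (gcd m n)
    gcd-combination m n with Bézout.identity (gcd-GCD m n)
    ... | Bézout.Identity.+- x y eq = pos x , ⊝ pos y , trans (cong (_⊕ (⊝ pos y) ⊗ pos n)
          (trans (sym (ℤP.pos-* x m)) (trans (cong pos (sym eq)) (trans (ℤP.pos-+ (gcd m n) (y * n)) (cong (pos (gcd m n) ⊕_) (ℤP.pos-* y n))))))
          (e (pos (gcd m n)) (pos y) (pos n))
      where
      e : ∀ g y n → g ⊕ y ⊗ n ⊕ (⊝ y) ⊗ n ≡ g
      e = ℤ-Solver.solve-∀
    ... | Bézout.Identity.-+ x y eq = ⊝ pos x , pos y , trans (cong ((⊝ pos x) ⊗ pos m ⊕_)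
          (trans (sym (ℤP.pos-* y n)) (trans (cong pos (sym eq)) (trans (ℤP.pos-+ (gcd m n) (x * m)) (cong (pos (gcd m n) ⊕_) (ℤP.pos-* x m))))))
          (e (pos (gcd m n)) (pos x) (pos m))
      where
      e : ∀ g y n → (⊝ y) ⊗ n ⊕ (g ⊕ y ⊗ n) ≡ g
      e = ℤ-Solver.solve-∀

  primitive⇒generates : ∀ x → Primitive x → Generates (vals x)
  primitive⇒generates (a , b) c with gcd-combination (toℕ a) (toℕ b) | unit-elim (pos (gcd (toℕ a) (toℕ b))) c
  ... | s , t , eq | r , p = generates-intro (s ⊗ r) (t ⊗ r) (val a , val b) (≈-trans (≈-reflexive (trans (e s t r (val a) (val b)) (cong (_⊗ r) eq))) p)
    where
    e : ∀ s t r a b → s ⊗ r ⊗ a ⊕ t ⊗ r ⊗ b ≡ (s ⊗ a ⊕ t ⊗ b) ⊗ r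
    e = ℤ-Solver.solve-∀

  -- The carrier of (ℤ/v)ˣ × D₃, cut down to the group by the list `scalars`. The two factors
  -- commute because the matrices act linearly.
  Scalar : Set
  Scalar = Fin v × Matrix

  units : List (Fin v)
  units = filter (unit? ∘ val) (allFin v)

  scalars : List Scalar
  scalars = cartesianProduct units D₃

  primitives : List Pair
  primitives = filter primitive? (cartesianProduct (allFin v) (allFin v))

  ∈-units⁺ : ∀ {u} → Unit (val u) → u ∈ units
  ∈-units⁺ {u} c = Mem.∈-filter⁺ (unit? ∘ val) (Mem.∈-allFin u) c

  ∈-units⁻ : ∀ {u} → u ∈ units → Unit (val u)
  ∈-units⁻ u∈ = proj₂ (Mem.∈-filter⁻ (unit? ∘ val) {xs = allFin v} u∈)

  ∈-scalars⁻ : ∀ {u M} → (u , M) ∈ scalars → Unit (val u) × M ∈ D₃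
  ∈-scalars⁻ g∈ with Mem.∈-cartesianProduct⁻ units D₃ g∈
  ... | u∈ , M∈ = ∈-units⁻ u∈ , M∈

  ∈-scalars⁺ : ∀ {u M} → Unit (val u) → M ∈ D₃ → (u , M) ∈ scalars
  ∈-scalars⁺ c M∈ = Mem.∈-cartesianProduct⁺ (∈-units⁺ c) M∈

  ∈-primitives⁺ : ∀ {x} → Generates (vals x) → x ∈ primitives
  ∈-primitives⁺ {a , b} g = Mem.∈-filter⁺ primitive? (Mem.∈-cartesianProduct⁺ (Mem.∈-allFin a) (Mem.∈-allFin b)) (generates⇒primitive (a , b) g)

  ∈-primitives⁻ : ∀ {x} → x ∈ primitives → Generates (vals x)
  ∈-primitives⁻ {x} x∈ = primitive⇒generates x (proj₂ (Mem.∈-filter⁻ primitive? {xs = cartesianProduct (allFin v) (allFin v)} x∈))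

  resPair : ℤ × ℤ → Pair
  resPair (x , y) = res x , res y

  vals-res : ∀ p → vals (resPair p) ≋ p
  vals-res (x , y) = pair (val-res x) (val-res y)

  resPair-cong : ∀ {p q} → p ≋ q → resPair p ≡ resPair q
  resPair-cong (pair e f) = cong₂ _,_ (res-cong e) (res-cong f)

  vals-injective : ∀ {x y} → vals x ≋ vals y → x ≡ y
  vals-injective {_ , _} {_ , _} (pair e f) = cong₂ _,_ (val-injective e) (val-injective f)

  actOn : Scalar → Pair → Pair
  actOn (u , M) x = resPair (val u • apply M (vals x))

  vals-actOn : ∀ u M x → vals (actOn (u , M) x) ≋ val u • apply M (vals x)
  vals-actOn u M x = vals-res (val u • apply M (vals x))

  actOn-≡ : ∀ u M x y → val u • apply M (vals x) ≋ vals y → actOn (u , M) x ≡ y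
  actOn-≡ u M x y e = vals-injective {actOn (u , M) x} {y} (≋-trans (vals-actOn u M x) e)

  actOn-≡⁻ : ∀ u M x y → actOn (u , M) x ≡ y → val u • apply M (vals x) ≋ vals y
  actOn-≡⁻ u M x y refl = ≋-sym (vals-actOn u M x)

  unit-res : ∀ {x} → Unit x → Unit (val (res x))
  unit-res {x} c {d} = unit-cong (≈-sym (val-res x)) c {d}

  private
    mulS : Scalar → Scalar → Scalar
    mulS (u , M) (w , N) = res (val u ⊗ val w) , M · N

    invS : Scalar → Scalar
    invS (u , M) = res (recipᵛ (val u)) , inverse M

    actOn-mul : ∀ u M w N x → actOn (mulS (u , M) (w , N)) x ≡ actOn (u , M) (actOn (w , N) x)
    actOn-mul u M w N x = resPair-cong (≋-trans (•-cong (val-res (val u ⊗ val w)) (≋-reflexive (apply-· M N (vals x))))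
      (≋-trans (≋-reflexive (trans (•-• (val u) (val w) _) (cong (val u •_) (sym (apply-• M (val w) (apply N (vals x)))))))
        (•-cong (≈-refl {val u}) (apply-cong M (≋-sym (vals-actOn w N x))))))

    actOn-inv : ∀ u M x → Unit (val u) → M ∈ D₃ → actOn (invS (u , M)) (actOn (u , M) x) ≡ x
    actOn-inv u M x c M∈ = actOn-≡ (res (recipᵛ (val u))) (inverse M) (actOn (u , M) x) x (≋-trans
      (•-cong (val-res (recipᵛ (val u))) (apply-cong (inverse M) (vals-actOn u M x)))
      (≋-trans (≋-reflexive (trans (cong (recipᵛ (val u) •_) (apply-• (inverse M) (val u) (apply M (vals x))))
          (trans (sym (•-• (recipᵛ (val u)) (val u) _)) (cong ((recipᵛ (val u) ⊗ val u) •_) (apply-inverse (vals x) M∈)))))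
        (≋-trans (•-cong (≈-trans (≈-reflexive (ℤP.*-comm (recipᵛ (val u)) (val u))) (⊗-recipᵛ (val u) c)) (≋-reflexive refl))
          (≋-reflexive (1-• (vals x))))))

    generates-actOn : ∀ u M x → Unit (val u) → M ∈ D₃ → Generates (vals x) → Generates (vals (actOn (u , M) x))
    generates-actOn u M x c M∈ g = generates-cong (≋-sym (vals-actOn u M x))
      (generates-• (val u) _ c (generates-apply (vals x) M∈ g))

    unit-1 : Unit (val (res (pos 1)))
    unit-1 = unit-res {pos 1} (λ {d} (d∣1 , _) → Div.∣1⇒≡1 d∣1)

  action : FiniteAction Scalar Pair
  action = record
    { _≟_         = _≟ᴾ_
    ; gs          = scalars
    ; xs          = primitives
    ; gs-unique   = Uniq.cartesianProduct⁺ (Uniq.filter⁺ (unit? ∘ val) (Uniq.allFin⁺ v)) D₃-unique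
    ; xs-unique   = Uniq.filter⁺ primitive? (Uniq.cartesianProduct⁺ (Uniq.allFin⁺ v) (Uniq.allFin⁺ v))
    ; act         = actOn
    ; mul         = mulS
    ; inv         = invS
    ; one         = res (pos 1) , 1ᴹ
    ; one∈        = ∈-scalars⁺ unit-1 (here refl)
    ; act∈        = λ {(u , M)} {x} g∈ x∈ → let (c , M∈) = ∈-scalars⁻ g∈ in
                      ∈-primitives⁺ (generates-actOn u M x c M∈ (∈-primitives⁻ x∈))
    ; mul∈        = λ {(u , M)} {(w , N)} g∈ h∈ → let (c , M∈) = ∈-scalars⁻ g∈ ; (d , N∈) = ∈-scalars⁻ h∈ in
                      ∈-scalars⁺ (unit-res {val u ⊗ val w} (unit-⊗ {val u} {val w} c d)) (·∈D₃ M∈ N∈)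
    ; inv∈        = λ {(u , M)} g∈ → let (c , M∈) = ∈-scalars⁻ g∈ in
                      ∈-scalars⁺ (unit-res {recipᵛ (val u)} (unit-recipᵛ (val u) c)) (inverse∈D₃ M∈)
    ; act-mul     = λ {(u , M)} {(w , N)} {x} _ _ _ → actOn-mul u M w N x
    ; act-inv     = λ {(u , M)} {x} g∈ _ → let (c , M∈) = ∈-scalars⁻ g∈ in actOn-inv u M x c M∈
    ; mul-cancelʳ = λ {(u , M)} {(u′ , M′)} {(w , N)} g∈ g′∈ h∈ eq →
                      let (_ , M∈) = ∈-scalars⁻ g∈ ; (_ , M′∈) = ∈-scalars⁻ g′∈ ; (d , N∈) = ∈-scalars⁻ h∈ in
                      cong₂ _,_
                        (val-injective (unit-cancel (val w) d
                          (≈-trans (≈-reflexive (ℤP.*-comm (val w) (val u)))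
                            (≈-trans (res-injective (cong proj₁ eq)) (≈-reflexive (ℤP.*-comm (val u′) (val w)))))))
                        (·-cancelʳ M∈ M′∈ N∈ (cong proj₂ eq))
    }

  open Burnside action public

-- Fixed points of the action on generating pairs

module FixedPoints (v : ℕ) .{{_ : NonZero v}} where
  open Classes v
  open FiniteAction action using (xs-unique)

  fixedPoints : Matrix → ℕ
  fixedPoints M = ∑ units (λ u → ∑ primitives (λ x → 𝟙 (actOn (u , M) x ≟ᴾ x)))

  units-unique : Unique units
  units-unique = Uniq.filter⁺ (unit? ∘ val) (Uniq.allFin⁺ v)

  -- If M′ is the conjugate of M by N, then N maps the pairs fixed by u M′ injectively to those
  -- fixed by u M, because u commutes with N. The reverse inequality is another instance.
  fixedPoints-conjugate≤ : ∀ {M M′ N} → N ∈ D₃ → N · M′ ≡ M · N → fixedPoints M′ ≤ fixedPoints M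
  fixedPoints-conjugate≤ {M} {M′} {N} N∈ eq = mono units
    where
    open ≡-Reasoning
    slide : ∀ u p → val u • apply M (apply N p) ≡ apply N (val u • apply M′ p)
    slide u p = begin
      val u • apply M (apply N p)   ≡⟨ cong (val u •_) (apply-· M N p) ⟨
      val u • apply (M · N) p       ≡⟨ cong (λ K → val u • apply K p) eq ⟨
      val u • apply (N · M′) p      ≡⟨ cong (val u •_) (apply-· N M′ p) ⟩
      val u • apply N (apply M′ p)  ≡⟨ apply-• N (val u) (apply M′ p) ⟨
      apply N (val u • apply M′ p)  ∎
    move : Pair → Pair
    move x = resPair (apply N (vals x))
    each : ∀ u → ∑ primitives (λ x → 𝟙 (actOn (u , M′) x ≟ᴾ x)) ≤ ∑ primitives (λ x → 𝟙 (actOn (u , M) x ≟ᴾ x))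
    each u = ∑-𝟙-injection (λ x → actOn (u , M′) x ≟ᴾ x) (λ x → actOn (u , M) x ≟ᴾ x) move xs-unique
      (λ {x} x∈ fixed →
          ∈-primitives⁺ (generates-cong (≋-sym (vals-res (apply N (vals x)))) (generates-apply (vals x) N∈ (∈-primitives⁻ x∈)))
        , actOn-≡ u M (move x) (move x) (≋-trans (•-cong (≈-refl {val u}) (apply-cong M (vals-res (apply N (vals x)))))
            (≋-trans (≋-reflexive (slide u (vals x)))
              (≋-trans (apply-cong N (actOn-≡⁻ u M′ x x fixed)) (≋-sym (vals-res (apply N (vals x))))))))
      (λ {x} {y} _ _ _ _ same → vals-injective {x} {y}
        (≋-trans (≋-reflexive (sym (apply-inverse (vals x) N∈)))
          (≋-trans (apply-cong (inverse N)
            (≋-trans (≋-sym (vals-res (apply N (vals x)))) (≋-trans (≋-reflexive (cong vals same)) (vals-res (apply N (vals y))))))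
            (≋-reflexive (apply-inverse (vals y) N∈)))))
    mono : ∀ us → ∑ us (λ u → ∑ primitives (λ x → 𝟙 (actOn (u , M′) x ≟ᴾ x))) ≤ ∑ us (λ u → ∑ primitives (λ x → 𝟙 (actOn (u , M) x ≟ᴾ x)))
    mono []       = z≤n
    mono (u ∷ us) = ℕP.+-mono-≤ (each u) (mono us)

  ∑-units : ∑ (allFin v) (λ a → 𝟙 (unit? (val a))) ≡ totient v
  ∑-units = ∑-allFin v (λ a → 𝟙 (coprime? a v))

  -- Applying to u x = x a form with value 1 at x gives u = 1. So each generating pair is fixed by
  -- exactly one unit, and the total is the number of generating pairs.
  fixedPoints-1 : fixedPoints 1ᴹ ≡ jordan₂ v
  fixedPoints-1 = begin
    ∑ units (λ u → ∑ primitives (λ x → 𝟙 (actOn (u , 1ᴹ) x ≟ᴾ x)))  ≡⟨ ∑-swap units primitives _ ⟩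
    ∑ primitives (λ x → ∑ units (λ u → 𝟙 (actOn (u , 1ᴹ) x ≟ᴾ x)))  ≡⟨ ∑-cong∈ primitives single ⟩
    ∑ primitives (λ _ → 1)                                           ≡⟨ trans (∑-const primitives 1) (ℕP.*-identityʳ _) ⟩
    length primitives                                                ≡⟨ length-filter primitive? (cartesianProduct (allFin v) (allFin v)) ⟩
    ∑ (cartesianProduct (allFin v) (allFin v)) (𝟙 ∘ primitive?)      ≡⟨ ∑-cartesianProduct (allFin v) (allFin v) (𝟙 ∘ primitive?) ⟩
    ∑ (allFin v) (λ a → ∑ (allFin v) (λ b → 𝟙 (coprime? (gcd (toℕ a) (toℕ b)) v)))
      ≡⟨ ∑-cong (allFin v) (λ a → ∑-allFin v (λ b → 𝟙 (coprime? (gcd (toℕ a) b) v))) ⟩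
    ∑ (allFin v) (λ a → ∑ (upTo v) (λ b → 𝟙 (coprime? (gcd (toℕ a) b) v)))
      ≡⟨ ∑-allFin v (λ a → ∑ (upTo v) (λ b → 𝟙 (coprime? (gcd a b) v))) ⟩
    jordan₂ v                                                        ∎
    where
    open ≡-Reasoning
    1# : Fin v
    1# = res (pos 1)
    only : ∀ u x → Generates (vals x) → actOn (u , 1ᴹ) x ≡ x → u ≡ 1#
    only u x (φ , eq) fixed = val-injective (≈-trans (combine₂ (pos 1) (pos 1 ⊖ val u) e eq (l (val u) (eval φ (vals x)))) (≈-sym (val-res (pos 1))))
      where
      e : val u ⊗ eval φ (vals x) ≈ eval φ (vals x)
      e = subst (_≈ eval φ (vals x)) (trans (cong (λ p → eval φ (val u • p)) (apply-1 (vals x))) (eval-• φ (val u) (vals x)))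
            (eval-cong φ (actOn-≡⁻ u 1ᴹ x x fixed))
      l : ∀ u y → u ⊖ pos 1 ≡ pos 1 ⊗ (u ⊗ y ⊖ y) ⊕ (pos 1 ⊖ u) ⊗ (y ⊖ pos 1)
      l = ℤ-Solver.solve-∀
    single : ∀ x → x ∈ primitives → ∑ units (λ u → 𝟙 (actOn (u , 1ᴹ) x ≟ᴾ x)) ≡ 1
    single x x∈ = ∑-𝟙-single (λ u → actOn (u , 1ᴹ) x ≟ᴾ x) units-unique {1#}
      (∈-units⁺ (λ {d} → unit-res {pos 1} (λ {d} (d∣1 , _) → Div.∣1⇒≡1 d∣1) {d}))
      (actOn-≡ 1# 1ᴹ x x (≋-trans (•-cong (val-res (pos 1)) (≋-reflexive (apply-1 (vals x)))) (≋-reflexive (1-• (vals x)))))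
      (λ {u} _ → only u x (∈-primitives⁻ x∈))

  -- The fixed pairs are the (a , κ u a) with a a unit and u a root of f.
  module _ (M : Matrix) (f : ℤ → ℤ) (κ : ℤ)
    (forward  : ∀ u a b → Generates (a , b) → u • apply M (a , b) ≋ (a , b) → b ≈ κ ⊗ (u ⊗ a) × Unit a × pos v ∣ᶻ f u)
    (backward : ∀ u a b → pos v ∣ᶻ f u → b ≈ κ ⊗ (u ⊗ a) → Unit u × u • apply M (a , b) ≋ (a , b)) where

    private
      P? : ∀ ((u , x) : Fin v × Pair) → Dec (actOn (u , M) x ≡ x)
      P? (u , x) = actOn (u , M) x ≟ᴾ x

      Q? : ∀ ((a , u) : Fin v × Fin v) → Dec (Unit (val a) × pos v ∣ᶻ f (val u))
      Q? (a , u) = unit? (val a) ×-dec (pos v ∣ᶻ? f (val u))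

      second : Fin v → Fin v → Fin v
      second a u = res (κ ⊗ (val u ⊗ val a))

      fixed⇒ : ∀ u a b → (a , b) ∈ primitives → actOn (u , M) (a , b) ≡ (a , b) →
               b ≡ second a u × Unit (val a) × pos v ∣ᶻ f (val u)
      fixed⇒ u a b m fixed = val-injective (≈-trans (proj₁ facts) (≈-sym (val-res (κ ⊗ (val u ⊗ val a))))) , proj₂ facts
        where
        facts : val b ≈ κ ⊗ (val u ⊗ val a) × Unit (val a) × pos v ∣ᶻ f (val u)
        facts = forward (val u) (val a) (val b) (∈-primitives⁻ {a , b} m) (actOn-≡⁻ u M (a , b) (a , b) fixed)

      all² : List (Fin v × Fin v)
      all² = cartesianProduct (allFin v) (allFin v)

      second-∈ : ∀ {u x} → (u , x) ∈ cartesianProduct units primitives → x ∈ primitives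
      second-∈ m = proj₂ (Mem.∈-cartesianProduct⁻ units primitives m)

      join : ∀ {u u′ a a′ b b′} → b ≡ second a u → b′ ≡ second a′ u′ → (a , u) ≡ (a′ , u′) → (u , (a , b)) ≡ (u′ , (a′ , b′))
      join refl refl refl = refl

      to : ∑ (cartesianProduct units primitives) (𝟙 ∘ P?) ≤ ∑ all² (𝟙 ∘ Q?)
      to = ∑-𝟙-injection P? Q? (λ (u , (a , b)) → a , u) (Uniq.cartesianProduct⁺ units-unique xs-unique)
        (λ {(u , (a , b))} m fixed → Mem.∈-cartesianProduct⁺ (Mem.∈-allFin a) (Mem.∈-allFin u) , proj₂ (fixed⇒ u a b (second-∈ m) fixed))
        (λ {(u , (a , b))} {(u′ , (a′ , b′))} m m′ fixed fixed′ same →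
          join (proj₁ (fixed⇒ u a b (second-∈ m) fixed)) (proj₁ (fixed⇒ u′ a′ b′ (second-∈ m′) fixed′)) same)

      from : ∑ all² (𝟙 ∘ Q?) ≤ ∑ (cartesianProduct units primitives) (𝟙 ∘ P?)
      from = ∑-𝟙-injection Q? P? (λ (a , u) → u , (a , second a u)) (Uniq.cartesianProduct⁺ (Uniq.allFin⁺ v) (Uniq.allFin⁺ v))
        (λ {(a , u)} _ (c , root) → let (uc , fixed) = backward (val u) (val a) (val (second a u)) root (val-res (κ ⊗ (val u ⊗ val a))) in
           Mem.∈-cartesianProduct⁺ (∈-units⁺ (λ {d} → uc {d})) (∈-primitives⁺ {a , second a u} (generates-intro (recipᵛ (val a)) (pos 0) (vals (a , second a u))
             (combine₁ (pos 1) (⊗-recipᵛ (val a) c) (l (val a) (recipᵛ (val a)) (val (second a u)))))) , actOn-≡ u M (a , second a u) (a , second a u) fixed)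
        (λ { {(a , u)} {(a′ , u′)} _ _ _ _ same → cong₂ _,_ (cong (proj₁ ∘ proj₂) same) (cong proj₁ same) })
        where
        l : ∀ a r b → r ⊗ a ⊕ pos 0 ⊗ b ⊖ pos 1 ≡ pos 1 ⊗ (a ⊗ r ⊖ pos 1)
        l = ℤ-Solver.solve-∀

    fixedPoints-roots : fixedPoints M ≡ totient v * roots f v
    fixedPoints-roots = begin
      fixedPoints M                                                              ≡⟨ ∑-cartesianProduct units primitives (𝟙 ∘ P?) ⟨
      ∑ (cartesianProduct units primitives) (𝟙 ∘ P?)                             ≡⟨ ℕP.≤-antisym to from ⟩
      ∑ all² (𝟙 ∘ Q?)                                                            ≡⟨ ∑-cartesianProduct (allFin v) (allFin v) (𝟙 ∘ Q?) ⟩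
      ∑ (allFin v) (λ a → ∑ (allFin v) (λ u → 𝟙 (Q? (a , u))))                   ≡⟨ ∑-cong (allFin v) inner ⟩
      ∑ (allFin v) (λ a → roots f v * 𝟙 (unit? (val a)))                         ≡⟨ ∑-*ˡ (allFin v) (roots f v) (λ a → 𝟙 (unit? (val a))) ⟩
      roots f v * ∑ (allFin v) (λ a → 𝟙 (unit? (val a)))                         ≡⟨ cong (roots f v *_) ∑-units ⟩
      roots f v * totient v                                                      ≡⟨ ℕP.*-comm (roots f v) (totient v) ⟩
      totient v * roots f v                                                      ∎
      where
      open ≡-Reasoning
      inner : ∀ a → ∑ (allFin v) (λ u → 𝟙 (Q? (a , u))) ≡ roots f v * 𝟙 (unit? (val a))
      inner a = begin
        ∑ (allFin v) (λ u → 𝟙 (Q? (a , u)))                                     ≡⟨ ∑-cong (allFin v) (λ u → 𝟙-× (unit? (val a)) (pos v ∣ᶻ? f (val u))) ⟩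
        ∑ (allFin v) (λ u → 𝟙 (unit? (val a)) * 𝟙 (pos v ∣ᶻ? f (val u)))        ≡⟨ ∑-*ˡ (allFin v) (𝟙 (unit? (val a))) (λ u → 𝟙 (pos v ∣ᶻ? f (val u))) ⟩
        𝟙 (unit? (val a)) * ∑ (allFin v) (λ u → 𝟙 (pos v ∣ᶻ? f (val u)))        ≡⟨ cong (𝟙 (unit? (val a)) *_) (∑-allFin v (λ u → 𝟙 (pos v ∣ᶻ? f (pos u)))) ⟩
        𝟙 (unit? (val a)) * roots f v                                           ≡⟨ ℕP.*-comm (𝟙 (unit? (val a))) (roots f v) ⟩
        roots f v * 𝟙 (unit? (val a))                                           ∎

  private
    scaled-≡ : ∀ u M a b → u • apply M (a , b) ≡
      (u ⊗ (proj₁ (proj₁ M) ⊗ a ⊕ proj₂ (proj₁ M) ⊗ b) , u ⊗ (proj₁ (proj₂ M) ⊗ a ⊕ proj₂ (proj₂ M) ⊗ b))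
    scaled-≡ u M a b = trans (•-≡ u (apply M (a , b)))
      (cong₂ (λ x y → u ⊗ x , u ⊗ y) (eval-≡ (proj₁ M) (a , b)) (eval-≡ (proj₂ M) (a , b)))

    unit-first : ∀ {a b} c → b ≈ c ⊗ a → Generates (a , b) → Unit a
    unit-first {a} {b} c e g with generates-elim (a , b) g
    ... | s , t , eq = unit-intro a (s ⊕ t ⊗ c) (combine₂ (pos 1) (⊝ t) eq e (l a b c s t))
      where
      l : ∀ a b c s t → a ⊗ (s ⊕ t ⊗ c) ⊖ pos 1 ≡ pos 1 ⊗ (s ⊗ a ⊕ t ⊗ b ⊖ pos 1) ⊕ (⊝ t) ⊗ (b ⊖ c ⊗ a)
      l = ℤ-Solver.solve-∀

  -- A fixed pair satisfies u b = a and u a = b. As b is a multiple of a, the generator a alone is a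
  -- unit, and cancelling it from u² a = a leaves u² = 1.
  fixedPoints-flip : fixedPoints flip ≡ totient v * roots square-1 v
  fixedPoints-flip = fixedPoints-roots flip square-1 (pos 1) forward backward
    where
    l₁ : ∀ u a b → b ⊖ u ⊗ a ≡ (⊝ pos 1) ⊗ (u ⊗ (pos 1 ⊗ a ⊕ pos 0 ⊗ b) ⊖ b)
    l₁ = ℤ-Solver.solve-∀
    l₂ : ∀ u a b → a ⊗ (u ⊗ u) ⊖ a ⊗ pos 1 ≡ pos 1 ⊗ (u ⊗ (pos 0 ⊗ a ⊕ pos 1 ⊗ b) ⊖ a) ⊕ (⊝ u) ⊗ (b ⊖ u ⊗ a)
    l₂ = ℤ-Solver.solve-∀
    l₃ : ∀ u a b → u ⊗ (pos 0 ⊗ a ⊕ pos 1 ⊗ b) ⊖ a ≡ u ⊗ (b ⊖ pos 1 ⊗ (u ⊗ a)) ⊕ a ⊗ (u ⊗ u ⊖ pos 1)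
    l₃ = ℤ-Solver.solve-∀
    l₄ : ∀ u a b → u ⊗ (pos 1 ⊗ a ⊕ pos 0 ⊗ b) ⊖ b ≡ (⊝ pos 1) ⊗ (b ⊖ pos 1 ⊗ (u ⊗ a))
    l₄ = ℤ-Solver.solve-∀
    forward : ∀ u a b → Generates (a , b) → u • apply flip (a , b) ≋ (a , b) →
              b ≈ pos 1 ⊗ (u ⊗ a) × Unit a × pos v ∣ᶻ square-1 u
    forward u a b g fixed with subst (_≋ (a , b)) (scaled-≡ u flip a b) fixed
    ... | pair e f = ≈-trans b≈ua (≈-reflexive (sym (ℤP.*-identityˡ (u ⊗ a)))) , (λ {d} → c {d}) ,
                     ∣-difference (unit-cancel a {u ⊗ u} {pos 1} c (combine₂ (pos 1) (⊝ u) e b≈ua (l₂ u a b)))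
      where
      b≈ua : b ≈ u ⊗ a
      b≈ua = combine₁ (⊝ pos 1) f (l₁ u a b)
      c : Unit a
      c = unit-first u b≈ua g
    backward : ∀ u a b → pos v ∣ᶻ square-1 u → b ≈ pos 1 ⊗ (u ⊗ a) → Unit u × u • apply flip (a , b) ≋ (a , b)
    backward u a b root e = (λ {d} → unit-intro u u (by root) {d}) ,
      subst (_≋ (a , b)) (sym (scaled-≡ u flip a b))
        (pair (combine₂ u a e (by {u ⊗ u} {pos 1} root) (l₃ u a b)) (combine₁ (⊝ pos 1) e (l₄ u a b)))

  -- A fixed pair satisfies u(b - a) = a and -u a = b. Again a is a unit, and substituting b leaves
  -- u² + u + 1 = 0.
  fixedPoints-rot : fixedPoints rot ≡ totient v * roots cyclotomic₃ v
  fixedPoints-rot = fixedPoints-roots rot cyclotomic₃ (⊝ pos 1) forward backward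
    where
    l₁ : ∀ u a b → b ⊖ (⊝ u) ⊗ a ≡ (⊝ pos 1) ⊗ (u ⊗ ((⊝ pos 1) ⊗ a ⊕ pos 0 ⊗ b) ⊖ b)
    l₁ = ℤ-Solver.solve-∀
    l₂ : ∀ u a b → a ⊗ (u ⊗ u ⊕ u ⊕ pos 1) ⊖ a ⊗ pos 0 ≡ (⊝ pos 1) ⊗ (u ⊗ ((⊝ pos 1) ⊗ a ⊕ pos 1 ⊗ b) ⊖ a) ⊕ u ⊗ (b ⊖ (⊝ u) ⊗ a)
    l₂ = ℤ-Solver.solve-∀
    l₃ : ∀ u a b → u ⊗ ((⊝ pos 1) ⊗ a ⊕ pos 1 ⊗ b) ⊖ a ≡ u ⊗ (b ⊖ (⊝ pos 1) ⊗ (u ⊗ a)) ⊕ (⊝ a) ⊗ (u ⊗ u ⊕ u ⊕ pos 1 ⊖ pos 0)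
    l₃ = ℤ-Solver.solve-∀
    l₄ : ∀ u a b → u ⊗ ((⊝ pos 1) ⊗ a ⊕ pos 0 ⊗ b) ⊖ b ≡ (⊝ pos 1) ⊗ (b ⊖ (⊝ pos 1) ⊗ (u ⊗ a))
    l₄ = ℤ-Solver.solve-∀
    l₅ : ∀ u a → (⊝ u) ⊗ a ≡ (⊝ pos 1) ⊗ (u ⊗ a)
    l₅ = ℤ-Solver.solve-∀
    l₆ : ∀ u → u ⊗ (⊝ (u ⊕ pos 1)) ⊖ pos 1 ≡ (⊝ pos 1) ⊗ (u ⊗ u ⊕ u ⊕ pos 1 ⊖ pos 0)
    l₆ = ℤ-Solver.solve-∀
    forward : ∀ u a b → Generates (a , b) → u • apply rot (a , b) ≋ (a , b) →
              b ≈ (⊝ pos 1) ⊗ (u ⊗ a) × Unit a × pos v ∣ᶻ cyclotomic₃ u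
    forward u a b g fixed with subst (_≋ (a , b)) (scaled-≡ u rot a b) fixed
    ... | pair e f = ≈-trans b≈-ua (≈-reflexive (l₅ u a)) , (λ {d} → c {d}) ,
                     subst (pos v ∣ᶻ_) (ℤP.+-identityʳ (cyclotomic₃ u))
                       (∣-difference (unit-cancel a {cyclotomic₃ u} {pos 0} c (combine₂ (⊝ pos 1) u e b≈-ua (l₂ u a b))))
      where
      b≈-ua : b ≈ (⊝ u) ⊗ a
      b≈-ua = combine₁ (⊝ pos 1) f (l₁ u a b)
      c : Unit a
      c = unit-first (⊝ u) b≈-ua g
    backward : ∀ u a b → pos v ∣ᶻ cyclotomic₃ u → b ≈ (⊝ pos 1) ⊗ (u ⊗ a) → Unit u × u • apply rot (a , b) ≋ (a , b)
    backward u a b root e = (λ {d} → unit-intro u (⊝ (u ⊕ pos 1)) (combine₁ (⊝ pos 1) cy (l₆ u)) {d}) ,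
      subst (_≋ (a , b)) (sym (scaled-≡ u rot a b)) (pair (combine₂ u (⊝ a) e cy (l₃ u a b)) (combine₁ (⊝ pos 1) e (l₄ u a b)))
      where
      cy : cyclotomic₃ u ≈ pos 0
      cy = by (subst (pos v ∣ᶻ_) (sym (ℤP.+-identityʳ (cyclotomic₃ u))) root)

  private
    flip∈ : flip ∈ D₃
    flip∈ = there (here refl)
    rot∈ : rot ∈ D₃
    rot∈ = there (there (here refl))
    rot²∈ : rot · rot ∈ D₃
    rot²∈ = there (there (there (here refl)))

    conjugate : ∀ M M′ N N′ → N ∈ D₃ → N′ ∈ D₃ → N · M′ ≡ M · N → N′ · M ≡ M′ · N′ → fixedPoints M′ ≡ fixedPoints M
    conjugate M M′ N N′ N∈ N′∈ e e′ = ℕP.≤-antisym (fixedPoints-conjugate≤ {M} {M′} {N} N∈ e) (fixedPoints-conjugate≤ {M′} {M} {N′} N′∈ e′)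

    by-matrix : ∀ Ms → ∑ (cartesianProduct units Ms) (λ g → ∑ primitives (λ x → 𝟙 (actOn g x ≟ᴾ x))) ≡ ∑ Ms fixedPoints
    by-matrix Ms = trans (∑-cartesianProduct units Ms (λ g → ∑ primitives (λ x → 𝟙 (actOn g x ≟ᴾ x))))
      (∑-swap units Ms (λ u M → ∑ primitives (λ x → 𝟙 (actOn (u , M) x ≟ᴾ x))))

    -- The conjugacy classes of D₃ have 1, 3 and 2 members, which explains the coefficients.
    ∑-D₃ : ∀ (F : Matrix → ℕ) {j s t} → F 1ᴹ ≡ j → F flip ≡ s → F rot ≡ t →
           F (rot · rot) ≡ F rot → F (flip · rot) ≡ F flip → F (rot · flip) ≡ F flip → ∑ D₃ F ≡ j + 3 * s + 2 * t
    ∑-D₃ F refl refl refl e₁ e₂ e₃ = trans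
      (cong (λ k → F 1ᴹ + (F flip + (F rot + k))) (cong₂ _+_ e₁ (cong₂ _+_ e₂ (cong (_+ 0) e₃))))
      (l (F 1ᴹ) (F flip) (F rot))
      where
      l : ∀ j s t → j + (s + (t + (t + (s + (s + 0))))) ≡ j + 3 * s + 2 * t
      l = ℕ-Solver.solve-∀

    length-scalars : length scalars ≡ totient v * 6
    length-scalars = trans (length-cartesianProduct units D₃) (cong (_* 6) (trans (length-filter (unit? ∘ val) (allFin v)) ∑-units))

    burnside-scalars : length orbitReps * length scalars ≡ ∑ scalars (λ g → ∑ primitives (λ x → 𝟙 (actOn g x ≟ᴾ x)))
    burnside-scalars = burnside

    rot²-fixed : fixedPoints (rot · rot) ≡ fixedPoints rot
    rot²-fixed = conjugate rot (rot · rot) flip flip flip∈ flip∈ refl refl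

    flip-rot-fixed : fixedPoints (flip · rot) ≡ fixedPoints flip
    flip-rot-fixed = conjugate flip (flip · rot) (rot · rot) rot rot²∈ rot∈ refl refl

    rot-flip-fixed : fixedPoints (rot · flip) ≡ fixedPoints flip
    rot-flip-fixed = conjugate flip (rot · flip) rot (rot · rot) rot∈ rot²∈ refl refl

    scalars-fixed : ∑ scalars (λ g → ∑ primitives (λ x → 𝟙 (actOn g x ≟ᴾ x))) ≡ ∑ D₃ fixedPoints
    scalars-fixed = by-matrix D₃

  burnside-D₃ : length orbitReps * (totient v * 6) ≡
                jordan₂ v + 3 * (totient v * roots square-1 v) + 2 * (totient v * roots cyclotomic₃ v)
  burnside-D₃ = chain (length orbitReps) length-scalars burnside-scalars scalars-fixed
    (∑-D₃ fixedPoints fixedPoints-1 fixedPoints-flip fixedPoints-rot rot²-fixed flip-rot-fixed rot-flip-fixed)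
    where
    -- The sums are replaced by variables, so that composing the equations does not compare them by
    -- evaluation.
    chain : ∀ n {l t a b c : ℕ} → l ≡ t → n * l ≡ a → a ≡ b → b ≡ c → n * t ≡ c
    chain n refl refl refl refl = refl

-- Degenerate classes

negated : List Form → List Form
negated = map (λ (α , β) → ⊝ α , ⊝ β)

-- For the points p, q, w of {0, a, b}: the differences p - q, their doubles, and the 2p - q - w (all up to sign).
differences doubles middles : List Form
differences = let φs = (pos 1 , pos 0) ∷ (pos 0 , pos 1) ∷ (pos 1 , ⊝ pos 1) ∷ [] in φs ++ negated φs
doubles     = let φs = (pos 2 , pos 0) ∷ (pos 0 , pos 2) ∷ (pos 2 , ⊝ pos 2) ∷ [] in φs ++ negated φs
middles     = let φs = (pos 1 , pos 1) ∷ (pos 2 , ⊝ pos 1) ∷ (⊝ pos 1 , pos 2) ∷ [] in φs ++ negated φs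

-- Closure under relabelling makes the vanishing of some form of the list a property of the class of
-- a pair.
D₃-Closed : List Form → Set
D₃-Closed φs = All (λ M → All (λ φ → φ ∘ᴹ M ∈ φs) φs) D₃

_≟ᶠ_ : (φ ψ : Form) → Dec (φ ≡ ψ)
_≟ᶠ_ = ≡-dec ℤ._≟_ ℤ._≟_

open DecMem _≟ᶠ_ using () renaming (_∈?_ to _∈ᶠ?_) public

D₃-closed? : ∀ φs → Dec (D₃-Closed φs)
D₃-closed? φs = All.all? (λ M → All.all? (λ φ → (φ ∘ᴹ M) ∈ᶠ? φs) φs) D₃

differences-closed : D₃-Closed differences
differences-closed = from-yes (D₃-closed? differences)

doubles-closed : D₃-Closed doubles
doubles-closed = from-yes (D₃-closed? doubles)

middles-closed : D₃-Closed middles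
middles-closed = from-yes (D₃-closed? middles)

-- Up to sign, every form of the list is κ t + t′ in the coordinates (t, t′) given by some matrix of
-- D₃. So the list is one relation up to relabelling, and its vanishing determines a single class.
Moves : ℤ → List Form → Set
Moves κ φs = All (λ φ → Any.Any (λ M → φ ≡ (κ , pos 1) ∘ᴹ M ⊎ φ ≡ (⊝ κ , ⊝ pos 1) ∘ᴹ M) D₃) φs

moves? : ∀ κ φs → Dec (Moves κ φs)
moves? κ φs = All.all? (λ φ → Any.any? (λ M → (φ ≟ᶠ ((κ , pos 1) ∘ᴹ M)) ⊎-dec (φ ≟ᶠ ((⊝ κ , ⊝ pos 1) ∘ᴹ M))) D₃) φs

middles-moves : Moves (pos 1) middles
middles-moves = from-yes (moves? (pos 1) middles)

module BadClasses (v : ℕ) .{{_ : NonZero v}} (4<v : 4 < v) where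
  open Classes v
  open FiniteAction action using (xs-unique)

  Singular : List Form → ℤ × ℤ → Set
  Singular φs p = Any.Any (λ φ → eval φ p ≈ pos 0) φs

  singular-intro : ∀ {φs φ p} → φ ∈ φs → eval φ p ≈ pos 0 → Singular φs p
  singular-intro φ∈ e = Any.map (λ { refl → e }) φ∈

  singular-cong : ∀ {φs p q} → p ≋ q → Singular φs p → Singular φs q
  singular-cong e = Any.map (λ {φ} z → ≈-trans (eval-cong φ (≋-sym e)) z)

  -- If u M x = y and φ vanishes at y, then φ composed with M, which is again in the list, vanishes
  -- at x once u is cancelled.
  singular-∼ : ∀ {φs} → D₃-Closed φs → ∀ {x y} → x ∼ y → Singular φs (vals y) → Singular φs (vals x)
  singular-∼ {φs} closed {x} {y} x∼y s =
    let ((u , M) , g∈ , eq) = ∼-elim x∼y ; (φ , φ∈ , z) = find s ; (c , M∈) = ∈-scalars⁻ g∈ in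
    singular-intro (All.lookup (All.lookup closed M∈) φ∈)
      (subst (_≈ pos 0) (eval-∘ φ M (vals x)) (unit-cancel (val u) c
        (subst₂ _≈_ (eval-• φ (val u) (apply M (vals x))) (sym (ℤP.*-zeroʳ (val u)))
          (≈-trans (eval-cong φ (actOn-≡⁻ u M x y eq)) z))))

  singular-elim : ∀ {φs p} → Singular φs p → Any.Any (λ φ → proj₁ φ ⊗ proj₁ p ⊕ proj₂ φ ⊗ proj₂ p ≈ pos 0) φs
  singular-elim {φs} {p} = Any.map (λ {φ} z → subst (_≈ pos 0) (eval-≡ φ p) z)

  -- This says that the six differences of {0, a, b} are distinct: p - q = q - p is a vanishing
  -- double, p - q = w - p a vanishing middle, and a vanishing difference also makes its double
  -- vanish.
  Good : ℤ × ℤ → Set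
  Good p = ¬ Singular doubles p × ¬ Singular middles p

  good? : ∀ p → Dec (Good p)
  good? p = ¬? (singular? doubles) ×-dec ¬? (singular? middles)
    where
    singular? : ∀ φs → Dec (Singular φs p)
    singular? = Any.any? (λ φ → eval φ p ≈? pos 0)

  ¬good⇒singular : ∀ p → ¬ Good p → Singular doubles p ⊎ Singular middles p
  ¬good⇒singular p ¬g with Any.any? (λ φ → eval φ p ≈? pos 0) doubles | Any.any? (λ φ → eval φ p ≈? pos 0) middles
  ... | yes s | _     = inj₁ s
  ... | no _  | yes s = inj₂ s
  ... | no ¬s | no ¬t = contradiction (¬s , ¬t) ¬g

  good-∼ : ∀ {x y} → x ∼ y → Good (vals x) → Good (vals y)
  good-∼ x∼y (g , h) = g ∘ singular-∼ doubles-closed x∼y , h ∘ singular-∼ middles-closed x∼y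

  goodReps : List Pair
  goodReps = filter (good? ∘ vals) orbitReps

  -- Every orbit representative is either good or equivalent to exactly one member of `es`, never
  -- both, so the two indicators add up to 1. Each member of `es` is in turn met by exactly one
  -- representative.
  goodReps-count : ∀ es → Unique es → (∀ {e} → e ∈ es → e ∈ primitives) →
    (∀ {e} → e ∈ es → ¬ Good (vals e)) → (∀ {e e′} → e ∈ es → e′ ∈ es → e ∼ e′ → e ≡ e′) →
    (∀ {x} → x ∈ primitives → ¬ Good (vals x) → ∃ λ e → e ∈ es × x ∼ e) →
    length goodReps + length es ≡ length orbitReps
  goodReps-count es es-unique es⊆ es-bad es-inequivalent classify =
    assemble (length-filter (good? ∘ vals) orbitReps) (∑-+ orbitReps good represented) total swapped (∑-1 es) (∑-1 orbitReps)
    where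
    good represented : Pair → ℕ
    good r        = 𝟙 (good? (vals r))
    represented r = ∑ es (λ e → 𝟙 (r ∼? e))
    each : ∀ r → r ∈ primitives → good r + represented r ≡ 1
    each r r∈ with good? (vals r)
    ... | yes g = cong suc (∑-zero es (λ e e∈ → 𝟙-no (r ∼? e) (λ r∼e → es-bad e∈ (good-∼ r∼e g))))
    ... | no ¬g with classify r∈ ¬g
    ...   | e , e∈ , r∼e = ∑-𝟙-single (r ∼?_) es-unique e∈ r∼e
              (λ e′∈ r∼e′ → es-inequivalent e′∈ e∈ (∼-trans (es⊆ e′∈) (∼-sym r∈ r∼e′) r∼e))
    total : ∑ orbitReps (λ r → good r + represented r) ≡ ∑ orbitReps (λ _ → 1)
    total = ∑-cong∈ orbitReps (λ r r∈ → each r (orbitReps⊆ r∈))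
    swapped : ∑ orbitReps represented ≡ ∑ es (λ _ → 1)
    swapped = trans (∑-swap orbitReps es (λ r e → 𝟙 (r ∼? e))) (∑-cong∈ es (λ e e∈ → ∑-orbitReps (es⊆ e∈)))
    assemble : ∀ {g G t c b s o n : ℕ} → g ≡ G → t ≡ G + b → t ≡ o → b ≡ s → s ≡ c → o ≡ n → g + c ≡ n
    assemble refl refl refl refl refl refl = refl

  ∼-normalise : ∀ {x M} p w → M ∈ D₃ → Unit w → apply M (vals x) ≋ w • p → x ∼ resPair p
  ∼-normalise {x} {M} p w M∈ c e = ∼-intro (∈-scalars⁺ (λ {d} → unit-res {recipᵛ w} (unit-recipᵛ w c) {d}) M∈)
    (resPair-cong (≋-trans (•-cong (val-res (recipᵛ w)) e) (≋-trans (≋-reflexive (sym (•-• (recipᵛ w) w p)))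
      (≋-trans (•-cong (≈-trans (≈-reflexive (ℤP.*-comm (recipᵛ w) w)) (⊗-recipᵛ w c)) (≋-reflexive refl)) (≋-reflexive (1-• p))))))

  pos≉0 : ∀ {n} → 0 < n → n < v → ¬ pos n ≈ pos 0
  pos≉0 {n} 0<n n<v (by d) = ℕP.<⇒≢ 0<n (sym (∣-<⇒≡ n<v (ℕP.≤-trans (s≤s z≤n) 4<v) d))

  -- `E₀` stands for lines with two coinciding points. `E₁` gives the progression {0, 1, -1}, which
  -- shares two points with its translate by 1.
  E₀ E₁ : Pair
  E₀ = resPair (pos 0 , pos 1)
  E₁ = resPair (pos 1 , ⊝ pos 1)

  E₀∈ : E₀ ∈ primitives
  E₀∈ = ∈-primitives⁺ (generates-cong (≋-sym (vals-res (pos 0 , pos 1))) (generates-intro (pos 0) (pos 1) (pos 0 , pos 1) ≈-refl))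

  E₁∈ : E₁ ∈ primitives
  E₁∈ = ∈-primitives⁺ (generates-cong (≋-sym (vals-res (pos 1 , ⊝ pos 1))) (generates-intro (pos 1) (pos 0) (pos 1 , ⊝ pos 1) ≈-refl))

  E₀-singular : ∀ {φs} α → (α , pos 0) ∈ φs → Singular φs (vals E₀)
  E₀-singular α m = singular-cong (≋-sym (vals-res (pos 0 , pos 1)))
    (singular-intro m (≈-reflexive (trans (eval-≡ (α , pos 0) (pos 0 , pos 1)) (l α))))
    where
    l : ∀ α → α ⊗ pos 0 ⊕ pos 0 ⊗ pos 1 ≡ pos 0
    l = ℤ-Solver.solve-∀

  E₁-singular : Singular middles (vals E₁)
  E₁-singular = singular-cong (≋-sym (vals-res (pos 1 , ⊝ pos 1))) (here (≈-reflexive (eval-≡ (pos 1 , pos 1) (pos 1 , ⊝ pos 1))))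

  -- A difference of `E₀` vanishes, whereas those of `E₁` are 1 and 2 up to sign.
  E₁≁E₀ : ¬ E₁ ∼ E₀
  E₁≁E₀ r = cases (singular-elim {differences} {pos 1 , ⊝ pos 1}
      (singular-cong (vals-res (pos 1 , ⊝ pos 1)) (singular-∼ differences-closed r (E₀-singular (pos 1) (here refl)))))
    where
    1≉0 : ¬ pos 1 ≈ pos 0
    1≉0 = pos≉0 {1} (s≤s z≤n) (ℕP.≤-trans (s≤s (s≤s z≤n)) 4<v)
    2≉0 : ¬ pos 2 ≈ pos 0
    2≉0 = pos≉0 {2} (s≤s z≤n) (ℕP.≤-trans (s≤s (s≤s (s≤s z≤n))) 4<v)
    negative : ∀ {x} → ⊝ x ≈ pos 0 → x ≈ pos 0
    negative {x} z = combine₁ (⊝ pos 1) z (l x)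
      where
      l : ∀ x → x ⊖ pos 0 ≡ (⊝ pos 1) ⊗ (⊝ x ⊖ pos 0)
      l = ℤ-Solver.solve-∀
    cases : ¬ Any.Any (λ φ → proj₁ φ ⊗ pos 1 ⊕ proj₂ φ ⊗ (⊝ pos 1) ≈ pos 0) differences
    cases (here z)                                          = 1≉0 z
    cases (there (here z))                                  = 1≉0 (negative {pos 1} z)
    cases (there (there (here z)))                          = 2≉0 z
    cases (there (there (there (here z))))                  = 1≉0 (negative {pos 1} z)
    cases (there (there (there (there (here z)))))          = 1≉0 z
    cases (there (there (there (there (there (here z))))))  = 2≉0 (negative {pos 2} z)

  -- The second coordinate of the normalised pair is forced by the relation κ t + t′ = 0.
  singular⇒∼ : ∀ κ {φs} → Moves κ φs → ∀ {x} → Generates (vals x) → Singular φs (vals x) → x ∼ resPair (pos 1 , ⊝ κ)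
  singular⇒∼ κ moves {x} g s = let (φ , φ∈ , z) = find s ; (M , M∈ , φ≡) = find (All.lookup moves φ∈) in conclude φ z M M∈ φ≡
    where
    l : ∀ κ t t′ → t′ ⊖ t ⊗ (⊝ κ) ≡ pos 1 ⊗ (κ ⊗ t ⊕ pos 1 ⊗ t′ ⊖ pos 0)
    l = ℤ-Solver.solve-∀
    l₂ : ∀ κ t t′ → κ ⊗ t ⊕ pos 1 ⊗ t′ ⊖ pos 0 ≡ (⊝ pos 1) ⊗ ((⊝ κ) ⊗ t ⊕ (⊝ pos 1) ⊗ t′ ⊖ pos 0)
    l₂ = ℤ-Solver.solve-∀
    l₃ : ∀ κ s s′ t t′ → t ⊗ (s ⊖ s′ ⊗ κ) ⊖ pos 1 ≡ pos 1 ⊗ (s ⊗ t ⊕ s′ ⊗ t′ ⊖ pos 1) ⊕ (⊝ s′) ⊗ (κ ⊗ t ⊕ pos 1 ⊗ t′ ⊖ pos 0)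
    l₃ = ℤ-Solver.solve-∀
    conclude : ∀ φ → eval φ (vals x) ≈ pos 0 → ∀ M → M ∈ D₃ →
               φ ≡ (κ , pos 1) ∘ᴹ M ⊎ φ ≡ (⊝ κ , ⊝ pos 1) ∘ᴹ M → x ∼ resPair (pos 1 , ⊝ κ)
    conclude φ z M M∈ φ≡ = ∼-normalise (pos 1 , ⊝ κ) t M∈ c
        (subst (apply M (vals x) ≋_) (sym (•-≡ t (pos 1 , ⊝ κ)))
          (pair (≈-reflexive (sym (ℤP.*-identityʳ t))) (combine₁ (pos 1) e (l κ t t′))))
      where
      t  = proj₁ (apply M (vals x))
      t′ = proj₂ (apply M (vals x))
      unfold : ∀ ψ → φ ≡ ψ ∘ᴹ M → proj₁ ψ ⊗ t ⊕ proj₂ ψ ⊗ t′ ≈ pos 0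
      unfold ψ eq = subst (_≈ pos 0) (trans (cong (λ χ → eval χ (vals x)) eq) (trans (sym (eval-∘ ψ M (vals x))) (eval-≡ ψ (apply M (vals x))))) z
      e : κ ⊗ t ⊕ pos 1 ⊗ t′ ≈ pos 0
      e = [ unfold (κ , pos 1) , (λ eq → combine₁ (⊝ pos 1) (unfold (⊝ κ , ⊝ pos 1) eq) (l₂ κ t t′)) ]′ φ≡
      c : Unit t
      c = let (s , s′ , eq) = generates-elim (apply M (vals x)) (generates-apply (vals x) M∈ g) in
          unit-intro t (s ⊖ s′ ⊗ κ) (combine₂ (pos 1) (⊝ s′) eq e (l₃ κ s s′ t t′))

  middle⇒E₁ : ∀ {x} → Generates (vals x) → Singular middles (vals x) → x ∼ E₁
  middle⇒E₁ = singular⇒∼ (pos 1) middles-moves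

  -- If the first coordinate is 0, the second one generates ℤ/v by itself, so it is a unit and can
  -- be scaled to 1.
  first-zero⇒E₀ : ∀ {x M} → M ∈ D₃ → Generates (vals x) → proj₁ (apply M (vals x)) ≈ pos 0 → x ∼ E₀
  first-zero⇒E₀ {x} {M} M∈ g e = ∼-normalise (pos 0 , pos 1) t′ M∈ (λ {d} → c {d})
    (subst (apply M (vals x) ≋_) (sym (•-≡ t′ (pos 0 , pos 1)))
      (pair (≈-trans e (≈-reflexive (sym (ℤP.*-zeroʳ t′)))) (≈-reflexive (sym (ℤP.*-identityʳ t′)))))
    where
    t  = proj₁ (apply M (vals x))
    t′ = proj₂ (apply M (vals x))
    l : ∀ s s′ t t′ → t′ ⊗ s′ ⊖ pos 1 ≡ pos 1 ⊗ (s ⊗ t ⊕ s′ ⊗ t′ ⊖ pos 1) ⊕ (⊝ s) ⊗ (t ⊖ pos 0)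
    l = ℤ-Solver.solve-∀
    c : Unit t′
    c = let (s , s′ , eq) = generates-elim (apply M (vals x)) (generates-apply (vals x) M∈ g) in
        unit-intro t′ s′ (combine₂ (pos 1) (⊝ s) eq e (l s s′ t t′))

  double⇒first : ∀ {x} → Singular doubles (vals x) → ∃ λ M → M ∈ D₃ × pos 2 ⊗ proj₁ (apply M (vals x)) ≈ pos 0
  double⇒first {x} s = let (φ , φ∈ , z) = find s ; (M , M∈ , φ≡) = find (All.lookup moves φ∈) in M , M∈ , conclude φ z M φ≡
    where
    moves : All (λ φ → Any.Any (λ M → φ ≡ (pos 2 , pos 0) ∘ᴹ M ⊎ φ ≡ (⊝ pos 2 , pos 0) ∘ᴹ M) D₃) doubles
    moves = from-yes (All.all? (λ φ → Any.any? (λ M → (φ ≟ᶠ ((pos 2 , pos 0) ∘ᴹ M)) ⊎-dec (φ ≟ᶠ ((⊝ pos 2 , pos 0) ∘ᴹ M))) D₃) doubles)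
    l₁ : ∀ t t′ → pos 2 ⊗ t ⊖ pos 0 ≡ pos 1 ⊗ (pos 2 ⊗ t ⊕ pos 0 ⊗ t′ ⊖ pos 0)
    l₁ = ℤ-Solver.solve-∀
    l₂ : ∀ t t′ → pos 2 ⊗ t ⊖ pos 0 ≡ (⊝ pos 1) ⊗ ((⊝ pos 2) ⊗ t ⊕ pos 0 ⊗ t′ ⊖ pos 0)
    l₂ = ℤ-Solver.solve-∀
    conclude : ∀ φ → eval φ (vals x) ≈ pos 0 → ∀ M → φ ≡ (pos 2 , pos 0) ∘ᴹ M ⊎ φ ≡ (⊝ pos 2 , pos 0) ∘ᴹ M →
               pos 2 ⊗ proj₁ (apply M (vals x)) ≈ pos 0
    conclude φ z M φ≡ =
      [ (λ eq → combine₁ (pos 1) (unfold (pos 2 , pos 0) eq) (l₁ t t′))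
      , (λ eq → combine₁ (⊝ pos 1) (unfold (⊝ pos 2 , pos 0) eq) (l₂ t t′)) ]′ φ≡
      where
      t  = proj₁ (apply M (vals x))
      t′ = proj₂ (apply M (vals x))
      unfold : ∀ ψ → φ ≡ ψ ∘ᴹ M → proj₁ ψ ⊗ t ⊕ proj₂ ψ ⊗ t′ ≈ pos 0
      unfold ψ eq = subst (_≈ pos 0) (trans (cong (λ χ → eval χ (vals x)) eq) (trans (sym (eval-∘ ψ M (vals x))) (eval-≡ ψ (apply M (vals x))))) z

  -- For odd v the number 2 is a unit, so a vanishing double is a vanishing difference and leads to
  -- `E₀`.
  goodReps-odd : ¬ 2 ∣ v → length goodReps + 2 ≡ length orbitReps
  goodReps-odd 2∤v = goodReps-count (E₁ ∷ E₀ ∷ []) (((λ eq → E₁≁E₀ (subst (E₁ ∼_) eq (∼-refl E₁∈))) ∷ []) ∷ [] ∷ [])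
    (λ { (here refl) → E₁∈ ; (there (here refl)) → E₀∈ })
    (λ { (here refl) (_ , h) → h E₁-singular ; (there (here refl)) (g , _) → g (E₀-singular (pos 2) (here refl)) })
    (λ { (here refl) (here refl) _ → refl
       ; (here refl) (there (here refl)) r → contradiction r E₁≁E₀
       ; (there (here refl)) (here refl) r → contradiction (∼-sym E₀∈ r) E₁≁E₀
       ; (there (here refl)) (there (here refl)) _ → refl })
    classify
    where
    classify : ∀ {x} → x ∈ primitives → ¬ Good (vals x) → ∃ λ e → e ∈ E₁ ∷ E₀ ∷ [] × x ∼ e
    classify {x} x∈ bad = [ by-double , (λ s → E₁ , here refl , middle⇒E₁ (∈-primitives⁻ x∈) s) ]′ (¬good⇒singular (vals x) bad)
      where
      by-double : Singular doubles (vals x) → ∃ λ e → e ∈ E₁ ∷ E₀ ∷ [] × x ∼ e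
      by-double s = let (M , M∈ , e) = double⇒first s in E₀ , there (here refl) , first-zero⇒E₀ M∈ (∈-primitives⁻ x∈)
        (unit-cancel (pos 2) (Coprimality.sym (prime-coprime Primality.prime[2] 2∤v)) e)

module EvenBadClasses (v : ℕ) .{{_ : NonZero v}} (4<v : 4 < v) (h : ℕ) (v≡2h : v ≡ 2 * h) where
  open Classes v
  open BadClasses v 4<v

  private
    H : ℤ
    H = pos h

    V≡ : pos v ≡ pos 2 ⊗ H
    V≡ = trans (cong pos v≡2h) (ℤP.pos-* 2 h)

    2H≈0 : pos 2 ⊗ H ≈ pos 0
    2H≈0 = subst (_≈ pos 0) V≡ modulus≈0

    3≤h : 3 ≤ h
    3≤h = ℕP.≰⇒> (λ h≤2 → ℕP.<⇒≱ 4<v (subst (_≤ 4) (sym v≡2h) (ℕP.*-monoʳ-≤ 2 h≤2)))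

    below : ∀ {n} → n ≤ h + 1 → n < v
    below {n} n≤ = ℕP.≤-trans (s≤s n≤) (subst (suc (h + 1) ≤_) (sym v≡2h)
      (subst (_≤ 2 * h) (ℕP.+-suc h 1) (ℕP.+-monoʳ-≤ h (ℕP.≤-trans (ℕP.≤-trans (s≤s (s≤s z≤n)) 3≤h) (ℕP.≤-reflexive (sym (ℕP.+-identityʳ h)))))))

  -- The line contains 0 and h = v/2, and so does its translate by h: the double of h vanishes
  -- although h does not.
  E₂ : Pair
  E₂ = resPair (H , pos 1)

  E₂∈ : E₂ ∈ primitives
  E₂∈ = ∈-primitives⁺ (generates-cong (≋-sym (vals-res (H , pos 1)))
    (generates-intro (pos 0) (pos 1) (H , pos 1) (≈-reflexive (l H))))
    where
    l : ∀ h → pos 0 ⊗ h ⊕ pos 1 ⊗ pos 1 ≡ pos 1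
    l = ℤ-Solver.solve-∀

  E₂-singular : Singular doubles (vals E₂)
  E₂-singular = singular-cong (≋-sym (vals-res (H , pos 1))) (here (combine₁ (pos 1) 2H≈0 (trans (cong (_⊖ pos 0) (eval-≡ (pos 2 , pos 0) (H , pos 1))) (l H))))
    where
    l : ∀ h → pos 2 ⊗ h ⊕ pos 0 ⊗ pos 1 ⊖ pos 0 ≡ pos 1 ⊗ (pos 2 ⊗ h ⊖ pos 0)
    l = ℤ-Solver.solve-∀

  private
    h-k : ∀ k → k ≤ 2 → ¬ H ⊖ pos k ≈ pos 0
    h-k k k≤2 e = pos≉0 {h ∸ k} (ℕP.m<n⇒0<n∸m (ℕP.≤-trans (s≤s k≤2) 3≤h)) (below (ℕP.≤-trans (ℕP.m∸n≤m h k) (ℕP.m≤m+n h 1)))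
      (≈-trans (≈-reflexive (sym (trans (ℤP.m-n≡m⊖n h k) (ℤP.⊖-≥ (ℕP.≤-trans k≤2 (ℕP.≤-trans (s≤s (s≤s z≤n)) 3≤h)))))) e)

    1≉0 : ¬ pos 1 ≈ pos 0
    1≉0 = pos≉0 (s≤s z≤n) (ℕP.≤-trans (s≤s (s≤s z≤n)) 4<v)

    h+1≉0 : ¬ H ⊕ pos 1 ≈ pos 0
    h+1≉0 = pos≉0 {h + 1} (ℕP.m≤n+m 1 h) (below ℕP.≤-refl)

    h≉0 : ¬ H ⊖ pos 0 ≈ pos 0
    h≉0 = h-k 0 z≤n

  -- Up to sign, the differences of `E₂` are h, 1 and h - 1, all nonzero since h ≥ 3.
  E₂≁E₀ : ¬ E₂ ∼ E₀
  E₂≁E₀ r = cases (singular-elim (singular-cong (vals-res (H , pos 1)) (singular-∼ differences-closed r (E₀-singular (pos 1) (here refl)))))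
    where
    l₀ : ∀ h → h ⊖ pos 0 ⊖ pos 0 ≡ pos 1 ⊗ (pos 1 ⊗ h ⊕ pos 0 ⊗ pos 1 ⊖ pos 0)
    l₀ = ℤ-Solver.solve-∀
    l₁ : ∀ h → pos 1 ⊖ pos 0 ≡ pos 1 ⊗ (pos 0 ⊗ h ⊕ pos 1 ⊗ pos 1 ⊖ pos 0)
    l₁ = ℤ-Solver.solve-∀
    l₂ : ∀ h → h ⊖ pos 1 ⊖ pos 0 ≡ pos 1 ⊗ (pos 1 ⊗ h ⊕ (⊝ pos 1) ⊗ pos 1 ⊖ pos 0)
    l₂ = ℤ-Solver.solve-∀
    l₃ : ∀ h → h ⊖ pos 0 ⊖ pos 0 ≡ (⊝ pos 1) ⊗ ((⊝ pos 1) ⊗ h ⊕ pos 0 ⊗ pos 1 ⊖ pos 0)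
    l₃ = ℤ-Solver.solve-∀
    l₄ : ∀ h → pos 1 ⊖ pos 0 ≡ (⊝ pos 1) ⊗ (pos 0 ⊗ h ⊕ (⊝ pos 1) ⊗ pos 1 ⊖ pos 0)
    l₄ = ℤ-Solver.solve-∀
    l₅ : ∀ h → h ⊖ pos 1 ⊖ pos 0 ≡ (⊝ pos 1) ⊗ ((⊝ pos 1) ⊗ h ⊕ pos 1 ⊗ pos 1 ⊖ pos 0)
    l₅ = ℤ-Solver.solve-∀
    cases : ¬ Any.Any (λ φ → proj₁ φ ⊗ H ⊕ proj₂ φ ⊗ pos 1 ≈ pos 0) differences
    cases (here z)                                          = h≉0 (combine₁ (pos 1) z (l₀ H))
    cases (there (here z))                                  = 1≉0 (combine₁ (pos 1) z (l₁ H))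
    cases (there (there (here z)))                          = h-k 1 (s≤s z≤n) (combine₁ (pos 1) z (l₂ H))
    cases (there (there (there (here z))))                  = h≉0 (combine₁ (⊝ pos 1) z (l₃ H))
    cases (there (there (there (there (here z)))))          = 1≉0 (combine₁ (⊝ pos 1) z (l₄ H))
    cases (there (there (there (there (there (here z))))))  = h-k 1 (s≤s z≤n) (combine₁ (⊝ pos 1) z (l₅ H))

  -- Up to sign, the middles of `E₂` are h + 1, 2h - 1 = -1 and h - 2. The last of them is why h ≥
  -- 3, and hence v > 4, matters.
  E₂≁E₁ : ¬ E₂ ∼ E₁
  E₂≁E₁ r = cases (singular-elim (singular-cong (vals-res (H , pos 1)) (singular-∼ middles-closed r E₁-singular)))
    where
    l₀ : ∀ h → h ⊕ pos 1 ⊖ pos 0 ≡ pos 1 ⊗ (pos 1 ⊗ h ⊕ pos 1 ⊗ pos 1 ⊖ pos 0)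
    l₀ = ℤ-Solver.solve-∀
    l₁ : ∀ h → pos 1 ⊖ pos 0 ≡ (⊝ pos 1) ⊗ (pos 2 ⊗ h ⊕ (⊝ pos 1) ⊗ pos 1 ⊖ pos 0) ⊕ pos 1 ⊗ (pos 2 ⊗ h ⊖ pos 0)
    l₁ = ℤ-Solver.solve-∀
    l₂ : ∀ h → h ⊖ pos 2 ⊖ pos 0 ≡ (⊝ pos 1) ⊗ ((⊝ pos 1) ⊗ h ⊕ pos 2 ⊗ pos 1 ⊖ pos 0)
    l₂ = ℤ-Solver.solve-∀
    l₃ : ∀ h → h ⊕ pos 1 ⊖ pos 0 ≡ (⊝ pos 1) ⊗ ((⊝ pos 1) ⊗ h ⊕ (⊝ pos 1) ⊗ pos 1 ⊖ pos 0)
    l₃ = ℤ-Solver.solve-∀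
    l₄ : ∀ h → pos 1 ⊖ pos 0 ≡ pos 1 ⊗ ((⊝ pos 2) ⊗ h ⊕ pos 1 ⊗ pos 1 ⊖ pos 0) ⊕ pos 1 ⊗ (pos 2 ⊗ h ⊖ pos 0)
    l₄ = ℤ-Solver.solve-∀
    l₅ : ∀ h → h ⊖ pos 2 ⊖ pos 0 ≡ pos 1 ⊗ (pos 1 ⊗ h ⊕ (⊝ pos 2) ⊗ pos 1 ⊖ pos 0)
    l₅ = ℤ-Solver.solve-∀
    cases : ¬ Any.Any (λ φ → proj₁ φ ⊗ H ⊕ proj₂ φ ⊗ pos 1 ≈ pos 0) middles
    cases (here z)                                          = h+1≉0 (combine₁ (pos 1) z (l₀ H))
    cases (there (here z))                                  = 1≉0 (combine₂ (⊝ pos 1) (pos 1) z 2H≈0 (l₁ H))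
    cases (there (there (here z)))                          = h-k 2 ℕP.≤-refl (combine₁ (⊝ pos 1) z (l₂ H))
    cases (there (there (there (here z))))                  = h+1≉0 (combine₁ (⊝ pos 1) z (l₃ H))
    cases (there (there (there (there (here z)))))          = 1≉0 (combine₂ (pos 1) (pos 1) z 2H≈0 (l₄ H))
    cases (there (there (there (there (there (here z))))))  = h-k 2 ℕP.≤-refl (combine₁ (pos 1) z (l₅ H))

  private
    -- A common divisor of y and h divides every combination of them, hence 1; being odd as well, y
    -- is coprime to 2h = v.
    odd-unit : ∀ y → ¬ pos 2 ∣ᶻ y → Generates (H , y) → Unit y
    odd-unit y 2∤y g {d} = subst (Coprime ℤ.∣ y ∣) (sym v≡2h) (coprime-* (prime-coprime Primality.prime[2] (2∤y ∘ ∣⇒∣ᶻ)) coprime-h) {d}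
      where
      l : ∀ s t h y → pos 1 ≡ s ⊗ h ⊕ t ⊗ y ⊕ (⊝ pos 1) ⊗ (s ⊗ h ⊕ t ⊗ y ⊖ pos 1)
      l = ℤ-Solver.solve-∀
      coprime-h : Coprime ℤ.∣ y ∣ h
      coprime-h (d∣y , d∣h) with generates-elim (H , y) g
      ... | s , t , by p = Div.∣1⇒≡1 (∣ᶻ⇒∣ {x = pos 1} (∣-combine₃ s t (⊝ pos 1) (∣⇒∣ᶻ {x = H} d∣h) (∣⇒∣ᶻ {x = y} d∣y)
        (∣ᶻ-trans (Div.∣-trans d∣h (subst (h ∣_) (sym v≡2h) (Div.n∣m*n 2))) p) (l s t H y)))

    -- The difference (y - 1)h is a multiple of 2h = v.
    odd-*h : ∀ y → ¬ pos 2 ∣ᶻ y → H ≈ y ⊗ H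
    odd-*h y 2∤y with halves y
      where
      halves : ∀ y → pos 2 ∣ᶻ y ⊎ pos 2 ∣ᶻ (y ⊖ pos 1)
      halves y with y %ℕ 2 | ℤDivMod.n%ℕd<d y 2 | ℤDivMod.a≡a%ℕn+[a/ℕn]*n y 2
      ... | 0 | _ | e = inj₁ (dividesᶻ (y /ℕ 2) (trans e (ℤP.+-identityˡ _)))
      ... | 1 | _ | e = inj₂ (dividesᶻ (y /ℕ 2) (trans (cong (_⊖ pos 1) e) (l (y /ℕ 2))))
        where
        l : ∀ q → pos 1 ⊕ q ⊗ pos 2 ⊖ pos 1 ≡ q ⊗ pos 2
        l = ℤ-Solver.solve-∀
      ... | suc (suc _) | s≤s (s≤s ()) | _
    ... | inj₁ 2∣y = contradiction 2∣y 2∤y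
    ... | inj₂ (dividesᶻ c e) = combine₁ (⊝ c) 2H≈0 (trans (l y H) (trans (cong (λ z → (⊝ z) ⊗ H) e) (l₂ c H)))
      where
      l : ∀ y h → h ⊖ y ⊗ h ≡ (⊝ (y ⊖ pos 1)) ⊗ h
      l = ℤ-Solver.solve-∀
      l₂ : ∀ c h → (⊝ (c ⊗ pos 2)) ⊗ h ≡ (⊝ c) ⊗ (pos 2 ⊗ h ⊖ pos 0)
      l₂ = ℤ-Solver.solve-∀

    -- By primitivity, t′ and t′ - h are not both even, and an odd one is a unit.
    first-half⇒E₂ : ∀ {x M} → M ∈ D₃ → Generates (vals x) → proj₁ (apply M (vals x)) ≈ H → x ∼ E₂
    first-half⇒E₂ {x} {M} M∈ g e = cases (pos 2 ∣ᶻ? proj₂ (apply M (vals x)))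
     where
     cases : Dec (pos 2 ∣ᶻ proj₂ (apply M (vals x))) → x ∼ E₂
     cases (no 2∤t′) = ∼-normalise (H , pos 1) t′ M∈
            (odd-unit t′ 2∤t′ (generates-cong (pair e ≈-refl) (generates-apply (vals x) M∈ g)))
            (subst (apply M (vals x) ≋_) (sym (•-≡ t′ (H , pos 1)))
              (pair (≈-trans e (odd-*h t′ 2∤t′)) (≈-reflexive (sym (ℤP.*-identityʳ t′)))))
      where t′ = proj₂ (apply M (vals x))
     -- The matrix `flip · rot` takes (t, t′) to (-t, t′ - t), which for t = h is (h, t′ - h),
     -- because -h = h.
     cases (yes 2∣t′) = ∼-normalise (H , pos 1) w (·∈D₃ shear∈ M∈)
            (odd-unit w 2∤w gen)
            (subst₂ _≋_ (sym (trans (apply-· (flip · rot) M (vals x))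
                (cong₂ _,_ (eval-≡ (⊝ pos 1 , pos 0) (t , t′)) (eval-≡ (⊝ pos 1 , pos 1) (t , t′))))) (sym (•-≡ w (H , pos 1)))
              (pair (≈-trans eq₁ (odd-*h w 2∤w)) (≈-trans eq₂ (≈-reflexive (sym (ℤP.*-identityʳ w))))))
      where
      t  = proj₁ (apply M (vals x))
      t′ = proj₂ (apply M (vals x))
      w = t′ ⊖ H
      shear∈ : flip · rot ∈ D₃
      shear∈ = there (there (there (there (here refl))))
      l₁ : ∀ t t′ h → (⊝ pos 1) ⊗ t ⊕ pos 0 ⊗ t′ ⊖ h ≡ (⊝ pos 1) ⊗ (t ⊖ h) ⊕ (⊝ pos 1) ⊗ (pos 2 ⊗ h ⊖ pos 0)
      l₁ = ℤ-Solver.solve-∀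
      eq₁ : (⊝ pos 1) ⊗ t ⊕ pos 0 ⊗ t′ ≈ H
      eq₁ = combine₂ (⊝ pos 1) (⊝ pos 1) e 2H≈0 (l₁ t t′ H)
      l₂ : ∀ t t′ h → (⊝ pos 1) ⊗ t ⊕ pos 1 ⊗ t′ ⊖ (t′ ⊖ h) ≡ (⊝ pos 1) ⊗ (t ⊖ h)
      l₂ = ℤ-Solver.solve-∀
      eq₂ : (⊝ pos 1) ⊗ t ⊕ pos 1 ⊗ t′ ≈ w
      eq₂ = combine₁ (⊝ pos 1) e (l₂ t t′ H)
      gen : Generates (H , w)
      gen with generates-elim (apply M (vals x)) (generates-apply (vals x) M∈ g)
      ... | s , s′ , eq = generates-intro (s ⊕ s′) s′ (H , w) (combine₂ (pos 1) (⊝ s) eq e (l₃ s s′ t t′ H))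
        where
        l₃ : ∀ s s′ t t′ h → (s ⊕ s′) ⊗ h ⊕ s′ ⊗ (t′ ⊖ h) ⊖ pos 1 ≡ pos 1 ⊗ (s ⊗ t ⊕ s′ ⊗ t′ ⊖ pos 1) ⊕ (⊝ s) ⊗ (t ⊖ h)
        l₃ = ℤ-Solver.solve-∀
      2∤w : ¬ pos 2 ∣ᶻ w
      2∤w 2∣w with generates-elim (apply M (vals x)) (generates-apply (vals x) M∈ g)
      ... | s , s′ , by p = case Div.∣1⇒≡1 (∣ᶻ⇒∣ {x = pos 1} (∣-combine₃ (s ⊕ s′) (⊝ s) (pos 1) 2∣t′ 2∣w rest (l₃ s s′ t t′ H))) of λ ()
        where
        2∣v : 2 ∣ v
        2∣v = subst (2 ∣_) (sym v≡2h) (Div.m∣m*n h)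
        rest : pos 2 ∣ᶻ (s ⊗ (t ⊖ H) ⊖ (s ⊗ t ⊕ s′ ⊗ t′ ⊖ pos 1))
        rest = ∣-combine₂ s (⊝ pos 1) (∣ᶻ-trans 2∣v (∣-difference e)) (∣ᶻ-trans 2∣v p) (l₄ s (t ⊖ H) (s ⊗ t ⊕ s′ ⊗ t′ ⊖ pos 1))
          where
          l₄ : ∀ s x y → s ⊗ x ⊖ y ≡ s ⊗ x ⊕ (⊝ pos 1) ⊗ y
          l₄ = ℤ-Solver.solve-∀
        l₃ : ∀ s s′ t t′ h → pos 1 ≡ (s ⊕ s′) ⊗ t′ ⊕ (⊝ s) ⊗ (t′ ⊖ h) ⊕ pos 1 ⊗ (s ⊗ (t ⊖ h) ⊖ (s ⊗ t ⊕ s′ ⊗ t′ ⊖ pos 1))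
        l₃ = ℤ-Solver.solve-∀

    -- Cancelling 2 from 2h ∣ 2t shows that t is a multiple of h; the parity of the quotient decides
    -- between 0 and h.
    order-two : ∀ t → pos 2 ⊗ t ≈ pos 0 → t ≈ pos 0 ⊎ t ≈ H
    order-two t (by d) with ℤDiv.*-cancelˡ-∣ (pos 2) (subst₂ _∣ᶻ_ V≡ (ℤP.+-identityʳ (pos 2 ⊗ t)) d)
    ... | dividesᶻ c e with pos 2 ∣ᶻ? c
    ...   | yes (dividesᶻ c′ e′) = inj₁ (combine₁ c′ 2H≈0 (trans (cong (_⊖ pos 0) (trans e (cong (_⊗ H) e′))) (l c′ H)))
      where
      l : ∀ c h → c ⊗ pos 2 ⊗ h ⊖ pos 0 ≡ c ⊗ (pos 2 ⊗ h ⊖ pos 0)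
      l = ℤ-Solver.solve-∀
    ...   | no 2∤c = inj₂ (≈-trans (≈-reflexive e) (≈-sym (odd-*h c 2∤c)))

  goodReps-even : length goodReps + 3 ≡ length orbitReps
  goodReps-even = goodReps-count (E₂ ∷ E₁ ∷ E₀ ∷ [])
    (((λ eq → E₂≁E₁ (subst (E₂ ∼_) eq (∼-refl E₂∈))) ∷ (λ eq → E₂≁E₀ (subst (E₂ ∼_) eq (∼-refl E₂∈))) ∷ [])
      ∷ ((λ eq → E₁≁E₀ (subst (E₁ ∼_) eq (∼-refl E₁∈))) ∷ []) ∷ [] ∷ [])
    (λ { (here refl) → E₂∈ ; (there (here refl)) → E₁∈ ; (there (there (here refl))) → E₀∈ })
    (λ { (here refl) (g , _) → g E₂-singular
       ; (there (here refl)) (_ , h) → h E₁-singular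
       ; (there (there (here refl))) (g , _) → g (E₀-singular (pos 2) (here refl)) })
    (λ { (here refl) (here refl) _ → refl
       ; (here refl) (there (here refl)) r → contradiction r E₂≁E₁
       ; (here refl) (there (there (here refl))) r → contradiction r E₂≁E₀
       ; (there (here refl)) (here refl) r → contradiction (∼-sym E₁∈ r) E₂≁E₁
       ; (there (here refl)) (there (here refl)) _ → refl
       ; (there (here refl)) (there (there (here refl))) r → contradiction r E₁≁E₀
       ; (there (there (here refl))) (here refl) r → contradiction (∼-sym E₀∈ r) E₂≁E₀
       ; (there (there (here refl))) (there (here refl)) r → contradiction (∼-sym E₀∈ r) E₁≁E₀
       ; (there (there (here refl))) (there (there (here refl))) _ → refl })
    classify
    where
    classify : ∀ {x} → x ∈ primitives → ¬ Good (vals x) → ∃ λ e → e ∈ E₂ ∷ E₁ ∷ E₀ ∷ [] × x ∼ e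
    classify {x} x∈ bad = [ by-double , (λ s → E₁ , there (here refl) , middle⇒E₁ (∈-primitives⁻ x∈) s) ]′ (¬good⇒singular (vals x) bad)
      where
      by-double : Singular doubles (vals x) → ∃ λ e → e ∈ E₂ ∷ E₁ ∷ E₀ ∷ [] × x ∼ e
      by-double s = let (M , M∈ , e) = double⇒first s in
        [ (λ z → E₀ , there (there (here refl)) , first-zero⇒E₀ M∈ (∈-primitives⁻ x∈) z)
        , (λ z → E₂ , here refl , first-half⇒E₂ M∈ (∈-primitives⁻ x∈) z) ]′ (order-two (proj₁ (apply M (vals x))) e)

-- Configurations and their isomorphisms

infix 4 _∈ˢ_ _∈ˢ?_

_∈ˢ_ : ∀ {n} → Fin n → Subset n → Set
_∈ˢ_ = Sub._∈_

_∈ˢ?_ : ∀ {n} (x : Fin n) (s : Subset n) → Dec (x ∈ˢ s)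
_∈ˢ?_ = SubP._∈?_

elements : ∀ {n} → Subset n → List (Fin n)
elements {n} s = filter (_∈ˢ? s) (allFin n)

∈-elements⁺ : ∀ {n} {s : Subset n} {x} → x ∈ˢ s → x ∈ elements s
∈-elements⁺ {s = s} {x} x∈ = Mem.∈-filter⁺ (_∈ˢ? s) (Mem.∈-allFin x) x∈

∈-elements⁻ : ∀ {n} {s : Subset n} {x} → x ∈ elements s → x ∈ˢ s
∈-elements⁻ {n} {s} x∈ = proj₂ (Mem.∈-filter⁻ (_∈ˢ? s) {xs = allFin n} x∈)

elements-unique : ∀ {n} (s : Subset n) → Unique (elements s)
elements-unique {n} s = Uniq.filter⁺ (_∈ˢ? s) (Uniq.allFin⁺ n)

card≡length : ∀ {n} (s : Subset n) → card s ≡ length (elements s)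
card≡length {n} s = trans (count s) (sym (length-filter (_∈ˢ? s) (allFin n)))
  where
  ∑-tabulate : ∀ {m} {A : Set} (g : Fin m → A) f → ∑ (Data.List.tabulate g) f ≡ ∑ (allFin m) (f ∘ g)
  ∑-tabulate {zero}  g f = refl
  ∑-tabulate {suc m} g f = cong (f (g Fin.zero) +_)
    (trans (∑-tabulate (g ∘ Fin.suc) f) (sym (∑-tabulate Fin.suc (f ∘ g))))
  tail : ∀ {m} b (s : Subset m) → ∑ (Data.List.tabulate Fin.suc) (λ x → 𝟙 (x ∈ˢ? (b Vec.∷ s))) ≡ ∑ (allFin m) (λ x → 𝟙 (x ∈ˢ? s))
  tail {m} b s = trans (∑-tabulate {m} Fin.suc (λ x → 𝟙 (x ∈ˢ? (b Vec.∷ s))))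
    (∑-cong (allFin m) (λ x → 𝟙-cong (Fin.suc x ∈ˢ? (b Vec.∷ s)) (x ∈ˢ? s) SubP.drop-there Vec.there))
  count : ∀ {m} (s : Subset m) → card s ≡ ∑ (allFin m) (λ x → 𝟙 (x ∈ˢ? s))
  count Vec.[]           = refl
  count (true Vec.∷ s)   = cong suc (trans (count s) (sym (tail true s)))
  count (false Vec.∷ s)  = trans (count s) (sym (tail false s))

⟪_⟫ : ∀ {n} {P : Fin n → Set} → (∀ x → Dec (P x)) → Subset n
⟪ P? ⟫ = Vec.tabulate (λ x → does (P? x))

∈-⟪⟫⁺ : ∀ {n} {P : Fin n → Set} (P? : ∀ x → Dec (P x)) {x} → P x → x ∈ˢ ⟪ P? ⟫
∈-⟪⟫⁺ P? {x} px = VecP.lookup⇒[]= x _ (trans (VecP.lookup∘tabulate _ x) (dec-true (P? x) px))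

∈-⟪⟫⁻ : ∀ {n} {P : Fin n → Set} (P? : ∀ x → Dec (P x)) {x} → x ∈ˢ ⟪ P? ⟫ → P x
∈-⟪⟫⁻ P? {x} x∈ = toWitness′ (P? x) (trans (sym (VecP.lookup∘tabulate _ x)) (VecP.[]=⇒lookup x∈))
  where
  toWitness′ : ∀ {Q : Set} (q : Dec Q) → does q ≡ true → Q
  toWitness′ (yes q) _ = q

module _ {n} (σ : Permutation′ n) where

  ∈-image⁺ : ∀ {s x} → x ∈ˢ s → (σ ⟨$⟩ʳ x) ∈ˢ image σ s
  ∈-image⁺ {s} {x} x∈ = VecP.lookup⇒[]= (σ ⟨$⟩ʳ x) _ (trans (VecP.lookup∘tabulate _ (σ ⟨$⟩ʳ x))
    (trans (cong (Vec.lookup s) (inverseˡ σ)) (VecP.[]=⇒lookup x∈)))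

  ∈-image⁻ : ∀ {s y} → y ∈ˢ image σ s → (σ ⟨$⟩ˡ y) ∈ˢ s
  ∈-image⁻ {s} {y} y∈ = VecP.lookup⇒[]= (σ ⟨$⟩ˡ y) s (trans (sym (VecP.lookup∘tabulate _ y)) (VecP.[]=⇒lookup y∈))

  image-≡ : ∀ {s t} → (∀ {x} → x ∈ˢ s → (σ ⟨$⟩ʳ x) ∈ˢ t) → (∀ {x} → (σ ⟨$⟩ʳ x) ∈ˢ t → x ∈ˢ s) → image σ s ≡ t
  image-≡ {s} {t} to from = SubP.⊆-antisym
    (λ {y} y∈ → subst (_∈ˢ t) (inverseʳ σ) (to (∈-image⁻ y∈)))
    (λ {y} y∈ → subst (_∈ˢ image σ s) (inverseʳ σ) (∈-image⁺ (from (subst (_∈ˢ t) (sym (inverseʳ σ)) y∈))))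

  image-≡⁺ : ∀ {s t} → image σ s ≡ t → ∀ {x} → x ∈ˢ s → (σ ⟨$⟩ʳ x) ∈ˢ t
  image-≡⁺ refl = ∈-image⁺

  image-≡⁻ : ∀ {s t} → image σ s ≡ t → ∀ {x} → (σ ⟨$⟩ʳ x) ∈ˢ t → x ∈ˢ s
  image-≡⁻ {s} refl x∈ = subst (_∈ˢ s) (inverseˡ σ) (∈-image⁻ x∈)

image-flip : ∀ {n} (σ : Permutation′ n) {s t} → image σ s ≡ t → image (FinPerm.flip σ) t ≡ s
image-flip σ {s} {t} eq = image-≡ (FinPerm.flip σ)
  (λ y∈ → image-≡⁻ σ eq (subst (_∈ˢ t) (sym (inverseʳ σ)) y∈))
  (λ y∈ → subst (_∈ˢ t) (inverseʳ σ) (image-≡⁺ σ eq y∈))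

image-∘ : ∀ {n} (σ ρ : Permutation′ n) {s t u} → image σ s ≡ t → image ρ t ≡ u → image (σ FinPerm.∘ₚ ρ) s ≡ u
image-∘ σ ρ {s} {t} {u} eq eq′ = image-≡ (σ FinPerm.∘ₚ ρ) {s} {u}
  (image-≡⁺ ρ {t} eq′ ∘ image-≡⁺ σ {s} eq) (image-≡⁻ σ {s} eq ∘ image-≡⁻ ρ {t} eq′)

isomorphic-sym : ∀ {v} {C D : Config v} → Isomorphic C D → Isomorphic D C
isomorphic-sym (σ , f , g) = FinPerm.flip σ ,
  (λ j → let (i , eq) = g j in i , image-flip σ eq) , (λ i → let (j , eq) = f i in j , image-flip σ eq)

isomorphic-trans : ∀ {v} {C D E : Config v} → Isomorphic C D → Isomorphic D E → Isomorphic C E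
isomorphic-trans {C = C} (σ , f , g) (ρ , f′ , g′) = σ FinPerm.∘ₚ ρ ,
  (λ i → let (j , eq) = f i ; (k , eq′) = f′ j in k , image-∘ σ ρ {line C i} eq eq′) ,
  (λ k → let (j , eq′) = g′ k ; (i , eq) = g j in i , image-∘ σ ρ {line C i} eq eq′)

lines-meet : ∀ {v} (C : Config v) {i j x y} → x ∈ˢ line C i → x ∈ˢ line C j → y ∈ˢ line C i → y ∈ˢ line C j → x ≢ y → i ≡ j
lines-meet C {i} {j} {x} {y} xi xj yi yj x≢y with i FinP.≟ j
... | yes i≡j = i≡j
... | no i≢j  = contradiction (subst (_≤ 1) (card≡length (line C i ∩ line C j)) (meet C i j i≢j))
  (ℕP.<⇒≱ (unique-⊆-length {xs = x ∷ y ∷ []} ((x≢y ∷ []) ∷ [] ∷ [])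
    (λ { (here refl) → ∈-elements⁺ (SubP.x∈p∩q⁺ (xi , xj)) ; (there (here refl)) → ∈-elements⁺ (SubP.x∈p∩q⁺ (yi , yj)) })))

injective⇒surjective : ∀ {n} (f : Fin n → Fin n) → (∀ {x y} → f x ≡ f y → x ≡ y) → ∀ y → ∃ λ x → f x ≡ y
injective⇒surjective {n} f inj y =
  let (x , _ , eq) = Mem.∈-map⁻ f (PermP.∈-resp-↭ (Perm.↭-sym perm) (Mem.∈-allFin y)) in x , sym eq
  where
  perm : map f (allFin n) ↭ allFin n
  perm = unique-⊆-↭ (Uniq.map⁺ inj (Uniq.allFin⁺ n)) (λ _ → Mem.∈-allFin _) (ℕP.≤-reflexive (sym (List.length-map f (allFin n))))

-- The k-th point of the line {0, a, b} is α k · a + β k · b.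
α β : Fin 3 → ℤ
α 0F = pos 0
α 1F = pos 1
α 2F = pos 0
β 0F = pos 0
β 1F = pos 0
β 2F = pos 1

offset : ℤ × ℤ → Fin 3 → ℤ
offset p 0F = pos 0
offset p 1F = proj₁ p
offset p 2F = proj₂ p

offset-≡ : ∀ p k → offset p k ≡ α k ⊗ proj₁ p ⊕ β k ⊗ proj₂ p
offset-≡ p 0F = e (proj₁ p) (proj₂ p)
  where
  e : ∀ x y → pos 0 ≡ pos 0 ⊗ x ⊕ pos 0 ⊗ y
  e = ℤ-Solver.solve-∀
offset-≡ p 1F = e (proj₁ p) (proj₂ p)
  where
  e : ∀ x y → x ≡ pos 1 ⊗ x ⊕ pos 0 ⊗ y
  e = ℤ-Solver.solve-∀
offset-≡ p 2F = e (proj₁ p) (proj₂ p)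
  where
  e : ∀ x y → y ≡ pos 0 ⊗ x ⊕ pos 1 ⊗ y
  e = ℤ-Solver.solve-∀

-- Combinations of points of a line are recorded as integer coefficient vectors. Statements about
-- all places in `Fin 3` then concern finitely many forms and are decided by enumeration.
two : Fin 3 → Fin 3 → Form
two k l = α k ⊖ α l , β k ⊖ β l

four : Fin 3 → Fin 3 → Fin 3 → Fin 3 → Form
four k l m n = α k ⊖ α l ⊖ (α m ⊖ α n) , β k ⊖ β l ⊖ (β m ⊖ β n)

six : Fin 3 → Fin 3 → Fin 3 → Fin 3 → Fin 3 → Fin 3 → Form
six i s t j x y = α i ⊖ α s ⊕ α t ⊖ (α j ⊖ α x ⊕ α y) , β i ⊖ β s ⊕ β t ⊖ (β j ⊖ β x ⊕ β y)

abstract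
  two-≡ : ∀ p k l → offset p k ⊖ offset p l ≡ eval (two k l) p
  two-≡ p k l = trans (cong₂ _⊖_ (offset-≡ p k) (offset-≡ p l))
    (trans (e (α k) (β k) (α l) (β l) (proj₁ p) (proj₂ p)) (sym (eval-≡ (two k l) p)))
    where
    e : ∀ a b c d x y → a ⊗ x ⊕ b ⊗ y ⊖ (c ⊗ x ⊕ d ⊗ y) ≡ (a ⊖ c) ⊗ x ⊕ (b ⊖ d) ⊗ y
    e = ℤ-Solver.solve-∀

  four-≡ : ∀ p k l m n → offset p k ⊖ offset p l ⊖ (offset p m ⊖ offset p n) ≡ eval (four k l m n) p
  four-≡ p k l m n = trans (cong₂ _⊖_ (two-≡ p k l) (two-≡ p m n))
    (trans (cong₂ _⊖_ (eval-≡ (two k l) p) (eval-≡ (two m n) p))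
      (trans (e (α k ⊖ α l) (β k ⊖ β l) (α m ⊖ α n) (β m ⊖ β n) (proj₁ p) (proj₂ p)) (sym (eval-≡ (four k l m n) p))))
    where
    e : ∀ a b c d x y → a ⊗ x ⊕ b ⊗ y ⊖ (c ⊗ x ⊕ d ⊗ y) ≡ (a ⊖ c) ⊗ x ⊕ (b ⊖ d) ⊗ y
    e = ℤ-Solver.solve-∀

  six-≡ : ∀ p i s t j x y → offset p i ⊖ offset p s ⊕ offset p t ⊖ (offset p j ⊖ offset p x ⊕ offset p y) ≡ eval (six i s t j x y) p
  six-≡ p i s t j x y = trans (cong₂ _⊖_ (three i s t) (three j x y))
    (trans (e (α i ⊖ α s ⊕ α t) (β i ⊖ β s ⊕ β t) (α j ⊖ α x ⊕ α y) (β j ⊖ β x ⊕ β y) (proj₁ p) (proj₂ p)) (sym (eval-≡ (six i s t j x y) p)))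
    where
    e : ∀ a b c d x y → a ⊗ x ⊕ b ⊗ y ⊖ (c ⊗ x ⊕ d ⊗ y) ≡ (a ⊖ c) ⊗ x ⊕ (b ⊖ d) ⊗ y
    e = ℤ-Solver.solve-∀
    e₃ : ∀ a b c d f g x y → a ⊗ x ⊕ b ⊗ y ⊖ (c ⊗ x ⊕ d ⊗ y) ⊕ (f ⊗ x ⊕ g ⊗ y) ≡ (a ⊖ c ⊕ f) ⊗ x ⊕ (b ⊖ d ⊕ g) ⊗ y
    e₃ = ℤ-Solver.solve-∀
    three : ∀ i s t → offset p i ⊖ offset p s ⊕ offset p t ≡ (α i ⊖ α s ⊕ α t) ⊗ proj₁ p ⊕ (β i ⊖ β s ⊕ β t) ⊗ proj₂ p
    three i s t = trans (cong₂ _⊕_ (cong₂ _⊖_ (offset-≡ p i) (offset-≡ p s)) (offset-≡ p t))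
      (e₃ (α i) (β i) (α s) (β s) (α t) (β t) (proj₁ p) (proj₂ p))

forbidden : List Form
forbidden = differences ++ doubles ++ middles

-- A coincidence dₖ - dₗ = dₘ - dₙ with k ≠ l and k ≠ m is never an identity in a and b: it always
-- imposes one of the listed relations.
four-forbidden : ∀ k l m n → k ≢ l → k ≢ m → four k l m n ∈ forbidden
four-forbidden = from-yes (FinP.all? λ k → FinP.all? λ l → FinP.all? λ m → FinP.all? λ n →
  ¬? (k FinP.≟ l) →-dec (¬? (k FinP.≟ m) →-dec (four k l m n ∈ᶠ? forbidden)))

forbidden-four : ∀ {φ} → φ ∈ doubles ++ middles →
  ∃ λ k → ∃ λ l → ∃ λ m → ∃ λ n → k ≢ l × k ≢ m × φ ≡ four k l m n
forbidden-four φ∈ = All.lookup table φ∈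
  where
  table : All (λ φ → ∃ λ k → ∃ λ l → ∃ λ m → ∃ λ n → k ≢ l × k ≢ m × φ ≡ four k l m n) (doubles ++ middles)
  table = from-yes (All.all? (λ φ → FinP.any? λ k → FinP.any? λ l → FinP.any? λ m → FinP.any? λ n →
    ¬? (k FinP.≟ l) ×-dec (¬? (k FinP.≟ m) ×-dec (φ ≟ᶠ four k l m n))) (doubles ++ middles))

-- A matrix of D₃ makes the point k the new origin and lists the points i and j relative to it.
D₃-permutation : ∀ {M} → M ∈ D₃ → ∃ λ i → ∃ λ j → ∃ λ k → (i ≢ j × i ≢ k × j ≢ k) × M ≡ (two i k , two j k)
D₃-permutation M∈ = All.lookup table M∈
  where
  table : All (λ M → ∃ λ i → ∃ λ j → ∃ λ k → (i ≢ j × i ≢ k × j ≢ k) × M ≡ (two i k , two j k)) D₃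
  table = from-yes (All.all? (λ M → FinP.any? λ i → FinP.any? λ j → FinP.any? λ k →
    (¬? (i FinP.≟ j) ×-dec (¬? (i FinP.≟ k) ×-dec ¬? (j FinP.≟ k))) ×-dec (M ≟ᴹ (two i k , two j k))) D₃)

permutation-D₃ : ∀ i j k → i ≢ j → i ≢ k → j ≢ k → (two i k , two j k) ∈ D₃
permutation-D₃ = from-yes (FinP.all? λ i → FinP.all? λ j → FinP.all? λ k →
  ¬? (i FinP.≟ j) →-dec (¬? (i FinP.≟ k) →-dec (¬? (j FinP.≟ k) →-dec ((two i k , two j k) ∈ᴹ? D₃))))

third : ∀ {i j k l : Fin 3} → i ≢ j → k ≢ i → k ≢ j → l ≢ i → l ≢ j → k ≡ l
third {i} {j} {k} {l} = from-yes (FinP.all? {n = 3} λ i → FinP.all? {n = 3} λ j → FinP.all? {n = 3} λ k → FinP.all? {n = 3} λ l →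
  ¬? (i FinP.≟ j) →-dec (¬? (k FinP.≟ i) →-dec (¬? (k FinP.≟ j) →-dec (¬? (l FinP.≟ i) →-dec (¬? (l FinP.≟ j) →-dec (k FinP.≟ l)))))) i j k l

remaining : ∀ (i j : Fin 3) → i ≢ j → ∃ λ k → k ≢ i × k ≢ j
remaining = from-yes (FinP.all? {n = 3} λ i → FinP.all? {n = 3} λ j → ¬? (i FinP.≟ j) →-dec
  (FinP.any? {n = 3} λ k → ¬? (k FinP.≟ i) ×-dec ¬? (k FinP.≟ j)))

-- The configuration of translates of a line {0, a, b}

module Standard (v : ℕ) .{{_ : NonZero v}} (4<v : 4 < v) where
  open Classes v public
  open BadClasses v 4<v public

  good⇒forbidden : ∀ {p φ} → Good p → φ ∈ forbidden → ¬ eval φ p ≈ pos 0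
  good⇒forbidden {p} {φ} (¬H , ¬W) φ∈ z = [ by-difference , (λ m → [ (λ m → ¬H (singular-intro m z)) , (λ m → ¬W (singular-intro m z)) ]′ (Mem.∈-++⁻ doubles m)) ]′ (Mem.∈-++⁻ differences φ∈)
    where
    twice : Form → Form
    twice (a , b) = pos 2 ⊗ a , pos 2 ⊗ b
    table : All (λ φ → twice φ ∈ doubles) differences
    table = from-yes (All.all? (λ φ → twice φ ∈ᶠ? doubles) differences)
    l : ∀ a b x y → pos 2 ⊗ a ⊗ x ⊕ pos 2 ⊗ b ⊗ y ⊖ pos 0 ≡ pos 2 ⊗ (a ⊗ x ⊕ b ⊗ y ⊖ pos 0)
    l = ℤ-Solver.solve-∀
    by-difference : φ ∈ differences → ⊥
    by-difference m = ¬H (singular-intro (All.lookup table m) (combine₁ (pos 2) z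
      (trans (cong (_⊖ pos 0) (eval-≡ (twice φ) p)) (trans (l (proj₁ φ) (proj₂ φ) (proj₁ p) (proj₂ p))
        (cong (λ e → pos 2 ⊗ (e ⊖ pos 0)) (sym (eval-≡ φ p)))))))

  -- The places m and n may agree, so the case m = n = l also excludes coinciding points of the
  -- line.
  DistinctDifferences : ℤ × ℤ → Set
  DistinctDifferences p = ∀ k l m n → k ≢ l → offset p k ⊖ offset p l ≈ offset p m ⊖ offset p n → k ≡ m

  good⇒distinct : ∀ {p} → Good p → DistinctDifferences p
  good⇒distinct {p} g k l m n k≢l e = decidable-stable (k FinP.≟ m) (λ k≢m → good⇒forbidden g (four-forbidden k l m n k≢l k≢m)
    (subst (_≈ pos 0) (four-≡ p k l m n) (combine₁ (pos 1) e (l₀ (offset p k ⊖ offset p l) (offset p m ⊖ offset p n)))))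
    where
    l₀ : ∀ x y → x ⊖ y ⊖ pos 0 ≡ pos 1 ⊗ (x ⊖ y)
    l₀ = ℤ-Solver.solve-∀

  distinct⇒good : ∀ {p} → DistinctDifferences p → Good p
  distinct⇒good {p} dd = (λ s → refute (λ {φ} m → Mem.∈-++⁺ˡ {v = φ} m) s) , (λ s → refute (λ {φ} m → Mem.∈-++⁺ʳ {v = φ} doubles m) s)
    where
    l₀ : ∀ x y → x ⊖ y ≡ pos 1 ⊗ (x ⊖ y ⊖ pos 0)
    l₀ = ℤ-Solver.solve-∀
    refute : ∀ {φs} → (∀ {φ} → φ ∈ φs → φ ∈ doubles ++ middles) → ¬ Singular φs p
    refute sub s = let (φ , φ∈ , z) = find s ; (k , l , m , n , k≢l , k≢m , eq) = forbidden-four (sub φ∈) in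
      k≢m (dd k l m n k≢l (combine₁ (pos 1) (subst (_≈ pos 0) (trans (cong (λ ψ → eval ψ p) eq) (sym (four-≡ p k l m n))) z)
        (l₀ (offset p k ⊖ offset p l) (offset p m ⊖ offset p n))))

  offset-injective : ∀ {p} → Good p → ∀ {k l} → offset p k ≈ offset p l → k ≡ l
  offset-injective {p} g {k} {l} e = decidable-stable (k FinP.≟ l) (λ k≢l →
    k≢l (good⇒distinct g k l l l k≢l (combine₁ (pos 1) e (l₀ (offset p k) (offset p l)))))
    where
    l₀ : ∀ x y → x ⊖ y ⊖ (y ⊖ y) ≡ pos 1 ⊗ (x ⊖ y)
    l₀ = ℤ-Solver.solve-∀

  point : ℤ × ℤ → Fin 3 → Fin v → Fin v
  point p k ℓ = res (val ℓ ⊕ offset p k)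

  point-≈ : ∀ {p p′ k k′ ℓ ℓ′} → point p k ℓ ≡ point p′ k′ ℓ′ → val ℓ ⊕ offset p k ≈ val ℓ′ ⊕ offset p′ k′
  point-≈ = res-injective

  point-injective : ∀ {p} → Good p → ∀ {k l ℓ} → point p k ℓ ≡ point p l ℓ → k ≡ l
  point-injective {p} g {k} {l} {ℓ} eq = offset-injective g (combine₁ (pos 1) (point-≈ {p} {p} {k} {l} {ℓ} {ℓ} eq) (l₀ (val ℓ) (offset p k) (offset p l)))
    where
    l₀ : ∀ z x y → x ⊖ y ≡ pos 1 ⊗ (z ⊕ x ⊖ (z ⊕ y))
    l₀ = ℤ-Solver.solve-∀

  OnLine : ℤ × ℤ → Fin v → Fin v → Set
  OnLine p ℓ y = ∃ λ k → y ≡ point p k ℓ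

  onLine? : ∀ p ℓ y → Dec (OnLine p ℓ y)
  onLine? p ℓ y = FinP.any? (λ k → y FinP.≟ point p k ℓ)

  stdLine : ℤ × ℤ → Fin v → Subset v
  stdLine p ℓ = ⟪ onLine? p ℓ ⟫

  ∈-stdLine⁺ : ∀ p k ℓ → point p k ℓ ∈ˢ stdLine p ℓ
  ∈-stdLine⁺ p k ℓ = ∈-⟪⟫⁺ (onLine? p ℓ) (k , refl)

  ∈-stdLine⁻ : ∀ p {ℓ y} → y ∈ˢ stdLine p ℓ → OnLine p ℓ y
  ∈-stdLine⁻ p {ℓ} = ∈-⟪⟫⁻ (onLine? p ℓ)

  -- A common point of the lines i and j, at places k and l, gives dₖ - dₗ = j - i. Two common
  -- points therefore give equal differences, hence the same place k on the line i.
  stdLine-meet : ∀ {p} → Good p → ∀ {i j y z} → i ≢ j → y ∈ˢ stdLine p i → y ∈ˢ stdLine p j → z ∈ˢ stdLine p i → z ∈ˢ stdLine p j → y ≡ z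
  stdLine-meet {p} g {i} {j} {y} {z} i≢j yi yj zi zj =
    let (k , y≡) = ∈-stdLine⁻ p yi ; (l , y≡′) = ∈-stdLine⁻ p yj ; (m , z≡) = ∈-stdLine⁻ p zi ; (n , z≡′) = ∈-stdLine⁻ p zj in
    go k l m n y≡ (trans (sym y≡) y≡′) z≡ (trans (sym z≡) z≡′)
    where
    l₁ : ∀ i j x y → x ⊖ y ⊖ (j ⊖ i) ≡ pos 1 ⊗ (i ⊕ x ⊖ (j ⊕ y))
    l₁ = ℤ-Solver.solve-∀
    difference : ∀ k l → point p k i ≡ point p l j → offset p k ⊖ offset p l ≈ val j ⊖ val i
    difference k l eq = combine₁ (pos 1) (point-≈ {p} {p} {k} {l} {i} {j} eq) (l₁ (val i) (val j) (offset p k) (offset p l))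
    l₂ : ∀ i j x → i ⊖ j ≡ pos 1 ⊗ (x ⊖ x ⊖ (j ⊖ i))
    l₂ = ℤ-Solver.solve-∀
    go : ∀ k l m n → y ≡ point p k i → point p k i ≡ point p l j → z ≡ point p m i → point p m i ≡ point p n j → y ≡ z
    go k l m n y≡ e z≡ e′ = trans y≡ (trans (cong (λ x → point p x i) (good⇒distinct g k l m n k≢l
        (≈-trans (difference k l e) (≈-sym (difference m n e′))))) (sym z≡))
      where
      k≢l : k ≢ l
      k≢l refl = i≢j (val-injective (combine₁ (pos 1) (difference k k e) (l₂ (val i) (val j) (offset p k))))

  unique-length≤1 : ∀ {A : Set} {xs : List A} → Unique xs → (∀ {x y} → x ∈ xs → y ∈ xs → x ≡ y) → length xs ≤ 1
  unique-length≤1 {xs = []}         u same = z≤n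
  unique-length≤1 {xs = x ∷ []}     u same = s≤s z≤n
  unique-length≤1 {xs = x ∷ y ∷ xs} ((x≢y ∷ _) ∷ _) same = contradiction (same (here refl) (there (here refl))) x≢y

  std : ∀ p → Good p → Config v
  std p g = record
    { line     = stdLine p
    ; lineSize = λ i → trans (card≡length (stdLine p i)) (PermP.↭-length (line-↭ i))
    ; pointDeg = λ x → PermP.↭-length (pencil-↭ x)
    ; meet     = λ i j i≢j → subst (_≤ 1) (sym (card≡length (stdLine p i ∩ stdLine p j)))
        (unique-length≤1 (elements-unique (stdLine p i ∩ stdLine p j)) (λ x∈ y∈ →
          let (xi , xj) = SubP.x∈p∩q⁻ (stdLine p i) (stdLine p j) (∈-elements⁻ x∈)
              (yi , yj) = SubP.x∈p∩q⁻ (stdLine p i) (stdLine p j) (∈-elements⁻ y∈) in stdLine-meet g i≢j xi xj yi yj))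
    }
    where
    line-↭ : ∀ i → elements (stdLine p i) ↭ map (λ k → point p k i) (allFin 3)
    line-↭ i = unique-↭ (elements-unique (stdLine p i)) (Uniq.map⁺ {f = λ k → point p k i} (λ {k} {l} → point-injective g {k} {l} {i}) (Uniq.allFin⁺ 3))
      (λ y∈ → let (k , eq) = ∈-stdLine⁻ p (∈-elements⁻ y∈) in subst (_∈ map (λ k → point p k i) (allFin 3)) (sym eq) (Mem.∈-map⁺ (λ k → point p k i) (Mem.∈-allFin k)))
      (λ y∈ → let (k , _ , eq) = Mem.∈-map⁻ (λ k → point p k i) {xs = allFin 3} y∈ in ∈-elements⁺ (subst (_∈ˢ stdLine p i) (sym eq) (∈-stdLine⁺ p k i)))
    l₂ : ∀ x y d → x ⊖ (y ⊖ d) ≡ (⊝ pos 1) ⊗ (y ⊖ (x ⊕ d))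
    l₂ = ℤ-Solver.solve-∀
    l₃ : ∀ z x y → x ⊖ y ≡ (⊝ pos 1) ⊗ (z ⊖ x ⊖ (z ⊖ y))
    l₃ = ℤ-Solver.solve-∀
    l₄ : ∀ x y d → y ⊖ (x ⊕ d) ≡ (⊝ pos 1) ⊗ (x ⊖ (y ⊖ d))
    l₄ = ℤ-Solver.solve-∀
    lineThrough : Fin v → Fin 3 → Fin v
    lineThrough x k = res (val x ⊖ offset p k)
    through⁺ : ∀ x k → x ∈ˢ stdLine p (lineThrough x k)
    through⁺ x k = subst (_∈ˢ stdLine p (lineThrough x k)) (sym (val-injective (≈-trans
      (combine₁ (⊝ pos 1) (val-res (val x ⊖ offset p k)) (l₄ (val (lineThrough x k)) (val x) (offset p k)))
      (≈-sym (val-res _))))) (∈-stdLine⁺ p k (lineThrough x k))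
    through⁻ : ∀ x i → x ∈ˢ stdLine p i → ∃ λ k → i ≡ lineThrough x k
    through⁻ x i x∈ = let (k , eq) = ∈-stdLine⁻ p x∈ in k , val-injective (≈-trans
      (combine₁ (⊝ pos 1) (≈-trans (≈-reflexive (cong val eq)) (val-res (val i ⊕ offset p k))) (l₂ (val i) (val x) (offset p k)))
      (≈-sym (val-res (val x ⊖ offset p k))))
    pencil-↭ : ∀ x → filter (λ i → x ∈ˢ? stdLine p i) (allFin v) ↭ map (lineThrough x) (allFin 3)
    pencil-↭ x = unique-↭ (Uniq.filter⁺ (λ i → x ∈ˢ? stdLine p i) (Uniq.allFin⁺ v))
      (Uniq.map⁺ {f = lineThrough x} (λ {k} {l} eq → offset-injective g (combine₁ (⊝ pos 1) (res-injective {val x ⊖ offset p k} {val x ⊖ offset p l} eq) (l₃ (val x) (offset p k) (offset p l)))) (Uniq.allFin⁺ 3))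
      (λ i∈ → let (k , eq) = through⁻ x _ (proj₂ (Mem.∈-filter⁻ (λ i → x ∈ˢ? stdLine p i) {xs = allFin v} i∈)) in
        subst (_∈ map (lineThrough x) (allFin 3)) (sym eq) (Mem.∈-map⁺ (lineThrough x) (Mem.∈-allFin k)))
      (λ i∈ → let (k , _ , eq) = Mem.∈-map⁻ (lineThrough x) {xs = allFin 3} i∈ in
        Mem.∈-filter⁺ (λ i → x ∈ˢ? stdLine p i) (Mem.∈-allFin _) (subst (λ i → x ∈ˢ stdLine p i) (sym eq) (through⁺ x k)))

-- Rigidity of cyclic configurations

-- The forms 3p - 2q - r for the points p, q, r of {0, a, b} in all orders, up to sign.
skew : List Form
skew = let φs = (pos 2 , pos 1) ∷ (pos 1 , pos 2) ∷ (pos 3 , ⊝ pos 1) ∷ (pos 3 , ⊝ pos 2) ∷ (⊝ pos 1 , pos 3) ∷ (⊝ pos 2 , pos 3) ∷ []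
       in φs ++ negated φs

skew-moves : Moves (pos 2) skew
skew-moves = from-yes (moves? (pos 2) skew)

thrice : Fin 3 → Fin 3 → Form
thrice i j = pos 3 ⊗ (α i ⊖ α j) , pos 3 ⊗ (β i ⊖ β j)

-- The 16 possible coincidences of the apexes of two triangles on the points i and j of a line.
six-table : ∀ i j s t x y → i ≢ j → s ≢ i → t ≢ s → x ≢ j → y ≢ x →
  (s ≡ x × t ≡ j × y ≡ i) ⊎ six i s t j x y ∈ thrice i j ∷ thrice j i ∷ [] ⊎ six i s t j x y ∈ skew ⊎ six i s t j x y ∈ forbidden
six-table = from-yes (FinP.all? λ i → FinP.all? λ j → FinP.all? λ s → FinP.all? λ t → FinP.all? λ x → FinP.all? λ y →
  ¬? (i FinP.≟ j) →-dec (¬? (s FinP.≟ i) →-dec (¬? (t FinP.≟ s) →-dec (¬? (x FinP.≟ j) →-dec (¬? (y FinP.≟ x) →-dec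
    (((s FinP.≟ x) ×-dec ((t FinP.≟ j) ×-dec (y FinP.≟ i))) ⊎-dec
      ((six i s t j x y ∈ᶠ? (thrice i j ∷ thrice j i ∷ [])) ⊎-dec ((six i s t j x y ∈ᶠ? skew) ⊎-dec (six i s t j x y ∈ᶠ? forbidden)))))))))

covered : ∀ (i j k a : Fin 3) → i ≢ j → i ≢ k → j ≢ k → a ≡ i ⊎ a ≡ j ⊎ a ≡ k
covered = from-yes (FinP.all? {n = 3} λ i → FinP.all? {n = 3} λ j → FinP.all? {n = 3} λ k → FinP.all? {n = 3} λ a →
  ¬? (i FinP.≟ j) →-dec (¬? (i FinP.≟ k) →-dec (¬? (j FinP.≟ k) →-dec ((a FinP.≟ i) ⊎-dec ((a FinP.≟ j) ⊎-dec (a FinP.≟ k))))))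

module Rigidity (v : ℕ) .{{_ : NonZero v}} (4<v : 4 < v) where
  open Standard v 4<v

  -- The apex of a triangle on the points i and j of line 0 is dᵢ - dₛ + dₜ = dⱼ - dₓ + d_y. In the honeycomb picture
  -- the solution s = x, t = j, y = i is a hexagonal face; the base is unique if that is the only triangle on it.
  UniqueBase : ℤ × ℤ → Fin 3 → Fin 3 → Set
  UniqueBase p i j = ∀ s t x y → s ≢ i → t ≢ s → x ≢ j → y ≢ x →
    offset p i ⊖ offset p s ⊕ offset p t ≈ offset p j ⊖ offset p x ⊕ offset p y → s ≡ x × t ≡ j × y ≡ i

  -- By `six-table`, every coincidence other than the face makes a form vanish that is excluded by
  -- one of the hypotheses.
  unique-base : ∀ {p} i j → Good p → ¬ Singular skew p → ¬ pos 3 ⊗ (offset p i ⊖ offset p j) ≈ pos 0 → i ≢ j → UniqueBase p i j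
  unique-base {p} i j g ¬skew ¬3 i≢j s t x y s≢i t≢s x≢j y≢x e =
    [ id , [ (λ m → ⊥-elim (by-thrice m)) , [ (λ m → ⊥-elim (¬skew (singular-intro m z))) , (λ m → ⊥-elim (good⇒forbidden g m z)) ]′ ]′ ]′
      (six-table i j s t x y i≢j s≢i t≢s x≢j y≢x)
    where
    l₀ : ∀ x y → x ⊖ y ⊖ pos 0 ≡ pos 1 ⊗ (x ⊖ y)
    l₀ = ℤ-Solver.solve-∀
    z : eval (six i s t j x y) p ≈ pos 0
    z = subst (_≈ pos 0) (six-≡ p i s t j x y) (combine₁ (pos 1) e (l₀ (offset p i ⊖ offset p s ⊕ offset p t) (offset p j ⊖ offset p x ⊕ offset p y)))
    thrice-≡ : ∀ i j → eval (thrice i j) p ≡ pos 3 ⊗ (offset p i ⊖ offset p j)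
    thrice-≡ i j = trans (eval-≡ (thrice i j) p) (trans (l (α i ⊖ α j) (β i ⊖ β j) (proj₁ p) (proj₂ p))
      (cong (pos 3 ⊗_) (trans (sym (eval-≡ (two i j) p)) (sym (two-≡ p i j)))))
      where
      l : ∀ a b x y → pos 3 ⊗ a ⊗ x ⊕ pos 3 ⊗ b ⊗ y ≡ pos 3 ⊗ (a ⊗ x ⊕ b ⊗ y)
      l = ℤ-Solver.solve-∀
    l₁ : ∀ x y → pos 3 ⊗ (x ⊖ y) ⊖ pos 0 ≡ (⊝ pos 1) ⊗ (pos 3 ⊗ (y ⊖ x) ⊖ pos 0)
    l₁ = ℤ-Solver.solve-∀
    by-thrice : six i s t j x y ∈ thrice i j ∷ thrice j i ∷ [] → ⊥
    by-thrice (here eq)         = ¬3 (subst (_≈ pos 0) (trans (cong (λ φ → eval φ p) eq) (thrice-≡ i j)) z)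
    by-thrice (there (here eq)) = ¬3 (combine₁ (⊝ pos 1) (subst (_≈ pos 0) (trans (cong (λ φ → eval φ p) eq) (thrice-≡ j i)) z)
      (l₁ (offset p i) (offset p j)))

  skewPair : Pair
  skewPair = resPair (pos 1 , ⊝ pos 2)

  -- Outside the skew class, failure of the pair {a, b} means 3(a - b) = 0 and failure of {0, a}
  -- means 3a = 0. Both together would make 3 annihilate a and b, hence 1, which v > 4 forbids.
  rigid : ∀ x → Generates (vals x) → Good (vals x) → (∃ λ i → ∃ λ j → i ≢ j × UniqueBase (vals x) i j) ⊎ x ∼ skewPair
  rigid x gen g = cases (Any.any? (λ φ → eval φ p ≈? pos 0) skew) (pos 3 ⊗ (offset p 1F ⊖ offset p 2F) ≈? pos 0)
    where
    p = vals x
    3≉0 : ¬ pos 3 ≈ pos 0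
    3≉0 = pos≉0 {3} (s≤s z≤n) (ℕP.≤-trans (s≤s (s≤s (s≤s (s≤s z≤n)))) 4<v)
    l : ∀ s t a b → pos 3 ⊖ pos 0 ≡ (⊝ (s ⊕ t)) ⊗ (pos 3 ⊗ (pos 0 ⊖ a) ⊖ pos 0) ⊕ (⊝ t) ⊗ (pos 3 ⊗ (a ⊖ b) ⊖ pos 0) ⊕ (⊝ pos 3) ⊗ (s ⊗ a ⊕ t ⊗ b ⊖ pos 1)
    l = ℤ-Solver.solve-∀
    cases : Dec (Singular skew p) → Dec (pos 3 ⊗ (offset p 1F ⊖ offset p 2F) ≈ pos 0) →
            (∃ λ i → ∃ λ j → i ≢ j × UniqueBase (vals x) i j) ⊎ x ∼ skewPair
    cases (yes s) _ = inj₂ (singular⇒∼ (pos 2) skew-moves gen s)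
    cases (no ¬s) (no ¬3) = inj₁ (1F , 2F , (λ ()) , unique-base 1F 2F g ¬s ¬3 (λ ()))
    cases (no ¬s) (yes e) = inj₁ (0F , 1F , (λ ()) , unique-base 0F 1F g ¬s
      (λ e′ → let (s , t , eq) = generates-elim p gen in 3≉0 (combine₃ (⊝ (s ⊕ t)) (⊝ t) (⊝ pos 3) e′ e eq (l s t (proj₁ p) (proj₂ p)))) (λ ()))

  module _ (x x′ : Pair) (gen : Generates (vals x)) (gen′ : Generates (vals x′)) (g : Good (vals x)) (g′ : Good (vals x′))
           (iso : Isomorphic (std (vals x) g) (std (vals x′) g′)) where
    private
      P P′ : ℤ × ℤ
      P  = vals x
      P′ = vals x′

      σ : Fin v → Fin v
      σ y = proj₁ iso ⟨$⟩ʳ y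

      σ-injective : ∀ {y z} → σ y ≡ σ z → y ≡ z
      σ-injective eq = trans (sym (inverseˡ (proj₁ iso))) (trans (cong (proj₁ iso ⟨$⟩ˡ_) eq) (inverseˡ (proj₁ iso)))

      abstract
        τ : Fin v → Fin v
        τ ℓ = proj₁ (proj₁ (proj₂ iso) ℓ)

        image-τ : ∀ ℓ → image (proj₁ iso) (stdLine P ℓ) ≡ stdLine P′ (τ ℓ)
        image-τ ℓ = proj₂ (proj₁ (proj₂ iso) ℓ)

        π : Fin v → Fin 3 → Fin 3
        π ℓ k = proj₁ (∈-stdLine⁻ P′ (image-≡⁺ (proj₁ iso) (image-τ ℓ) (∈-stdLine⁺ P k ℓ)))

        σ-point : ∀ ℓ k → σ (point P k ℓ) ≡ point P′ (π ℓ k) (τ ℓ)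
        σ-point ℓ k = proj₂ (∈-stdLine⁻ P′ (image-≡⁺ (proj₁ iso) (image-τ ℓ) (∈-stdLine⁺ P k ℓ)))

      π-injective : ∀ ℓ {k l} → π ℓ k ≡ π ℓ l → k ≡ l
      π-injective ℓ {k} {l} eq = point-injective g {k} {l} {ℓ} (σ-injective
        (trans (σ-point ℓ k) (trans (cong (λ a → point P′ a (τ ℓ)) eq) (sym (σ-point ℓ l)))))

      τ-injective : ∀ {ℓ m} → τ ℓ ≡ τ m → ℓ ≡ m
      τ-injective {ℓ} {m} eq = lines-meet (std P g) (∈-stdLine⁺ P 0F ℓ) (on 0F) (∈-stdLine⁺ P 1F ℓ) (on 1F)
        (λ same → case point-injective g {0F} {1F} {ℓ} same of λ ())
        where
        on : ∀ k → point P k ℓ ∈ˢ stdLine P m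
        on k = image-≡⁻ (proj₁ iso) (trans (image-τ m) (cong (stdLine P′) (sym eq)))
          (image-≡⁺ (proj₁ iso) (image-τ ℓ) (∈-stdLine⁺ P k ℓ))

      d d′ : Fin 3 → ℤ
      d  = offset P
      d′ = offset P′

      incident : ∀ {ℓ m k l} → val ℓ ⊕ d k ≈ val m ⊕ d l → val (τ ℓ) ⊕ d′ (π ℓ k) ≈ val (τ m) ⊕ d′ (π m l)
      incident {ℓ} {m} {k} {l} e = point-≈ {P′} {P′} {π ℓ k} {π m l} {τ ℓ} {τ m}
        (trans (sym (σ-point ℓ k)) (trans (cong σ (res-cong e)) (σ-point m l)))

      record Types (ℓ : Fin v) (i j k I J K : Fin 3) : Set where
        constructor types
        field
          πi : π ℓ i ≡ I
          πj : π ℓ j ≡ J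
          πk : π ℓ k ≡ K

      -- Uniqueness forces the face on i and j of ℓ to go to a face, so its two other lines m and n see the same types as ℓ.
      face : ∀ {ℓ m n i j k I J K} → i ≢ j → i ≢ k → j ≢ k → UniqueBase P′ I J → Types ℓ i j k I J K →
             val m ≈ val ℓ ⊕ (d i ⊖ d k) → val n ≈ val ℓ ⊕ (d j ⊖ d k) →
             (Types m i j k I J K × val (τ m) ≈ val (τ ℓ) ⊕ (d′ I ⊖ d′ K)) ×
             (Types n i j k I J K × val (τ n) ≈ val (τ ℓ) ⊕ (d′ J ⊖ d′ K))
      face {ℓ} {m} {n} {i} {j} {k} {I} {J} {K} i≢j i≢k j≢k unique (types refl refl refl) em en =
          (types (third J≢K (λ eq → i≢j (π-injective m (trans eq (sym t≡J)))) (λ eq → i≢k (π-injective m (trans eq (sym s≡K)))) (λ eq → i≢j (π-injective ℓ eq)) (λ eq → i≢k (π-injective ℓ eq))) t≡J s≡K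
            , subst (λ a → val (τ m) ≈ val (τ ℓ) ⊕ (d′ I ⊖ d′ a)) s≡K (combine₁ (⊝ pos 1) e₁ (l₄ (val (τ m)) (val (τ ℓ)) (d′ I) (d′ s))))
        , (types y≡I (third I≢K (λ eq → i≢j (sym (π-injective n (trans eq (sym y≡I))))) (λ eq → j≢k (π-injective n (trans eq (sym x≡K)))) (λ eq → i≢j (sym (π-injective ℓ eq))) (λ eq → j≢k (π-injective ℓ eq))) x≡K
            , subst (λ a → val (τ n) ≈ val (τ ℓ) ⊕ (d′ J ⊖ d′ a)) x≡K (combine₁ (⊝ pos 1) e₃ (l₄ (val (τ n)) (val (τ ℓ)) (d′ J) (d′ x₀))))
        where
        s t x₀ y₀ : Fin 3
        s  = π m k
        t  = π m j
        x₀ = π n k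
        y₀ = π n i
        I≢K : I ≢ K
        I≢K eq = i≢k (π-injective ℓ eq)
        J≢K : J ≢ K
        J≢K eq = j≢k (π-injective ℓ eq)
        I≢J : I ≢ J
        I≢J eq = i≢j (π-injective ℓ eq)
        l₁ : ∀ ℓ m a c → ℓ ⊕ a ⊖ (m ⊕ c) ≡ (⊝ pos 1) ⊗ (m ⊖ (ℓ ⊕ (a ⊖ c)))
        l₁ = ℤ-Solver.solve-∀
        l₂ : ∀ ℓ m n a b c → m ⊕ b ⊖ (n ⊕ a) ≡ pos 1 ⊗ (m ⊖ (ℓ ⊕ (a ⊖ c))) ⊕ (⊝ pos 1) ⊗ (n ⊖ (ℓ ⊕ (b ⊖ c)))
        l₂ = ℤ-Solver.solve-∀
        e₁ : val (τ ℓ) ⊕ d′ I ≈ val (τ m) ⊕ d′ s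
        e₁ = incident {ℓ} {m} {i} {k} (combine₁ (⊝ pos 1) em (l₁ (val ℓ) (val m) (d i) (d k)))
        e₂ : val (τ m) ⊕ d′ t ≈ val (τ n) ⊕ d′ y₀
        e₂ = incident {m} {n} {j} {i} (combine₂ (pos 1) (⊝ pos 1) em en (l₂ (val ℓ) (val m) (val n) (d i) (d j) (d k)))
        e₃ : val (τ ℓ) ⊕ d′ J ≈ val (τ n) ⊕ d′ x₀
        e₃ = incident {ℓ} {n} {j} {k} (combine₁ (⊝ pos 1) en (l₁ (val ℓ) (val n) (d j) (d k)))
        l₃ : ∀ L M N I s t J x y → I ⊖ s ⊕ t ⊖ (J ⊖ x ⊕ y) ≡ pos 1 ⊗ (L ⊕ I ⊖ (M ⊕ s)) ⊕ pos 1 ⊗ (M ⊕ t ⊖ (N ⊕ y)) ⊕ (⊝ pos 1) ⊗ (L ⊕ J ⊖ (N ⊕ x))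
        l₃ = ℤ-Solver.solve-∀
        l₄ : ∀ M L I s → M ⊖ (L ⊕ (I ⊖ s)) ≡ (⊝ pos 1) ⊗ (L ⊕ I ⊖ (M ⊕ s))
        l₄ = ℤ-Solver.solve-∀
        l₅ : ∀ L M I → L ⊖ M ≡ pos 1 ⊗ (L ⊕ I ⊖ (M ⊕ I))
        l₅ = ℤ-Solver.solve-∀
        l₆ : ∀ ℓ m a c → a ⊖ c ≡ (⊝ pos 1) ⊗ (m ⊖ (ℓ ⊕ (a ⊖ c))) ⊕ pos 1 ⊗ (m ⊖ ℓ)
        l₆ = ℤ-Solver.solve-∀
        moved : ∀ {q a} → val q ≈ val ℓ ⊕ (d a ⊖ d k) → a ≢ k → ∀ {A S} → val (τ ℓ) ⊕ d′ A ≈ val (τ q) ⊕ d′ S → S ≢ A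
        moved {q} {a} eq a≢k {A} e refl = a≢k (offset-injective g (combine₂ (⊝ pos 1) (pos 1) eq
          (≈-reflexive (cong val (sym (τ-injective {ℓ} {q} (val-injective (combine₁ (pos 1) e (l₅ (val (τ ℓ)) (val (τ q)) (d′ A))))))))
          (l₆ (val ℓ) (val q) (d a) (d k))))
        s≢I : s ≢ I
        s≢I = moved {m} {i} em i≢k {I} e₁
        x≢J : x₀ ≢ J
        x≢J = moved {n} {j} en j≢k {J} e₃
        -- Adding the incidences around the triangle eliminates the positions of its three lines and
        -- leaves exactly the equation between offsets treated by `UniqueBase`.
        found : s ≡ x₀ × t ≡ J × y₀ ≡ I
        found = unique s t x₀ y₀ s≢I (λ eq → j≢k (π-injective m eq)) x≢J (λ eq → i≢k (π-injective n eq))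
          (combine₃ (pos 1) (pos 1) (⊝ pos 1) e₁ e₂ e₃ (l₃ (val (τ ℓ)) (val (τ m)) (val (τ n)) (d′ I) (d′ s) (d′ t) (d′ J) (d′ x₀) (d′ y₀)))
        t≡J : t ≡ J
        t≡J = proj₁ (proj₂ found)
        y≡I : y₀ ≡ I
        y≡I = proj₂ (proj₂ found)
        s≡K : s ≡ K
        -- Since t = J and `π m` is injective, s is not J; with s ≠ I only K remains.
        s≡K = third I≢J s≢I (λ eq → j≢k (sym (π-injective m (trans eq (sym t≡J))))) (λ eq → I≢K (sym eq)) (λ eq → J≢K (sym eq))
        x≡K : x₀ ≡ K
        x≡K = trans (sym (proj₁ found)) s≡K

      module Propagate (i j k : Fin 3) (i≢j : i ≢ j) (i≢k : i ≢ k) (j≢k : j ≢ k)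
                       (unique : UniqueBase P′ (π (res (pos 0)) i) (π (res (pos 0)) j)) where
        o : Fin v
        o = res (pos 0)
        I J K : Fin 3
        I = π o i
        J = π o j
        K = π o k
        δ₁ δ₂ ε₁ ε₂ : ℤ
        δ₁ = d i ⊖ d k
        δ₂ = d j ⊖ d k
        ε₁ = d′ I ⊖ d′ K
        ε₂ = d′ J ⊖ d′ K

        Reached : ℤ → ℤ → Fin v → Set
        Reached s t ℓ = val ℓ ≈ s ⊗ δ₁ ⊕ t ⊗ δ₂ × Types ℓ i j k I J K × val (τ ℓ) ≈ val (τ o) ⊕ (s ⊗ ε₁ ⊕ t ⊗ ε₂)

        step : ∀ {ℓ s t} → Reached s t ℓ → (∃ λ m → Reached (pos 1 ⊕ s) t m) × (∃ λ n → Reached s (pos 1 ⊕ t) n)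
        step {ℓ} {s} {t} (e , ty , f) =
          let m = res (val ℓ ⊕ δ₁)
              n = res (val ℓ ⊕ δ₂)
              ((tm , fm) , (tn , fn)) = face {ℓ} {m} {n} i≢j i≢k j≢k unique ty (val-res (val ℓ ⊕ δ₁)) (val-res (val ℓ ⊕ δ₂)) in
            (m , combine₂ (pos 1) (pos 1) (val-res (val ℓ ⊕ δ₁)) e (l₁ (val m) (val ℓ) s t δ₁ δ₂) , tm ,
               combine₂ (pos 1) (pos 1) fm f (l₃ (val (τ m)) (val (τ ℓ)) (val (τ o)) s t ε₁ ε₂))
          , (n , combine₂ (pos 1) (pos 1) (val-res (val ℓ ⊕ δ₂)) e (l₂ (val n) (val ℓ) s t δ₁ δ₂) , tn ,
               combine₂ (pos 1) (pos 1) fn f (l₄ (val (τ n)) (val (τ ℓ)) (val (τ o)) s t ε₁ ε₂))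
          where
          l₁ : ∀ m ℓ s t a b → m ⊖ ((pos 1 ⊕ s) ⊗ a ⊕ t ⊗ b) ≡ pos 1 ⊗ (m ⊖ (ℓ ⊕ a)) ⊕ pos 1 ⊗ (ℓ ⊖ (s ⊗ a ⊕ t ⊗ b))
          l₁ = ℤ-Solver.solve-∀
          l₂ : ∀ m ℓ s t a b → m ⊖ (s ⊗ a ⊕ (pos 1 ⊕ t) ⊗ b) ≡ pos 1 ⊗ (m ⊖ (ℓ ⊕ b)) ⊕ pos 1 ⊗ (ℓ ⊖ (s ⊗ a ⊕ t ⊗ b))
          l₂ = ℤ-Solver.solve-∀
          l₃ : ∀ m ℓ o s t a b → m ⊖ (o ⊕ ((pos 1 ⊕ s) ⊗ a ⊕ t ⊗ b)) ≡ pos 1 ⊗ (m ⊖ (ℓ ⊕ a)) ⊕ pos 1 ⊗ (ℓ ⊖ (o ⊕ (s ⊗ a ⊕ t ⊗ b)))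
          l₃ = ℤ-Solver.solve-∀
          l₄ : ∀ m ℓ o s t a b → m ⊖ (o ⊕ (s ⊗ a ⊕ (pos 1 ⊕ t) ⊗ b)) ≡ pos 1 ⊗ (m ⊖ (ℓ ⊕ b)) ⊕ pos 1 ⊗ (ℓ ⊖ (o ⊕ (s ⊗ a ⊕ t ⊗ b)))
          l₄ = ℤ-Solver.solve-∀

        reach : ∀ s t → ∃ (Reached (pos s) (pos t))
        reach zero    zero    = o , ≈-trans (val-res (pos 0)) (≈-reflexive (l₀ δ₁ δ₂)) , types refl refl refl , ≈-reflexive (l₁ (val (τ o)) ε₁ ε₂)
          where
          l₀ : ∀ a b → pos 0 ≡ pos 0 ⊗ a ⊕ pos 0 ⊗ b
          l₀ = ℤ-Solver.solve-∀
          l₁ : ∀ o a b → o ≡ o ⊕ (pos 0 ⊗ a ⊕ pos 0 ⊗ b)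
          l₁ = ℤ-Solver.solve-∀
        reach zero    (suc t) = proj₂ (step {proj₁ (reach zero t)} {pos zero} {pos t} (proj₂ (reach zero t)))
        reach (suc s) t       = proj₁ (step {proj₁ (reach s t)} {pos s} {pos t} (proj₂ (reach s t)))

        -- Two combinations of δ₁ and δ₂ that agree modulo v are the same line, and `τ` has one
        -- value there. Hence the linear map from the δ to the ε is well defined.
        transfer : ∀ s t s′ t′ → s ⊗ δ₁ ⊕ t ⊗ δ₂ ≈ s′ ⊗ δ₁ ⊕ t′ ⊗ δ₂ → s ⊗ ε₁ ⊕ t ⊗ ε₂ ≈ s′ ⊗ ε₁ ⊕ t′ ⊗ ε₂
        transfer s t s′ t′ e =
          -- The coefficients are first replaced by natural numbers below v, because `reach`
          -- proceeds by adding δ₁ and δ₂.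
          let (ℓ , eℓ , _ , fℓ) = reach (toℕ (res s)) (toℕ (res t))
              (m , em , _ , fm) = reach (toℕ (res s′)) (toℕ (res t′))
              ℓ≡m = val-injective {ℓ} {m} (≈-trans eℓ (≈-trans (reps s t δ₁ δ₂) (≈-trans e (≈-trans (≈-sym (reps s′ t′ δ₁ δ₂)) (≈-sym em))))) in
          ≈-trans (≈-sym (reps s t ε₁ ε₂)) (≈-trans
            (combine₃ (⊝ pos 1) (pos 1) (pos 1) fℓ fm (≈-reflexive (cong (val ∘ τ) ℓ≡m))
              (l (val (τ ℓ)) (val (τ m)) (val (τ o)) (val (res s) ⊗ ε₁ ⊕ val (res t) ⊗ ε₂) (val (res s′) ⊗ ε₁ ⊕ val (res t′) ⊗ ε₂)))
            (reps s′ t′ ε₁ ε₂))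
          where
          reps : ∀ s t a b → val (res s) ⊗ a ⊕ val (res t) ⊗ b ≈ s ⊗ a ⊕ t ⊗ b
          reps s t a b = combine₂ a b (val-res s) (val-res t) (l₂ (val (res s)) (val (res t)) s t a b)
            where
            l₂ : ∀ S T s t a b → S ⊗ a ⊕ T ⊗ b ⊖ (s ⊗ a ⊕ t ⊗ b) ≡ a ⊗ (S ⊖ s) ⊕ b ⊗ (T ⊖ t)
            l₂ = ℤ-Solver.solve-∀
          l : ∀ L M o X Y → X ⊖ Y ≡ (⊝ pos 1) ⊗ (L ⊖ (o ⊕ X)) ⊕ pos 1 ⊗ (M ⊖ (o ⊕ Y)) ⊕ pos 1 ⊗ (L ⊖ M)
          l = ℤ-Solver.solve-∀

        M M′ : Matrix
        M  = two i k , two j k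
        M′ = two I K , two J K

        M∈ : M ∈ D₃
        M∈ = permutation-D₃ i j k i≢j i≢k j≢k
        M′∈ : M′ ∈ D₃
        M′∈ = permutation-D₃ I J K (λ eq → i≢j (π-injective o eq)) (λ eq → i≢k (π-injective o eq)) (λ eq → j≢k (π-injective o eq))

        Δ≡ : apply M P ≡ (δ₁ , δ₂)
        Δ≡ = cong₂ _,_ (sym (two-≡ P i k)) (sym (two-≡ P j k))
        Δ′≡ : apply M′ P′ ≡ (ε₁ , ε₂)
        Δ′≡ = cong₂ _,_ (sym (two-≡ P′ I K)) (sym (two-≡ P′ J K))

        gen-δ : ∃ λ s → ∃ λ t → s ⊗ δ₁ ⊕ t ⊗ δ₂ ≈ pos 1
        gen-δ = generates-elim (δ₁ , δ₂) (subst Generates Δ≡ (generates-apply P M∈ gen))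
        module Conclude (s₀ t₀ : ℤ) (e₀ : s₀ ⊗ δ₁ ⊕ t₀ ⊗ δ₂ ≈ pos 1) where
          -- The image of 1 = s₀ δ₁ + t₀ δ₂; the linear map is then multiplication by u.
          u : ℤ
          u = s₀ ⊗ ε₁ ⊕ t₀ ⊗ ε₂

          multiple : ∀ δ ε a b → a ⊗ δ₁ ⊕ b ⊗ δ₂ ≡ δ → a ⊗ ε₁ ⊕ b ⊗ ε₂ ≡ ε → ε ≈ u ⊗ δ
          multiple δ ε a b eqδ eqε = ≈-trans (≈-reflexive (sym eqε)) (≈-trans
            (transfer a b (δ ⊗ s₀) (δ ⊗ t₀) (≈-trans (≈-reflexive eqδ) (combine₁ (⊝ δ) e₀ (l₁ δ s₀ t₀ δ₁ δ₂))))
            (≈-reflexive (l₂ δ s₀ t₀ ε₁ ε₂)))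
            where
            l₁ : ∀ δ s t a b → δ ⊖ (δ ⊗ s ⊗ a ⊕ δ ⊗ t ⊗ b) ≡ (⊝ δ) ⊗ (s ⊗ a ⊕ t ⊗ b ⊖ pos 1)
            l₁ = ℤ-Solver.solve-∀
            l₂ : ∀ δ s t a b → δ ⊗ s ⊗ a ⊕ δ ⊗ t ⊗ b ≡ (s ⊗ a ⊕ t ⊗ b) ⊗ δ
            l₂ = ℤ-Solver.solve-∀

          first : ∀ a b → pos 1 ⊗ a ⊕ pos 0 ⊗ b ≡ a
          first = ℤ-Solver.solve-∀
          second : ∀ a b → pos 0 ⊗ a ⊕ pos 1 ⊗ b ≡ b
          second = ℤ-Solver.solve-∀

          Δ′≋uΔ : apply M′ P′ ≋ u • apply M P
          Δ′≋uΔ = subst₂ _≋_ (sym Δ′≡) (sym (trans (cong (u •_) Δ≡) (•-≡ u (δ₁ , δ₂))))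
            (pair (multiple δ₁ ε₁ (pos 1) (pos 0) (first δ₁ δ₂) (first ε₁ ε₂)) (multiple δ₂ ε₂ (pos 0) (pos 1) (second δ₁ δ₂) (second ε₁ ε₂)))

          u-unit : Unit u
          u-unit = let (φ , e) = generates-apply P′ M′∈ gen′ in
            unit-intro u (eval φ (apply M P)) (≈-trans (≈-reflexive (sym (eval-• φ u (apply M P)))) (≈-trans (eval-cong φ (≋-sym Δ′≋uΔ)) e))

          equivalent : x ∼ x′
          equivalent = ∼-intro {g = res u , inverse M′ · M} (∈-scalars⁺ (unit-res {u} u-unit) (·∈D₃ (inverse∈D₃ M′∈) M∈))
            (actOn-≡ (res u) (inverse M′ · M) x x′ (≋-trans (•-cong (val-res u) (≋-reflexive (apply-· (inverse M′) M P)))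
              (≋-trans (≋-reflexive (sym (apply-• (inverse M′) u (apply M P))))
                (≋-trans (apply-cong (inverse M′) (≋-sym Δ′≋uΔ)) (≋-reflexive (apply-inverse P′ M′∈))))))

        result : x ∼ x′
        result = let (s₀ , t₀ , e₀) = gen-δ in Conclude.equivalent s₀ t₀ e₀

    unique-base⇒∼ : ∀ I J → I ≢ J → UniqueBase (vals x′) I J → x ∼ x′
    unique-base⇒∼ I J I≢J unique =
      let (i , πi) = injective⇒surjective (π o) (π-injective o) I
          (j , πj) = injective⇒surjective (π o) (π-injective o) J
          i≢j = λ i≡j → I≢J (trans (sym πi) (trans (cong (π o) i≡j) πj))
          (k , k≢i , k≢j) = remaining i j i≢j in
      Propagate.result i j k i≢j (k≢i ∘ sym) (k≢j ∘ sym) (subst₂ (UniqueBase (vals x′)) (sym πi) (sym πj) unique)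
      where
      o : Fin v
      o = res (pos 0)

  -- A unique base on either side suffices, as the isomorphism can be reversed. If neither side has
  -- one, both pairs belong to the skew class and are equivalent whatever the isomorphism is.
  isomorphic⇒∼ : ∀ x x′ → x ∈ primitives → x′ ∈ primitives → (g : Good (vals x)) (g′ : Good (vals x′)) →
                 Isomorphic (std (vals x) g) (std (vals x′) g′) → x ∼ x′
  isomorphic⇒∼ x x′ x∈ x′∈ g g′ iso = cases (rigid x gen g) (rigid x′ gen′ g′)
    where
    gen : Generates (vals x)
    gen = ∈-primitives⁻ x∈
    gen′ : Generates (vals x′)
    gen′ = ∈-primitives⁻ x′∈
    cases : (∃ λ i → ∃ λ j → i ≢ j × UniqueBase (vals x) i j) ⊎ x ∼ skewPair →
            (∃ λ i → ∃ λ j → i ≢ j × UniqueBase (vals x′) i j) ⊎ x′ ∼ skewPair → x ∼ x′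
    cases _ (inj₁ (I , J , I≢J , unique)) = unique-base⇒∼ x x′ gen gen′ g g′ iso I J I≢J unique
    cases (inj₁ (I , J , I≢J , unique)) (inj₂ _) = ∼-sym x′∈
      (unique-base⇒∼ x′ x gen′ gen g′ g (isomorphic-sym {C = std (vals x) g} {std (vals x′) g′} iso) I J I≢J unique)
    cases (inj₂ s) (inj₂ s′) = ∼-trans x∈ s (∼-sym x′∈ s′)

-- Equivalence gives isomorphism; standard configurations are cyclic and connected

module Realisation (v : ℕ) .{{_ : NonZero v}} (4<v : 4 < v) where
  open Standard v 4<v

  scaling : ∀ u → Unit u → Permutation′ v
  scaling u c = permutation (λ z → res (u ⊗ val z)) (λ z → res (recipᵛ u ⊗ val z))
    (λ z → val-injective (≈-trans (val-res (u ⊗ val (res (recipᵛ u ⊗ val z))))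
      (combine₂ u (val z) (val-res (recipᵛ u ⊗ val z)) (⊗-recipᵛ u c) (l₁ u (recipᵛ u) (val z) (val (res (recipᵛ u ⊗ val z)))))))
    (λ z → val-injective (≈-trans (val-res (recipᵛ u ⊗ val (res (u ⊗ val z))))
      (combine₂ (recipᵛ u) (val z) (val-res (u ⊗ val z)) (⊗-recipᵛ u c) (l₂ u (recipᵛ u) (val z) (val (res (u ⊗ val z)))))))
    where
    l₁ : ∀ u r z w → u ⊗ w ⊖ z ≡ u ⊗ (w ⊖ r ⊗ z) ⊕ z ⊗ (u ⊗ r ⊖ pos 1)
    l₁ = ℤ-Solver.solve-∀
    l₂ : ∀ u r z w → r ⊗ w ⊖ z ≡ r ⊗ (w ⊖ u ⊗ z) ⊕ z ⊗ (u ⊗ r ⊖ pos 1)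
    l₂ = ℤ-Solver.solve-∀

  translation : Permutation′ v
  translation = permutation (λ z → res (val z ⊕ pos 1)) (λ z → res (val z ⊖ pos 1))
    (λ z → val-injective (≈-trans (val-res (val (res (val z ⊖ pos 1)) ⊕ pos 1))
      (combine₁ (pos 1) (val-res (val z ⊖ pos 1)) (l₁ (val z) (val (res (val z ⊖ pos 1)))))))
    (λ z → val-injective (≈-trans (val-res (val (res (val z ⊕ pos 1)) ⊖ pos 1))
      (combine₁ (pos 1) (val-res (val z ⊕ pos 1)) (l₂ (val z) (val (res (val z ⊕ pos 1)))))))
    where
    l₁ : ∀ z w → w ⊕ pos 1 ⊖ z ≡ pos 1 ⊗ (w ⊖ (z ⊖ pos 1))
    l₁ = ℤ-Solver.solve-∀
    l₂ : ∀ z w → w ⊖ pos 1 ⊖ z ≡ pos 1 ⊗ (w ⊖ (z ⊕ pos 1))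
    l₂ = ℤ-Solver.solve-∀

  permutation-injective : (σ : Permutation′ v) → ∀ {y z} → σ ⟨$⟩ʳ y ≡ σ ⟨$⟩ʳ z → y ≡ z
  permutation-injective σ eq = trans (sym (inverseˡ σ)) (trans (cong (σ ⟨$⟩ˡ_) eq) (inverseˡ σ))

  image-stdLine : (σ : Permutation′ v) → ∀ p q ℓ ℓ′ (match : Fin 3 → Fin 3) → (∀ k → ∃ λ b → k ≡ match b) →
                  (∀ b → σ ⟨$⟩ʳ point p (match b) ℓ ≡ point q b ℓ′) → image σ (stdLine p ℓ) ≡ stdLine q ℓ′
  image-stdLine σ p q ℓ ℓ′ match onto eq = image-≡ σ
    (λ y∈ → let (k , y≡) = ∈-stdLine⁻ p y∈ ; (b , k≡) = onto k in
      subst (_∈ˢ stdLine q ℓ′) (sym (trans (cong (σ ⟨$⟩ʳ_) (trans y≡ (cong (λ a → point p a ℓ) k≡))) (eq b))) (∈-stdLine⁺ q b ℓ′))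
    (λ y∈ → let (b , y≡) = ∈-stdLine⁻ q y∈ in
      subst (_∈ˢ stdLine p ℓ) (permutation-injective σ (trans (eq b) (sym y≡))) (∈-stdLine⁺ p (match b) ℓ))

  module _ (p q : ℤ × ℤ) (g : Good p) (g′ : Good q) (u : ℤ) (c : Unit u) (i j k : Fin 3)
           (i≢j : i ≢ j) (i≢k : i ≢ k) (j≢k : j ≢ k) (e : u • apply (two i k , two j k) p ≋ q) where
    private
      d : Fin 3 → ℤ
      d = offset p

      match : Fin 3 → Fin 3
      match 0F = k
      match 1F = i
      match 2F = j

      onto : ∀ a → ∃ λ b → a ≡ match b
      onto a = [ (λ eq → 1F , eq) , [ (λ eq → 2F , eq) , (λ eq → 0F , eq) ]′ ]′ (covered i j k a i≢j i≢k j≢k)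

      e′ : (u ⊗ (d i ⊖ d k) , u ⊗ (d j ⊖ d k)) ≋ q
      e′ = subst (_≋ q) (trans (•-≡ u (apply (two i k , two j k) p))
        (cong₂ (λ x y → u ⊗ x , u ⊗ y) (sym (two-≡ p i k)) (sym (two-≡ p j k)))) e

      offset-q : ∀ b → offset q b ≈ u ⊗ (d (match b) ⊖ d k)
      offset-q 0F = ≈-reflexive (l u (d k))
        where
        l : ∀ u x → pos 0 ≡ u ⊗ (x ⊖ x)
        l = ℤ-Solver.solve-∀
      offset-q 1F = ≈-sym (_≋_.fst≈ e′)
      offset-q 2F = ≈-sym (_≋_.snd≈ e′)

      -- The point at place k becomes the origin of the image line, so the base moves to u(ℓ + dₖ).
      target : Fin v → Fin v
      target ℓ = res (u ⊗ (val ℓ ⊕ d k))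

      l₁ : ∀ u ℓ a c w t o → u ⊗ w ⊖ (t ⊕ o) ≡ u ⊗ (w ⊖ (ℓ ⊕ a)) ⊕ (⊝ pos 1) ⊗ (t ⊖ u ⊗ (ℓ ⊕ c)) ⊕ (⊝ pos 1) ⊗ (o ⊖ u ⊗ (a ⊖ c))
      l₁ = ℤ-Solver.solve-∀

      σ-point : ∀ ℓ b → scaling u c ⟨$⟩ʳ point p (match b) ℓ ≡ point q b (target ℓ)
      σ-point ℓ b = res-cong (combine₃ u (⊝ pos 1) (⊝ pos 1) (val-res (val ℓ ⊕ d (match b))) (val-res (u ⊗ (val ℓ ⊕ d k))) (offset-q b)
        (l₁ u (val ℓ) (d (match b)) (d k) (val (point p (match b) ℓ)) (val (target ℓ)) (offset q b)))

      source : Fin v → Fin v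
      source m = res (recipᵛ u ⊗ val m ⊖ d k)

      l₂ : ∀ u r m a w → u ⊗ (w ⊕ a) ⊖ m ≡ u ⊗ (w ⊖ (r ⊗ m ⊖ a)) ⊕ m ⊗ (u ⊗ r ⊖ pos 1)
      l₂ = ℤ-Solver.solve-∀

      target-source : ∀ m → target (source m) ≡ m
      target-source m = val-injective (≈-trans (val-res (u ⊗ (val (source m) ⊕ d k)))
        (combine₂ u (val m) (val-res (recipᵛ u ⊗ val m ⊖ d k)) (⊗-recipᵛ u c) (l₂ u (recipᵛ u) (val m) (d k) (val (source m)))))

      image-line : ∀ ℓ → image (scaling u c) (stdLine p ℓ) ≡ stdLine q (target ℓ)
      image-line ℓ = image-stdLine (scaling u c) p q ℓ (target ℓ) match onto (σ-point ℓ)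

    scaled-isomorphic : Isomorphic (std p g) (std q g′)
    scaled-isomorphic = scaling u c , (λ ℓ → target ℓ , image-line ℓ) ,
      (λ m → source m , trans (image-line (source m)) (cong (stdLine q) (target-source m)))

  ∼⇒isomorphic : ∀ x y (g : Good (vals x)) (g′ : Good (vals y)) → x ∼ y → Isomorphic (std (vals x) g) (std (vals y) g′)
  ∼⇒isomorphic x y g g′ x∼y =
    let ((u , M) , s∈ , eq) = ∼-elim x∼y
        (c , M∈) = ∈-scalars⁻ s∈
        (i , j , k , (i≢j , i≢k , j≢k) , M≡) = D₃-permutation M∈ in
    scaled-isomorphic (vals x) (vals y) g g′ (val u) c i j k i≢j i≢k j≢k
      (subst (λ N → val u • apply N (vals x) ≋ vals y) M≡ (actOn-≡⁻ u M x y eq))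

  std-cyclic : ∀ p (g : Good p) → Cyclic (std p g)
  std-cyclic p g = translation , ((λ ℓ → next ℓ , image-line ℓ) , (λ m → previous m , trans (image-line (previous m)) (cong (stdLine p) (inverseʳ translation)))) , full
    where
    next previous : Fin v → Fin v
    next     = translation ⟨$⟩ʳ_
    previous = translation ⟨$⟩ˡ_
    l₁ : ∀ w ℓ a t → w ⊕ pos 1 ⊖ (t ⊕ a) ≡ pos 1 ⊗ (w ⊖ (ℓ ⊕ a)) ⊕ (⊝ pos 1) ⊗ (t ⊖ (ℓ ⊕ pos 1))
    l₁ = ℤ-Solver.solve-∀
    image-line : ∀ ℓ → image translation (stdLine p ℓ) ≡ stdLine p (next ℓ)
    image-line ℓ = image-stdLine translation p p ℓ (next ℓ) id (λ k → k , refl)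
      (λ b → res-cong (combine₂ (pos 1) (⊝ pos 1) (val-res (val ℓ ⊕ offset p b)) (val-res (val ℓ ⊕ pos 1))
        (l₁ (val (point p b ℓ)) (val ℓ) (offset p b) (val (next ℓ)))))
    l₂ : ∀ w x n → w ⊕ pos 1 ⊖ (x ⊕ (pos 1 ⊕ n)) ≡ pos 1 ⊗ (w ⊖ (x ⊕ n))
    l₂ = ℤ-Solver.solve-∀
    iterate : ∀ n x → val (iter next n x) ≈ val x ⊕ pos n
    iterate zero    x = ≈-reflexive (sym (ℤP.+-identityʳ (val x)))
    iterate (suc n) x = ≈-trans (val-res (val (iter next n x) ⊕ pos 1)) (combine₁ (pos 1) (iterate n x) (l₂ (val (iter next n x)) (val x) (pos n)))
    l₃ : ∀ w x y n → w ⊖ y ≡ pos 1 ⊗ (w ⊖ (x ⊕ n)) ⊕ pos 1 ⊗ (n ⊖ (y ⊖ x))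
    l₃ = ℤ-Solver.solve-∀
    full : FullCycle translation
    full x y = n , val-injective (combine₂ (pos 1) (pos 1) (iterate n x) (val-res (val y ⊖ val x)) (l₃ (val (iter next n x)) (val x) (val y) (pos n)))
      where
      n : ℕ
      n = toℕ (res (val y ⊖ val x))

  -- The line w contains w, w + a and w + b, so a part that is a union of lines is closed under
  -- adding a and b. As a combination of a and b equals 1, every z is reached from every y.
  std-connected : ∀ p (g : Good p) → Generates p → Connected (std p g)
  std-connected p g gen (Q , (y , y∈) , (z , z∈) , sides) = SubP.x∈∁p⇒x∉p z∈ (subst (_∈ˢ Q) reach (many 2F t (many 1F s y∈)))
    where
    a : Fin 3 → ℤ
    a = offset p
    l₀ : ∀ w → w ⊕ pos 0 ≡ w
    l₀ = ℤ-Solver.solve-∀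
    start : ∀ w → point p 0F w ≡ w
    start w = trans (cong res (ℤP.+-identityʳ (val w))) (res-val w)
    move : ∀ k {w} → w ∈ˢ Q → point p k w ∈ˢ Q
    move k {w} w∈ = [ (λ sub → sub (∈-stdLine⁺ p k w))
                    , (λ sub → contradiction w∈ (SubP.x∈∁p⇒x∉p (sub (subst (_∈ˢ stdLine p w) (start w) (∈-stdLine⁺ p 0F w))))) ]′ (sides w)
    many : ∀ k n {w} → w ∈ˢ Q → res (val w ⊕ pos n ⊗ a k) ∈ˢ Q
    many k zero    {w} w∈ = subst (_∈ˢ Q) (sym (trans (cong res (trans (cong (val w ⊕_) (ℤP.*-zeroˡ (a k))) (l₀ (val w)))) (res-val w))) w∈
    many k (suc n) {w} w∈ = subst (_∈ˢ Q) (res-cong (combine₁ (pos 1) (val-res (val w ⊕ pos n ⊗ a k)) (l (val (res (val w ⊕ pos n ⊗ a k))) (val w) (pos n) (a k)))) (move k (many k n w∈))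
      where
      l : ∀ r w n a → r ⊕ a ⊖ (w ⊕ (pos 1 ⊕ n) ⊗ a) ≡ pos 1 ⊗ (r ⊖ (w ⊕ n ⊗ a))
      l = ℤ-Solver.solve-∀
    coefficients : ∃ λ s → ∃ λ t → s ⊗ proj₁ p ⊕ t ⊗ proj₂ p ≈ pos 1
    coefficients = generates-elim p gen
    S T Δ : ℤ
    S = proj₁ coefficients
    T = proj₁ (proj₂ coefficients)
    Δ = val z ⊖ val y
    s t : ℕ
    s = toℕ (res (Δ ⊗ S))
    t = toℕ (res (Δ ⊗ T))
    y₁ : Fin v
    y₁ = res (val y ⊕ pos s ⊗ a 1F)
    reach : res (val y₁ ⊕ pos t ⊗ a 2F) ≡ z
    reach = val-injective (≈-trans (val-res (val y₁ ⊕ pos t ⊗ a 2F)) (≈-trans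
      (combine₃ (pos 1) (a 1F) (a 2F) (val-res (val y ⊕ pos s ⊗ a 1F)) (val-res (Δ ⊗ S)) (val-res (Δ ⊗ T))
        (l₂ (val y₁) (val y) (pos s) (pos t) (Δ ⊗ S) (Δ ⊗ T) (a 1F) (a 2F)))
      (combine₁ Δ (proj₂ (proj₂ coefficients)) (l₃ (val y) (val z) S T (a 1F) (a 2F)))))
      where
      l₂ : ∀ w y s t S T a b → w ⊕ t ⊗ b ⊖ (y ⊕ (S ⊗ a ⊕ T ⊗ b)) ≡ pos 1 ⊗ (w ⊖ (y ⊕ s ⊗ a)) ⊕ a ⊗ (s ⊖ S) ⊕ b ⊗ (t ⊖ T)
      l₂ = ℤ-Solver.solve-∀
      l₃ : ∀ y z S T a b → y ⊕ ((z ⊖ y) ⊗ S ⊗ a ⊕ (z ⊖ y) ⊗ T ⊗ b) ⊖ z ≡ (z ⊖ y) ⊗ (S ⊗ a ⊕ T ⊗ b ⊖ pos 1)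
      l₃ = ℤ-Solver.solve-∀

-- Cyclic configurations are standard

iter-+ : ∀ {A : Set} (f : A → A) m n x → iter f (m + n) x ≡ iter f m (iter f n x)
iter-+ f zero    n x = refl
iter-+ f (suc m) n x = cong f (iter-+ f m n x)

iter-injective : ∀ {A : Set} (f : A → A) → (∀ {x y} → f x ≡ f y → x ≡ y) → ∀ n {x y} → iter f n x ≡ iter f n y → x ≡ y
iter-injective f inj zero    eq = eq
iter-injective f inj (suc n) eq = iter-injective f inj n (inj eq)

length≡3 : ∀ {A : Set} (xs : List A) → length xs ≡ 3 → ∃ λ a → ∃ λ b → ∃ λ c → xs ≡ a ∷ b ∷ c ∷ []
length≡3 (a ∷ b ∷ c ∷ []) refl = a , b , c , refl

line-elements : ∀ {v} (C : Config v) i → ∃ λ a → ∃ λ b → ∃ λ c → elements (line C i) ≡ a ∷ b ∷ c ∷ []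
line-elements C i = length≡3 (elements (line C i)) (trans (sym (card≡length (line C i))) (lineSize C i))

lines-distinct : ∀ {v} (C : Config v) {i j} → (∀ {y} → y ∈ˢ line C i → y ∈ˢ line C j) → i ≡ j
lines-distinct C {i} {j} sub = let (a , b , c , eq) = line-elements C i in two-points a b c eq (subst Unique eq (elements-unique (line C i)))
  where
  two-points : ∀ a b c → elements (line C i) ≡ a ∷ b ∷ c ∷ [] → Unique (a ∷ b ∷ c ∷ []) → i ≡ j
  two-points a b c eq ((a≢b ∷ _) ∷ _) = lines-meet C ai (sub ai) bi (sub bi) a≢b
    where
    ai : a ∈ˢ line C i
    ai = ∈-elements⁻ (subst (a ∈_) (sym eq) (here refl))
    bi : b ∈ˢ line C i
    bi = ∈-elements⁻ (subst (b ∈_) (sym eq) (there (here refl)))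

module CyclicNormalForm (v : ℕ) .{{_ : NonZero v}} (4<v : 4 < v) (C : Config v) (connected : Connected C)
                        (σ : Permutation′ v) (aut : IsIsoVia σ C C) (full : FullCycle σ) where
  open Standard v 4<v
  private
    next : Fin v → Fin v
    next y = σ ⟨$⟩ʳ y

    next-injective : ∀ {y z} → next y ≡ next z → y ≡ z
    next-injective eq = trans (sym (inverseˡ σ)) (trans (cong (σ ⟨$⟩ˡ_) eq) (inverseˡ σ))

    o : Fin v
    o = res (pos 0)

    e : ℕ → Fin v
    e n = iter next n o

    abstract
      period : ∃ λ q → 0 < q × q ≤ v × e q ≡ o
      period with FinP.pigeonhole (ℕP.n<1+n v) (λ i → e (toℕ i))
      ... | i , j , i<j , eq = toℕ j ∸ toℕ i , ℕP.m<n⇒0<n∸m i<j ,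
            ℕP.≤-trans (ℕP.m∸n≤m (toℕ j) (toℕ i)) (ℕP.≤-pred (FinP.toℕ<n j)) ,
            iter-injective next next-injective (toℕ i) (trans (sym (iter-+ next (toℕ i) (toℕ j ∸ toℕ i) o))
              (trans (cong e (ℕP.m+[n∸m]≡n (ℕP.<⇒≤ i<j))) (sym eq)))

    q : ℕ
    q = proj₁ period

    instance
      q≢0 : NonZero q
      q≢0 = ℕ.>-nonZero (proj₁ (proj₂ period))

    e-multiple : ∀ k → e (k * q) ≡ o
    e-multiple zero    = refl
    e-multiple (suc k) = trans (iter-+ next q (k * q) o) (trans (cong (iter next q) (e-multiple k)) (proj₂ (proj₂ (proj₂ period))))

    e-% : ∀ n → e n ≡ e (n % q)
    e-% n = trans (cong e (m≡m%n+[m/n]*n n q)) (trans (iter-+ next (n % q) (n ℕ./ q * q) o) (cong (iter next (n % q)) (e-multiple (n ℕ./ q))))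

    -- The cycle being full, each point is some `e n` with n below q, so there are at most q points;
    -- the pigeonhole that produced q bounds it by v.
    q≡v : q ≡ v
    q≡v = ℕP.≤-antisym (proj₁ (proj₂ (proj₂ period))) (subst₂ _≤_ (List.length-tabulate {n = v} id) (trans (List.length-map e (upTo q)) (List.length-upTo q))
      (unique-⊆-length {xs = allFin v} {map e (upTo q)} (Uniq.allFin⁺ v) (λ {y} _ →
        let (n , eq) = full o y in subst (_∈ map e (upTo q)) (trans (sym (e-% n)) eq) (Mem.∈-map⁺ e (Mem.∈-upTo⁺ (m%n<n n q))))))

    e-cong : ∀ {m n} → pos m ≈ pos n → e m ≡ e n
    e-cong {m} {n} (by d) = trans (e-% m) (trans (cong e (∣-<⇒≡ (m%n<n m q) (m%n<n n q)
      (∣-combine₃ (pos 1) (⊝ pos 1) (pos 1) (subst (λ k → pos k ∣ᶻ (pos m ⊖ pos n)) (sym q≡v) d) (∣-% m q) (∣-% n q)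
        (l (pos m) (pos n) (pos (m % q)) (pos (n % q)))))) (sym (e-% n)))
      where
      l : ∀ m n r s → r ⊖ s ≡ pos 1 ⊗ (m ⊖ n) ⊕ (⊝ pos 1) ⊗ (m ⊖ r) ⊕ pos 1 ⊗ (n ⊖ s)
      l = ℤ-Solver.solve-∀

    plus : Fin v → ℕ → Fin v
    plus z n = res (val z ⊕ pos n)

    abstract
      -- Labels the points by exponents of σ, which turns σ into z ↦ z + 1.
      E : Fin v → Fin v
      E z = e (toℕ z)

      index : Fin v → Fin v
      index y = res (pos (proj₁ (full o y)))

      E-index : ∀ y → E (index y) ≡ y
      E-index y = trans (e-cong (val-res (pos (proj₁ (full o y))))) (proj₂ (full o y))

      E-plus : ∀ z n → E (plus z n) ≡ iter next n (E z)
      E-plus z n = trans (e-cong {toℕ (plus z n)} {n + toℕ z} (≈-trans (val-res (val z ⊕ pos n)) (≈-reflexive (cong pos (ℕP.+-comm (toℕ z) n)))))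
        (iter-+ next n (toℕ z) o)

    index-E : ∀ z → index (E z) ≡ z
    index-E z = let (y , eq) = injective⇒surjective index (λ {y} {y′} eq → trans (sym (E-index y)) (trans (cong E eq) (E-index y′))) z in
      trans (cong (index ∘ E) (sym eq)) (trans (cong index (E-index y)) eq)

    E-injective : ∀ {y z} → E y ≡ E z → y ≡ z
    E-injective {y} {z} eq = trans (sym (index-E y)) (trans (cong index eq) (index-E z))

    label : Permutation′ v
    label = permutation E index E-index index-E

    shift : Fin v → Fin v
    shift i = proj₁ (proj₁ aut i)

    on-next⁺ : ∀ n {i y} → y ∈ˢ line C i → iter next n y ∈ˢ line C (iter shift n i)
    on-next⁺ zero    y∈ = y∈
    on-next⁺ (suc n) {i} y∈ = image-≡⁺ σ (proj₂ (proj₁ aut (iter shift n i))) (on-next⁺ n y∈)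

    on-next⁻ : ∀ n {i y} → iter next n y ∈ˢ line C (iter shift n i) → y ∈ˢ line C i
    on-next⁻ zero    y∈ = y∈
    on-next⁻ (suc n) {i} y∈ = on-next⁻ n (image-≡⁻ σ (proj₂ (proj₁ aut (iter shift n i))) y∈)

    shift-injective : ∀ {i j} → shift i ≡ shift j → i ≡ j
    shift-injective {i} {j} eq = lines-distinct C (λ {y} y∈ → on-next⁻ 1 {j} {y} (subst (λ k → next y ∈ˢ line C k) eq (on-next⁺ 1 {i} y∈)))

    On : Fin v → Fin v → Set
    On i z = E z ∈ˢ line C i

    on-plus⁺ : ∀ n {i z} → On i z → On (iter shift n i) (plus z n)
    on-plus⁺ n {i} {z} z∈ = subst (_∈ˢ line C (iter shift n i)) (sym (E-plus z n)) (on-next⁺ n z∈)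

    on-plus⁻ : ∀ n {i z} → On (iter shift n i) (plus z n) → On i z
    on-plus⁻ n {i} {z} z∈ = on-next⁻ n (subst (_∈ˢ line C (iter shift n i)) (E-plus z n) z∈)

    record Through (i : Fin v) : Set where
      field
        a b  : Fin v
        o≢a  : o ≢ a
        o≢b  : o ≢ b
        a≢b  : a ≢ b
        on-o : On i o
        on-a : On i a
        on-b : On i b
        only : ∀ {z} → On i z → z ≡ o ⊎ z ≡ a ⊎ z ≡ b

    swap-through : ∀ {i} → Through i → Through i
    swap-through t = record { a = b ; b = a ; o≢a = o≢b ; o≢b = o≢a ; a≢b = a≢b ∘ sym ; on-o = on-o ; on-a = on-b ; on-b = on-a
                            ; only = λ z∈ → Sum.map₂ Sum.swap (only z∈) }
      where open Through t

    through : ∀ {i} → On i o → Through i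
    through {i} o∈ = let (y₁ , y₂ , y₃ , eq) = line-elements C i in
      build y₁ y₂ y₃ eq (subst Unique eq (elements-unique (line C i))) (subst (E o ∈_) eq (∈-elements⁺ o∈))
      where
      build : ∀ y₁ y₂ y₃ → elements (line C i) ≡ y₁ ∷ y₂ ∷ y₃ ∷ [] → Unique (y₁ ∷ y₂ ∷ y₃ ∷ []) → E o ∈ y₁ ∷ y₂ ∷ y₃ ∷ [] → Through i
      build y₁ y₂ y₃ eq ((y₁≢y₂ ∷ y₁≢y₃ ∷ []) ∷ (y₂≢y₃ ∷ []) ∷ _) = cases
        where
        on : ∀ {y} → y ∈ y₁ ∷ y₂ ∷ y₃ ∷ [] → On i (index y)
        on {y} y∈ = subst (_∈ˢ line C i) (sym (E-index y)) (∈-elements⁻ (subst (y ∈_) (sym eq) y∈))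
        listed : ∀ {z} → On i z → E z ∈ y₁ ∷ y₂ ∷ y₃ ∷ []
        listed z∈ = subst (_ ∈_) eq (∈-elements⁺ z∈)
        same : ∀ {z y} → E z ≡ y → z ≡ index y
        same {z} refl = sym (index-E z)
        apart : ∀ {y y′} → y ≢ y′ → index y ≢ index y′
        apart {y} {y′} y≢ eq = y≢ (trans (sym (E-index y)) (trans (cong E eq) (E-index y′)))
        from-o : ∀ {y y′} → E o ≡ y → y ≢ y′ → o ≢ index y′
        from-o eo y≢ eq = apart y≢ (trans (sym (same eo)) eq)
        positions : ∀ {z} → On i z → z ≡ index y₁ ⊎ z ≡ index y₂ ⊎ z ≡ index y₃
        positions z∈ = locate (listed z∈)
          where
          locate : ∀ {z} → E z ∈ y₁ ∷ y₂ ∷ y₃ ∷ [] → z ≡ index y₁ ⊎ z ≡ index y₂ ⊎ z ≡ index y₃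
          locate (here eq)                 = inj₁ (same eq)
          locate (there (here eq))         = inj₂ (inj₁ (same eq))
          locate (there (there (here eq))) = inj₂ (inj₂ (same eq))
        cases : E o ∈ y₁ ∷ y₂ ∷ y₃ ∷ [] → Through i
        cases (here eo) = record
          { a = index y₂ ; b = index y₃ ; o≢a = from-o eo y₁≢y₂ ; o≢b = from-o eo y₁≢y₃ ; a≢b = apart y₂≢y₃
          ; on-o = o∈ ; on-a = on (there (here refl)) ; on-b = on (there (there (here refl)))
          ; only = λ z∈ → Sum.map₁ (λ eq → trans eq (sym (same eo))) (positions z∈) }
        cases (there (here eo)) = record
          { a = index y₁ ; b = index y₃ ; o≢a = from-o eo (y₁≢y₂ ∘ sym) ; o≢b = from-o eo y₂≢y₃ ; a≢b = apart y₁≢y₃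
          ; on-o = o∈ ; on-a = on (here refl) ; on-b = on (there (there (here refl)))
          ; only = λ z∈ → [ (λ eq → inj₂ (inj₁ eq)) , [ (λ eq → inj₁ (trans eq (sym (same eo)))) , (λ eq → inj₂ (inj₂ eq)) ]′ ]′ (positions z∈) }
        cases (there (there (here eo))) = record
          { a = index y₁ ; b = index y₂ ; o≢a = from-o eo (y₁≢y₃ ∘ sym) ; o≢b = from-o eo (y₂≢y₃ ∘ sym) ; a≢b = apart y₁≢y₂
          ; on-o = o∈ ; on-a = on (here refl) ; on-b = on (there (here refl))
          ; only = λ z∈ → [ (λ eq → inj₂ (inj₁ eq)) , [ (λ eq → inj₂ (inj₂ eq)) , (λ eq → inj₁ (trans eq (sym (same eo)))) ]′ ]′ (positions z∈) }

    o≈0 : val o ≈ pos 0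
    o≈0 = val-res (pos 0)

    ≢o⇒≉0 : ∀ {z} → o ≢ z → ¬ val z ≈ pos 0
    ≢o⇒≉0 o≢z z≈0 = o≢z (val-injective (≈-trans o≈0 (≈-sym z≈0)))

    -- The line is the subgroup {0, a, 2a} of order 3.
    Coset : ∀ {i} → Through i → Set
    Coset t = pos 3 ⊗ val a ≈ pos 0 × val b ≈ pos 2 ⊗ val a
      where open Through t

    coset? : ∀ {i} (t : Through i) → Dec (Coset t)
    coset? t = (pos 3 ⊗ val a ≈? pos 0) ×-dec (val b ≈? pos 2 ⊗ val a)
      where open Through t

    -- The orbit of the line under translation has full length v.
    Free : Fin v → Set
    Free i = ∀ n → ¬ pos n ≈ pos 0 → iter shift n i ≢ i

    -- A line fixed by a translation n ∈ {a , b} is a coset of the subgroup {0 , n , 2n} of order 3.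
    stable⇒coset : ∀ {i} (t : Through i) n → ¬ pos n ≈ pos 0 → iter shift n i ≡ i → pos n ≈ val (Through.a t) → Coset t
    stable⇒coset {i} t n n≉0 fixed n≈a = cases₁ (only (closed on-a))
      where
      open Through t
      A = val a
      B = val b
      closed : ∀ {z} → On i z → On i (plus z n)
      closed {z} z∈ = subst (λ j → On j (plus z n)) fixed (on-plus⁺ n z∈)
      value : ∀ {z w} → plus z n ≡ w → val z ⊕ A ≈ val w
      value {z} {w} eq = combine₂ (⊝ pos 1) (⊝ pos 1) (val-res (val z ⊕ pos n)) n≈a
        (trans (cong (λ y → val z ⊕ A ⊖ val y) (sym eq)) (l (val z) A (pos n) (val (plus z n))))
        where
        l : ∀ z a n w → z ⊕ a ⊖ w ≡ (⊝ pos 1) ⊗ (w ⊖ (z ⊕ n)) ⊕ (⊝ pos 1) ⊗ (n ⊖ a)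
        l = ℤ-Solver.solve-∀
      l₁ : ∀ a → a ⊖ pos 0 ≡ pos 1 ⊗ (a ⊕ a ⊖ a)
      l₁ = ℤ-Solver.solve-∀
      A≉0 : ¬ A ≈ pos 0
      A≉0 = ≢o⇒≉0 o≢a
      B≉0 : ¬ B ≈ pos 0
      B≉0 = ≢o⇒≉0 o≢b
      A≉B : ¬ A ≈ B
      A≉B e = a≢b (val-injective e)
      cancelˡ : ∀ x y → x ⊕ y ≈ x → y ≈ pos 0
      cancelˡ x y e = combine₁ (pos 1) e (l x y)
        where
        l : ∀ x y → y ⊖ pos 0 ≡ pos 1 ⊗ (x ⊕ y ⊖ x)
        l = ℤ-Solver.solve-∀
      cases₃ : A ⊕ A ≈ val o → plus b n ≡ o ⊎ plus b n ≡ a ⊎ plus b n ≡ b → Coset t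
      cases₃ e (inj₁ eq) = ⊥-elim (A≉B (combine₂ (pos 1) (⊝ pos 1) e (value eq) (l A B (val o))))
        where
        l : ∀ a b o → a ⊖ b ≡ pos 1 ⊗ (a ⊕ a ⊖ o) ⊕ (⊝ pos 1) ⊗ (b ⊕ a ⊖ o)
        l = ℤ-Solver.solve-∀
      cases₃ e (inj₂ (inj₁ eq)) = ⊥-elim (B≉0 (combine₁ (pos 1) (value eq) (l A B)))
        where
        l : ∀ a b → b ⊖ pos 0 ≡ pos 1 ⊗ (b ⊕ a ⊖ a)
        l = ℤ-Solver.solve-∀
      cases₃ e (inj₂ (inj₂ eq)) = ⊥-elim (A≉0 (cancelˡ B A (value eq)))
      cases₂ : A ⊕ A ≈ B → plus b n ≡ o ⊎ plus b n ≡ a ⊎ plus b n ≡ b → Coset t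
      cases₂ e (inj₁ eq) = combine₃ (pos 1) (pos 1) (pos 1) e (value eq) o≈0 (l A B (val o)) , combine₁ (⊝ pos 1) e (l₂ A B)
        where
        l : ∀ a b o → pos 3 ⊗ a ⊖ pos 0 ≡ pos 1 ⊗ (a ⊕ a ⊖ b) ⊕ pos 1 ⊗ (b ⊕ a ⊖ o) ⊕ pos 1 ⊗ (o ⊖ pos 0)
        l = ℤ-Solver.solve-∀
        l₂ : ∀ a b → b ⊖ pos 2 ⊗ a ≡ (⊝ pos 1) ⊗ (a ⊕ a ⊖ b)
        l₂ = ℤ-Solver.solve-∀
      cases₂ e (inj₂ (inj₁ eq)) = ⊥-elim (B≉0 (combine₁ (pos 1) (value eq) (l A B)))
        where
        l : ∀ a b → b ⊖ pos 0 ≡ pos 1 ⊗ (b ⊕ a ⊖ a)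
        l = ℤ-Solver.solve-∀
      cases₂ e (inj₂ (inj₂ eq)) = ⊥-elim (A≉0 (cancelˡ B A (value eq)))
      cases₁ : plus a n ≡ o ⊎ plus a n ≡ a ⊎ plus a n ≡ b → Coset t
      cases₁ (inj₁ eq)        = cases₃ (value eq) (only (closed on-b))
      cases₁ (inj₂ (inj₁ eq)) = ⊥-elim (A≉0 (combine₁ (pos 1) (value eq) (l₁ A)))
      cases₁ (inj₂ (inj₂ eq)) = cases₂ (value eq) (only (closed on-b))

    unswap-coset : ∀ {i} (t : Through i) → Coset (swap-through t) → Coset t
    unswap-coset t (e , f) = combine₂ (pos 3) (pos 2) f e (l₁ (val a) (val b)) , combine₂ (⊝ pos 2) (⊝ pos 1) f e (l₂ (val a) (val b))
      where
      open Through t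
      l₁ : ∀ a b → pos 3 ⊗ a ⊖ pos 0 ≡ pos 3 ⊗ (a ⊖ pos 2 ⊗ b) ⊕ pos 2 ⊗ (pos 3 ⊗ b ⊖ pos 0)
      l₁ = ℤ-Solver.solve-∀
      l₂ : ∀ a b → b ⊖ pos 2 ⊗ a ≡ (⊝ pos 2) ⊗ (a ⊖ pos 2 ⊗ b) ⊕ (⊝ pos 1) ⊗ (pos 3 ⊗ b ⊖ pos 0)
      l₂ = ℤ-Solver.solve-∀

    -- A nontrivial translation fixing the line takes 0 to another of its points, so it is the
    -- translation by a or by b.
    ¬coset⇒free : ∀ {i} (t : Through i) → ¬ Coset t → Free i
    ¬coset⇒free {i} t ¬coset n n≉0 fixed = cases (only (subst (λ j → On j (plus o n)) fixed (on-plus⁺ n on-o)))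
      where
      open Through t
      l : ∀ n w o → n ⊖ w ≡ (⊝ pos 1) ⊗ (w ⊖ (o ⊕ n)) ⊕ (⊝ pos 1) ⊗ (o ⊖ pos 0)
      l = ℤ-Solver.solve-∀
      value : ∀ {w} → plus o n ≡ w → pos n ≈ val w
      value {w} eq = combine₂ (⊝ pos 1) (⊝ pos 1) (subst (λ y → val y ≈ val o ⊕ pos n) eq (val-res (val o ⊕ pos n))) o≈0 (l (pos n) (val w) (val o))
      cases : plus o n ≡ o ⊎ plus o n ≡ a ⊎ plus o n ≡ b → ⊥
      cases (inj₁ eq)        = n≉0 (≈-trans (value eq) o≈0)
      cases (inj₂ (inj₁ eq)) = ¬coset (stable⇒coset t n n≉0 fixed (value eq))
      cases (inj₂ (inj₂ eq)) = ¬coset (unswap-coset t (stable⇒coset (swap-through t) n n≉0 fixed (value eq)))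

    third-part : ∀ z → ¬ val z ≈ pos 0 → pos 3 ⊗ val z ≈ pos 0 → 3 * toℕ z ≡ v ⊎ 3 * toℕ z ≡ 2 * v
    third-part z z≉0 (by d) = cases (∣ᶻ⇒∣ {x = pos (3 * toℕ z)} (subst (pos v ∣ᶻ_) (trans (ℤP.+-identityʳ (pos 3 ⊗ val z)) (sym (ℤP.pos-* 3 (toℕ z)))) d))
      where
      cases : v ∣ 3 * toℕ z → 3 * toℕ z ≡ v ⊎ 3 * toℕ z ≡ 2 * v
      cases (divides 0 eq) = ⊥-elim (z≉0 (≈-reflexive (cong pos (ℕP.m*n≡0⇒m≡0 (toℕ z) 3 (trans (ℕP.*-comm (toℕ z) 3) eq)))))
      cases (divides 1 eq) = inj₁ (trans eq (ℕP.*-identityˡ v))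
      cases (divides 2 eq) = inj₂ eq
      cases (divides (suc (suc (suc c))) eq) = contradiction (FinP.toℕ<n z) (ℕP.≤⇒≯ (ℕP.*-cancelˡ-≤ 3 (subst (3 * v ≤_) (sym eq)
        (ℕP.*-monoˡ-≤ v {3} {3 + c} (s≤s (s≤s (s≤s z≤n)))))))

    -- Both cosets are the subgroup of order 3.
    cosets-meet : ∀ {i j} (t : Through i) (s : Through j) → Coset t → Coset s → Through.a s ≡ Through.a t ⊎ Through.a s ≡ Through.b t
    cosets-meet t s (e , f) (e′ , _) = cases (third-part A (≢o⇒≉0 (Through.o≢a t)) e) (third-part A′ (≢o⇒≉0 (Through.o≢a s)) e′)
      where
      A = Through.a t
      A′ = Through.a s
      l : ∀ a a′ b V → a′ ⊖ b ≡ pos 1 ⊗ (a ⊕ a′ ⊖ V) ⊕ pos 1 ⊗ (V ⊖ pos 0) ⊕ (⊝ pos 1) ⊗ (b ⊖ pos 2 ⊗ a ⊕ pos 3 ⊗ a ⊖ pos 0)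
      l = ℤ-Solver.solve-∀
      l₂ : ∀ a b → b ⊖ pos 2 ⊗ a ⊕ pos 3 ⊗ a ⊖ pos 0 ≡ pos 1 ⊗ (b ⊖ pos 2 ⊗ a) ⊕ pos 1 ⊗ (pos 3 ⊗ a ⊖ pos 0)
      l₂ = ℤ-Solver.solve-∀
      third-multiple : val (Through.b t) ⊖ pos 2 ⊗ val A ⊕ pos 3 ⊗ val A ≈ pos 0
      third-multiple = combine₂ (pos 1) (pos 1) f e (l₂ (val A) (val (Through.b t)))
      equal : 3 * toℕ A′ ≡ 3 * toℕ A → A′ ≡ A
      equal eq = FinP.toℕ-injective (ℕP.*-cancelˡ-≡ (toℕ A′) (toℕ A) 3 eq)
      complementary : 3 * toℕ A + 3 * toℕ A′ ≡ 3 * v → A′ ≡ Through.b t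
      complementary eq = val-injective (combine₃ (pos 1) (pos 1) (⊝ pos 1)
        (≈-reflexive {val A ⊕ val A′} (cong pos (ℕP.*-cancelˡ-≡ (toℕ A + toℕ A′) v 3 (trans (ℕP.*-distribˡ-+ 3 (toℕ A) (toℕ A′)) eq))))
        modulus≈0 third-multiple (l (val A) (val A′) (val (Through.b t)) (pos v)))
      cases : 3 * toℕ A ≡ v ⊎ 3 * toℕ A ≡ 2 * v → 3 * toℕ A′ ≡ v ⊎ 3 * toℕ A′ ≡ 2 * v → A′ ≡ A ⊎ A′ ≡ Through.b t
      cases (inj₁ p) (inj₁ p′) = inj₁ (equal (trans p′ (sym p)))
      cases (inj₂ p) (inj₂ p′) = inj₁ (equal (trans p′ (sym p)))
      cases (inj₁ p) (inj₂ p′) = inj₂ (complementary (cong₂ _+_ p p′))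
      cases (inj₂ p) (inj₁ p′) = inj₂ (complementary (trans (cong₂ _+_ p p′) (ℕP.+-comm (2 * v) v)))

    -- If two lines through the same point were both cosets, they would share a second point and be
    -- equal.
    free-line : ∃ λ i → Through i × Free i
    free-line = let (i , j , k , eq) = length≡3 (filter (λ i → E o ∈ˢ? line C i) (allFin v)) (pointDeg C (E o)) in
      choose i j k eq (subst Unique eq (Uniq.filter⁺ (λ i → E o ∈ˢ? line C i) (Uniq.allFin⁺ v)))
      where
      choose : ∀ i j k → filter (λ i → E o ∈ˢ? line C i) (allFin v) ≡ i ∷ j ∷ k ∷ [] → Unique (i ∷ j ∷ k ∷ []) → ∃ λ i → Through i × Free i
      choose i j k eq ((i≢j ∷ _) ∷ _) = decide (coset? tᵢ) (coset? tⱼ)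
        where
        on : ∀ {l} → l ∈ i ∷ j ∷ k ∷ [] → On l o
        on {l} l∈ = proj₂ (Mem.∈-filter⁻ (λ i → E o ∈ˢ? line C i) {xs = allFin v} (subst (l ∈_) (sym eq) l∈))
        tᵢ : Through i
        tᵢ = through (on (here refl))
        tⱼ : Through j
        tⱼ = through (on (there (here refl)))
        decide : Dec (Coset tᵢ) → Dec (Coset tⱼ) → ∃ λ i → Through i × Free i
        decide (no ¬c) _      = i , tᵢ , ¬coset⇒free tᵢ ¬c
        decide (yes _) (no ¬c) = j , tⱼ , ¬coset⇒free tⱼ ¬c
        decide (yes c) (yes c′) = contradiction (lines-meet C (Through.on-o tᵢ) (Through.on-o tⱼ) common (Through.on-a tⱼ)
            (λ eq → Through.o≢a tⱼ (E-injective eq))) i≢j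
          where
          common : On i (Through.a tⱼ)
          common = [ (λ eq → subst (On i) (sym eq) (Through.on-a tᵢ)) , (λ eq → subst (On i) (sym eq) (Through.on-b tᵢ)) ]′ (cosets-meet tᵢ tⱼ c c′)

    module FromLine (i : Fin v) (t : Through i) (free : Free i) where
      open Through t

      x : Pair
      x = a , b
      p : ℤ × ℤ
      p = vals x

      orbit : Fin v → Fin v
      orbit n = iter shift (toℕ n) i

      toℕ≉0 : ∀ {m n} → m < n → n < v → ¬ pos (n ∸ m) ≈ pos 0
      toℕ≉0 {m} {n} m<n n<v = pos≉0 (ℕP.m<n⇒0<n∸m m<n) (ℕP.≤-<-trans (ℕP.m∸n≤m n m) n<v)

      iter-distinct : ∀ {m n} → m < n → n < v → iter shift m i ≢ iter shift n i
      iter-distinct {m} {n} m<n n<v eq = free (n ∸ m) (toℕ≉0 m<n n<v) (sym (iter-injective shift shift-injective m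
        (trans eq (trans (cong (λ k → iter shift k i) (sym (ℕP.m+[n∸m]≡n (ℕP.<⇒≤ m<n)))) (iter-+ shift m (n ∸ m) i)))))

      orbit-injective : ∀ {m n} → orbit m ≡ orbit n → m ≡ n
      orbit-injective {m} {n} eq = FinP.toℕ-injective (decidable-stable (toℕ m ℕ.≟ toℕ n) (λ m≢n →
        [ (λ m≤n → iter-distinct (ℕP.≤∧≢⇒< m≤n m≢n) (FinP.toℕ<n n) eq) , (λ n≤m → iter-distinct (ℕP.≤∧≢⇒< n≤m (m≢n ∘ sym)) (FinP.toℕ<n m) (sym eq)) ]′ (ℕP.≤-total (toℕ m) (toℕ n))))

      -- Freeness gives v distinct translates, and a balanced configuration has only v lines.
      orbit-surjective : ∀ j → ∃ λ n → orbit n ≡ j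
      orbit-surjective = injective⇒surjective orbit orbit-injective

      base : Fin 3 → Fin v
      base 0F = o
      base 1F = a
      base 2F = b

      on-base : ∀ k → On i (base k)
      on-base 0F = on-o
      on-base 1F = on-a
      on-base 2F = on-b

      base-offset : ∀ k → val (base k) ≈ offset p k
      base-offset 0F = o≈0
      base-offset 1F = ≈-refl
      base-offset 2F = ≈-refl

      base-injective : ∀ {k l} → base k ≡ base l → k ≡ l
      base-injective {0F} {0F} _  = refl
      base-injective {1F} {1F} _  = refl
      base-injective {2F} {2F} _  = refl
      base-injective {0F} {1F} eq = ⊥-elim (o≢a eq)
      base-injective {0F} {2F} eq = ⊥-elim (o≢b eq)
      base-injective {1F} {0F} eq = ⊥-elim (o≢a (sym eq))
      base-injective {1F} {2F} eq = ⊥-elim (a≢b eq)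
      base-injective {2F} {0F} eq = ⊥-elim (o≢b (sym eq))
      base-injective {2F} {1F} eq = ⊥-elim (a≢b (sym eq))

      plus-base : ∀ k n → plus (base k) (toℕ n) ≡ point p k n
      plus-base k n = res-cong (combine₁ (pos 1) (base-offset k) (l (val (base k)) (val n) (offset p k)))
        where
        l : ∀ w n d → w ⊕ n ⊖ (n ⊕ d) ≡ pos 1 ⊗ (w ⊖ d)
        l = ℤ-Solver.solve-∀

      on-point : ∀ k n → On (orbit n) (point p k n)
      on-point k n = subst (On (orbit n)) (plus-base k n) (on-plus⁺ (toℕ n) (on-base k))

      on⇒point : ∀ n {z} → On (orbit n) z → ∃ λ k → z ≡ point p k n
      on⇒point n {z} z∈ = [ found 0F , [ found 1F , found 2F ]′ ]′ (only (on-plus⁻ (toℕ n) (subst (On (orbit n)) (sym back) z∈)))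
        where
        w : Fin v
        w = res (val z ⊖ val n)
        l : ∀ w z n → w ⊕ n ⊖ z ≡ pos 1 ⊗ (w ⊖ (z ⊖ n))
        l = ℤ-Solver.solve-∀
        back : plus w (toℕ n) ≡ z
        back = val-injective (≈-trans (val-res (val w ⊕ val n)) (combine₁ (pos 1) (val-res (val z ⊖ val n)) (l (val w) (val z) (val n))))
        found : ∀ k → w ≡ base k → ∃ λ k → z ≡ point p k n
        found k eq = k , trans (sym back) (trans (cong (λ u → plus u (toℕ n)) eq) (plus-base k n))

      -- If r = dₖ - dₗ = dₘ - dₙ with k ≠ m, the line and its translate by r share the points at k
      -- and m, hence are equal. This contradicts freeness, as k ≠ l makes r nonzero.
      distinct : DistinctDifferences p
      distinct k l m n k≢l eq = decidable-stable (k FinP.≟ m) (λ k≢m → free (toℕ r) r≉0 (sym (lines-meet C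
          (on-base k) (shared k l (≈-refl)) (on-base m) (shared m n eq) (λ same → k≢m (base-injective (E-injective same))))))
        where
        r : Fin v
        r = res (offset p k ⊖ offset p l)
        l₂ : ∀ k l r → k ⊖ l ≡ (⊝ pos 1) ⊗ (r ⊖ (k ⊖ l)) ⊕ pos 1 ⊗ (r ⊖ pos 0)
        l₂ = ℤ-Solver.solve-∀
        shared : ∀ m n → offset p k ⊖ offset p l ≈ offset p m ⊖ offset p n → On (iter shift (toℕ r) i) (base m)
        shared m n eq = subst (On (iter shift (toℕ r) i)) (val-injective (≈-trans (val-res (val (base n) ⊕ val r))
          (combine₃ (pos 1) (pos 1) (pos 1) (⊖-cong (base-offset n) (base-offset m)) (val-res (offset p k ⊖ offset p l)) eq
            (l₃ (val (base n)) (val (base m)) (val r) (offset p k) (offset p l) (offset p m) (offset p n)))))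
          (on-plus⁺ (toℕ r) (on-base n))
          where
          l₃ : ∀ b d r k l m n → b ⊕ r ⊖ d ≡ pos 1 ⊗ (b ⊖ d ⊖ (n ⊖ m)) ⊕ pos 1 ⊗ (r ⊖ (k ⊖ l)) ⊕ pos 1 ⊗ (k ⊖ l ⊖ (m ⊖ n))
          l₃ = ℤ-Solver.solve-∀
        r≉0 : ¬ pos (toℕ r) ≈ pos 0
        r≉0 z = k≢l (base-injective (val-injective (≈-trans (base-offset k) (≈-trans
          (combine₂ (⊝ pos 1) (pos 1) (val-res (offset p k ⊖ offset p l)) z (l₂ (offset p k) (offset p l) (val r))) (≈-sym (base-offset l))))))

      good : Good p
      good = distinct⇒good distinct

      isomorphic : Isomorphic (std p good) C
      isomorphic = label , (λ n → orbit n , image-line n) , (λ j → let (n , eq) = orbit-surjective j in n , trans (image-line n) (cong (line C) eq))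
        where
        image-line : ∀ n → image label (stdLine p n) ≡ line C (orbit n)
        image-line n = image-≡ label
          (λ z∈ → let (k , eq) = ∈-stdLine⁻ p z∈ in subst (On (orbit n)) (sym eq) (on-point k n))
          (λ z∈ → let (k , eq) = on⇒point n z∈ in subst (_∈ˢ stdLine p n) (sym eq) (∈-stdLine⁺ p k n))

      -- Otherwise the residues divisible by g = gcd(a, b, v) are the points of a component.
      x-primitive : Primitive x
      x-primitive = decidable-stable (primitive? x) (λ ¬prim → connected (decomposition ¬prim))
        where
        g : ℕ
        g = gcd (gcd (toℕ a) (toℕ b)) v
        g∣v : g ∣ v
        g∣v = gcd[m,n]∣n (gcd (toℕ a) (toℕ b)) v
        g∣offset : ∀ k → pos g ∣ᶻ offset p k
        g∣offset 0F = ∣ᶻ0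
        g∣offset 1F = ∣⇒∣ᶻ {x = val a} (Div.∣-trans (gcd[m,n]∣m (gcd (toℕ a) (toℕ b)) v) (gcd[m,n]∣m (toℕ a) (toℕ b)))
        g∣offset 2F = ∣⇒∣ᶻ {x = val b} (Div.∣-trans (gcd[m,n]∣m (gcd (toℕ a) (toℕ b)) v) (gcd[m,n]∣n (toℕ a) (toℕ b)))
        divisible? : ∀ y → Dec (pos g ∣ᶻ val (index y))
        divisible? y = pos g ∣ᶻ? val (index y)
        l : ∀ w x → w ≡ pos 1 ⊗ (w ⊖ x) ⊕ pos 1 ⊗ x
        l = ℤ-Solver.solve-∀
        l₂ : ∀ w x → x ≡ (⊝ pos 1) ⊗ (w ⊖ x) ⊕ pos 1 ⊗ w
        l₂ = ℤ-Solver.solve-∀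
        res⁺ : ∀ {z} → pos g ∣ᶻ z → pos g ∣ᶻ val (res z)
        res⁺ {z} d = ∣-combine₂ (pos 1) (pos 1) (∣ᶻ-trans g∣v (∣-difference (val-res z))) d (l (val (res z)) z)
        res⁻ : ∀ {z} → pos g ∣ᶻ val (res z) → pos g ∣ᶻ z
        res⁻ {z} d = ∣-combine₂ (⊝ pos 1) (pos 1) (∣ᶻ-trans g∣v (∣-difference (val-res z))) d (l₂ (val (res z)) z)
        component : Subset v
        component = ⟪ divisible? ⟫
        decomposition : ¬ Primitive x → Decomposable C
        decomposition ¬prim = component ,
          (E o , ∈-⟪⟫⁺ divisible? (subst (λ z → pos g ∣ᶻ val z) (sym (index-E o)) (res⁺ ∣ᶻ0))) ,
          (E (res (pos 1)) , SubP.x∉p⇒x∈∁p (λ y∈ → ¬prim (Coprimality.gcd≡1⇒coprime (Div.∣1⇒≡1 (∣ᶻ⇒∣ {x = pos 1}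
            (res⁻ (subst (λ z → pos g ∣ᶻ val z) (index-E (res (pos 1))) (∈-⟪⟫⁻ divisible? y∈)))))))) ,
          side
          where
          module _ (n : Fin v) where
            along : ∀ {y} → y ∈ˢ line C (orbit n) → ∃ λ k → index y ≡ point p k n
            along {y} y∈ = on⇒point n (subst (_∈ˢ line C (orbit n)) (sym (E-index y)) y∈)
            inside : pos g ∣ᶻ val n → line C (orbit n) ⊆ component
            inside d {y} y∈ = let (k , eq) = along y∈ in
              ∈-⟪⟫⁺ divisible? (subst (λ z → pos g ∣ᶻ val z) (sym eq) (res⁺ (ℤDiv.∣m∣n⇒∣m+n d (g∣offset k))))
            outside : ¬ pos g ∣ᶻ val n → line C (orbit n) ⊆ ∁ component
            outside ¬d {y} y∈ = let (k , eq) = along y∈ in SubP.x∉p⇒x∈∁p (λ c∈ →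
              ¬d (ℤDiv.∣m+n∣n⇒∣m (res⁻ (subst (λ z → pos g ∣ᶻ val z) eq (∈-⟪⟫⁻ divisible? c∈))) (g∣offset k)))
            side-orbit : Dec (pos g ∣ᶻ val n) → line C (orbit n) ⊆ component ⊎ line C (orbit n) ⊆ ∁ component
            side-orbit (yes d) = inj₁ (inside d)
            side-orbit (no ¬d) = inj₂ (outside ¬d)
          side : ∀ j → line C j ⊆ component ⊎ line C j ⊆ ∁ component
          side j = let (n , eq) = orbit-surjective j in
            subst (λ j → line C j ⊆ component ⊎ line C j ⊆ ∁ component) eq (side-orbit n (pos g ∣ᶻ? val n))

  normal-form : ∃ λ x → Generates (vals x) × (Σ (Good (vals x)) λ g → Isomorphic C (std (vals x) g))
  normal-form = let (i , t , free) = free-line in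
    let open FromLine i t free in
    x , primitive⇒generates x x-primitive , good , isomorphic-sym {C = std p good} {C} isomorphic

-- The count


-- Normalised fractions do not compute on variables, so their identities are checked on unnormalised
-- numerators and denominators.
fromℚᵘ-* : ∀ p q → ℚ.fromℚᵘ p ℚ.* ℚ.fromℚᵘ q ≡ ℚ.fromℚᵘ (p ℚᵘ.* q)
fromℚᵘ-* p q = ℚP.toℚᵘ-injective (ℚᵘP.≃-trans (ℚP.toℚᵘ-homo-* (ℚ.fromℚᵘ p) (ℚ.fromℚᵘ q))
  (ℚᵘP.≃-trans (ℚᵘP.*-cong (ℚP.toℚᵘ-fromℚᵘ p) (ℚP.toℚᵘ-fromℚᵘ q)) (ℚᵘP.≃-sym (ℚP.toℚᵘ-fromℚᵘ (p ℚᵘ.* q)))))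

fromℚᵘ-+ : ∀ p q → ℚ.fromℚᵘ p ℚ.+ ℚ.fromℚᵘ q ≡ ℚ.fromℚᵘ (p ℚᵘ.+ q)
fromℚᵘ-+ p q = ℚP.toℚᵘ-injective (ℚᵘP.≃-trans (ℚP.toℚᵘ-homo-+ (ℚ.fromℚᵘ p) (ℚ.fromℚᵘ q))
  (ℚᵘP.≃-trans (ℚᵘP.+-cong (ℚP.toℚᵘ-fromℚᵘ p) (ℚP.toℚᵘ-fromℚᵘ q)) (ℚᵘP.≃-sym (ℚP.toℚᵘ-fromℚᵘ (p ℚᵘ.+ q)))))

fromℕ-* : ∀ m n → fromℕ (m * n) ≡ fromℕ m ℚ.* fromℕ n
fromℕ-* m n = sym (trans (fromℚᵘ-* (mkℚᵘ (pos m) 0) (mkℚᵘ (pos n) 0))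
  (ℚP.fromℚᵘ-cong {mkℚᵘ (pos m) 0 ℚᵘ.* mkℚᵘ (pos n) 0} {mkℚᵘ (pos (m * n)) 0} (ℚᵘ.*≡* (cong (_⊗ pos 1) (sym (ℤP.pos-* m n))))))

fromℕ-+ : ∀ m n → fromℕ (m + n) ≡ fromℕ m ℚ.+ fromℕ n
fromℕ-+ m n = sym (trans (fromℚᵘ-+ (mkℚᵘ (pos m) 0) (mkℚᵘ (pos n) 0))
  (ℚP.fromℚᵘ-cong {mkℚᵘ (pos m) 0 ℚᵘ.+ mkℚᵘ (pos n) 0} {mkℚᵘ (pos (m + n)) 0} (ℚᵘ.*≡* (cong (_⊗ pos 1)
    (trans (cong₂ _⊕_ (ℤP.*-identityʳ (pos m)) (ℤP.*-identityʳ (pos n))) (sym (ℤP.pos-+ m n)))))))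

recip-* : ∀ n .{{_ : NonZero n}} → recip n ℚ.* fromℕ n ≡ ℚ.1ℚ
recip-* (suc n) = trans (fromℚᵘ-* (mkℚᵘ (pos 1) n) (mkℚᵘ (pos (suc n)) 0))
  (ℚP.fromℚᵘ-cong {mkℚᵘ (pos 1) n ℚᵘ.* mkℚᵘ (pos (suc n)) 0} {mkℚᵘ (pos 1) 0} (ℚᵘ.*≡* (l (pos (suc n)))))
  where
  l : ∀ x → pos 1 ⊗ x ⊗ pos 1 ≡ pos 1 ⊗ (x ⊗ pos 1)
  l = ℤ-Solver.solve-∀

12*v/6 : ∀ v → fromℕ 12 ℚ.* (pos v ℚ./ 6) ≡ fromℕ (2 * v)
12*v/6 v = trans (fromℚᵘ-* (mkℚᵘ (pos 12) 0) (mkℚᵘ (pos v) 5))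
  (ℚP.fromℚᵘ-cong {mkℚᵘ (pos 12) 0 ℚᵘ.* mkℚᵘ (pos v) 5} {mkℚᵘ (pos (2 * v)) 0} (ℚᵘ.*≡* (trans (l (pos v)) (cong (_⊗ pos 6) (sym (ℤP.pos-* 2 v))))))
  where
  l : ∀ x → pos 12 ⊗ x ⊗ pos 1 ≡ pos 2 ⊗ x ⊗ pos 6
  l = ℤ-Solver.solve-∀

fromℕ-cancel : ∀ n .{{_ : NonZero n}} {p q} → p ℚ.* fromℕ n ≡ q ℚ.* fromℕ n → p ≡ q
fromℕ-cancel n {p} {q} eq = trans (sym (undo p)) (trans (cong (recip n ℚ.*_) eq) (undo q))
  where
  open ℚ-Solver.+-*-Solver
  undo : ∀ p → recip n ℚ.* (p ℚ.* fromℕ n) ≡ p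
  undo p = trans (solve 3 (λ r p n → r :* (p :* n) := (r :* n) :* p) refl (recip n) p (fromℕ n))
    (trans (cong (ℚ._* p) (recip-* n)) (ℚP.*-identityˡ p))

prodFactor-* : ∀ v → prodFactor v ℚ.* fromℕ (product (primeDivisors v)) ≡ fromℕ (product (map suc (primeDivisors v)))
prodFactor-* v = go (primeDivisors v) (All.tabulate (λ p∈ → Primality.prime⇒nonZero (proj₁ (∈-primeDivisors⁻ {v} p∈))))
  where
  open ℚ-Solver.+-*-Solver
  factors : List ℕ → ℚ
  factors = Data.List.foldr (λ p acc → (ℚ.1ℚ ℚ.+ recip p) ℚ.* acc) ℚ.1ℚ
  go : ∀ ps → All NonZero ps → factors ps ℚ.* fromℕ (product ps) ≡ fromℕ (product (map suc ps))
  go []       []        = refl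
  go (p ∷ ps) (nz ∷ nzs) = begin
    (ℚ.1ℚ ℚ.+ recip p) ℚ.* factors ps ℚ.* fromℕ (p * product ps)             ≡⟨ cong ((ℚ.1ℚ ℚ.+ recip p) ℚ.* factors ps ℚ.*_) (fromℕ-* p (product ps)) ⟩
    (ℚ.1ℚ ℚ.+ recip p) ℚ.* factors ps ℚ.* (fromℕ p ℚ.* fromℕ (product ps))   ≡⟨ solve 5 (λ o r f p π → (o :+ r) :* f :* (p :* π) := (o :* p :+ r :* p) :* (f :* π)) refl ℚ.1ℚ (recip p) (factors ps) (fromℕ p) (fromℕ (product ps)) ⟩
    (ℚ.1ℚ ℚ.* fromℕ p ℚ.+ recip p ℚ.* fromℕ p) ℚ.* (factors ps ℚ.* fromℕ (product ps)) ≡⟨ cong₂ ℚ._*_ (cong₂ ℚ._+_ (ℚP.*-identityˡ (fromℕ p)) (recip-* p {{nz}})) (go ps nzs) ⟩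
    (fromℕ p ℚ.+ fromℕ 1) ℚ.* fromℕ (product (map suc ps))                   ≡⟨ cong (ℚ._* fromℕ (product (map suc ps))) (fromℕ-+ p 1) ⟨
    fromℕ (p + 1) ℚ.* fromℕ (product (map suc ps))                           ≡⟨ fromℕ-* (p + 1) _ ⟨
    fromℕ ((p + 1) * product (map suc ps))                                   ≡⟨ cong (λ k → fromℕ (k * product (map suc ps))) (ℕP.+-comm p 1) ⟩
    fromℕ (suc p * product (map suc ps))                                     ∎
    where open ≡-Reasoning

product≢0 : ∀ v → NonZero (product (primeDivisors v))
product≢0 v = Primality.productOfPrimes≢0 (All.tabulate (λ p∈ → proj₁ (∈-primeDivisors⁻ {v} p∈)))

-- Clears the denominators 12 and ∏ p.
rational-count : ∀ v N K c s {coefficient subtrahend} → fromℕ 12 ℚ.* coefficient ≡ fromℕ c → fromℕ 12 ℚ.* subtrahend ≡ fromℕ s →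
  12 * N * product (primeDivisors v) + s * product (primeDivisors v) ≡ 2 * v * product (map suc (primeDivisors v)) + c * K * product (primeDivisors v) →
  fromℕ N ≡ (pos v ℚ./ 6) ℚ.* prodFactor v ℚ.+ coefficient ℚ.* fromℕ K ℚ.- subtrahend
rational-count v N K c s {coefficient} {subtrahend} ec es eq =
  fromℕ-cancel 12 (fromℕ-cancel Π {{product≢0 v}} (begin
    f N ℚ.* f 12 ℚ.* f Π
      ≡⟨ solve 4 (λ n t p s → n :* t :* p := (t :* n :* p :+ s :* p) :- s :* p) refl (f N) (f 12) (f Π) (f s) ⟩
    (f 12 ℚ.* f N ℚ.* f Π ℚ.+ f s ℚ.* f Π) ℚ.- f s ℚ.* f Π
      ≡⟨ cong (ℚ._- f s ℚ.* f Π) naturals ⟩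
    (f (2 * v) ℚ.* f Π⁺ ℚ.+ f c ℚ.* f K ℚ.* f Π) ℚ.- f s ℚ.* f Π
      ≡⟨ cong₂ (λ x y → (x ℚ.* y ℚ.+ f c ℚ.* f K ℚ.* f Π) ℚ.- f s ℚ.* f Π) (12*v/6 v) (prodFactor-* v) ⟨
    (f 12 ℚ.* (pos v ℚ./ 6) ℚ.* (prodFactor v ℚ.* f Π) ℚ.+ f c ℚ.* f K ℚ.* f Π) ℚ.- f s ℚ.* f Π
      ≡⟨ cong₂ (λ x y → (f 12 ℚ.* (pos v ℚ./ 6) ℚ.* (prodFactor v ℚ.* f Π) ℚ.+ x ℚ.* f K ℚ.* f Π) ℚ.- y ℚ.* f Π) ec es ⟨
    (f 12 ℚ.* (pos v ℚ./ 6) ℚ.* (prodFactor v ℚ.* f Π) ℚ.+ f 12 ℚ.* coefficient ℚ.* f K ℚ.* f Π) ℚ.- f 12 ℚ.* subtrahend ℚ.* f Π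
      ≡⟨ solve 7 (λ t w h p c k s → (t :* w :* (h :* p) :+ t :* c :* k :* p) :- t :* s :* p := ((w :* h :+ c :* k :- s) :* t) :* p) refl
           (f 12) (pos v ℚ./ 6) (prodFactor v) (f Π) coefficient (f K) subtrahend ⟩
    ((pos v ℚ./ 6) ℚ.* prodFactor v ℚ.+ coefficient ℚ.* f K ℚ.- subtrahend) ℚ.* f 12 ℚ.* f Π ∎))
  where
  open ≡-Reasoning
  open ℚ-Solver.+-*-Solver
  f = fromℕ
  Π  = product (primeDivisors v)
  Π⁺ = product (map suc (primeDivisors v))
  naturals : f 12 ℚ.* f N ℚ.* f Π ℚ.+ f s ℚ.* f Π ≡ f (2 * v) ℚ.* f Π⁺ ℚ.+ f c ℚ.* f K ℚ.* f Π
  naturals = begin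
    f 12 ℚ.* f N ℚ.* f Π ℚ.+ f s ℚ.* f Π                 ≡⟨ cong₂ ℚ._+_ (trans (cong (ℚ._* f Π) (sym (fromℕ-* 12 N))) (sym (fromℕ-* (12 * N) Π))) (sym (fromℕ-* s Π)) ⟩
    f (12 * N * Π) ℚ.+ f (s * Π)                         ≡⟨ fromℕ-+ (12 * N * Π) (s * Π) ⟨
    f (12 * N * Π + s * Π)                               ≡⟨ cong f eq ⟩
    f (2 * v * Π⁺ + c * K * Π)                           ≡⟨ fromℕ-+ (2 * v * Π⁺) (c * K * Π) ⟩
    f (2 * v * Π⁺) ℚ.+ f (c * K * Π)                     ≡⟨ cong₂ ℚ._+_ (fromℕ-* (2 * v) Π⁺) (trans (fromℕ-* (c * K) Π) (cong (ℚ._* f Π) (fromℕ-* c K))) ⟩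
    f (2 * v) ℚ.* f Π⁺ ℚ.+ f c ℚ.* f K ℚ.* f Π           ∎

if-true : ∀ {A P : Set} (d : Dec P) {x y : A} → P → (if does d then x else y) ≡ x
if-true (yes _) p = refl
if-true (no ¬p) p = contradiction p ¬p

if-false : ∀ {A P : Set} (d : Dec P) {x y : A} → ¬ P → (if does d then x else y) ≡ y
if-false (yes p) ¬p = contradiction p ¬p
if-false (no _)  ¬p = refl

-- From the number of orbits to the formula

module Count (v : ℕ) .{{_ : NonZero v}} (4<v : 4 < v) where
  open Classes v using (orbitReps)
  open BadClasses v 4<v using (goodReps; goodReps-odd)
  private
    A N Q T Π Π⁺ K φ : ℕ
    A  = length orbitReps
    N  = length goodReps
    Q  = roots square-1 v
    T  = roots cyclotomic₃ v
    Π  = product (primeDivisors v)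
    Π⁺ = product (map suc (primeDivisors v))
    K  = 2 ^ length (primeDivisors v)
    φ  = totient v

    nz : NonZero v
    nz = ℕ.>-nonZero (ℕP.≤-trans (s≤s z≤n) 4<v)

    totient≢0 : NonZero φ
    totient≢0 = ℕ.>-nonZero (subst (0 <_) (length-filter (λ a → coprime? a v) (upTo v))
      (Mem.∈-length (Mem.∈-filter⁺ (λ a → coprime? a v) (Mem.∈-upTo⁺ (ℕP.≤-trans (s≤s (s≤s z≤n)) 4<v)) (Coprimality.1-coprimeTo v))))

    abstract
      -- Burnside's count multiplied by Π; substituting J Π = φ v Π⁺ gives every term the factor φ,
      -- which is cancelled.
      master : ∀ A Q T φ J Π Π⁺ → NonZero φ → A * (φ * 6) ≡ J + 3 * (φ * Q) + 2 * (φ * T) → J * Π ≡ φ * (v * Π⁺) →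
               6 * A * Π ≡ v * Π⁺ + 3 * Q * Π + 2 * T * Π
      master A Q T φ J Π Π⁺ φ≢0 b j = ℕP.*-cancelˡ-≡ _ _ φ {{φ≢0}} (begin
        φ * (6 * A * Π)                                    ≡⟨ l₁ φ A Π ⟩
        A * (φ * 6) * Π                                    ≡⟨ cong (_* Π) b ⟩
        (J + 3 * (φ * Q) + 2 * (φ * T)) * Π                ≡⟨ l₂ J φ Q T Π ⟩
        J * Π + φ * (3 * Q * Π + 2 * T * Π)                ≡⟨ cong (_+ φ * (3 * Q * Π + 2 * T * Π)) j ⟩
        φ * (v * Π⁺) + φ * (3 * Q * Π + 2 * T * Π)         ≡⟨ l₃ φ (v * Π⁺) (3 * Q * Π) (2 * T * Π) ⟩
        φ * (v * Π⁺ + 3 * Q * Π + 2 * T * Π)               ∎)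
        where
        open ≡-Reasoning
        l₁ : ∀ f a p → f * (6 * a * p) ≡ a * (f * 6) * p
        l₁ = ℕ-Solver.solve-∀
        l₂ : ∀ j f q t p → (j + 3 * (f * q) + 2 * (f * t)) * p ≡ j * p + f * (3 * q * p + 2 * t * p)
        l₂ = ℕ-Solver.solve-∀
        l₃ : ∀ f a b c → f * a + f * (b + c) ≡ f * (a + b + c)
        l₃ = ℕ-Solver.solve-∀

      -- Removes the j bad classes and doubles, so that the coefficient of 2^k becomes c/12, where
      -- 12 is a common denominator of all values of α and β.
      shifted : ∀ A N j Q T c K Π Π⁺ → 6 * A * Π ≡ v * Π⁺ + 3 * Q * Π + 2 * T * Π → N + j ≡ A → 6 * Q + 4 * T ≡ c * K →
                12 * N * Π + 12 * j * Π ≡ 2 * v * Π⁺ + c * K * Π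
      shifted A N j Q T c K Π Π⁺ m n r = begin
        12 * N * Π + 12 * j * Π                        ≡⟨ l₁ N j Π ⟩
        2 * (6 * (N + j) * Π)                          ≡⟨ cong (λ a → 2 * (6 * a * Π)) n ⟩
        2 * (6 * A * Π)                                ≡⟨ cong (2 *_) m ⟩
        2 * (v * Π⁺ + 3 * Q * Π + 2 * T * Π)           ≡⟨ l₂ v Π⁺ Q T Π ⟩
        2 * v * Π⁺ + (6 * Q + 4 * T) * Π               ≡⟨ cong (λ x → 2 * v * Π⁺ + x * Π) r ⟩
        2 * v * Π⁺ + c * K * Π                         ∎
        where
        open ≡-Reasoning
        l₁ : ∀ n j p → 12 * n * p + 12 * j * p ≡ 2 * (6 * (n + j) * p)
        l₁ = ℕ-Solver.solve-∀
        l₂ : ∀ v p⁺ q t p → 2 * (v * p⁺ + 3 * q * p + 2 * t * p) ≡ 2 * v * p⁺ + (6 * q + 4 * t) * p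
        l₂ = ℕ-Solver.solve-∀

    identity : ∀ j c → N + j ≡ A → 6 * Q + 4 * T ≡ c * K → 12 * N * Π + 12 * j * Π ≡ 2 * v * Π⁺ + c * K * Π
    identity j c n r = shifted A N j Q T c K Π Π⁺ (master A Q T φ (jordan₂ v) Π Π⁺ totient≢0 (FixedPoints.burnside-D₃ v) (jordan₂-totient v)) n r

    odd-count : ∀ c coefficient → fromℕ 12 ℚ.* coefficient ≡ fromℕ c → ¬ 2 ∣ v → 6 * Q + 4 * T ≡ c * K → alpha v ≡ coefficient → fromℕ N ≡ countFormula v
    odd-count c coefficient ec 2∤v r eq = trans (rational-count v N K c 24 {coefficient} {fromℕ 2} ec refl (identity 2 c (goodReps-odd 2∤v) r))
      (trans (cong (λ α → (pos v ℚ./ 6) ℚ.* prodFactor v ℚ.+ α ℚ.* fromℕ K ℚ.- fromℕ 2) (sym eq)) (sym (if-false (2 ∣? v) 2∤v)))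

    even-count : ∀ c coefficient → fromℕ 12 ℚ.* coefficient ≡ fromℕ c → (2∣v : 2 ∣ v) → 6 * Q + 4 * T ≡ c * K → beta v ≡ coefficient → fromℕ N ≡ countFormula v
    even-count c coefficient ec 2∣v@(divides h v≡) r eq = trans (rational-count v N K c 36 {coefficient} {fromℕ 3} ec refl
        (identity 3 c (EvenBadClasses.goodReps-even v 4<v h (trans v≡ (ℕP.*-comm h 2))) r))
      (trans (cong (λ β → (pos v ℚ./ 6) ℚ.* prodFactor v ℚ.+ β ℚ.* fromℕ K ℚ.- fromℕ 3) (sym eq)) (sym (if-true (2 ∣? v) 2∣v)))

    all1? : Dec (All (λ p → p % 3 ≡ 1) (primeDivisors v))
    all1? = All.all? (λ p → p % 3 ℕ.≟ 1) (primeDivisors v)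

    three? : Dec (3 ∣ v × ¬ 9 ∣ v × All (λ p → p ≡ 3 ⊎ p % 3 ≡ 1) (primeDivisors v))
    three? = (3 ∣? v) ×-dec ((¬? (9 ∣? v)) ×-dec All.all? (λ p → (p ℕ.≟ 3) ⊎-dec (p % 3 ℕ.≟ 1)) (primeDivisors v))

    odd-case : ¬ 2 ∣ v → fromℕ N ≡ countFormula v
    odd-case 2∤v = cases all1? three?
      where
      Q≡K : Q ≡ K
      Q≡K = roots-square-1-odd-modulus v nz 2∤v
      cases : Dec (All (λ p → p % 3 ≡ 1) (primeDivisors v)) → Dec (3 ∣ v × ¬ 9 ∣ v × All (λ p → p ≡ 3 ⊎ p % 3 ≡ 1) (primeDivisors v)) → fromℕ N ≡ countFormula v
      -- The constants 10, 8 and 6 are the values of 12α: with Q = K, the sum 6Q + 4T is 10K, 8K or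
      -- 6K according as T is K, K/2 or 0.
      cases (yes all) _ = odd-count 10 (pos 5 ℚ./ 6) refl 2∤v
        (trans (cong₂ (λ q t → 6 * q + 4 * t) Q≡K (roots-cyclotomic₃-all1mod3 v nz all)) (sym (ℕP.*-distribʳ-+ K 6 4))) (if-true all1? all)
      cases (no ¬all) (yes t@(3∣v , 9∤v , all)) = odd-count 8 (pos 2 ℚ./ 3) refl 2∤v
        (trans (cong₂ _+_ (cong (6 *_) Q≡K) (trans (ℕP.*-assoc 2 2 T) (cong (2 *_) (roots-cyclotomic₃-3 v nz 3∣v 9∤v all)))) (sym (ℕP.*-distribʳ-+ K 6 2)))
        (trans (if-false all1? ¬all) (if-true three? t))
      cases (no ¬all) (no ¬three) = odd-count 6 (pos 1 ℚ./ 2) refl 2∤v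
        (trans (cong₂ (λ q t → 6 * q + 4 * t) Q≡K (roots-cyclotomic₃-other v nz ¬all ¬three)) (ℕP.+-identityʳ (6 * K)))
        (trans (if-false all1? ¬all) (if-false three? ¬three))

    even-case : 2 ∣ v → fromℕ N ≡ countFormula v
    even-case 2∣v = cases (square-1-even v nz 2∣v)
      where
      only-Q : 6 * Q + 4 * T ≡ 6 * Q
      only-Q = trans (cong (λ t → 6 * Q + 4 * t) (roots-cyclotomic₃-even v 2∣v)) (ℕP.+-identityʳ (6 * Q))
      cases : (v % 8 ≡ 0 × Q ≡ 2 * K) ⊎ (v % 8 ≡ 4 × Q ≡ K) ⊎ (v % 8 ≢ 0 × v % 8 ≢ 4 × 2 * Q ≡ K) → fromℕ N ≡ countFormula v
      -- The constants 12, 6 and 3 are the values of 12β: T = 0, and Q is 2K, K or K/2.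
      cases (inj₁ (v≡0 , q)) = even-count 12 ℚ.1ℚ refl 2∣v (trans only-Q (trans (cong (6 *_) q) (sym (ℕP.*-assoc 6 2 K)))) (if-true (v % 8 ℕ.≟ 0) v≡0)
      cases (inj₂ (inj₁ (v≡4 , q))) = even-count 6 (pos 1 ℚ./ 2) refl 2∣v (trans only-Q (cong (6 *_) q))
        (trans (if-false (v % 8 ℕ.≟ 0) (λ v≡0 → case trans (sym v≡0) v≡4 of λ ())) (if-true (v % 8 ℕ.≟ 4) v≡4))
      cases (inj₂ (inj₂ (v≢0 , v≢4 , q))) = even-count 3 (pos 1 ℚ./ 4) refl 2∣v (trans only-Q (trans (ℕP.*-assoc 3 2 Q) (cong (3 *_) q)))
        (trans (if-false (v % 8 ℕ.≟ 0) v≢0) (if-false (v % 8 ℕ.≟ 4) v≢4))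

  count : fromℕ N ≡ countFormula v
  count = by-parity (2 ∣? v)
    where
    by-parity : Dec (2 ∣ v) → fromℕ N ≡ countFormula v
    by-parity (yes 2∣v) = even-case 2∣v
    by-parity (no 2∤v)  = odd-case 2∤v

-- The list of representatives

module Classification (v : ℕ) .{{_ : NonZero v}} (4<v : 4 < v) where
  open Standard v 4<v
  open Rigidity v 4<v using (isomorphic⇒∼)
  open Realisation v 4<v using (∼⇒isomorphic; std-cyclic; std-connected)

  abstract
    -- An opaque copy of `std`, known only through the four facts that follow, so that the reasoning
    -- about lists never unfolds a configuration.
    stdConfig : ∀ x → Good (vals x) → Config v
    stdConfig x g = std (vals x) g

    stdConfig-sound : ∀ x g → Generates (vals x) → Connected (stdConfig x g) × Cyclic (stdConfig x g)
    stdConfig-sound x g gen = std-connected (vals x) g gen , std-cyclic (vals x) g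

    stdConfig-complete : ∀ C → Connected C → Cyclic C →
      ∃ λ x → Generates (vals x) × (Σ (Good (vals x)) λ g → Isomorphic C (stdConfig x g))
    stdConfig-complete C connected (σ , aut , full) = CyclicNormalForm.normal-form v 4<v C connected σ aut full

    stdConfig-rigid : ∀ x y g h → x ∈ primitives → y ∈ primitives → Isomorphic (stdConfig x g) (stdConfig y h) → x ∼ y
    stdConfig-rigid x y g h x∈ y∈ = isomorphic⇒∼ x y x∈ y∈ g h

    stdConfig-∼ : ∀ x y g h → x ∼ y → Isomorphic (stdConfig x g) (stdConfig y h)
    stdConfig-∼ x y g h = ∼⇒isomorphic x y g h

  configs : ∀ rs → All (Good ∘ vals) rs → List (Config v)
  configs []       []       = []
  configs (r ∷ rs) (g ∷ gs) = stdConfig r g ∷ configs rs gs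

  length-configs : ∀ rs (gs : All (Good ∘ vals) rs) → length (configs rs gs) ≡ length rs
  length-configs []       []       = refl
  length-configs (r ∷ rs) (g ∷ gs) = cong suc (length-configs rs gs)

  configs-all : ∀ {P : Config v → Set} (rs : List Pair) (gs : All (Good ∘ vals) rs) →
                (∀ {r} → r ∈ rs → (g : Good (vals r)) → P (stdConfig r g)) → All P (configs rs gs)
  configs-all []       []       p = []
  configs-all {P} (r ∷ rs) (g ∷ gs) p = p {r} (here refl) g ∷ configs-all {P} rs gs (λ {s} s∈ → p {s} (there s∈))

  lookup-configs : ∀ rs (gs : All (Good ∘ vals) rs) i → ∃ λ r → r ∈ rs × Σ (Good (vals r)) λ g → lookup (configs rs gs) i ≡ stdConfig r g
  lookup-configs (r ∷ rs) (g ∷ gs) Fin.zero    = r , here refl , g , refl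
  lookup-configs (r ∷ rs) (g ∷ gs) (Fin.suc i) = let (s , s∈ , h , eq) = lookup-configs rs gs i in s , there s∈ , h , eq

  ∈-configs : ∀ {r} rs (gs : All (Good ∘ vals) rs) → r ∈ rs → ∃ λ i → Σ (Good (vals r)) λ g → lookup (configs rs gs) i ≡ stdConfig r g
  ∈-configs (r ∷ rs) (g ∷ gs) (here refl) = Fin.zero , g , refl
  ∈-configs (r ∷ rs) (g ∷ gs) (there r∈)  = let (i , h , eq) = ∈-configs rs gs r∈ in Fin.suc i , h , eq

  -- All proofs of goodness are allowed, because looking up a configuration returns one of them
  -- without saying which.
  Separated : List Pair → Set
  Separated rs = ∀ {r s} → r ∈ rs → s ∈ rs → (g : Good (vals r)) (h : Good (vals s)) → Isomorphic (stdConfig r g) (stdConfig s h) → r ≡ s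

  configs-distinct : ∀ rs (gs : All (Good ∘ vals) rs) → Unique rs → Separated rs →
    ∀ i j → i ≢ j → ¬ Isomorphic (lookup (configs rs gs) i) (lookup (configs rs gs) j)
  configs-distinct (r ∷ rs) (g ∷ gs) (r∉ ∷ u) sep Fin.zero    Fin.zero    i≢j iso = i≢j refl
  configs-distinct (r ∷ rs) (g ∷ gs) (r∉ ∷ u) sep Fin.zero    (Fin.suc j) i≢j iso =
    let (s , s∈ , h , eq) = lookup-configs rs gs j in
    All.lookup r∉ s∈ (sep (here refl) (there s∈) g h (subst (Isomorphic (stdConfig r g)) eq iso))
  configs-distinct (r ∷ rs) (g ∷ gs) (r∉ ∷ u) sep (Fin.suc i) Fin.zero    i≢j iso =
    let (s , s∈ , h , eq) = lookup-configs rs gs i in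
    All.lookup r∉ s∈ (sym (sep (there s∈) (here refl) h g (subst (λ C → Isomorphic C (stdConfig r g)) eq iso)))
  configs-distinct (r ∷ rs) (g ∷ gs) (r∉ ∷ u) sep (Fin.suc i) (Fin.suc j) i≢j iso =
    configs-distinct rs gs u (λ r∈ s∈ → sep (there r∈) (there s∈)) i j (i≢j ∘ cong Fin.suc) iso

  ∈-goodReps⁻ : ∀ {r} → r ∈ goodReps → r ∈ orbitReps
  ∈-goodReps⁻ r∈ = proj₁ (Mem.∈-filter⁻ (good? ∘ vals) {xs = orbitReps} r∈)

  goods : All (Good ∘ vals) goodReps
  goods = AllP.all-filter (good? ∘ vals) orbitReps

  representatives : List (Config v)
  representatives = configs goodReps goods

  representatives-sound : All (λ C → Connected C × Cyclic C) representatives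
  representatives-sound = configs-all goodReps goods (λ {r} r∈ g →
    stdConfig-sound r g (∈-primitives⁻ (orbitReps⊆ (∈-goodReps⁻ r∈))))

  representatives-distinct : ∀ i j → i ≢ j → ¬ Isomorphic (lookup representatives i) (lookup representatives j)
  representatives-distinct = configs-distinct goodReps goods (Uniq.filter⁺ (good? ∘ vals) orbitReps-unique)
    (λ {r} {s} r∈ s∈ g h iso → orbitReps-inequivalent (∈-goodReps⁻ r∈) (∈-goodReps⁻ s∈)
      (stdConfig-rigid r s g h (orbitReps⊆ (∈-goodReps⁻ r∈)) (orbitReps⊆ (∈-goodReps⁻ s∈)) iso))

  representatives-complete : ∀ C → Connected C → Cyclic C → ∃ λ i → Isomorphic C (lookup representatives i)
  representatives-complete C connected cyclic =
    let (x , gen , g , iso) = stdConfig-complete C connected cyclic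
        x∈ = ∈-primitives⁺ gen
        (r , r∈ , r∼x) = orbitReps-cover x∈
        x∼r = ∼-sym (orbitReps⊆ r∈) r∼x
        (i , h , eq) = ∈-configs goodReps goods (Mem.∈-filter⁺ (good? ∘ vals) r∈ (good-∼ x∼r g)) in
    i , subst (Isomorphic C) (sym eq) (isomorphic-trans {C = C} {stdConfig x g} {stdConfig r h} iso (stdConfig-∼ x r g h x∼r))

theoremA : (v : ℕ) → 4 < v →
    Σ (List (Config v)) λ Cs →
    (fromℕ (length Cs) ≡ countFormula v) ×
    All (λ C → Connected C × Cyclic C) Cs ×
    (∀ (i j : Fin (length Cs)) → i ≢ j → ¬ Isomorphic (lookup Cs i) (lookup Cs j)) ×
    (∀ (C : Config v) → Connected C → Cyclic C → ∃ λ i → Isomorphic C (lookup Cs i))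
theoremA v 4<v = representatives ,
    trans (cong fromℕ (length-configs goodReps goods)) (Count.count v 4<v) ,
    representatives-sound , representatives-distinct , representatives-complete
  where
  instance
    v≢0 : NonZero v
    v≢0 = ℕ.>-nonZero (ℕP.≤-trans (s≤s z≤n) 4<v)
  open Classification v 4<v
  open BadClasses v 4<v using (goodReps)
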